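{- Let $n\ge 2$ and let $D_n=\langle a,b\mid a^n=b^2=1,\ bab=a^{ -1}\rangle$ be the dihedral group of order $2n$. Let $\mathcal{M}=CM(D_n,X,p)$ be a reflexible regular Cayley map for $D_n$ of valency $d=|X|$. If $d=2$, then $\mathcal{M}$ is isomorphic to $CM(D_n,\{b,ab\},(b,ab))$. If $d=3$, then $\mathcal{M}$ is isomorphic to $CM(D_2,\{b,ab,a\},(b,ab,a))$, to $CM(D_3,\{b,ab,a^2b\},(b,ab,a^2b))$, or to $CM(D_4,\{b,a,a^{ -1}\},(b,a,a^{ -1}))$. If $d\ge 4$, then $\mathcal{M}$ is isomorphic to one of the following maps (in each case $X_i$ is the set of entries of the cycle $p_i$): (1) $\mathcal{M}_1=CM(D_n,X_1,p_1)$ with $p_1=(b,\ ab,\ a^{\ell+1}b,\ a^{\ell^2+\ell+1}b,\ \ldots,\ a^{\ell^{d-2}+\ell^{d-3}+\cdots+1}b)$ (i.e. the $k$-th entry, $k=0,\dots,d-1$, is $a^{1+\ell+\cdots+\ell^{k-1}}b$), for some integer $\ell$ with $\ell^2\equiv 1\pmod n$, where $d$ is the smallest positive integer with $\ell^{d-1}+\ell^{d-2}+\cdots+1\equiv 0\pmod n$; (2) $n$ is even and $\mathcal{M}_2=CM(D_n,X_2,p_2)$ with $p_2=(b,a,a^2b,a^3,a^4b,\ldots,a^{n-2}b,a^{n-1})$ (the $k$-th entry, $k=0,\dots,n-1$, is $a^kb$ for $k$ even and $a^k$ for $k$ odd); (3) $n=2m$ is a multiple of $8$ and $\mathcal{M}_3=CM(D_n,X_3,p_3)$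 with $p_3=(b,a,a^{m+2}b,a^3,a^4b,\ldots,a^{m-2}b,a^{n-1})$ (the $k$-th entry, $k=0,\dots,n-1$, is $a^{k+(k/2)m}b$ for $k$ even and $a^k$ for $k$ odd); (4) $n=3k$ for some positive integer $k$ and $\mathcal{M}_4=CM(D_n,X_4,p_4)$ with $p_4=(a^{ -1},a,b,a^2b)$; (5) $n=2m=8k+4$ for some positive integer $k$ and $\mathcal{M}_5=CM(D_n,X_5,p_5)$ with $p_5=(a^{ -1},a,b,a^{m+1},a^{m-1},a^{m+2}b)$; (6) $n=2m=4k+2$ for some positive integer $k$ and $\mathcal{M}_6=CM(D_n,X_6,p_6)$ with $p_6=(b,a^{m-2}b,a,a^{ -2}b,a^mb,a^{ -1})$. Furthermore, all the Cayley maps $\mathcal{M}_1,\dots,\mathcal{M}_6$ listed above (under the stated conditions) are reflexible regular Cayley maps.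
   Context: For a finite group $G$ and a generating set $X\subseteq G\setminus\{1_G\}$ with $X=X^{ -1}$, the Cayley graph $C(G,X)$ has vertex set $G$ with $g,h$ adjacent iff $g^{ -1}h\in X$. For a cyclic permutation $p$ of $X$, the Cayley map $CM(G,X,p)$ is the embedding of $C(G,X)$ into an orientable surface in which the cyclic order of the edges $\{g,gx\}$, $x\in X$, around every vertex $g$ is given by $p$. A map automorphism is a graph automorphism extending to a homeomorphism of the surface. The map is regular if its group of orientation-preserving automorphisms acts transitively (hence regularly) on arcs (incident vertex-edge pairs), and reflexible if moreover it admits an orientation-reversing automorphism. The valency of $CM(G,X,p)$ is $|X|$. Isomorphism means isomorphism of maps. -}

module Defs where

open import Data.Nat as ℕ using (ℕ; zero; suc; NonZero; _∸_; _≤_; _<_; ⌊_/2⌋)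
open import Data.Nat.DivMod using (_mod_)
open import Data.Integer as ℤ using (ℤ; +_; _%ℕ_)
open import Data.Integer.Divisibility using () renaming (_∣_ to _∣ℤ_)
open import Data.Fin as Fin using (Fin; toℕ)
open import Data.Fin.Properties using (any?)
open import Data.Bool using (Bool; true; false; _xor_; if_then_else_)
open import Data.Bool.Properties using () renaming (_≟_ to _≟B_)
open import Data.Product using (Σ; ∃; ∃-syntax; _×_; _,_; proj₁)
open import Data.Product.Properties using (≡-dec)
open import Data.Sum using (_⊎_)
open import Data.List using (List; []; _∷_)
open import Relation.Nullary using (¬_; Dec; yes; no)
open import Relation.Binary.PropositionalEquality using (_≡_; _≢_)
open import Function.Bundles using (_↔_; Inverse)
open import Function.Definitions using (Injective)

ModEq : ℕ → ℤ → ℤ → Set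
ModEq n x y = (+ n) ∣ℤ (x ℤ.- y)

-- The dihedral group D_n = ⟨a,b | a^n = b^2 = 1, bab = a^{-1}⟩ of order 2n.
-- The pair (i , s) represents the element a^i b^s  (s = true means b^1).

Dih : ℕ → Set
Dih n = Fin n × Bool

module _ {n : ℕ} .{{_ : NonZero n}} where

  expo : ℤ → Fin n
  expo z = (z %ℕ n) mod n

  rot : ℤ → Dih n
  rot z = expo z , false

  refl' : ℤ → Dih n
  refl' z = expo z , true

  e : Dih n
  e = rot (+ 0)

  -- (a^i b^s)(a^j b^t) = a^(i + (-1)^s j) b^(s xor t)
  _·_ : Dih n → Dih n → Dih n
  (i , s) · (j , t) =
    ((toℕ i ℕ.+ (if s then n ∸ toℕ j else toℕ j)) mod n) , (s xor t)

  _⁻¹ : Dih n → Dih n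
  (i , false) ⁻¹ = (n ∸ toℕ i) mod n , false
  (i , true)  ⁻¹ = i , true

  _≟D_ : (g h : Dih n) → Dec (g ≡ h)
  _≟D_ = ≡-dec Fin._≟_ _≟B_

  prod : List (Dih n) → Dih n
  prod []       = e
  prod (g ∷ gs) = g · prod gs

-- Oriented maps, given combinatorially by darts (arcs), the rotation R
-- and the dart-reversing involution L.

record Map : Set₁ where
  field
    Dart : Set
    R    : Dart → Dart
    L    : Dart → Dart

open Map public

record OIso (M N : Map) : Set where
  field
    bij   : Dart M ↔ Dart N
    pres-R : ∀ δ → Inverse.to bij (R M δ) ≡ R N (Inverse.to bij δ)
    pres-L : ∀ δ → Inverse.to bij (L M δ) ≡ L N (Inverse.to bij δ)

-- orientation-reversing isomorphism: bijection f with f ∘ R = R⁻¹ ∘ f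
-- (written as R ∘ f ∘ R = f) and f ∘ L = L ∘ f
record RIso (M N : Map) : Set where
  field
    bij   : Dart M ↔ Dart N
    rev-R : ∀ δ → R N (Inverse.to bij (R M δ)) ≡ Inverse.to bij δ
    pres-L : ∀ δ → Inverse.to bij (L M δ) ≡ L N (Inverse.to bij δ)

-- isomorphism of maps (homeomorphism of surfaces, either orientation)
MapIso : Map → Map → Set
MapIso M N = OIso M N ⊎ RIso M N

Regular : Map → Set
Regular M = ∀ (δ δ' : Dart M) → Σ (OIso M M) λ φ → Inverse.to (OIso.bij φ) δ ≡ δ'

Reflexible : Map → Set
Reflexible M = Regular M × RIso M M

-- Cayley maps CM(D_n, X, p).  The cyclic permutation p of X is given as a
-- list x_0, …, x_{d-1} of the elements of X, with p(x_k) = x_{k+1 mod d}.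

csuc : {d : ℕ} → Fin d → Fin d
csuc {suc d} k = (suc (toℕ k)) mod (suc d)

module _ {n : ℕ} .{{_ : NonZero n}} where

  record IsCayleyData (d : ℕ) (x : Fin d → Dih n) : Set where
    field
      distinct  : Injective _≡_ _≡_ x
      no-unit   : ∀ k → x k ≢ e
      inv-closed : ∀ k → ∃[ j ] x j ≡ x k ⁻¹
      generates : ∀ (g : Dih n) → ∃[ ks ] prod (Data.List.map x ks) ≡ g

  -- index of the inverse of x_k (meaningful when X = X⁻¹)
  invIdx : {d : ℕ} → (x : Fin d → Dih n) → Fin d → Fin d
  invIdx x k with any? (λ j → x j ≟D (x k ⁻¹))
  ... | yes (j , _) = j
  ... | no _        = k

  -- darts (g , k) = arc from g to g x_k
  CM : (d : ℕ) → (Fin d → Dih n) → Map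
  CM d x = record
    { Dart = Dih n × Fin d
    ; R    = λ { (g , k) → g , csuc k }
    ; L    = λ { (g , k) → (g · x k) , invIdx x k }
    }

  ReflRegCM : (d : ℕ) → (Fin d → Dih n) → Set
  ReflRegCM d x = IsCayleyData d x × Reflexible (CM d x)

geom : ℤ → ℕ → ℤ
geom ℓ zero    = + 0
geom ℓ (suc k) = geom ℓ k ℤ.+ ℓ ℤ.^ k

isEven : ℕ → Bool
isEven zero          = true
isEven (suc zero)    = false
isEven (suc (suc k)) = isEven k

module _ {n : ℕ} .{{_ : NonZero n}} where

  p₀ : Fin 2 → Dih n
  p₀ Fin.zero           = refl' (+ 0)
  p₀ (Fin.suc Fin.zero) = refl' (+ 1)

  p₁ : ℤ → (d : ℕ) → Fin d → Dih n
  p₁ ℓ d k = refl' (geom ℓ (toℕ k))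

  p₂ : Fin n → Dih n
  p₂ k = if isEven (toℕ k) then refl' (+ toℕ k) else rot (+ toℕ k)

  p₃ : Fin n → Dih n
  p₃ k = if isEven (toℕ k)
         then refl' (+ (toℕ k ℕ.+ ⌊ toℕ k /2⌋ ℕ.* ⌊ n /2⌋))
         else rot (+ toℕ k)

  p₄ : Fin 4 → Dih n
  p₄ Fin.zero                             = rot (ℤ.- (+ 1))
  p₄ (Fin.suc Fin.zero)                   = rot (+ 1)
  p₄ (Fin.suc (Fin.suc Fin.zero))         = refl' (+ 0)
  p₄ (Fin.suc (Fin.suc (Fin.suc Fin.zero))) = refl' (+ 2)

  p₅ : Fin 6 → Dih n
  p₅ k = go (toℕ k)
    where
      m : ℤ
      m = + ⌊ n /2⌋
      go : ℕ → Dih n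
      go 0 = rot (ℤ.- (+ 1))
      go 1 = rot (+ 1)
      go 2 = refl' (+ 0)
      go 3 = rot (m ℤ.+ + 1)
      go 4 = rot (m ℤ.- + 1)
      go _ = refl' (m ℤ.+ + 2)

  p₆ : Fin 6 → Dih n
  p₆ k = go (toℕ k)
    where
      m : ℤ
      m = + ⌊ n /2⌋
      go : ℕ → Dih n
      go 0 = refl' (+ 0)
      go 1 = refl' (m ℤ.- + 2)
      go 2 = rot (+ 1)
      go 3 = refl' (ℤ.- (+ 2))
      go 4 = refl' m
      go _ = rot (ℤ.- (+ 1))

q₂ : Fin 3 → Dih 2
q₂ Fin.zero                     = refl' (+ 0)
q₂ (Fin.suc Fin.zero)           = refl' (+ 1)
q₂ (Fin.suc (Fin.suc Fin.zero)) = rot (+ 1)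

q₃ : Fin 3 → Dih 3
q₃ Fin.zero                     = refl' (+ 0)
q₃ (Fin.suc Fin.zero)           = refl' (+ 1)
q₃ (Fin.suc (Fin.suc Fin.zero)) = refl' (+ 2)

q₄ : Fin 3 → Dih 4
q₄ Fin.zero                     = refl' (+ 0)
q₄ (Fin.suc Fin.zero)           = rot (+ 1)
q₄ (Fin.suc (Fin.suc Fin.zero)) = rot (ℤ.- (+ 1))

Cond₁ : ℕ → ℤ → ℕ → Set
Cond₁ n ℓ d = ModEq n (ℓ ℤ.* ℓ) (+ 1)
            × 1 ≤ d
            × ModEq n (geom ℓ d) (+ 0)
            × (∀ d' → 1 ≤ d' → d' < d → ¬ ModEq n (geom ℓ d') (+ 0))

{-# OPTIONS --safe #-}

-- Index the generators by ℤ mod d in the order of p: x_k = a^(e k) b^(s k), with inverse x_(χ k). The automorphism rotating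
-- (or reflecting) the darts at 1 acts on words: it turns the letter k, read at a vertex where the rotation is off by c, into
-- σ k + c, and passes on the offset χ (σ k + c) − σ χ k. Words with equal products have images with equal products and equal
-- final offsets; everything follows from applying this to short relations of D_n.
--
-- The relation between a rotation and its conjugates shows that two rotations whose inverses are equally far away differ by a
-- period of the whole cyclic pattern of rotations and reflections. Only the following patterns survive: all reflections (M₁),
-- one rotation (n = 2), alternating (M₂ and M₃, found in the quotient by the least translation, which is 2 or 4), YYZ (the map of D₄ and
-- M₅), YYZZ (M₄), and rotations exactly at a coset of rℤ (which forces r = 3, M₆). The valency is bounded because a reversing
-- automorphism inverts a pattern-preserving rotation, while both act on ⟨a⟩ by multiplications, and these commute.
--
-- Conversely, each listed map has two explicit orientation-reversing involutions fixing the vertex 1, k ↦ r − k and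
-- k ↦ r + 1 − k; their product is the rotation at 1.

module Submission where

open import Defs renaming (e to 1ᴰ)
open import Data.Nat as ℕ using (ℕ; zero; suc; NonZero; z≤n; s≤s)
open import Data.Integer using (ℤ; +_; -[1+_]; _+_; _*_; _-_; -_; ∣_∣; 0ℤ; 1ℤ; -1ℤ; _%ℕ_; _/ℕ_; _≟_; ≢-nonZero; _^_)
open import Data.Integer.Properties using (+-inverseʳ; *-zeroˡ; *-cancelˡ-≡; pos-*; pos-+; abs-*; +-injective; ⊖-≥; m-n≡m⊖n)
open import Data.Integer.Divisibility.Signed using (_∣_; divides; _∣?_; ∣ᵤ⇒∣; ∣⇒∣ᵤ)
open import Data.Integer.DivMod using (a≡a%ℕn+[a/ℕn]*n; n%ℕd<d)
open import Data.Integer.Solver using (module +-*-Solver)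
open import Data.Fin using (Fin; toℕ; fromℕ<)
open import Data.Fin.Properties using (all?; toℕ-fromℕ<; ¬∀⟶∃¬; toℕ<n; any?; toℕ-injective)
open import Data.Product using (Σ; _×_; _,_; proj₁; proj₂; ∃-syntax)
open import Data.Sum using (_⊎_; inj₁; inj₂)
open import Data.Empty using (⊥; ⊥-elim)
open import Relation.Nullary using (¬_; Dec; yes; no)
open import Relation.Nullary.Decidable using (True; toWitness; map′; _→-dec_; ¬?; _×-dec_; decidable-stable; False; toWitnessFalse)
open import Relation.Binary.PropositionalEquality using (_≡_; _≢_; refl; sym; trans; cong; cong₂; subst; subst₂)
open import Data.Nat.Induction using (<-wellFounded)
open import Induction.WellFounded using (Acc; acc)
open import Data.Bool using (Bool; true; false; not; _xor_; if_then_else_)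
open import Data.Bool.Properties using (xor-assoc) renaming (_≟_ to _≟ᵇ_)
open import Data.List using (List; []; _∷_; _++_; map)
open import Function using (_∘_)
open import Function.Bundles using (_↔_; Inverse; mk↔ₛ′)
open import Data.Fin as Fin using (Fin; toℕ)
import Data.Nat.Properties as ℕ
import Data.Nat.Divisibility as ℕ
import Data.Nat.GCD as ℕ
import Data.Nat.DivMod as ℕ
import Data.Nat.Solver as ℕSolver
open +-*-Solver using (solve; _:=_; _:+_; _:*_; _:-_; :-_; con)
open ℕSolver.+-*-Solver using () renaming (solve to solveℕ; _:=_ to _:≡_; _:+_ to _⊞_; _:*_ to _⊠_; con to conℕ)

-- Congruences in ℤ

-- A map automorphism fixing 1 is usually no group automorphism, because its offset varies from
-- vertex to vertex. Only where the pattern is symmetric does `hom` recover a group automorphism,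
-- and the bound on the valency needs two of these at once, a translation and a reversal. In the
-- alternating case the shifts at hand move inverses backwards, χ (k + v) = χ k - v, so they are not
-- periods and `hom` is out of reach. Dividing by the least such v makes all rotations equally far
-- from their inverses; then 2 is a period, and the general bound says that v divides 4. The
-- quotient is formed on indices and exponents alone. It satisfies the same law because its kernel
-- consists of powers of a product of two reflections, which every shift sends to a trivial product.
-- Indices and exponents are integers with congruences modulo d and n, so that each computation is a
-- linear combination of known congruences justified by a ring identity.

infix 4 _≈_[_] _≈?_[_]
infix 8 ⊖_
infixr 7 _⊙_
infixl 6 _⊕_

-- A record, so that both sides and the modulus can be inferred from the type of a proof; the
-- quotient is data because later arguments compute with it. The modulus is any integer, and modulo
-- 0 the relation is equality.
record _≈_[_] (a b m : ℤ) : Set where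
  constructor mod≈
  field
    quotient : ℤ
    equality : a - b ≡ quotient * m

_≈?_[_] : ∀ a b m → Dec (a ≈ b [ m ])
a ≈? b [ m ] = map′ (λ { (divides q eq) → mod≈ q eq }) (λ { (mod≈ q eq) → divides q eq }) (m ∣? (a - b))

by-computation : ∀ {a b m} {_ : True (a ≈? b [ m ])} → a ≈ b [ m ]
by-computation {_} {_} {_} {t} = toWitness t

≡⇒≈ : ∀ {a b m} → a ≡ b → a ≈ b [ m ]
≡⇒≈ {a} {_} {m} refl = mod≈ 0ℤ (trans (+-inverseʳ a) (sym (*-zeroˡ m)))

≈-refl : ∀ {a m} → a ≈ a [ m ]
≈-refl = ≡⇒≈ refl

_⊕_ : ∀ {a b c d m} → a ≈ b [ m ] → c ≈ d [ m ] → a + c ≈ b + d [ m ]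
_⊕_ {a} {b} {c} {d} {m} (mod≈ p x) (mod≈ q y) = mod≈ (p + q)
  (trans (solve 4 (λ a b c d → a :+ b :- (c :+ d) := a :- c :+ (b :- d)) refl a c b d) (trans (cong₂ _+_ x y)
      (solve 3 (λ a b c → a :* b :+ c :* b := (a :+ c) :* b) refl p m q)))

_⊙_ : ∀ {a b m} k → a ≈ b [ m ] → k * a ≈ k * b [ m ]
_⊙_ {a} {b} {m} k (mod≈ q x) = mod≈ (k * q)
  (trans (solve 3 (λ a b c → a :* b :- a :* c := a :* (b :- c)) refl k a b) (trans (cong (k *_) x)
      (solve 3 (λ a b c → a :* (b :* c) := a :* b :* c) refl k q m)))

⊖_ : ∀ {a b m} → a ≈ b [ m ] → - a ≈ - b [ m ]
⊖_ {a} {b} {m} (mod≈ q x) = mod≈ (- q)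
  (trans (solve 2 (λ a b → :- a :- :- b := :- (a :- b)) refl a b) (trans (cong -_ x) (solve 2 (λ a b → :- (a :* b) := :- a :* b) refl q m)))

-- Linear combinations: the goal and the given congruence differ by a ring identity, which the solver proves.
lc : ∀ {a b x y m} → x ≈ y [ m ] → a - b ≡ x - y → a ≈ b [ m ]
lc (mod≈ q x) eq = mod≈ q (trans eq x)

≈-sym : ∀ {a b m} → a ≈ b [ m ] → b ≈ a [ m ]
≈-sym {a} {b} h = lc (⊖ h) (solve 2 (λ a b → a :- b := :- b :- :- a) refl b a)

≈-trans : ∀ {a b c m} → a ≈ b [ m ] → b ≈ c [ m ] → a ≈ c [ m ]
≈-trans {a} {b} {c} h k = lc (h ⊕ k) (solve 3 (λ a b c → a :- b := a :+ c :- (c :+ b)) refl a c b)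

modulus≈0 : ∀ {m} → m ≈ 0ℤ [ m ]
modulus≈0 {m} = mod≈ 1ℤ (solve 1 (λ a → a :- con 0ℤ := con 1ℤ :* a) refl m)

≈-coarsen : ∀ {a b m l} → m ≈ 0ℤ [ l ] → a ≈ b [ m ] → a ≈ b [ l ]
≈-coarsen {a} {b} {m} {l} (mod≈ p x) (mod≈ q y) = mod≈ (q * p)
  (trans y (trans (solve 2 (λ a b → a :* b := a :* (b :- con 0ℤ)) refl q m) (trans (cong (q *_) x)
      (solve 3 (λ a b c → a :* (b :* c) := a :* b :* c) refl q p l))))

≈0⇒multiple : ∀ {a m} → a ≈ 0ℤ [ m ] → ∃[ q ] a ≡ q * m
≈0⇒multiple {a} (mod≈ q eq) = q , trans (solve 1 (λ a → a := a :- con 0ℤ) refl a) eq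

multiple⇒≈0 : ∀ {m} q → q * m ≈ 0ℤ [ m ]
multiple⇒≈0 {m} q = mod≈ q (solve 2 (λ a b → a :* b :- con 0ℤ := a :* b) refl q m)

residue : ∀ (a : ℤ) (m : ℕ) .{{_ : NonZero m}} → a ≈ + (a %ℕ m) [ + m ]
residue a m = mod≈ (a /ℕ m) (trans (cong (_- + (a %ℕ m)) (a≡a%ℕn+[a/ℕn]*n a m))
  (solve 3 (λ a b c → a :+ b :* c :- a := b :* c) refl (+ (a %ℕ m)) (a /ℕ m) (+ m)))

-- Parity, 2-torsion, greatest common divisors and subgroups of ℤ

abstract
  parity : ∀ (a : ℤ) → ∃[ q ] (a ≡ + 2 * q ⊎ a ≡ + 2 * q + 1ℤ)
  parity a = let mod≈ q eq = residue a 2 in q , go q (a %ℕ 2) (n%ℕd<d a 2) eq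
    where
    go : ∀ q r → r ℕ.< 2 → a - + r ≡ q * + 2 → a ≡ + 2 * q ⊎ a ≡ + 2 * q + 1ℤ
    go q 0 _ eq = inj₁ (trans (solve 1 (λ a → a := a :- con (+ 0)) refl a) (trans eq (solve 1 (λ a → a :* con (+ 2) := con (+ 2) :* a) refl q)))
    go q 1 _ eq = inj₂ (trans (solve 1 (λ a → a := a :- con (+ 1) :+ con (+ 1)) refl a) (trans (cong (_+ 1ℤ) eq)
        (solve 1 (λ a → a :* con (+ 2) :+ con 1ℤ := con (+ 2) :* a :+ con 1ℤ) refl q)))
    go q (suc (suc _)) (ℕ.s≤s (ℕ.s≤s ())) _

-- Write 2a = qn. If q were even, cancelling 2 would make a a multiple of n; so q is odd.
2-torsion-half : ∀ {a n} → a + a ≈ 0ℤ [ n ] → ¬ a ≈ 0ℤ [ n ] → ∃[ q ] (a + a ≡ n + + 2 * (q * n))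
2-torsion-half {a} {n} h a≉0 = let q , eq = ≈0⇒multiple h ; r , even⊎odd = parity q in r , go q r eq even⊎odd
  where
  go : ∀ q r → a + a ≡ q * n → (q ≡ + 2 * r ⊎ q ≡ + 2 * r + 1ℤ) → a + a ≡ n + + 2 * (r * n)
  go q r eq (inj₁ refl) = ⊥-elim (a≉0 (subst (_≈ 0ℤ [ n ]) (sym (*-cancelˡ-≡ (+ 2) a (r * n) (trans (solve 1 (λ a → con (+ 2) :* a := a :+ a) refl a)
      (trans eq (solve 2 (λ a b → con (+ 2) :* a :* b := con (+ 2) :* (a :* b)) refl r n))))) (multiple⇒≈0 r)))
  go q r eq (inj₂ refl) = trans eq (solve 2 (λ a b → (con (+ 2) :* a :+ con 1ℤ) :* b := b :+ con (+ 2) :* (a :* b)) refl r n)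

-- The cyclic group ⟨a⟩ has at most one involution: both doubles are odd multiples of n, so their
-- difference is an even multiple, which can be halved.
2-torsion-unique : ∀ {a b n} → a + a ≈ 0ℤ [ n ] → ¬ a ≈ 0ℤ [ n ] → b + b ≈ 0ℤ [ n ] → ¬ b ≈ 0ℤ [ n ] → a ≈ b [ n ]
2-torsion-unique {a} {b} {n} ha a≉0 hb b≉0 =
  let p , eqa = 2-torsion-half ha a≉0
      q , eqb = 2-torsion-half hb b≉0
  in mod≈ (p - q) (*-cancelˡ-≡ (+ 2) (a - b) ((p - q) * n)
      (trans (solve 2 (λ a b → con (+ 2) :* (a :- b) := a :+ a :- (b :+ b)) refl a b)
        (trans (cong₂ _-_ eqa eqb) (solve 3 (λ a b c → a :+ con (+ 2) :* (b :* a) :- (a :+ con (+ 2) :* (c :* a)) := con (+ 2) :* ((b :- c) :* a)) refl n p q))))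

abstract
  bezout : ∀ a n → ∃[ g ] ((∃[ α ] + g ≈ α * a [ + n ]) × a ≈ 0ℤ [ + g ] × + n ≈ 0ℤ [ + g ] × g ≡ ℕ.gcd ∣ a ∣ n)
  bezout a n = g , combine (ℕ.Bézout.identity (ℕ.gcd-GCD ∣ a ∣ n)) , g∣a , ∣→ (ℕ.gcd[m,n]∣n ∣ a ∣ n) , refl
    where
    g : ℕ
    g = ℕ.gcd ∣ a ∣ n
    A : ℤ
    A = + ∣ a ∣
    ∣→ : ∀ {b} → g ℕ.∣ b → + b ≈ 0ℤ [ + g ]
    ∣→ (ℕ.divides q refl) = subst (_≈ 0ℤ [ + g ]) (sym (pos-* q g)) (multiple⇒≈0 (+ q))
    sign-abs : ∀ a → (+ ∣ a ∣ ≡ a) ⊎ (+ ∣ a ∣ ≡ - a)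
    sign-abs (+ k) = inj₁ refl
    sign-abs -[1+ k ] = inj₂ refl
    -- The Bézout identity concerns absolute values; the sign σ of `a` carries it over to `a`
    -- itself.
    ∣a∣≈ : ∃[ σ ] (+ ∣ a ∣ ≡ σ * a × a ≡ σ * + ∣ a ∣)
    ∣a∣≈ with sign-abs a
    ... | inj₁ eq = 1ℤ , trans eq (solve 1 (λ a → a := con 1ℤ :* a) refl a) , trans (solve 1 (λ a → a := con 1ℤ :* a) refl a) (cong (1ℤ *_) (sym eq))
    ... | inj₂ eq = -1ℤ , trans eq (solve 1 (λ a → :- a := con -1ℤ :* a) refl a) , trans (solve 1 (λ a → a := con -1ℤ :* :- a) refl a)
        (cong (-1ℤ *_) (sym eq))
    σ : ℤ
    σ = proj₁ ∣a∣≈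
    σa : + ∣ a ∣ ≈ σ * a [ + n ]
    σa = ≡⇒≈ (proj₁ (proj₂ ∣a∣≈))
    g∣a : a ≈ 0ℤ [ + g ]
    g∣a = subst (_≈ 0ℤ [ + g ]) (sym (proj₂ (proj₂ ∣a∣≈)))
      (lc (σ ⊙ ∣→ (ℕ.gcd[m,n]∣m ∣ a ∣ n)) (solve 2 (λ a b → a :* b :- con 0ℤ := a :* b :- a :* con 0ℤ) refl σ A))
    lift : ∀ x y z w → x ℕ.+ y ℕ.* z ≡ w → + x + + y * + z ≡ + w
    lift x y z w eq = trans (cong (_+_ (+ x)) (sym (pos-* y z))) (trans (sym (pos-+ x (y ℕ.* z))) (cong +_ eq))
    combine : ℕ.Bézout.Identity g ∣ a ∣ n → (∃[ α ] + g ≈ α * a [ + n ])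
    combine (ℕ.Bézout.+- x y eq) = + x * σ ,
      (lc (≡⇒≈ (trans (lift g y n (x ℕ.* ∣ a ∣) eq) (pos-* x ∣ a ∣)) ⊕ (+ x) ⊙ σa ⊕ (- + y) ⊙ modulus≈0)
          (solve 7 (λ a b c d e f g → a :- b :* c :* d := a :+ e :* f :+ b :* g :+ :- e :* f :- (b :* g :+ b :* (c :* d) :+ :- e :* con 0ℤ)) refl
          (+ g) (+ x) σ a (+ y) (+ n) A))
    combine (ℕ.Bézout.-+ x y eq) = - (+ x * σ) ,
      (lc (≡⇒≈ (trans (lift g x ∣ a ∣ (y ℕ.* n) eq) (pos-* y n)) ⊕ (- + x) ⊙ σa ⊕ (+ y) ⊙ modulus≈0)
          (solve 7 (λ a b c d e f g → a :- :- (b :* c) :* d := a :+ b :* e :+ :- b :* e :+ f :* g :- (f :* g :+ :- b :* (c :* d) :+ f :* con 0ℤ)) refl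
          (+ g) (+ x) σ a A (+ y) (+ n)))

-- With g = gcd(a, n), the number n/g annihilates a and hence b, so g divides b; and g is a multiple
-- of a modulo n by Bézout.
annihilator⇒multiple : ∀ {a b} n .{{_ : NonZero n}} → (∀ μ → μ * a ≈ 0ℤ [ + n ] → μ * b ≈ 0ℤ [ + n ]) → ∃[ μ ] b ≈ μ * a [ + n ]
annihilator⇒multiple {a} {b} n ann =
  let g , (α , hα) , g∣a , g∣n , _ = bezout a n
      i , a≡ig = ≈0⇒multiple g∣a
      q , n≡qg = ≈0⇒multiple g∣n
      j , qb≡jn = ≈0⇒multiple (ann q (lc (q ⊙ ≡⇒≈ a≡ig ⊕ i ⊙ ≡⇒≈ (sym n≡qg) ⊕ i ⊙ modulus≈0)
          (solve 5 (λ a b c d e → a :* b :- con 0ℤ := a :* b :+ c :* (a :* d) :+ c :* e :- (a :* (c :* d) :+ c :* e :+ c :* con 0ℤ)) refl q a i (+ g)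
          (+ n))))
  in j * α , ≈-trans (≡⇒≈ (cancel {g} {q} {j} n≡qg qb≡jn)) (lc (j ⊙ hα) (solve 4 (λ a b c d → a :* b :- a :* c :* d := a :* b :- a :* (c :* d)) refl j (+ g) α a))
  where
  cancel : ∀ {g q j} → + n ≡ q * + g → q * b ≡ j * + n → b ≡ j * + g
  cancel {g} {q} {j} n≡qg qb≡jn = *-cancelˡ-≡ q b (j * + g) {{≢-nonZero q≢0}}
    (trans qb≡jn (trans (cong (j *_) n≡qg) (solve 3 (λ a b c → a :* (b :* c) := b :* (a :* c)) refl j q (+ g))))
    where
    q≢0 : q ≢ 0ℤ
    q≢0 refl = ℕ.≢-nonZero⁻¹ n (cong ∣_∣ n≡qg)

-- Descent on a positive element d: a smaller positive element replaces d. If there is none, the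
-- remainder of any element modulo d is again an element, lies below d, and so vanishes.
subgroup-generator : (P : ℤ → Set) → (∀ v → Dec (P v)) → (∀ {u v} → P u → P v → P (u - v)) →
  ∀ (d : ℕ) .{{_ : NonZero d}} → P (+ d) → ∃[ g ] (NonZero g × P (+ g) × (∀ v → P v → v ≈ 0ℤ [ + g ]))
subgroup-generator P P? P- d Pd = search d (<-wellFounded d) Pd
  where
  P0 : P 0ℤ
  P0 = subst P (+-inverseʳ (+ d)) (P- Pd Pd)
  P-multiple : ∀ {g} → P g → ∀ q → P (q * g)
  P-multiple {g} Pg (+ zero) = subst P (sym (*-zeroˡ g)) P0
  P-multiple {g} Pg (+ suc k) = subst P (solve 2 (λ a b → a :* b :- (con 0ℤ :- b) := (con 1ℤ :+ a) :* b) refl (+ k) g) (P- (P-multiple Pg (+ k))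
      (P- P0 Pg))
  P-multiple {g} Pg -[1+ zero ] = subst P (solve 1 (λ a → con 0ℤ :- a := con -1ℤ :* a) refl g) (P- P0 Pg)
  P-multiple {g} Pg -[1+ suc k ] = subst P (solve 2 (λ a b → :- (con 1ℤ :+ a) :* b :- b := :- (con 1ℤ :+ (con 1ℤ :+ a)) :* b) refl (+ k) g)
      (P- (P-multiple Pg -[1+ k ]) Pg)
  search : ∀ d .{{_ : NonZero d}} → Acc ℕ._<_ d → P (+ d) → ∃[ g ] (NonZero g × P (+ g) × (∀ v → P v → v ≈ 0ℤ [ + g ]))
  search d@(suc d') (acc rs) Pd with all? {n = d} (λ i → P? (+ toℕ i) →-dec (+ toℕ i ≟ 0ℤ))
  ... | yes minimal = d , _ , Pd , divisible
    where
    divisible : ∀ v → P v → v ≈ 0ℤ [ + d ]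
    divisible v Pv = ≈-trans (residue v d) (≡⇒≈ (trans (cong +_ (sym (toℕ-fromℕ< (n%ℕd<d v d))))
      (minimal (fromℕ< (n%ℕd<d v d)) (subst (λ r → P (+ r)) (sym (toℕ-fromℕ< (n%ℕd<d v d))) Pr))))
      where
      Pr : P (+ (v %ℕ d))
      Pr = subst P (trans (cong (_- (v /ℕ d) * + d) (a≡a%ℕn+[a/ℕn]*n v d)) (solve 3 (λ a b c → a :+ b :* c :- b :* c := a) refl (+ (v %ℕ d)) (v /ℕ d)
          (+ d)))
        (P- Pv (P-multiple Pd (v /ℕ d)))
  ... | no ¬minimal = go (¬∀⟶∃¬ d _ (λ i → P? (+ toℕ i) →-dec (+ toℕ i ≟ 0ℤ)) ¬minimal)
    where
    go : ∃[ i ] ¬ (P (+ toℕ i) → + toℕ i ≡ 0ℤ) → _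
    go (i , ¬p) with P? (+ toℕ i)
    ... | no ¬Pi = ⊥-elim (¬p (λ Pi → ⊥-elim (¬Pi Pi)))
    ... | yes Pi = search (toℕ i) {{ℕ.≢-nonZero (λ eq → ¬p (λ _ → cong +_ eq))}} (rs (toℕ<n i)) Pi

-- Turns a check over one round of indices into a statement about all integers; together with `all?`
-- it makes periods and translations decidable.
∀-residues : (d : ℕ) .{{_ : NonZero d}} (P : ℤ → Set) → (∀ {k l} → k ≈ l [ + d ] → P k → P l) →
  (∀ (i : Fin d) → P (+ toℕ i)) → ∀ k → P k
∀-residues d P resp f k = resp (≈-sym (residue k d)) (subst (λ r → P (+ r)) (toℕ-fromℕ< (n%ℕd<d k d)) (f (fromℕ< (n%ℕd<d k d))))

-- Words and map automorphisms

module Exponents (e : ℤ → ℤ) (s : ℤ → Bool) where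

  -- From b a^q = a^(-q) b: every reflection met negates the exponent of the rest of the word.
  exponent : List ℤ → ℤ
  exponent [] = 0ℤ
  exponent (k ∷ W) = if s k then e k - exponent W else e k + exponent W

  kind : List ℤ → Bool
  kind [] = false
  kind (k ∷ W) = s k xor kind W

  signed : Bool → ℤ → ℤ
  signed false p = p
  signed true p = - p

  exponent-++ : ∀ W V → exponent (W ++ V) ≡ exponent W + signed (kind W) (exponent V)
  exponent-++ [] V = solve 1 (λ a → a := con 0ℤ :+ a) refl (exponent V)
  exponent-++ (k ∷ W) V with s k | kind W | exponent-++ W V
  ... | false | t | eq = trans (cong (_+_ (e k)) eq) (solve 3 (λ a b c → a :+ (b :+ c) := a :+ b :+ c) refl (e k) (exponent W)
      (signed t (exponent V)))
  ... | true | false | eq = trans (cong (_-_ (e k)) eq) (solve 3 (λ a b c → a :- (b :+ c) := a :- b :+ :- c) refl (e k) (exponent W) (exponent V))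
  ... | true | true | eq = trans (cong (_-_ (e k)) eq) (solve 3 (λ a b c → a :- (b :+ :- c) := a :- b :+ c) refl (e k) (exponent W) (exponent V))

  kind-++ : ∀ W V → kind (W ++ V) ≡ kind W xor kind V
  kind-++ [] V = refl
  kind-++ (k ∷ W) V = trans (cong (s k xor_) (kind-++ W V)) (sym (xor-assoc (s k) (kind W) (kind V)))
    where open import Data.Bool.Properties using (xor-assoc)

  power : ℕ → List ℤ → List ℤ
  power zero W = []
  power (suc i) W = W ++ power i W

module Words (n : ℤ) (e : ℤ → ℤ) (s : ℤ → Bool) where
  open Exponents e s public

  -- The product of the letters x_k = a^(e k) b^(s k), k ∈ W, is a^p b^t.
  record Val (W : List ℤ) (p : ℤ) (t : Bool) : Set where
    constructor val
    field
      exponent≈ : exponent W ≈ p [ n ]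
      kind≡ : kind W ≡ t
  open Val public

  val[] : Val [] 0ℤ false
  val[] = val ≈-refl refl

  val-rot : ∀ {k W p t} → s k ≡ false → Val W p t → Val (k ∷ W) (e k + p) t
  val-rot {k} {W} {p} sk (val x y) = val
    (≈-trans (≡⇒≈ (cong (λ b → if b then e k - exponent W else e k + exponent W) sk)) (lc x
        (solve 3 (λ a b c → a :+ b :- (a :+ c) := b :- c) refl (e k) (exponent W) p)))
    (trans (cong (_xor kind W) sk) y)

  val-ref : ∀ {k W p t} → s k ≡ true → Val W p t → Val (k ∷ W) (e k - p) (not t)
  val-ref {k} {W} {p} sk (val x y) = val
    (≈-trans (≡⇒≈ (cong (λ b → if b then e k - exponent W else e k + exponent W) sk)) (lc (⊖ x)
        (solve 3 (λ a b c → a :- b :- (a :- c) := :- b :- :- c) refl (e k) (exponent W) p)))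
    (trans (cong (_xor kind W) sk) (cong not y))

  val-≈ : ∀ {W p q t} → Val W p t → p ≈ q [ n ] → Val W q t
  val-≈ (val x y) h = val (≈-trans x h) y

  val-exists : ∀ W → Val W (exponent W) (kind W)
  val-exists W = val ≈-refl refl

  val-++ : ∀ {W V p q t} → Val W p false → Val V q t → Val (W ++ V) (p + q) t
  val-++ {W} {V} {p} {q} {t} (val x y) (val x' y') = val
    (≈-trans (≡⇒≈ (trans (exponent-++ W V) (cong (λ u → exponent W + signed u (exponent V)) y)))
       (lc (x ⊕ x') (solve 4 (λ a b c d → a :+ b :- (c :+ d) := a :+ b :- (c :+ d)) refl (exponent W) (exponent V) p q)))
    (trans (kind-++ W V) (trans (cong (_xor kind V) y) y'))

  -- Powers of words have natural exponents; an integer multiple of p is realised later by passing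
  -- to the residue of the multiplier modulo n.
  val-power : ∀ {W p} i → Val W p false → Val (power i W) (+ i * p) false
  val-power {W} {p} zero v = val-≈ val[] (≡⇒≈ (solve 1 (λ a → con 0ℤ := con (+ 0) :* a) refl p))
  val-power {W} {p} (suc i) v = val-≈ (val-++ v (val-power i v)) (≡⇒≈ (solve 2 (λ a b → a :+ b :* a := (con 1ℤ :+ b) :* a) refl p (+ i)))

module Shifts (d : ℤ) (χ : ℤ → ℤ) where

  -- The image of a word under the automorphism (1 , k) ↦ (1 , σ k + c): the letter x_k read at a vertex
  -- with current offset c becomes x_(σ k + c), and the next offset is χ (σ k + c) - σ χ k.
  data Shift (σ : ℤ) : ℤ → List ℤ → List ℤ → ℤ → Set where
    done : ∀ {c c'} → c ≈ c' [ d ] → Shift σ c [] [] c'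
    step : ∀ {c k k' W W' c'} (l l' : ℤ) → χ k ≈ l [ d ] → χ k' ≈ l' [ d ] → k' ≈ σ * k + c [ d ] →
           Shift σ (l' - σ * l) W W' c' → Shift σ c (k ∷ W) (k' ∷ W') c'

  shift-start : ∀ {σ c c₁ W W' c'} → c₁ ≈ c [ d ] → Shift σ c W W' c' → Shift σ c₁ W W' c'
  shift-start h (done x) = done (≈-trans h x)
  shift-start {σ} {c} {c₁} h (step {k = k} {k' = k'} l l' x y z r) =
    step l l' x y (lc (z ⊕ ⊖ h) (solve 5 (λ a b c d e → a :- (b :* c :+ d) := a :+ :- d :- (b :* c :+ e :+ :- e)) refl k' σ k c₁ c)) r

  shift-end : ∀ {σ c c₁ W W' c'} → c' ≈ c₁ [ d ] → Shift σ c W W' c' → Shift σ c W W' c₁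
  shift-end h (done x) = done (≈-trans x h)
  shift-end h (step l l' x y z r) = step l l' x y z (shift-end h r)

  shift-++ : ∀ {σ c c₁ c₂ W W' V V'} → Shift σ c W W' c₁ → Shift σ c₁ V V' c₂ → Shift σ c (W ++ V) (W' ++ V') c₂
  shift-++ (done x) t = shift-start x t
  shift-++ (step l l' x y z r) t = step l l' x y z (shift-++ r t)

  image : ℤ → ℤ → List ℤ → List ℤ × ℤ
  image σ c [] = [] , c
  image σ c (k ∷ W) = let r = image σ (χ (σ * k + c) - σ * χ k) W in (σ * k + c) ∷ proj₁ r , proj₂ r

  shift-image : ∀ σ c W → Shift σ c W (proj₁ (image σ c W)) (proj₂ (image σ c W))
  shift-image σ c [] = done ≈-refl
  shift-image σ c (k ∷ W) = step _ _ ≈-refl ≈-refl ≈-refl (shift-image σ _ W)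

data Sign : ℤ → Set where
  pos : Sign 1ℤ
  neg : Sign -1ℤ

sign² : ∀ {σ} → Sign σ → σ * σ ≡ 1ℤ
sign² pos = refl
sign² neg = refl

sign-* : ∀ {σ τ} → Sign σ → Sign τ → Sign (σ * τ)
sign-* pos pos = pos
sign-* pos neg = neg
sign-* neg pos = neg
sign-* neg neg = pos

-- A reflexible regular Cayley map of D_n of valency d, with the generators indexed by ℤ (mod d):
-- x_k = a^(e k) b^(s k), and χ k is the index of x_k⁻¹. Comments write y_k for x_k when it is a rotation
-- (s k ≡ false) and z_k when it is a reflection.
record System (n d : ℕ) : Set where
  field
    e χ : ℤ → ℤ
    s : ℤ → Bool
    n≢0 : NonZero n
    d≢0 : NonZero d
    s-cong : ∀ {k l} → k ≈ l [ + d ] → s k ≡ s l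
    e-cong : ∀ {k l} → k ≈ l [ + d ] → e k ≈ e l [ + n ]
    χ-cong : ∀ {k l} → k ≈ l [ + d ] → χ k ≈ χ l [ + d ]
    χχ : ∀ k → χ (χ k) ≈ k [ + d ]
    s-χ : ∀ k → s (χ k) ≡ s k
    χ-ref : ∀ {k} → s k ≡ true → χ k ≈ k [ + d ]
    e-χ : ∀ {k} → s k ≡ false → e (χ k) ≈ - e k [ + n ]
    distinct : ∀ {k l} → s k ≡ s l → e k ≈ e l [ + n ] → k ≈ l [ + d ]
    nonunit : ∀ {k} → s k ≡ false → ¬ e k ≈ 0ℤ [ + n ]
  open Words (+ n) e s public
  open Shifts (+ d) χ public
  field
    generates : ∀ p t → ∃[ W ] Val W p t
    -- The case σ = 1 expresses regularity and σ = -1 reflexibility; c is arbitrary because an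
    -- automorphism fixing 1 may start at any offset.
    law : ∀ {σ} → Sign σ → ∀ {c W₁ W₁' c₁ W₂ W₂' c₂ p t q₁ u₁ q₂ u₂} →
      Val W₁ p t → Val W₂ p t → Shift σ c W₁ W₁' c₁ → Shift σ c W₂ W₂' c₂ →
      Val W₁' q₁ u₁ → Val W₂' q₂ u₂ → q₁ ≈ q₂ [ + n ] × u₁ ≡ u₂ × c₁ ≈ c₂ [ + d ]

bool-absurd : {A : Set} {b : Bool} → b ≡ false → b ≡ true → A
bool-absurd refl ()

-- Changes the origin and the direction of the cyclic order, so that later arguments can place a
-- chosen generator at index 0.
reindex : ∀ {n d} → System n d → ∀ {σ} → Sign σ → ℤ → System n d
reindex {n} {d} S {σ} sgn t = record
  { e = λ k → e (ι k) ; χ = χ' ; s = λ k → s (ι k) ; n≢0 = n≢0 ; d≢0 = d≢0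
  ; s-cong = λ h → s-cong (ι-cong h) ; e-cong = λ h → e-cong (ι-cong h)
  ; χ-cong = λ {k} {l} h → (lc (σ ⊙ χ-cong (ι-cong h)) (solve 4 (λ a b c d → a :* (b :- c) :- a :* (d :- c) := a :* b :- a :* d) refl σ (χ (ι k)) t
      (χ (ι l))))
  ; χχ = λ k → ≈-trans (σ ⊙ (≈-trans (χ-cong (ιχ' k)) (χχ (ι k)) ⊕ ≈-refl)) (ι⁻¹ k)
  ; s-χ = λ k → trans (s-cong (ιχ' k)) (s-χ (ι k))
  ; χ-ref = λ {k} h → ≈-trans (σ ⊙ (χ-ref h ⊕ ≈-refl)) (ι⁻¹ k)
  ; e-χ = λ {k} h → ≈-trans (e-cong (ιχ' k)) (e-χ h)
  ; distinct = λ {k} {l} h h' → ι-injective (distinct h h')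
  ; nonunit = nonunit
  ; generates = λ p t → let W , v = generates p t in
      map ι⁻ W , back {map ι⁻ W} (val-map W v)
  ; law = λ {σ'} sgn' v₁ v₂ r₁ r₂ v₁' v₂' → let q , u , c = law sgn' (forth v₁) (forth v₂) (Shift-forth r₁) (Shift-forth r₂) (forth v₁') (forth v₂')
      in q , u , offset-injective {σ'} c
  }
  where
  open System S
  ι : ℤ → ℤ
  ι k = σ * k + t
  ι⁻ : ℤ → ℤ
  ι⁻ k = σ * (k - t)
  χ' : ℤ → ℤ
  χ' k = σ * (χ (ι k) - t)
  σσ : ∀ {m} → σ * σ ≈ 1ℤ [ m ]
  σσ = ≡⇒≈ (sign² sgn)
  ι-cong : ∀ {k l m} → k ≈ l [ m ] → ι k ≈ ι l [ m ]
  ι-cong {k} {l} h = lc (σ ⊙ h) (solve 4 (λ a b c d → a :* b :+ c :- (a :* d :+ c) := a :* b :- a :* d) refl σ k t l)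
  ι-injective : ∀ {k l m} → ι k ≈ ι l [ m ] → k ≈ l [ m ]
  ι-injective {k} {l} {m} h = lc (σ ⊙ h ⊕ (l - k) ⊙ σσ)
      (solve 4 (λ a b c d → a :- b := c :* (c :* a :+ d) :+ (b :- a) :* (c :* c) :- (c :* (c :* b :+ d) :+ (b :- a) :* con 1ℤ)) refl k l σ t)
  ι⁻¹ : ∀ k {m} → ι⁻ (ι k) ≈ k [ m ]
  ι⁻¹ k {m} = lc (k ⊙ σσ) (solve 3 (λ a b c → a :* (a :* b :+ c :- c) :- b := b :* (a :* a) :- b :* con 1ℤ) refl σ k t)
  ιι⁻ : ∀ k {m} → ι (ι⁻ k) ≈ k [ m ]
  ιι⁻ k {m} = lc ((k - t) ⊙ σσ) (solve 3 (λ a b c → a :* (a :* (b :- c)) :+ c :- b := (b :- c) :* (a :* a) :- (b :- c) :* con 1ℤ) refl σ k t)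
  ιχ' : ∀ k {m} → ι (χ' k) ≈ χ (ι k) [ m ]
  ιχ' k = ιι⁻ (χ (ι k))
  module T = Words (+ n) (λ k → e (ι k)) (λ k → s (ι k))
  module U = Shifts (+ d) χ'
  exponent-ι : ∀ W → T.exponent W ≡ exponent (map ι W)
  exponent-ι [] = refl
  exponent-ι (k ∷ W) with s (ι k)
  ... | false = cong (_+_ (e (ι k))) (exponent-ι W)
  ... | true = cong (_-_ (e (ι k))) (exponent-ι W)
  kind-ι : ∀ W → T.kind W ≡ kind (map ι W)
  kind-ι [] = refl
  kind-ι (k ∷ W) = cong (s (ι k) xor_) (kind-ι W)
  forth : ∀ {W p t} → T.Val W p t → Val (map ι W) p t
  forth {W} {p} (T.val x y) = val (subst (_≈ p [ + n ]) (exponent-ι W) x) (trans (sym (kind-ι W)) y)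
  back : ∀ {W p t} → Val (map ι W) p t → T.Val W p t
  back {W} {p} (val x y) = T.val (subst (_≈ p [ + n ]) (sym (exponent-ι W)) x) (trans (kind-ι W) y)
  step-val : ∀ {k l W p t} → k ≈ l [ + d ] → ∀ b → s k ≡ b → exponent W ≈ p [ + n ] → kind W ≡ t →
    Val (l ∷ W) (if b then e k - p else e k + p) (b xor t)
  step-val {k} {l} {W} {p} h false eq x y = val-≈ (val-rot (trans (sym (s-cong h)) eq) (val x y)) (lc (⊖ e-cong h)
      (solve 3 (λ a b c → a :+ b :- (c :+ b) := :- c :- :- a) refl (e l) p (e k)))
  step-val {k} {l} {W} {p} h true eq x y = val-≈ (val-ref (trans (sym (s-cong h)) eq) (val x y)) (lc (⊖ e-cong h)
      (solve 3 (λ a b c → a :- b :- (c :- b) := :- c :- :- a) refl (e l) p (e k)))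
  same-val : ∀ W → Val (map ι (map ι⁻ W)) (exponent W) (kind W)
  same-val [] = val[]
  same-val (k ∷ W) = let val x y = same-val W in step-val (≈-sym (ιι⁻ k)) (s k) refl x y
  val-map : ∀ W {p t} → Val W p t → Val (map ι (map ι⁻ W)) p t
  val-map W (val x y) = let val x' y' = same-val W in val (≈-trans x' x) (trans y' y)
  -- In the old indices k ↦ σ' k + c becomes k ↦ σ' k + (σ c + t - σ' t), as one sees by applying ι
  -- to both sides.
  offset : ℤ → ℤ → ℤ
  offset σ' c = (σ * c + t) - σ' * t
  offset-injective : ∀ {σ' c c'} → offset σ' c ≈ offset σ' c' [ + d ] → c ≈ c' [ + d ]
  offset-injective {σ'} {c} {c'} h = ι-injective (lc h
      (solve 5 (λ a b c d e → a :* b :+ c :- (a :* d :+ c) := a :* b :+ c :- e :* c :- (a :* d :+ c :- e :* c)) refl σ c t c' σ'))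
  Shift-forth : ∀ {σ' c W W' c'} → U.Shift σ' c W W' c' → Shift σ' (offset σ' c) (map ι W) (map ι W') (offset σ' c')
  Shift-forth {σ'} (U.done {c} {c'} h) = done (lc (σ ⊙ h)
      (solve 5 (λ a b c d e → a :* b :+ c :- d :* c :- (a :* e :+ c :- d :* c) := a :* b :- a :* e) refl σ c t σ' c'))
  Shift-forth {σ'} (U.step {c} {k} {k'} l l' x y z r) =
    step (ι l) (ι l') (≈-trans (≈-sym (ιχ' k)) (ι-cong x)) (≈-trans (≈-sym (ιχ' k')) (ι-cong y))
      (lc (σ ⊙ z) (solve 6 (λ a b c d e f → a :* b :+ c :- (d :* (a :* e :+ c) :+ (a :* f :+ c :- d :* c)) := a :* b :- a :* (d :* e :+ f)) refl σ k' t σ' k c))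
      (shift-start (≡⇒≈ (solve 5 (λ a b c d e → a :* b :+ c :- d :* (a :* e :+ c) := a :* (b :- d :* e) :+ c :- d :* c) refl σ l' t σ' l))
          (Shift-forth r))

-- Consequences of generation, and group automorphisms

module Generic {n d : ℕ} (S : System n d) where
  open System S

  instance
    n-nonZero : NonZero n
    n-nonZero = n≢0
    d-nonZero : NonZero d
    d-nonZero = d≢0

  rotation? : (∃[ k ] s k ≡ false) ⊎ (∀ k → s k ≡ true)
  rotation? with any? {n = d} (λ i → s (+ toℕ i) ≟ᵇ false)
  ... | yes (i , h) = inj₁ (+ toℕ i , h)
  ... | no h = inj₂ (∀-residues d (λ k → s k ≡ true) (λ x → trans (sym (s-cong x))) (λ i → flip-to-true (λ x → h (i , x))))
    where
    flip-to-true : ∀ {b} → b ≢ false → b ≡ true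
    flip-to-true {false} h = ⊥-elim (h refl)
    flip-to-true {true} h = refl

  reflection-exists : ∃[ k ] s k ≡ true
  reflection-exists = let W , val x y = generates 0ℤ true in find W y
    where
    find : ∀ W → kind W ≡ true → ∃[ k ] s k ≡ true
    find (k ∷ W) h = by-kind (s k) refl h
      where
      by-kind : ∀ b → s k ≡ b → b xor kind W ≡ true → ∃[ k ] s k ≡ true
      by-kind true eq _ = k , eq
      by-kind false _ h = find W h

  -- The elements a^p and a^(p + j) b with `P p` form a subgroup; it contains all generators, hence
  -- every a^p. This is how generation of D_n shows that a few exponents already generate ℤ modulo
  -- n.
  span : (P : ℤ → Set) (j : ℤ) → P 0ℤ → (∀ {a b} → P a → P b → P (a - b)) → (∀ {a b} → a ≈ b [ + n ] → P a → P b) →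
    (∀ k → s k ≡ false → P (e k)) → (∀ k → s k ≡ true → P (e k - j)) → ∀ p → P p
  span P j P0 P- P≈ PY PZ p = let W , v = generates p false in
      P≈ (≈-trans (≡⇒≈ (solve 1 (λ a → a := a) refl (exponent W))) (exponent≈ v)) (subst (λ b → P (if b then exponent W - j else exponent W))
          (kind≡ v) (go W))
    where
    P+ : ∀ {a b} → P a → P b → P (a + b)
    P+ {a} {b} x y = P≈ (≡⇒≈ (solve 2 (λ a b → a :- (con 0ℤ :- b) := a :+ b) refl a b)) (P- x (P- P0 y))
    go : ∀ W → P (if kind W then exponent W - j else exponent W)
    go [] = P0
    go (k ∷ W) = by-kind (s k) refl (kind W) (go W)
      where
      by-kind : ∀ b → s k ≡ b → ∀ t → P (if t then exponent W - j else exponent W) →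
        P (if b xor t then (if b then e k - exponent W else e k + exponent W) - j else (if b then e k - exponent W else e k + exponent W))
      by-kind false eq false x = P+ (PY k eq) x
      by-kind false eq true x = P≈ (≡⇒≈ (solve 3 (λ a b c → a :+ (b :- c) := a :+ b :- c) refl (e k) (exponent W) j)) (P+ (PY k eq) x)
      by-kind true eq false x = P≈ (≡⇒≈ (solve 3 (λ a b c → a :- b :- c := a :- c :- b) refl (e k) j (exponent W))) (P- (PZ k eq) x)
      by-kind true eq true x = P≈ (≡⇒≈ (solve 3 (λ a b c → a :- b :- (c :- b) := a :- c) refl (e k) j (exponent W))) (P- (PZ k eq) x)

  span₁ : ∀ u j → (∀ k → s k ≡ false → ∃[ q ] e k ≈ q * u [ + n ]) → (∀ k → s k ≡ true → ∃[ q ] e k ≈ j + q * u [ + n ]) →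
    ∀ p → ∃[ q ] p ≈ q * u [ + n ]
  span₁ u j = λ Y Z → span (λ p → ∃[ q ] p ≈ q * u [ + n ]) j (0ℤ , (≡⇒≈ (solve 1 (λ a → con 0ℤ := con 0ℤ :* a) refl u)))
    (λ { {a} {b} (q , x) (r , y) → q - r , (lc (x ⊕ ⊖ y)
        (solve 5 (λ a b c d e → a :- b :- (c :- d) :* e := a :+ :- b :- (c :* e :+ :- (d :* e))) refl a b q r u)) })
    (λ { h (q , x) → q , ≈-trans (≈-sym h) x })
    Y (λ k z → let q , x = Z k z in q , (lc x (solve 4 (λ a b c d → a :- b :- c :* d := a :- (b :+ c :* d)) refl (e k) j q u)))

  span₂ : ∀ u v j → (∀ k → s k ≡ false → ∃[ q ] ∃[ r ] e k ≈ q * u + r * v [ + n ]) →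
    (∀ k → s k ≡ true → ∃[ q ] ∃[ r ] e k ≈ j + (q * u + r * v) [ + n ]) →
    ∀ p → ∃[ q ] ∃[ r ] p ≈ q * u + r * v [ + n ]
  span₂ u v j = λ Y Z → span (λ p → ∃[ q ] ∃[ r ] p ≈ q * u + r * v [ + n ]) j (0ℤ , 0ℤ , (≡⇒≈
      (solve 2 (λ a b → con 0ℤ := con 0ℤ :* a :+ con 0ℤ :* b) refl u v)))
    (λ { {a} {b} (q , q' , x) (r , r' , y) → q - r , q' - r' , (lc (x ⊕ ⊖ y)
        (solve 8 (λ a b c d e f g h → a :- b :- ((c :- d) :* e :+
        (f :- g) :* h) := a :+ :- b :- (c :* e :+ f :* h :+ :- (d :* e :+ g :* h))) refl a b q r u q' r' v)) })
    (λ { h (q , r , x) → q , r , ≈-trans (≈-sym h) x })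
    Y (λ k z → let q , r , x = Z k z in q , r , (lc x
        (solve 6 (λ a b c d e f → a :- b :- (c :* d :+ e :* f) := a :- (b :+ (c :* d :+ e :* f))) refl (e k) j q u r v)))

  shift-power : ∀ {σ c W W'} i → Shift σ c W W' c → Shift σ c (power i W) (power i W') c
  shift-power zero r = done ≈-refl
  shift-power (suc i) r = shift-++ r (shift-power i r)

  -- The effect on exponents of the group automorphism with a ↦ a^z that is induced by k ↦ σ k + t.
  -- Reflections enter through quotients of two of them, which lie in ⟨a⟩.
  record Hom (σ t : ℤ) : Set where
    field
      z : ℤ
      rot≈ : ∀ k → s k ≡ false → e (σ * k + t) ≈ z * e k [ + n ]
      ref≈ : ∀ k l → s k ≡ true → s l ≡ true → e (σ * k + t) - e (σ * l + t) ≈ z * (e k - e l) [ + n ]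

  -- If k ↦ σ k + t respects kinds and inverses, the offset is constantly t, and the map automorphism is a group automorphism.
  hom : ∀ {σ} → Sign σ → ∀ t → (∀ k → s (σ * k + t) ≡ s k) → (∀ k → χ (σ * k + t) ≈ σ * χ k + t [ + d ]) → Hom σ t
  hom {σ} sgn t st χt = record { z = z ; rot≈ = rot≈ ; ref≈ = ref≈ }
    where
    f : ℤ → ℤ
    f k = σ * k + t
    shift : ∀ W → Shift σ t W (map f W) t
    shift [] = done ≈-refl
    shift (k ∷ W) = step (χ k) (σ * χ k + t) ≈-refl (χt k) ≈-refl
      (shift-start (≡⇒≈ (solve 3 (λ a b c → a :* b :+ c :- a :* b := c) refl σ (χ k) t)) (shift W))
    kind-f : ∀ W → kind (map f W) ≡ kind W
    kind-f [] = refl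
    kind-f (k ∷ W) = cong₂ _xor_ (st k) (kind-f W)
    A : List ℤ
    A = proj₁ (generates 1ℤ false)
    z : ℤ
    z = exponent (map f A)
    val-A' : Val (map f A) z false
    val-A' = val ≈-refl (trans (kind-f A) (kind≡ (proj₂ (generates 1ℤ false))))
    -- With A a word for a, the word W has the same product as a power of A. Since the offset stays
    -- t, the image of this power is the same power of the image of A, whence the factor z.
    through-a : ∀ {W p q u} → Val W p false → Val (map f W) q u → q ≈ z * p [ + n ]
    through-a {W} {p} {q} v v' =
      let r = p %ℕ n
          h , _ = law sgn (val-≈ (val-power r (proj₂ (generates 1ℤ false))) (lc (⊖ residue p n)
              (solve 2 (λ a b → a :* con 1ℤ :- b := :- b :- :- a) refl (+ r) p)))
                    v (shift-power r (shift A)) (shift W) (val-power r val-A') v'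
      in (lc (⊖ h ⊕ (- z) ⊙ residue p n) (solve 4 (λ a b c d → a :- b :* c := :- (d :* b) :+ :- b :* c :- (:- a :+ :- b :* d)) refl q z p (+ r)))
    rot≈ : ∀ k → s k ≡ false → e (f k) ≈ z * e k [ + n ]
    rot≈ k y = through-a {k ∷ []} (val-≈ (val-rot y val[]) (≡⇒≈ (solve 1 (λ a → a :+ con 0ℤ := a) refl (e k))))
      (val-≈ (val-rot (trans (st k) y) val[]) (≡⇒≈ (solve 1 (λ a → a :+ con 0ℤ := a) refl (e (f k)))))
    ref≈ : ∀ k l → s k ≡ true → s l ≡ true → e (f k) - e (f l) ≈ z * (e k - e l) [ + n ]
    ref≈ k l y y' = through-a {k ∷ l ∷ []} (val-≈ (val-ref y (val-ref y' val[])) (≡⇒≈ (solve 2 (λ a b → a :- (b :- con 0ℤ) := a :- b) refl (e k)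
        (e l))))
      (val-≈ (val-ref (trans (st k) y) (val-ref (trans (st l) y') val[])) (≡⇒≈ (solve 2 (λ a b → a :- (b :- con 0ℤ) := a :- b) refl (e (f k))
          (e (f l)))))

  -- Conjugation by the orientation-reversing automorphism inverts the other one, while both act on ⟨a⟩ by commuting multiplications.
  double-period : ∀ {t r} → (∀ k → s (1ℤ * k + t) ≡ s k) → Hom 1ℤ t → (∀ k → s (-1ℤ * k + r) ≡ s k) → Hom -1ℤ r → ∀ {k} → s k ≡ false →
      + 2 * t ≈ 0ℤ [ + d ]
  double-period {t} {r} st H sr K {k} y = lc
      (distinct (trans (s-cong (≡⇒≈ (solve 2 (λ a b → a :+ con (+ 2) :* b := con 1ℤ :* (con 1ℤ :* a :+ b) :+ b) refl k t)))
      (trans (st _) (st k))) final) (solve 2 (λ a b → con (+ 2) :* a :- con 0ℤ := b :+ con (+ 2) :* a :- b) refl t k)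
    where
    open Hom H using (z) renaming (rot≈ to z≈)
    open Hom K using () renaming (z to v; rot≈ to v≈)
    l k' : ℤ
    l = 1ℤ * k + t
    k' = -1ℤ * l + r
    yl : s l ≡ false
    yl = trans (st k) y
    yk' : s k' ≡ false
    yk' = trans (sr l) yl
    -- Translation by t, the reversal, and translation by t compose to the reversal. So v e k = z v
    -- z e k; as v² fixes e k, so does z², that is, e (k + 2t) = e k.
    e₁ : e (-1ℤ * k + r) ≈ z * (v * (z * e k)) [ + n ]
    e₁ = ≈-trans (e-cong (≡⇒≈ (solve 3 (λ a b c → con -1ℤ :* a :+ b := con 1ℤ :* (con -1ℤ :* (con 1ℤ :* a :+ c) :+ b) :+ c) refl k r t)))
        (≈-trans (z≈ k' yk') (z ⊙ (≈-trans (v≈ l yl) (v ⊙ z≈ k y))))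
    vv : e k ≈ v * (v * e k) [ + n ]
    vv = ≈-trans (e-cong (≡⇒≈ (solve 2 (λ a b → a := con -1ℤ :* (con -1ℤ :* a :+ b) :+ b) refl k r))) (≈-trans (v≈ _ (trans (sr k) y)) (v ⊙ v≈ k y))
    final : e (k + + 2 * t) ≈ e k [ + n ]
    final = ≈-trans (e-cong (≡⇒≈ (solve 2 (λ a b → a :+ con (+ 2) :* b := con 1ℤ :* (con 1ℤ :* a :+ b) :+ b) refl k t))) (≈-trans (z≈ l yl)
      (lc (z ⊙ z≈ k y ⊕ (z * z) ⊙ vv ⊕ v ⊙ v≈ k y ⊕ (- v) ⊙ e₁ ⊕ -1ℤ ⊙ vv)
          (solve 5 (λ a b c d e → a :* b :- c := a :* b :+ a :* a :* c :+ d :* e :+ :- d :* e :+ con -1ℤ :* c :- (a :* (a :* c) :+ a :* a :*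
          (d :* (d :* c)) :+ d :* (d :* c) :+ :- d :* (a :* (d :* (a :* c))) :+ con -1ℤ :* (d :* (d :* c)))) refl z (e l) (e k) v
          (e (-1ℤ * k + r)))))

-- Periods of the pattern of rotations and reflections

module Periodicity {n d : ℕ} (S : System n d) where
  open System S
  open Generic S

  TypePeriod : ℤ → Set
  TypePeriod v = ∀ m → s (m + v) ≡ s m

  -- What `hom` asks of a translation: it preserves kinds and commutes with passing to inverses.
  Period : ℤ → Set
  Period v = ∀ m → s (m + v) ≡ s m × χ (m + v) ≈ χ m + v [ + d ]

  rotation-or-reflection : ∀ k → s k ≡ false ⊎ s k ≡ true
  rotation-or-reflection k with s k
  ... | false = inj₁ refl
  ... | true = inj₂ refl

  ¬rotation : ∀ {k} → ¬ s k ≡ false → s k ≡ true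
  ¬rotation {k} h with s k
  ... | false = ⊥-elim (h refl)
  ... | true = refl

  ¬reflection : ∀ {k} → ¬ s k ≡ true → s k ≡ false
  ¬reflection {k} h with s k
  ... | false = refl
  ... | true = ⊥-elim (h refl)

  type-period-cong : ∀ {u v} → u ≈ v [ + d ] → TypePeriod u → TypePeriod v
  type-period-cong {u} {v} h T m = trans (s-cong (lc (⊖ h) (solve 3 (λ a b c → a :+ b :- (a :+ c) := :- c :- :- b) refl m v u))) (T m)

  type-period-- : ∀ {u v} → TypePeriod u → TypePeriod v → TypePeriod (u - v)
  type-period-- {u} {v} T U m = trans (s-cong (≡⇒≈ (solve 3 (λ a b c → a :+ (b :- c) := a :- c :+ b) refl m u v))) (trans (T (m - v))
      (trans (sym (U (m - v))) (s-cong (≡⇒≈ (solve 2 (λ a b → a :- b :+ b := a) refl m v)))))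

  type-period-0 : TypePeriod 0ℤ
  type-period-0 m = s-cong (≡⇒≈ (solve 1 (λ a → a :+ con 0ℤ := a) refl m))

  type-period-neg : ∀ {u} → TypePeriod u → TypePeriod (- u)
  type-period-neg {u} T = type-period-cong (≡⇒≈ (solve 1 (λ a → con 0ℤ :- a := :- a) refl u)) (type-period-- type-period-0 T)

  type-period-+ : ∀ {u v} → TypePeriod u → TypePeriod v → TypePeriod (u + v)
  type-period-+ {u} {v} T U = type-period-cong (≡⇒≈ (solve 2 (λ a b → a :- :- b := a :+ b) refl u v)) (type-period-- T (type-period-neg U))

  type-period-* : ∀ {u} q → TypePeriod u → TypePeriod (q * u)
  type-period-* {u} q T = type-period-cong (lc ((- u) ⊙ residue q d)
      (solve 3 (λ a b c → a :* b :- c :* b := :- b :* c :- :- b :* a) refl (+ (q %ℕ d)) u q)) (go (q %ℕ d))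
    where
    go : ∀ i → TypePeriod (+ i * u)
    go zero = type-period-cong (≡⇒≈ (solve 1 (λ a → con 0ℤ := con (+ 0) :* a) refl u)) type-period-0
    go (suc i) = type-period-cong (≡⇒≈ (solve 2 (λ a b → a :+ b :* a := (con 1ℤ :+ b) :* a) refl u (+ i))) (type-period-+ T (go i))

  type-period-d : TypePeriod (+ d)
  type-period-d = type-period-cong (≈-sym modulus≈0) type-period-0

  type-period? : ∀ v → Dec (TypePeriod v)
  type-period? v = map′ (∀-residues d (λ m → s (m + v) ≡ s m) (λ {k} {l} h eq → trans (s-cong (lc (⊖ h)
      (solve 3 (λ a b c → a :+ b :- (c :+ b) := :- c :- :- a) refl l v k))) (trans eq (s-cong h))))
    (λ T i → T (+ toℕ i)) (all? (λ i → s (+ toℕ i + v) ≟ᵇ s (+ toℕ i)))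

  period-cong : ∀ {u v} → u ≈ v [ + d ] → Period u → Period v
  period-cong {u} {v} h P m = type-period-cong h (λ m → proj₁ (P m)) m ,
    ≈-trans (χ-cong (lc (⊖ h) (solve 3 (λ a b c → a :+ b :- (a :+ c) := :- c :- :- b) refl m v u))) (lc (proj₂ (P m) ⊕ h)
        (solve 4 (λ a b c d → a :- (b :+ c) := a :+ d :- (b :+ d :+ c)) refl (χ (m + u)) (χ m) v u))

  period-+ : ∀ {u v} → Period u → Period v → Period (u + v)
  period-+ {u} {v} P Q m = type-period-+ (λ m → proj₁ (P m)) (λ m → proj₁ (Q m)) m ,
    ≈-trans (χ-cong (≡⇒≈ (solve 3 (λ a b c → a :+ (b :+ c) := a :+ b :+ c) refl m u v))) (lc (proj₂ (Q (m + u)) ⊕ proj₂ (P m))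
        (solve 5 (λ a b c d e → a :- (b :+ (c :+ d)) := a :+ e :- (e :+ d :+ (b :+ c))) refl (χ ((m + u) + v)) (χ m) u v (χ (m + u))))

  period-* : ∀ {u} q → Period u → Period (q * u)
  period-* {u} q P = period-cong (lc ((- u) ⊙ residue q d) (solve 3 (λ a b c → a :* b :- c :* b := :- b :* c :- :- b :* a) refl (+ (q %ℕ d)) u q))
      (go (q %ℕ d))
    where
    go : ∀ i → Period (+ i * u)
    go zero m = s-cong (≡⇒≈ (solve 2 (λ a b → a :+ con (+ 0) :* b := a) refl m u)) , ≈-trans (χ-cong (≡⇒≈
        (solve 2 (λ a b → a :+ con (+ 0) :* b := a) refl m u))) (≡⇒≈ (solve 2 (λ a b → a := a :+ con (+ 0) :* b) refl (χ m) u))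
    go (suc i) = period-cong (≡⇒≈ (solve 2 (λ a b → a :+ b :* a := (con 1ℤ :+ b) :* a) refl u (+ i))) (period-+ P (go i))

  -- Type period 1 would make every generator a rotation.
  no-unit-type-period : ∀ {k} → s k ≡ false → ¬ TypePeriod 1ℤ
  no-unit-type-period {k} y T = let z , hz = reflection-exists in
    bool-absurd (trans (s-cong (≡⇒≈ (solve 2 (λ a b → a := b :+ (a :- b) :* con 1ℤ) refl z k))) (trans (type-period-* (z - k) T k) y)) hz

  module SameLevel {j k} (yj : s j ≡ false) (yk : s k ≡ false) (h : χ j - j ≈ χ k - k [ + d ]) where

    shift-jk : Shift 1ℤ (k - j) (j ∷ []) (k ∷ []) (k - j)
    shift-jk = step (χ j) (χ k) ≈-refl ≈-refl (≡⇒≈ (solve 2 (λ a b → a := con 1ℤ :* b :+ (a :- b)) refl k j)) (done (lc (⊖ h)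
        (solve 4 (λ a b c d → a :- con 1ℤ :* b :- (c :- d) := :- (b :- d) :- :- (a :- c)) refl (χ k) (χ j) k j)))

    val-j : Val (j ∷ []) (e j) false
    val-j = val-≈ (val-rot yj val[]) (≡⇒≈ (solve 1 (λ a → a :+ con 0ℤ := a) refl (e j)))

    val-k : Val (k ∷ []) (e k) false
    val-k = val-≈ (val-rot yk val[]) (≡⇒≈ (solve 1 (λ a → a :+ con 0ℤ := a) refl (e k)))

    -- The two inverses are equally far away, so the shift by k - j sends y_j to y_k and comes back
    -- to the offset k - j. It therefore sends powers of y_j to powers of y_k, and y_j^μ = 1 implies
    -- y_k^μ = 1.
    annihilators : ∀ μ → μ * e j ≈ 0ℤ [ + n ] → μ * e k ≈ 0ℤ [ + n ]
    annihilators μ x =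
      let r = μ %ℕ n
          y , _ = law pos (val-≈ (val-power r val-j) (lc (x ⊕ (- e j) ⊙ residue μ n)
              (solve 3 (λ a b c → a :* b :- con 0ℤ := c :* b :+ :- b :* c :- (con 0ℤ :+ :- b :* a)) refl (+ r) (e j) μ))) val[]
            (shift-power r shift-jk) (done ≈-refl) (val-power r val-k) val[]
      in (lc (y ⊕ e k ⊙ residue μ n) (solve 3 (λ a b c → a :* b :- con 0ℤ := c :* b :+ b :* a :- (con 0ℤ :+ b :* c)) refl μ (e k) (+ r)))

    -- If y_l is a power of y_j, then its shift has the product and the final offset of a power of
    -- y_k: it is a rotation, and its inverse moves along with it.
    shift-multiple : ∀ {l} → s l ≡ false → (∃[ μ ] e l ≈ μ * e j [ + n ]) → s (l + (k - j)) ≡ false × χ (l + (k - j)) ≈ χ l + (k - j) [ + d ]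
    shift-multiple {l} yl (μ , hμ) =
      let r = μ %ℕ n
          l' = l + (k - j)
          _ , u , c = law pos (val-≈ (val-rot yl val[]) (lc (hμ ⊕ e j ⊙ residue μ n)
              (solve 4 (λ a b c d → a :+ con 0ℤ :- b :* c := a :+ c :* d :- (d :* c :+ c :* b)) refl (e l) (+ r) (e j) μ))) (val-power r val-j)
            (step (χ l) (χ l') ≈-refl ≈-refl (≡⇒≈ (solve 3 (λ a b c → a :+ (b :- c) := con 1ℤ :* a :+ (b :- c)) refl l k j)) (done ≈-refl))
                (shift-power r shift-jk)
            (val-exists (l' ∷ [])) (val-power r val-k)
      in trans (sym (xor-identityʳ (s l'))) u , (lc c (solve 4 (λ a b c d → a :- (b :+ (c :- d)) := a :- con 1ℤ :* b :- (c :- d)) refl (χ l') (χ l) k j))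
      where open import Data.Bool.Properties using (xor-identityʳ)

  -- What annihilates y_j annihilates y_l when both are on the same level, so y_l is a power of y_j.
  shift-in-level : ∀ {j k l} → s j ≡ false → s k ≡ false → s l ≡ false → χ j - j ≈ χ k - k [ + d ] → χ l - l ≈ χ j - j [ + d ] →
    s (l + (k - j)) ≡ false × χ (l + (k - j)) ≈ χ l + (k - j) [ + d ]
  shift-in-level {j} {k} {l} yj yk yl h h' = SameLevel.shift-multiple yj yk h yl
    (annihilator⇒multiple n (SameLevel.annihilators yj yl (≈-sym h')))

  -- Two rotations y_j, y_k whose inverses are equally far away generate the same subgroup; shifting the
  -- relations y_j x_m = x_m y_j^(±1) by k - j then shows that k - j is a period of the whole pattern.
  same-level⇒period : ∀ {j k} → s j ≡ false → s k ≡ false → χ j - j ≈ χ k - k [ + d ] → Period (k - j)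
  same-level⇒period {j} {k} yj yk h m = go (rotation-or-reflection m) (rotation-or-reflection m') (rotation-or-reflection (q j))
      (rotation-or-reflection (q (χ j)))
    where
    v m' : ℤ
    v = k - j
    m' = m + v
    q : ℤ → ℤ
    q i = i + (χ m' - χ m)
    yχj : s (χ j) ≡ false
    yχj = trans (s-χ j) yj
    shift-left : Shift 1ℤ v (j ∷ m ∷ []) (k ∷ m' ∷ []) (χ m' - 1ℤ * χ m)
    shift-left = shift-++ (SameLevel.shift-jk yj yk h) (step (χ m) (χ m') ≈-refl ≈-refl (≡⇒≈ (solve 2 (λ a b → a :+ b := con 1ℤ :* a :+ b) refl m v))
        (done ≈-refl))
    shift-right : ∀ i → Shift 1ℤ v (m ∷ i ∷ []) (m' ∷ q i ∷ []) (χ (q i) - 1ℤ * χ i)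
    shift-right i = step (χ m) (χ m') ≈-refl ≈-refl (≡⇒≈ (solve 2 (λ a b → a :+ b := con 1ℤ :* a :+ b) refl m v))
      (step (χ i) (χ (q i)) ≈-refl ≈-refl (≡⇒≈ (solve 3 (λ a b c → a :+ (b :- c) := con 1ℤ :* a :+ (b :- con 1ℤ :* c)) refl i (χ m') (χ m)))
          (done ≈-refl))
    Goal : Set
    Goal = s m' ≡ s m × χ m' ≈ χ m + v [ + d ]
    go : s m ≡ false ⊎ s m ≡ true → s m' ≡ false ⊎ s m' ≡ true → s (q j) ≡ false ⊎ s (q j) ≡ true → s (q (χ j)) ≡ false ⊎ s (q (χ j)) ≡ true → Goal
    go (inj₁ ym) (inj₁ ym') (inj₁ yq) _ =
      let x , _ = law pos (val-rot yj (val-rot ym val[])) (val-≈ (val-rot ym (val-rot yj val[])) (≡⇒≈ (solve 2 (λ a b → a :+ (b :+ con 0ℤ) := b :+ (a :+ con 0ℤ)) refl (e m) (e j)))) shift-left (shift-right j)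
            (val-rot yk (val-rot ym' val[])) (val-rot ym' (val-rot yq val[]))
          q≈k = distinct (trans yq (sym yk)) (lc (⊖ x) (solve 3 (λ a b c → a :- b := :- (b :+ (c :+ con 0ℤ)) :- :- (c :+ (a :+ con 0ℤ))) refl (e
              (q j)) (e k) (e m')))
      in trans ym' (sym ym) , (lc q≈k (solve 4 (λ a b c d → a :- (b :+ (c :- d)) := d :+ (a :- b) :- c) refl (χ m') (χ m) k j))
    go (inj₁ ym) (inj₁ ym') (inj₂ zq) _ =
      let _ , u , _ = law pos (val-rot yj (val-rot ym val[])) (val-≈ (val-rot ym (val-rot yj val[])) (≡⇒≈ (solve 2 (λ a b → a :+ (b :+ con 0ℤ) := b :+ (a :+ con 0ℤ)) refl (e m) (e j)))) shift-left (shift-right j)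
            (val-rot yk (val-rot ym' val[])) (val-rot ym' (val-ref zq val[]))
      in bool-absurd refl u
    go (inj₁ ym) (inj₂ zm') (inj₂ zq) _ =
      let _ , u , _ = law pos (val-rot yj (val-rot ym val[])) (val-≈ (val-rot ym (val-rot yj val[])) (≡⇒≈ (solve 2 (λ a b → a :+ (b :+ con 0ℤ) := b :+ (a :+ con 0ℤ)) refl (e m) (e j)))) shift-left (shift-right j)
            (val-rot yk (val-ref zm' val[])) (val-ref zm' (val-ref zq val[]))
      in bool-absurd refl (sym u)
    -- An impossible mixed case. Comparing products gives q = χ k, which puts χ m on the level of j.
    -- Then χ m + (k - j) is a rotation whose inverse has index m', so m' is no reflection.
    go (inj₁ ym) (inj₂ zm') (inj₁ yq) _ =
      let x , _ = law pos (val-rot yj (val-rot ym val[])) (val-≈ (val-rot ym (val-rot yj val[])) (≡⇒≈ (solve 2 (λ a b → a :+ (b :+ con 0ℤ) := b :+ (a :+ con 0ℤ)) refl (e m) (e j)))) shift-left (shift-right j)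
            (val-rot yk (val-ref zm' val[])) (val-ref zm' (val-rot yq val[]))
          q≈χk = distinct (trans yq (sym (trans (s-χ k) yk))) (lc (x ⊕ ⊖ e-χ yk)
              (solve 4 (λ a b c d → a :- b := c :+ (d :- con 0ℤ) :+ :- b :- (d :- (a :+ con 0ℤ) :+ :- (:- c))) refl (e (q j)) (e (χ k)) (e k) (e m')))
          y , c = shift-in-level yj yk (trans (s-χ m) ym) h (lc (χχ m ⊕ q≈χk ⊕ ⊖ χ-ref zm' ⊕ ⊖ h)
              (solve 8 (λ a b c d e f g h → a :- b :- (c :- d) := a :+ (d :+ (e :- b)) :+ :- e :+ :- (c :- d) :- (f :+ g :+ :- (f :+
              (h :- d)) :+ :- (g :- h))) refl (χ (χ m)) (χ m) (χ j) j (χ m') m (χ k) k))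
      in bool-absurd (trans (s-cong (lc (⊖ c ⊕ ⊖ χχ m) (solve 5 (λ a b c d e → a :+ (b :- c) :- d := :- d :+ :- e :- (:- (e :+ (b :- c)) :+ :- a)) refl m k j (χ (χ m + (k - j))) (χ (χ m))))) (trans (s-χ _) y)) zm'
    go (inj₂ zm) (inj₂ zm') _ (inj₁ yq) =
      let x , _ = law pos (val-rot yj (val-ref zm val[])) (val-≈ (val-ref zm (val-rot yχj val[])) (lc (⊖ e-χ yj) (solve 3 (λ a b c → a :- (b :+ con 0ℤ) :- (c :+ (a :- con 0ℤ)) := :- b :- :- (:- c)) refl (e m) (e (χ j)) (e j)))) shift-left (shift-right (χ j))
            (val-rot yk (val-ref zm' val[])) (val-ref zm' (val-rot yq val[]))
          q≈χk = distinct (trans yq (sym (trans (s-χ k) yk))) (lc (x ⊕ ⊖ e-χ yk)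
              (solve 4 (λ a b c d → a :- b := c :+ (d :- con 0ℤ) :+ :- b :- (d :- (a :+ con 0ℤ) :+ :- (:- c))) refl (e (q (χ j))) (e (χ k)) (e k)
              (e m')))
      in trans zm' (sym zm) , (lc (q≈χk ⊕ ⊖ h) (solve 6 (λ a b c d e f → a :- (b :+ (c :- d)) := e :+ (a :- b) :+ :- (e :- d) :- (f :+ :- (f :- c))) refl (χ m') (χ m) k j (χ j) (χ k)))
    go (inj₂ zm) (inj₂ zm') _ (inj₂ zq) =
      let _ , u , _ = law pos (val-rot yj (val-ref zm val[])) (val-≈ (val-ref zm (val-rot yχj val[])) (lc (⊖ e-χ yj) (solve 3 (λ a b c → a :- (b :+ con 0ℤ) :- (c :+ (a :- con 0ℤ)) := :- b :- :- (:- c)) refl (e m) (e (χ j)) (e j)))) shift-left (shift-right (χ j))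
            (val-rot yk (val-ref zm' val[])) (val-ref zm' (val-ref zq val[]))
      in bool-absurd refl (sym u)
    go (inj₂ zm) (inj₁ ym') _ (inj₂ zq) =
      let _ , u , _ = law pos (val-rot yj (val-ref zm val[])) (val-≈ (val-ref zm (val-rot yχj val[])) (lc (⊖ e-χ yj) (solve 3 (λ a b c → a :- (b :+ con 0ℤ) :- (c :+ (a :- con 0ℤ)) := :- b :- :- (:- c)) refl (e m) (e (χ j)) (e j)))) shift-left (shift-right (χ j))
            (val-rot yk (val-rot ym' val[])) (val-rot ym' (val-ref zq val[]))
      in bool-absurd refl u
    -- Here q = k puts χ m' on the level of k; shifting back by j - k exhibits m as the index of the
    -- inverse of a rotation.
    go (inj₂ zm) (inj₁ ym') _ (inj₁ yq) =
      let x , _ = law pos (val-rot yj (val-ref zm val[])) (val-≈ (val-ref zm (val-rot yχj val[])) (lc (⊖ e-χ yj) (solve 3 (λ a b c → a :- (b :+ con 0ℤ) :- (c :+ (a :- con 0ℤ)) := :- b :- :- (:- c)) refl (e m) (e (χ j)) (e j)))) shift-left (shift-right (χ j))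
            (val-rot yk (val-rot ym' val[])) (val-rot ym' (val-rot yq val[]))
          q≈k = distinct (trans yq (sym yk)) (lc (⊖ x) (solve 3 (λ a b c → a :- b := :- (b :+ (c :+ con 0ℤ)) :- :- (c :+ (a :+ con 0ℤ))) refl (e
              (q (χ j))) (e k) (e m')))
          y , c = shift-in-level yk yj (trans (s-χ m') ym') (≈-sym h) (lc (χχ m' ⊕ ⊖ q≈k ⊕ ⊖ χ-ref zm ⊕ h)
              (solve 8 (λ a b c d e f g h → a :- b :- (c :- d) := a :+ :- (e :+ (b :- f)) :+ :- f :+ (e :- g) :- (h :+ (d :- g) :+ :- d :+ :- h :+
              (c :- d))) refl (χ (χ m')) (χ m') (χ k) k (χ j) (χ m) j m))
      in bool-absurd (trans (s-cong (lc (⊖ c ⊕ ⊖ χχ m') (solve 5 (λ a b c d e → a :- b := :- b :+ :- c :- (:- (c :+ (d :- e)) :+ :- (a :+ (e :- d)))) refl m (χ (χ m' + (j - k))) (χ (χ m')) j k))) (trans (s-χ _) y)) zm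

  -- Shifting y_(χ k) y_j = y_j y_(χ k) so that the first letter becomes the reflection z.
  module CommutingRotations {z j k} (hz : s z ≡ true) (yj : s j ≡ false) (yk : s k ≡ false) (yl : s (z + j - k) ≡ false) where
    l m q : ℤ
    l = z + j - k
    m = z + j - χ k
    q = χ k + (χ m - χ j)
    yχk : s (χ k) ≡ false
    yχk = trans (s-χ k) yk
    compare : ∀ {p u} → Val (m ∷ q ∷ []) p u → true ≡ u × χ l - 1ℤ * χ j ≈ χ q - 1ℤ * k [ + d ]
    compare v = let _ , u , c = law pos {z - χ k} (val-rot yχk (val-rot yj val[])) (val-≈ (val-rot yj (val-rot yχk val[])) (≡⇒≈ (solve 2 (λ a b → a :+ (b :+ con 0ℤ) := b :+ (a :+ con 0ℤ)) refl (e j) (e (χ k)))))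
                      (step k z (χχ k) (χ-ref hz) (≡⇒≈ (solve 2 (λ a b → a := con 1ℤ :* b :+ (a :- b)) refl z (χ k))) (step (χ j) (χ l) ≈-refl ≈-refl
                          (≡⇒≈ (solve 3 (λ a b c → a :+ b :- c := con 1ℤ :* b :+ (a :- con 1ℤ :* c)) refl z j k)) (done ≈-refl)))
                      (step (χ j) (χ m) ≈-refl ≈-refl (≡⇒≈ (solve 3 (λ a b c → a :+ b :- c := con 1ℤ :* b :+ (a :- c)) refl z j (χ k)))
                          (step k (χ q) (χχ k) ≈-refl (≡⇒≈ (solve 3 (λ a b c → a :+ (b :- c) := con 1ℤ :* a :+ (b :- con 1ℤ :* c)) refl (χ k) (χ m)
                          (χ j))) (done ≈-refl)))
                      (val-ref hz (val-rot yl val[])) v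
                in u , c

    -- The final offsets put y_q and y_l on the same level, and l - q = χ j - k.
    when-reflection : s m ≡ true → Period (χ j - k)
    when-reflection zm = go (rotation-or-reflection q)
      where
      go : s q ≡ false ⊎ s q ≡ true → Period (χ j - k)
      go (inj₂ zq) = bool-absurd refl (sym (proj₁ (compare (val-ref zm (val-ref zq val[])))))
      go (inj₁ yq) = let _ , c = compare (val-ref zm (val-rot yq val[])) in
        period-cong (lc (⊖ χ-ref zm ⊕ ≡⇒≈ {l} refl ⊕ ⊖ ≡⇒≈ {q} refl)
            (solve 8 (λ a b c d e f g h → a :- b :- (c :- d) := :- e :+ a :+ :- b :- (:- (f :+ g :- h) :+ (f :+ g :- d) :+ :- (h :+
            (e :- c)))) refl l q (χ j) k (χ m) z j (χ k)))
          (same-level⇒period yq yl (lc (⊖ c ⊕ ⊖ χ-ref zm ⊕ ≡⇒≈ {l} refl ⊕ ⊖ ≡⇒≈ {q} refl)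
              (solve 10 (λ a b c d e f g h i j → a :- b :- (c :- d) := :- (c :- con 1ℤ :* e) :+ :- f :+ d :+ :- b :- (:-
              (a :- con 1ℤ :* g) :+ :- (h :+ i :- j) :+ (h :+ i :- g) :+ :- (j :+ (f :- e)))) refl (χ q) q (χ l) l (χ j) (χ m) k z j (χ k))))

    -- Now y_m and y_l are on the same level, so l - m = χ k - k is a period. It moves k to χ k,
    -- hence χ k to χ (χ k) = k.
    when-rotation : s m ≡ false → (χ k - k) + (χ k - k) ≈ 0ℤ [ + d ]
    when-rotation ym = go (rotation-or-reflection q)
      where
      go : s q ≡ false ⊎ s q ≡ true → (χ k - k) + (χ k - k) ≈ 0ℤ [ + d ]
      go (inj₁ yq) = bool-absurd (proj₁ (compare (val-rot ym (val-rot yq val[])))) refl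
      go (inj₂ zq) = let _ , c = compare (val-rot ym (val-ref zq val[]))
                         _ , p = same-level⇒period ym yl (lc (⊖ c ⊕ ⊖ χ-ref zq ⊕ ≡⇒≈ {l} refl ⊕ ⊖ ≡⇒≈ {m} refl)
                             (solve 10 (λ a b c d e f g h i j → a :- b :- (c :- d) := :- (c :- con 1ℤ :* e) :+ :- f :+ d :+ :- b :- (:-
                             (f :- con 1ℤ :* g) :+ :- (h :+ (a :- e)) :+ (i :+ j :- g) :+ :- (i :+ j :- h))) refl (χ m) m (χ l) l (χ j) (χ q) k
                             (χ k) z j)) k
                     in (lc (⊖ p ⊕ χ-cong (lc (≡⇒≈ {l} refl ⊕ ⊖ ≡⇒≈ {m} refl) (solve 6 (λ a b c d e f → a :+ (b :- c) :- d := b :+ :- c :- (e :+ f :- a :+ :- (e :+ f :- d))) refl k l m (χ k) z j)) ⊕ χχ k ⊕ ⊖ ≡⇒≈ {l} refl ⊕ ≡⇒≈ {m} refl) (solve 8 (λ a b c d e f g h → a :- b :+ (a :- b) :- con 0ℤ := :- c :+ c :+ d :+ :- e :+ f :- (:- (a :+ (e :- f)) :+ d :+ b :+ :- (g :+ h :- b) :+ (g :+ h :- a))) refl (χ k) k (χ (k + (l - m))) (χ (χ k)) l m z j))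

  -- Shifting z_i y_j = y_(χ j) z_i by z - i.
  conjugated-rotation : ∀ {i z j} → s i ≡ true → s z ≡ true → s j ≡ false → s (z + j - i) ≡ true → s (z + χ j - i) ≡ true →
    (χ j - j) + (χ j - j) ≈ 0ℤ [ + d ]
  conjugated-rotation {i} {z} {j} zi zz yj zp zm = go (rotation-or-reflection q)
    where
    p m q : ℤ
    p = z + j - i
    m = z + χ j - i
    q = i + (m - j)
    yχj : s (χ j) ≡ false
    yχj = trans (s-χ j) yj
    compare : ∀ {r u} → Val (m ∷ q ∷ []) r u → false ≡ u × p - 1ℤ * χ j ≈ χ q - 1ℤ * i [ + d ]
    compare v = let _ , u , c = law pos {z - i} (val-ref zi (val-rot yj val[])) (val-≈ (val-rot yχj (val-ref zi val[])) (lc (e-χ yj) (solve 3 (λ a b c → a :+ (b :- con 0ℤ) :- (b :- (c :+ con 0ℤ)) := a :- :- c) refl (e (χ j)) (e i) (e j))))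
                      (step i z (χ-ref zi) (χ-ref zz) (≡⇒≈ (solve 2 (λ a b → a := con 1ℤ :* b :+ (a :- b)) refl z i)) (step (χ j) p ≈-refl (χ-ref zp)
                          (≡⇒≈ (solve 3 (λ a b c → a :+ b :- c := con 1ℤ :* b :+ (a :- con 1ℤ :* c)) refl z j i)) (done ≈-refl)))
                      (step j m (χχ j) (χ-ref zm) (≡⇒≈ (solve 3 (λ a b c → a :+ b :- c := con 1ℤ :* b :+ (a :- c)) refl z (χ j) i))
                          (step i (χ q) (χ-ref zi) ≈-refl (≡⇒≈ (solve 3 (λ a b c → a :+ (b :- c) := con 1ℤ :* a :+ (b :- con 1ℤ :* c)) refl i m j))
                          (done ≈-refl)))
                      (val-ref zz (val-ref zp val[])) v
                in u , c
    go : s q ≡ false ⊎ s q ≡ true → (χ j - j) + (χ j - j) ≈ 0ℤ [ + d ]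
    go (inj₁ yq) = bool-absurd refl (proj₁ (compare (val-ref zm (val-rot yq val[]))))
    go (inj₂ zq) = let _ , c = compare (val-ref zm (val-ref zq val[])) in
      (lc (⊖ c ⊕ ⊖ χ-ref zq ⊕ ≡⇒≈ {p} refl ⊕ ⊖ ≡⇒≈ {m} refl)
          (solve 7 (λ a b c d e f g → a :- b :+ (a :- b) :- con 0ℤ := :- (c :- con 1ℤ :* a) :+ :- d :+ c :+ :- e :- (:- (d :- con 1ℤ :* f) :+ :- (f :+
          (e :- b)) :+ (g :+ b :- f) :+ :- (g :+ a :- f))) refl (χ j) j p (χ q) m i z))

-- The possible patterns

mod3 : ∀ a → a ≈ 0ℤ [ + 3 ] ⊎ a ≈ 1ℤ [ + 3 ] ⊎ a ≈ -1ℤ [ + 3 ]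
mod3 a = go (a %ℕ 3) (n%ℕd<d a 3) (residue a 3)
  where
  go : ∀ r → r ℕ.< 3 → a ≈ + r [ + 3 ] → a ≈ 0ℤ [ + 3 ] ⊎ a ≈ 1ℤ [ + 3 ] ⊎ a ≈ -1ℤ [ + 3 ]
  go 0 _ h = inj₁ h
  go 1 _ h = inj₂ (inj₁ h)
  go 2 _ h = inj₂ (inj₂ (≈-trans h by-computation))
  go (suc (suc (suc _))) (ℕ.s≤s (ℕ.s≤s (ℕ.s≤s ()))) _

mod4 : ∀ a → a ≈ 0ℤ [ + 4 ] ⊎ a ≈ 1ℤ [ + 4 ] ⊎ a ≈ + 2 [ + 4 ] ⊎ a ≈ -1ℤ [ + 4 ]
mod4 a = go (a %ℕ 4) (n%ℕd<d a 4) (residue a 4)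
  where
  go : ∀ r → r ℕ.< 4 → a ≈ + r [ + 4 ] → a ≈ 0ℤ [ + 4 ] ⊎ a ≈ 1ℤ [ + 4 ] ⊎ a ≈ + 2 [ + 4 ] ⊎ a ≈ -1ℤ [ + 4 ]
  go 0 _ h = inj₁ h
  go 1 _ h = inj₂ (inj₁ h)
  go 2 _ h = inj₂ (inj₂ (inj₁ h))
  go 3 _ h = inj₂ (inj₂ (inj₂ (≈-trans h by-computation)))
  go (suc (suc (suc (suc _)))) (ℕ.s≤s (ℕ.s≤s (ℕ.s≤s (ℕ.s≤s ())))) _

module PatternTheorem {n d : ℕ} (S : System n d) where
  open System S
  open Generic S
  open Periodicity S

  -- In `yyz` and `yyzz` the inverse of a rotation is located only modulo the length of the block;
  -- that it lies in the same block is a later result. In `coset` the inverse lies half way round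
  -- the cycle.
  data Pattern : Set where
    single : ∀ k → s k ≡ false → χ k ≈ k [ + d ] → (∀ j → s j ≡ false → j ≈ k [ + d ]) → Pattern
    alternating : ∀ k → s k ≡ false → s (k + 1ℤ) ≡ true → TypePeriod (+ 2) → Pattern
    yyz : ∀ k → s k ≡ false → χ k ≈ k + 1ℤ [ + 3 ] → s (k + + 2) ≡ true → Period (+ 3) → + d ≈ 0ℤ [ + 3 ] → Pattern
    yyzz : ∀ k → s k ≡ false → χ k ≈ k + 1ℤ [ + 4 ] → s (k + + 2) ≡ true → s (k + + 3) ≡ true → Period (+ 4) → + d ≈ 0ℤ [ + 4 ] → Pattern
    coset : ∀ k → s k ≡ false → ¬ χ k ≈ k [ + d ] → (χ k - k) + (χ k - k) ≈ 0ℤ [ + d ] → (∀ j → s j ≡ false → Period (j - k)) → Pattern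

  type-period-via : ∀ {m u} → TypePeriod (u - m) → s m ≡ s u
  type-period-via {m} {u} T = trans (sym (T m)) (s-cong (≡⇒≈ (solve 2 (λ a b → a :+ (b :- a) := b) refl m u)))

  -- A translation mapping the finite set of reflection indices into itself maps it onto itself: the
  -- inverse translation is an iterate, with -1 modulo d as the number of steps.
  closed⇒type-period : ∀ v → (∀ z → s z ≡ true → s (z + v) ≡ true) → TypePeriod v
  closed⇒type-period v f m = go (rotation-or-reflection m) (rotation-or-reflection (m + v))
    where
    iterate : ∀ i z → s z ≡ true → s (z + + i * v) ≡ true
    iterate zero z h = trans (s-cong (≡⇒≈ (solve 2 (λ a b → a :+ con (+ 0) :* b := a) refl z v))) h
    iterate (suc i) z h = trans (s-cong (≡⇒≈ (solve 3 (λ a b c → a :+ (con 1ℤ :+ b) :* c := a :+ b :* c :+ c) refl z (+ i) v))) (f _ (iterate i z h))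
    backwards : ∀ z → s (z + v) ≡ true → s z ≡ true
    backwards z h = let r = -1ℤ %ℕ d in
      trans (s-cong (lc (v ⊙ residue -1ℤ d) (solve 3 (λ a b c → a :- (a :+ b :+ c :* b) := b :* con -1ℤ :- b :* c) refl z v (+ r))))
          (iterate r (z + v) h)
    go : s m ≡ false ⊎ s m ≡ true → s (m + v) ≡ false ⊎ s (m + v) ≡ true → s (m + v) ≡ s m
    go (inj₁ y) (inj₁ y') = trans y' (sym y)
    go (inj₂ z) (inj₂ z') = trans z' (sym z)
    go (inj₂ z) (inj₁ y') = bool-absurd y' (f m z)
    go (inj₁ y) (inj₂ z') = bool-absurd y (backwards m z')

  module GenericRotation {k} (yk : s k ≡ false) (generic : ¬ (χ k - k) + (χ k - k) ≈ 0ℤ [ + d ]) where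

    w : ℤ
    w = χ k - k

    -- Modulo type periods a rotation can only be k or χ k. If translation by j - k does not keep
    -- the reflections, it carries some reflection to a rotation, and `CommutingRotations` yields
    -- the period χ j - k.
    rotations : ∀ j → s j ≡ false → TypePeriod (j - k) ⊎ Period (j - χ k)
    rotations j yj with all? {n = d} (λ i → (s (+ toℕ i) ≟ᵇ true) →-dec (s (+ toℕ i + (j - k)) ≟ᵇ true))
    ... | yes f = inj₁ (closed⇒type-period (j - k) (∀-residues d (λ z → s z ≡ true → s (z + (j - k)) ≡ true)
            (λ {x} {y} h g sy → trans (s-cong (lc (⊖ h) (solve 4 (λ a b c d → a :+ (b :- c) :- (d :+ (b :- c)) := :- d :- :- a) refl y j k x)))
                (g (trans (s-cong h) sy))) f))
    ... | no ¬f = inj₂ (period (¬∀⟶∃¬ d _ (λ i → (s (+ toℕ i) ≟ᵇ true) →-dec (s (+ toℕ i + (j - k)) ≟ᵇ true)) ¬f))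
      where
      period : ∃[ i ] ¬ (s (+ toℕ i) ≡ true → s (+ toℕ i + (j - k)) ≡ true) → Period (j - χ k)
      -- Evaluating the period χ j - k at k gives j = χ k + (χ j - k).
      period (i , ¬g) = period-cong (lc (⊖ proj₂ (P k) ⊕ χ-cong (≡⇒≈ (solve 2 (λ a b → a :+ (b :- a) := b) refl k (χ j))) ⊕ χχ j)
          (solve 6 (λ a b c d e f → a :- b :- (c :- d) := :- e :+ e :+ f :- (:- (d :+ (a :- b)) :+ f :+ c)) refl (χ j) k j (χ k) (χ (k + (χ j - k)))
          (χ (χ j)))) P
        where
        z : ℤ
        z = + toℕ i
        zz : s z ≡ true
        zz = ¬rotation (λ y → ¬g (λ x → bool-absurd y x))
        open CommutingRotations {z} {j} {k} zz yj yk
            (¬reflection (λ x → ¬g (λ _ → trans (s-cong (≡⇒≈ (solve 3 (λ a b c → a :+ (b :- c) := a :+ b :- c) refl z j k))) x)))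
        P : Period (χ j - k)
        P = when-reflection (¬rotation (λ y → generic (when-rotation y)))

    rotations′ : ∀ j → s j ≡ false → TypePeriod (j - k) ⊎ TypePeriod (j - k - w)
    rotations′ j y with rotations j y
    ... | inj₁ T = inj₁ T
    ... | inj₂ P = inj₂ (type-period-cong (≡⇒≈ (solve 3 (λ a b c → a :- b := a :- c :- (b :- c)) refl j (χ k) k)) (λ m → proj₁ (P m)))

    -- If both z + k - i and z + χ k - i were reflections, `conjugated-rotation` would contradict
    -- `generic`. So one of them is a rotation, whose class modulo type periods is known.
    reflections : ∀ z i → s z ≡ true → s i ≡ true → TypePeriod (z - i) ⊎ TypePeriod (z - i - w) ⊎ TypePeriod (z - i + w)
    reflections z i zz zi with rotation-or-reflection (z + k - i)
    reflections z i zz zi | inj₁ y with rotations′ _ y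
    ... | inj₁ T = inj₁ (type-period-cong (≡⇒≈ (solve 3 (λ a b c → a :+ b :- c :- b := a :- c) refl z k i)) T)
    ... | inj₂ T = inj₂ (inj₁ (type-period-cong (≡⇒≈ (solve 4 (λ a b c d → a :+ b :- c :- b :- d := a :- c :- d) refl z k i w)) T))
    reflections z i zz zi | inj₂ zp with rotation-or-reflection (z + χ k - i)
    ... | inj₂ zm = ⊥-elim (generic (conjugated-rotation zi zz yk zp zm))
    ... | inj₁ ym with rotations′ _ ym
    ...   | inj₁ T = inj₂ (inj₂ (type-period-cong (≡⇒≈ (solve 4 (λ a b c d → a :+ b :- c :- d := a :- c :+ (b :- d)) refl z (χ k) i k)) T))
    ...   | inj₂ T = inj₁ (type-period-cong (≡⇒≈ (solve 4 (λ a b c d → a :+ b :- c :- d :- (b :- d) := a :- c) refl z (χ k) i k)) T)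

    -- Rotations and reflections now form one class each modulo the type periods. Neighbours in the
    -- same class would make 1 a type period, so the kinds alternate.
    when-period : TypePeriod w → Pattern
    when-period Tw = alternating k yk next two
      where
      coset-of-k : ∀ j → s j ≡ false → TypePeriod (j - k)
      coset-of-k j y with rotations′ j y
      ... | inj₁ T = T
      ... | inj₂ T = type-period-cong (≡⇒≈ (solve 3 (λ a b c → a :- b :- c :+ c := a :- b) refl j k w)) (type-period-+ T Tw)
      coset-of-reflections : ∀ z i → s z ≡ true → s i ≡ true → TypePeriod (z - i)
      coset-of-reflections z i zz zi with reflections z i zz zi
      ... | inj₁ T = T
      ... | inj₂ (inj₁ T) = type-period-cong (≡⇒≈ (solve 3 (λ a b c → a :- b :- c :+ c := a :- b) refl z i w)) (type-period-+ T Tw)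
      ... | inj₂ (inj₂ T) = type-period-cong (≡⇒≈ (solve 3 (λ a b c → a :- b :+ c :- c := a :- b) refl z i w)) (type-period-- T Tw)
      next : s (k + 1ℤ) ≡ true
      next = ¬rotation (λ y → no-unit-type-period yk (type-period-cong (≡⇒≈ (solve 1 (λ a → a :+ con 1ℤ :- a := con 1ℤ) refl k)) (coset-of-k _ y)))
      two : TypePeriod (+ 2)
      two with rotation-or-reflection (k + + 2)
      ... | inj₁ y = type-period-cong (≡⇒≈ (solve 1 (λ a → a :+ con (+ 2) :- a := con (+ 2)) refl k)) (coset-of-k _ y)
      ... | inj₂ z = ⊥-elim (no-unit-type-period yk (type-period-cong (≡⇒≈ (solve 1 (λ a → a :+ con (+ 2) :- (a :+ con 1ℤ) := con 1ℤ) refl k))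
          (coset-of-reflections _ _ z next)))

    module NoPeriod (¬Tw : ¬ TypePeriod w) where

      yχk : s (χ k) ≡ false
      yχk = trans (s-χ k) yk

      -- The rotation χ k + v cannot be in the class of k, because w is no type period; the other
      -- alternative of `rotations` is a full period.
      period : ∀ {v} → TypePeriod v → Period v
      period {v} T with rotations (χ k + v) (trans (T (χ k)) yχk)
      ... | inj₂ P = period-cong (≡⇒≈ (solve 2 (λ a b → a :+ b :- a := b) refl (χ k) v)) P
      ... | inj₁ T' = ⊥-elim (¬Tw (type-period-cong (≡⇒≈ (solve 3 (λ a b c → a :+ b :- c :- b := a :- c) refl (χ k) v k)) (type-period-- T' T)))

      -- If 2w were a type period, translation by w would merely exchange the classes of k and χ k.
      -- It would thus preserve the rotations, hence the reflections.
      ¬T2w : ¬ TypePeriod (+ 2 * w)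
      ¬T2w T2 = ¬Tw (closed⇒type-period w (λ z zz → ¬rotation (λ y → bool-absurd (trans (sym (T2 z)) (trans (s-cong (≡⇒≈
          (solve 2 (λ a b → a :+ con (+ 2) :* b := a :+ b :+ b) refl z w))) (shifted (z + w) y))) zz)))
        where
        shifted : ∀ m → s m ≡ false → s (m + w) ≡ false
        shifted m y with rotations′ m y
        ... | inj₁ T = trans (s-cong (≡⇒≈ (solve 3 (λ a b c → a :+ (b :- c) := b :+ (a :- c)) refl m (χ k) k))) (trans (T (χ k)) yχk)
        ... | inj₂ T = trans (s-cong (≡⇒≈ (solve 3 (λ a b c → a :+ b := c :+ (a :- c :- b :+ con (+ 2) :* b)) refl m w k)))
            (trans (type-period-+ T T2 k) yk)

      z₀ : s (k - w) ≡ true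
      z₀ = ¬rotation λ y → absurd (rotations′ _ y)
        where
        absurd : TypePeriod (k - w - k) ⊎ TypePeriod (k - w - k - w) → ⊥
        absurd (inj₁ T) = ¬Tw (type-period-cong (≡⇒≈ (solve 2 (λ a b → :- (a :- b :- a) := b) refl k w)) (type-period-neg T))
        absurd (inj₂ T) = ¬T2w (type-period-cong (≡⇒≈ (solve 2 (λ a b → :- (a :- b :- a :- b) := con (+ 2) :* b) refl k w)) (type-period-neg T))

      -- Modulo type periods the rotations lie in the classes of k and k + w, the reflections in
      -- those of k - w and k - 2w: at most four classes, all of the form k + qw.
      reflections′ : ∀ j → s j ≡ true → TypePeriod (j - k + w) ⊎ TypePeriod (j - k + + 2 * w)
      reflections′ j zj with reflections j (k - w) zj z₀
      ... | inj₁ T = inj₁ (type-period-cong (≡⇒≈ (solve 3 (λ a b c → a :- (b :- c) := a :- b :+ c) refl j k w)) T)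
      ... | inj₂ (inj₁ T) = bool-absurd (trans (s-cong (≡⇒≈ (solve 3 (λ a b c → a := b :+ (a :- (b :- c) :- c)) refl j k w))) (trans (T k) yk)) zj
      ... | inj₂ (inj₂ T) = inj₂ (type-period-cong (≡⇒≈ (solve 3 (λ a b c → a :- (b :- c) :+ c := a :- b :+ con (+ 2) :* c) refl j k w)) T)

      -- w generates ℤ modulo the type periods.
      one : ∃[ q ] TypePeriod (1ℤ - q * w)
      one with rotation-or-reflection (k + 1ℤ)
      one | inj₁ y with rotations′ _ y
      ... | inj₁ T = 0ℤ , type-period-cong (≡⇒≈ (solve 2 (λ a b → a :+ con 1ℤ :- a := con 1ℤ :- con 0ℤ :* b) refl k w)) T
      ... | inj₂ T = 1ℤ , type-period-cong (≡⇒≈ (solve 2 (λ a b → a :+ con 1ℤ :- a :- b := con 1ℤ :- con 1ℤ :* b) refl k w)) T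
      one | inj₂ z with reflections′ _ z
      ... | inj₁ T = -1ℤ , type-period-cong (≡⇒≈ (solve 2 (λ a b → a :+ con 1ℤ :- a :+ b := con 1ℤ :- con -1ℤ :* b) refl k w)) T
      ... | inj₂ T = - (+ 2) , type-period-cong (≡⇒≈ (solve 2 (λ a b → a :+ con 1ℤ :- a :+ con (+ 2) :* b := con 1ℤ :- :- con (+ 2) :* b) refl k w)) T

      order⇒type-period : ∀ r → TypePeriod (r * w) → TypePeriod r
      order⇒type-period r T = let q , U = one in
        type-period-cong (≡⇒≈ (solve 3 (λ a b c → a :* (con 1ℤ :- b :* c) :+ b :* (a :* c) := a) refl r q w)) (type-period-+ (type-period-* r U)
            (type-period-* q T))

      multiple-type-period : ∀ {r u v} → TypePeriod r → u ≈ v [ r ] → TypePeriod u → TypePeriod v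
      multiple-type-period {r} {u} {v} Tr (mod≈ q eq) T = type-period-cong (lc (≡⇒≈ eq)
          (solve 4 (λ a b c d → a :- b :* c :- d := a :- d :- b :* c) refl u q r v)) (type-period-- T (type-period-* q Tr))

      same-type : ∀ {r u v} → TypePeriod r → u ≈ v [ r ] → s u ≡ s v
      same-type {r} {u} {v} Tr h = sym (type-period-via {v} {u} (multiple-type-period {r} {0ℤ} {u - v} Tr (lc (⊖ h)
          (solve 2 (λ a b → con 0ℤ :- (a :- b) := :- a :- :- b) refl u v)) type-period-0))

      three : TypePeriod (+ 3 * w) → Pattern
      three T3w = go (mod3 w)
        where
        T3 : TypePeriod (+ 3)
        T3 = order⇒type-period (+ 3) T3w
        d∣ : + d ≈ 0ℤ [ + 3 ]
        d∣ with mod3 (+ d)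
        ... | inj₁ x = x
        ... | inj₂ (inj₁ x) = ⊥-elim (no-unit-type-period yk (multiple-type-period T3 x type-period-d))
        ... | inj₂ (inj₂ x) = ⊥-elim (no-unit-type-period yk (type-period-neg (multiple-type-period T3 x type-period-d)))
        go : w ≈ 0ℤ [ + 3 ] ⊎ w ≈ 1ℤ [ + 3 ] ⊎ w ≈ -1ℤ [ + 3 ] → Pattern
        go (inj₁ h) = ⊥-elim (¬Tw (multiple-type-period T3 (≈-sym h) type-period-0))
        go (inj₂ (inj₁ h)) = yyz k yk (lc h (solve 2 (λ a b → a :- (b :+ con 1ℤ) := a :- b :- con 1ℤ) refl (χ k) k))
          (trans (same-type T3 (lc (h ⊕ by-computation {+ 3} {0ℤ} {+ 3})
              (solve 2 (λ a b → a :+ con (+ 2) :- (a :- b) := b :+ con (+ 3) :- (con 1ℤ :+ con 0ℤ)) refl k w))) z₀) (period T3) d∣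
        -- When w is -1 modulo 3 the block starts at χ k instead of k.
        go (inj₂ (inj₂ h)) = yyz (χ k) yχk (≈-trans (≈-coarsen d∣ (χχ k)) (lc (⊖ h)
            (solve 2 (λ a b → a :- (b :+ con 1ℤ) := :- (b :- a) :- :- con -1ℤ) refl k (χ k))))
          (trans (same-type T3 (lc (h ⊕ h) (solve 3 (λ a b c → a :+ con (+ 2) :- (b :- c) := a :- b :+ c :- (con -1ℤ :+ con -1ℤ)) refl (χ k) k w))) z₀)
              (period T3) d∣

      four : TypePeriod (+ 4 * w) → s (k - + 2 * w) ≡ true → Pattern
      four T4w z₁ = go (mod4 w)
        where
        T4 : TypePeriod (+ 4)
        T4 = order⇒type-period (+ 4) T4w
        ¬T2 : ¬ TypePeriod (+ 2)
        ¬T2 T = ¬T2w (type-period-cong (≡⇒≈ (solve 1 (λ a → a :* con (+ 2) := con (+ 2) :* a) refl w)) (type-period-* w T))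
        d∣ : + d ≈ 0ℤ [ + 4 ]
        d∣ with mod4 (+ d)
        ... | inj₁ x = x
        ... | inj₂ (inj₁ x) = ⊥-elim (no-unit-type-period yk (multiple-type-period T4 x type-period-d))
        ... | inj₂ (inj₂ (inj₁ x)) = ⊥-elim (¬T2 (multiple-type-period T4 x type-period-d))
        ... | inj₂ (inj₂ (inj₂ x)) = ⊥-elim (no-unit-type-period yk (type-period-neg (multiple-type-period T4 x type-period-d)))
        go : w ≈ 0ℤ [ + 4 ] ⊎ w ≈ 1ℤ [ + 4 ] ⊎ w ≈ + 2 [ + 4 ] ⊎ w ≈ -1ℤ [ + 4 ] → Pattern
        go (inj₁ h) = ⊥-elim (¬Tw (multiple-type-period T4 (≈-sym h) type-period-0))
        go (inj₂ (inj₁ h)) = yyzz k yk (lc h (solve 2 (λ a b → a :- (b :+ con 1ℤ) := a :- b :- con 1ℤ) refl (χ k) k))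
          (trans (same-type T4 (lc ((+ 2) ⊙ h ⊕ by-computation {+ 4} {0ℤ} {+ 4})
              (solve 2 (λ a b → a :+ con (+ 2) :- (a :- con (+ 2) :* b) := con (+ 2) :* b :+ con
              (+ 4) :- (con (+ 2) :* con 1ℤ :+ con 0ℤ)) refl k w))) z₁)
          (trans (same-type T4 (lc (h ⊕ by-computation {+ 4} {0ℤ} {+ 4})
              (solve 2 (λ a b → a :+ con (+ 3) :- (a :- b) := b :+ con (+ 4) :- (con 1ℤ :+ con 0ℤ)) refl k w))) z₀) (period T4) d∣
        go (inj₂ (inj₂ (inj₁ h))) = ⊥-elim (¬T2w (multiple-type-period T4 (lc ((-[1+ 1 ]) ⊙ h ⊕ ⊖ by-computation {+ 4} {0ℤ} {+ 4})
            (solve 1 (λ a → con 0ℤ :- con (+ 2) :* a := con (-[1+ 1 ]) :* a :+ :- con (+ 4) :- (con (-[1+ 1 ]) :* con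
            (+ 2) :+ :- con 0ℤ)) refl w)) type-period-0))
        go (inj₂ (inj₂ (inj₂ h))) = yyzz (χ k) yχk (≈-trans (≈-coarsen d∣ (χχ k)) (lc (⊖ h)
            (solve 2 (λ a b → a :- (b :+ con 1ℤ) := :- (b :- a) :- :- con -1ℤ) refl k (χ k))))
          (trans (same-type T4 (lc (h ⊕ h) (solve 3 (λ a b c → a :+ con (+ 2) :- (b :- c) := a :- b :+ c :- (con -1ℤ :+ con -1ℤ)) refl (χ k) k w))) z₀)
          (trans (same-type T4 (lc (h ⊕ (+ 2) ⊙ h) (solve 3 (λ a b c → a :+ con (+ 3) :- (b :- con (+ 2) :* c) := a :- b :+ con (+ 2) :* c :- (con -1ℤ :+ con (+ 2) :* con -1ℤ)) refl (χ k) k w))) z₁)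
              (period T4) d∣

      pattern-of : Pattern
      pattern-of with rotation-or-reflection (k - + 2 * w)
      -- If k - 2w is a rotation, it lies in the class of k + w and 3w is a type period. Otherwise k
      -- + 2w turns out to be a reflection in the class of k - 2w, and 4w is a type period.
      pattern-of | inj₁ y with rotations′ _ y
      ... | inj₁ T = ⊥-elim (¬T2w (type-period-cong (≡⇒≈ (solve 2 (λ a b → :- (a :- con (+ 2) :* b :- a) := con (+ 2) :* b) refl k w))
          (type-period-neg T)))
      ... | inj₂ T = three (type-period-cong (≡⇒≈ (solve 2 (λ a b → :- (a :- con (+ 2) :* b :- a :- b) := con (+ 3) :* b) refl k w))
          (type-period-neg T))
      pattern-of | inj₂ z₁ = four (T4 (rotation-or-reflection (k + + 2 * w))) z₁
        where
        T4 : s (k + + 2 * w) ≡ false ⊎ s (k + + 2 * w) ≡ true → TypePeriod (+ 4 * w)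
        T4 (inj₁ y) with rotations′ _ y
        ... | inj₁ T = ⊥-elim (¬T2w (type-period-cong (≡⇒≈ (solve 2 (λ a b → a :+ con (+ 2) :* b :- a := con (+ 2) :* b) refl k w)) T))
        ... | inj₂ T = ⊥-elim (¬Tw (type-period-cong (≡⇒≈ (solve 2 (λ a b → a :+ con (+ 2) :* b :- a :- b := b) refl k w)) T))
        T4 (inj₂ z) with reflections′ _ z
        ... | inj₁ T = bool-absurd (trans (sym (T (k - + 2 * w))) (trans (s-cong (lc (≡⇒≈ {w} refl)
            (solve 3 (λ a b c → a :- con (+ 2) :* b :+ (a :+ con (+ 2) :* b :- a :+ b) :- c := b :- (c :- a)) refl k w (χ k)))) yχk)) z₁ 
        ... | inj₂ T = type-period-cong (≡⇒≈ (solve 2 (λ a b → a :+ con (+ 2) :* b :- a :+ con (+ 2) :* b := con (+ 4) :* b) refl k w)) T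

    generic-pattern : Pattern
    generic-pattern with type-period? w
    ... | yes T = when-period T
    ... | no ¬T = NoPeriod.pattern-of ¬T

  module NoGeneric (all-2-torsion : ∀ j → s j ≡ false → (χ j - j) + (χ j - j) ≈ 0ℤ [ + d ]) where

    fixed⇒2-torsion : ∀ {k} → s k ≡ false → χ k ≈ k [ + d ] → e k + e k ≈ 0ℤ [ + n ]
    fixed⇒2-torsion {k} y h = lc (e-χ y ⊕ ⊖ e-cong h) (solve 2 (λ a b → a :+ a :- con 0ℤ := b :+ :- b :- (:- a :+ :- a)) refl (e k) (e (χ k)))

    -- A rotation equal to its own inverse is the unique involution of ⟨a⟩.
    fixed-unique : ∀ {j k} → s j ≡ false → s k ≡ false → χ j ≈ j [ + d ] → χ k ≈ k [ + d ] → j ≈ k [ + d ]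
    fixed-unique yj yk hj hk = distinct (trans yj (sym yk)) (2-torsion-unique (fixed⇒2-torsion yj hj) (nonunit yj) (fixed⇒2-torsion yk hk)
        (nonunit yk))

    moved-level : ∀ {j} → ¬ χ j ≈ j [ + d ] → ¬ χ j - j ≈ 0ℤ [ + d ]
    moved-level {j} h x = h (lc x (solve 2 (λ a b → a :- b := a :- b :- con 0ℤ) refl (χ j) j))

    pattern-at : ∀ k → s k ≡ false → Pattern
    pattern-at k yk with χ k ≈? k [ + d ]
    -- A rotation y_j with χ j different from j is on the same level as its inverse, so the half
    -- turn χ j - j would be a period; it would move k to a second involution.
    ... | yes fixed = single k yk fixed unique
      where
      unique : ∀ j → s j ≡ false → j ≈ k [ + d ]
      unique j yj with χ j ≈? j [ + d ]
      ... | yes x = fixed-unique yj yk x fixed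
      ... | no moved = ⊥-elim (moved (lc (fixed-unique {k + (χ j - j)} {k} (trans (proj₁ (P k)) yk) yk (lc (proj₂ (P k) ⊕ fixed)
          (solve 5 (λ a b c d e → a :- (b :+ (c :- d)) := a :+ e :- (e :+ (c :- d) :+ b)) refl (χ (k + (χ j - j))) k (χ j) j (χ k))) fixed)
          (solve 3 (λ a b c → a :- b := c :+ (a :- b) :- c) refl (χ j) j k)))
        where
        P : Period (χ j - j)
        P = same-level⇒period yj (trans (s-χ j) yj) (lc (⊖ χχ j ⊕ all-2-torsion j yj)
            (solve 3 (λ a b c → a :- b :- (c :- a) := :- c :+ (a :- b :+ (a :- b)) :- (:- b :+ con 0ℤ)) refl (χ j) j (χ (χ j))))
    -- No rotation is an involution, by the same argument. So every level is the element of order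
    -- two of ℤ modulo d, and all rotations share one level.
    ... | no moved = coset k yk moved (all-2-torsion k yk) periods
      where
      periods : ∀ j → s j ≡ false → Period (j - k)
      periods j yj with χ j ≈? j [ + d ]
      ... | no moved′ = same-level⇒period yk yj (2-torsion-unique (all-2-torsion k yk) (moved-level moved) (all-2-torsion j yj) (moved-level moved′))
      ... | yes fixed = ⊥-elim (moved (lc (fixed-unique {j + (χ k - k)} {j} (trans (proj₁ (P j)) yj) yj (lc (proj₂ (P j) ⊕ fixed)
          (solve 5 (λ a b c d e → a :- (b :+ (c :- d)) := a :+ e :- (e :+ (c :- d) :+ b)) refl (χ (j + (χ k - k))) j (χ k) k (χ j))) fixed)
          (solve 3 (λ a b c → a :- b := c :+ (a :- b) :- c) refl (χ k) k j)))
        where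
        P : Period (χ k - k)
        P = same-level⇒period yk (trans (s-χ k) yk) (lc (⊖ χχ k ⊕ all-2-torsion k yk)
            (solve 3 (λ a b c → a :- b :- (c :- a) := :- c :+ (a :- b :+ (a :- b)) :- (:- b :+ con 0ℤ)) refl (χ k) k (χ (χ k))))

  level-double? : ∀ k → Dec ((χ k - k) + (χ k - k) ≈ 0ℤ [ + d ])
  level-double? k = _ ≈? _ [ + d ]

  pattern-theorem : ∀ k → s k ≡ false → Pattern
  pattern-theorem k yk with any? {n = d} (λ i → (s (+ toℕ i) ≟ᵇ false) ×-dec ¬? (level-double? (+ toℕ i)))
  ... | yes (i , y , generic) = GenericRotation.generic-pattern y generic
  ... | no none = NoGeneric.pattern-at (∀-residues d (λ j → s j ≡ false → (χ j - j) + (χ j - j) ≈ 0ℤ [ + d ])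
        (λ {i} {j} h f y → (lc (f (trans (s-cong h) y) ⊕ (+ 2) ⊙ h ⊕ (-[1+ 1 ]) ⊙ χ-cong h)
            (solve 4 (λ a b c d → a :- b :+ (a :- b) :- con 0ℤ := c :- d :+ (c :- d) :+ con (+ 2) :* d :+ con (-[1+ 1 ]) :* c :- (con 0ℤ :+ con
            (+ 2) :* b :+ con (-[1+ 1 ]) :* a)) refl (χ j) j (χ i) i)))
        (λ i y → decidable-stable (level-double? (+ toℕ i)) (λ x → none (i , y , x)))) k yk

-- All generators reflections, or a single rotation

distinct-by-computation : ∀ {a b m} {_ : False (a ≈? b [ m ])} → ¬ a ≈ b [ m ]
distinct-by-computation {_} {_} {_} {t} = toWitnessFalse t

≈0⇒∣ : ∀ {a m} → + a ≈ 0ℤ [ + m ] → m ℕ.∣ a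
≈0⇒∣ {a} {m} h = let q , eq = ≈0⇒multiple h in ℕ.divides ∣ q ∣ (trans (cong ∣_∣ eq) (abs-* q (+ m)))

∣⇒≈0 : ∀ {a m} → m ℕ.∣ a → + a ≈ 0ℤ [ + m ]
∣⇒≈0 {a} {m} (ℕ.divides q refl) = ≈-trans (≡⇒≈ (pos-* q m)) (multiple⇒≈0 (+ q))

below-modulus≉0 : ∀ {a m} → 0 ℕ.< a → a ℕ.< m → ¬ + a ≈ 0ℤ [ + m ]
below-modulus≉0 {suc a} _ a<m h = ℕ.<⇒≱ a<m (ℕ.∣⇒≤ (≈0⇒∣ h))

-- Up to an index map k ↦ σ k + t and the group automorphism a ↦ a^u, b ↦ a^j b, the generators are a^(e₀ i) b^(s₀ i).
record Model {n d : ℕ} (S : System n d) (e₀ : ℕ → ℤ) (s₀ : ℕ → Bool) : Set where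
  open System S
  field
    {σ} : ℤ
    sign : Sign σ
    t u j : ℤ
    kinds : ∀ i → i ℕ.< d → s (σ * + i + t) ≡ s₀ i
    rotations : ∀ i → i ℕ.< d → s₀ i ≡ false → e (σ * + i + t) ≈ u * e₀ i [ + n ]
    reflections : ∀ i → i ℕ.< d → s₀ i ≡ true → e (σ * + i + t) ≈ u * e₀ i + j [ + n ]

model-reindex : ∀ {n d} (S : System n d) {σ} (sgn : Sign σ) t {e₀ s₀} → Model (reindex S sgn t) e₀ s₀ → Model S e₀ s₀
model-reindex {n} {d} S {σ} sgn t M = record
  { sign = sign-* sgn (Model.sign M) ; t = σ * M.t + t ; u = M.u ; j = M.j
  ; kinds = λ i lt → trans (s-cong (index i)) (M.kinds i lt)
  ; rotations = λ i lt h → ≈-trans (e-cong (index i)) (M.rotations i lt h)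
  ; reflections = λ i lt h → ≈-trans (e-cong (index i)) (M.reflections i lt h) }
  where
  open System S
  module M = Model M
  τ : ℤ
  τ = M.σ
  t' : ℤ
  t' = M.t
  index : ∀ i → (σ * τ) * + i + (σ * t' + t) ≈ σ * (τ * + i + t') + t [ + d ]
  index i = ≡⇒≈ (solve 5 (λ a b c d e → a :* b :* c :+ (a :* d :+ e) := a :* (b :* c :+ d) :+ e) refl σ τ (+ i) t' t)

geom-suc : ∀ ℓ k → geom ℓ (suc k) ≡ 1ℤ + ℓ * geom ℓ k
geom-suc ℓ zero = solve 1 (λ a → con 0ℤ :+ con 1ℤ := con 1ℤ :+ a :* con 0ℤ) refl ℓ
geom-suc ℓ (suc k) = trans (cong (_+ (ℓ ^ suc k)) (geom-suc ℓ k)) (expand (ℓ ^ k) (geom ℓ k))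
  where
  expand : ∀ p g → (1ℤ + ℓ * g) + ℓ * p ≡ 1ℤ + ℓ * (g + p)
  expand p g = solve 3 (λ a b c → con 1ℤ :+ a :* b :+ a :* c := con 1ℤ :+ a :* (b :+ c)) refl ℓ g p

module AllReflections {n d : ℕ} (S : System n d) (all-ref : ∀ k → System.s S k ≡ true) where
  open System S
  open Generic S

  -- Every generator is its own inverse, so all translations and reversals of the indices induce
  -- group automorphisms.
  Φ : Hom 1ℤ 1ℤ
  Φ = hom pos 1ℤ (λ k → trans (all-ref _) (sym (all-ref k))) (λ k → ≈-trans (χ-ref (all-ref _)) (lc (⊖ χ-ref (all-ref k))
      (solve 2 (λ a b → con 1ℤ :* a :+ con 1ℤ :- (con 1ℤ :* b :+ con 1ℤ) := :- b :- :- a) refl k (χ k))))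

  Ψ : Hom -1ℤ 0ℤ
  Ψ = hom neg 0ℤ (λ k → trans (all-ref _) (sym (all-ref k))) (λ k → ≈-trans (χ-ref (all-ref _)) (lc (χ-ref (all-ref k))
      (solve 2 (λ a b → con -1ℤ :* a :+ con 0ℤ :- (con -1ℤ :* b :+ con 0ℤ) := b :- a) refl k (χ k))))

  ℓ v u : ℤ
  ℓ = Hom.z Φ
  v = Hom.z Ψ
  u = e 1ℤ - e 0ℤ

  Φ≈ : ∀ k l → e (k + 1ℤ) - e (l + 1ℤ) ≈ ℓ * (e k - e l) [ + n ]
  Φ≈ k l = lc (Hom.ref≈ Φ k l (all-ref k) (all-ref l) ⊕ ⊖ e-cong (≡⇒≈ (solve 1 (λ a → con 1ℤ :* a :+ con 1ℤ := a :+ con 1ℤ) refl k)) ⊕ e-cong (≡⇒≈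
      (solve 1 (λ a → con 1ℤ :* a :+ con 1ℤ := a :+ con 1ℤ) refl l)))
      (solve 7 (λ a b c d e f g → a :- b :- c :* (d :- e) := f :- g :+ :- f :+ g :- (c :* (d :- e) :+ :- a :+ b)) refl (e (k + 1ℤ)) (e (l + 1ℤ)) ℓ
      (e k) (e l) (e (1ℤ * k + 1ℤ)) (e (1ℤ * l + 1ℤ)))

  formula : ∀ i → e (+ i) ≈ u * geom ℓ i + e 0ℤ [ + n ]
  formula zero = ≡⇒≈ (solve 2 (λ a b → a := b :* con 0ℤ :+ a) refl (e 0ℤ) u)
  formula (suc i) = ≈-trans (e-cong {+ suc i} {+ i + 1ℤ} (≡⇒≈ (cong +_ (ℕ.+-comm 1 i))))
    (lc (Φ≈ (+ i) 0ℤ ⊕ (- u) ⊙ ≡⇒≈ (geom-suc ℓ i) ⊕ ℓ ⊙ formula i ⊕ ⊖ ≡⇒≈ {u} refl)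
        (solve 8 (λ a b c d e f g h → a :- (b :* c :+ d) := a :- e :+ :- b :* c :+ f :* g :+ :- b :- (f :* (g :- d) :+ :- b :*
        (con 1ℤ :+ f :* h) :+ f :* (b :* h :+ d) :+ :- (e :- d))) refl (e (+ i + 1ℤ)) u (geom ℓ (suc i)) (e 0ℤ) (e 1ℤ) ℓ (e (+ i)) (geom ℓ i)))

  unit : ∃[ q ] 1ℤ ≈ q * u [ + n ]
  unit = span₁ u (e 0ℤ) (λ k y → bool-absurd y (all-ref k))
    (λ k _ → geom ℓ (k %ℕ d) , ≈-trans (e-cong (residue k d)) (lc (formula (k %ℕ d))
        (solve 4 (λ a b c d → a :- (b :+ c :* d) := a :- (d :* c :+ b)) refl (e (+ (k %ℕ d))) (e 0ℤ) (geom ℓ (k %ℕ d)) u))) 1ℤ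

  cancel-u : ∀ {a} → u * a ≈ 0ℤ [ + n ] → a ≈ 0ℤ [ + n ]
  cancel-u {a} h = let q , x = unit in (lc (a ⊙ x ⊕ q ⊙ h)
      (solve 3 (λ a b c → a :- con 0ℤ := a :* con 1ℤ :+ b :* (c :* a) :- (a :* (b :* c) :+ b :* con 0ℤ)) refl a q u))

  -- Φ carries the Ψ-image v u of the first step to -u, and Φ² carries the Ψ-image v ℓ u of the
  -- second step to -u. So ℓ v u = -u = ℓ³ v u, whence ℓ² u = u.
  ℓ²≈1 : ℓ * ℓ ≈ 1ℤ [ + n ]
  ℓ²≈1 = lc (cancel-u {ℓ * ℓ - 1ℤ} (lc ((ℓ * ℓ) ⊙ h₁ ⊕ ⊖ h₃)
      (solve 3 (λ a b c → a :* (b :* b :- con 1ℤ) :- con 0ℤ := b :* b :* (b :* (c :* a)) :+ :- (b :* b :*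
      (c :* (b :* a))) :- (b :* b :* :- a :+ :- (:- a))) refl u ℓ v))) (solve 1 (λ a → a :* a :- con 1ℤ := a :* a :- con 1ℤ :- con 0ℤ) refl ℓ)
    where
    vu : e -1ℤ - e 0ℤ ≈ v * u [ + n ]
    vu = Hom.ref≈ Ψ 1ℤ 0ℤ (all-ref _) (all-ref _)
    h₁ : ℓ * (v * u) ≈ - u [ + n ]
    h₁ = lc (⊖ Φ≈ -1ℤ 0ℤ ⊕ (- ℓ) ⊙ vu ⊕ ≡⇒≈ {u} refl) (solve 6 (λ a b c d e f → a :* (b :* c) :- :- c := :- (d :- e) :+ :- a :* (f :- d) :+ c :- (:-
        (a :* (f :- d)) :+ :- a :* (b :* c) :+ (e :- d))) refl ℓ v u (e 0ℤ) (e 1ℤ) (e -1ℤ))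
    h₂ : e -[1+ 1 ] - e -1ℤ ≈ v * (ℓ * u) [ + n ]
    h₂ = ≈-trans (Hom.ref≈ Ψ (+ 2) 1ℤ (all-ref _) (all-ref _)) (v ⊙ Φ≈ 1ℤ 0ℤ)
    h₃ : ℓ * ℓ * (v * (ℓ * u)) ≈ - u [ + n ]
    h₃ = lc ((- ((ℓ * ℓ))) ⊙ h₂ ⊕ (- ℓ) ⊙ (Φ≈ -[1+ 1 ] -1ℤ) ⊕ ⊖ Φ≈ -1ℤ 0ℤ ⊕ ≡⇒≈ {u} refl)
        (solve 7 (λ a b c d e f g → a :* a :* (b :* (a :* c)) :- :- c := :- (a :* a) :* (d :- e) :+ :- a :* (e :- f) :+ :- (f :- g) :+ c :- (:-
        (a :* a) :* (b :* (a :* c)) :+ :- a :* (a :* (d :- e)) :+ :- (a :* (e :- f)) :+ (g :- f))) refl ℓ v u (e -[1+ 1 ]) (e -1ℤ) (e 0ℤ) (e 1ℤ))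

  geom≈0⇒index : ∀ i → geom ℓ i ≈ 0ℤ [ + n ] → + i ≈ 0ℤ [ + d ]
  geom≈0⇒index i h = distinct (trans (all-ref _) (sym (all-ref _))) (lc (formula i ⊕ u ⊙ h)
      (solve 4 (λ a b c d → a :- b := a :+ c :* d :- (c :* d :+ b :+ c :* con 0ℤ)) refl (e (+ i)) (e 0ℤ) u (geom ℓ i)))

  geom-d : geom ℓ d ≈ 0ℤ [ + n ]
  geom-d = cancel-u (lc (⊖ formula d ⊕ e-cong modulus≈0) (solve 4 (λ a b c d → a :* b :- con 0ℤ := :- c :+ c :- (:- (a :* b :+ d) :+ d)) refl u
      (geom ℓ d) (e (+ d)) (e 0ℤ)))

  model : Model S (geom ℓ) (λ _ → true)
  model = record { sign = pos ; t = 0ℤ ; u = u ; j = e 0ℤ ; kinds = λ i _ → all-ref _ ; rotations = λ _ _ ()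
    ; reflections = λ i _ _ → ≈-trans (e-cong (≡⇒≈ (solve 1 (λ a → con 1ℤ :* a :+ con 0ℤ := a) refl (+ i)))) (formula i) }

module SingleRotation {n d : ℕ} (S : System n d) (y₀ : System.s S 0ℤ ≡ false) (χ0 : System.χ S 0ℤ ≈ 0ℤ [ + d ])
  (only : ∀ j → System.s S j ≡ false → j ≈ 0ℤ [ + d ]) where
  open System S
  open Generic S
  open Periodicity S

  reflection : ∀ {k} → ¬ k ≈ 0ℤ [ + d ] → s k ≡ true
  reflection h = ¬rotation (λ y → h (only _ y))

  2e₀≈0 : e 0ℤ + e 0ℤ ≈ 0ℤ [ + n ]
  2e₀≈0 = lc (e-χ y₀ ⊕ ⊖ e-cong χ0) (solve 2 (λ a b → a :+ a :- con 0ℤ := b :+ :- b :- (:- a :+ :- a)) refl (e 0ℤ) (e (χ 0ℤ)))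

  -- The involution y₀ is central. Shifting z_i y₀ = y₀ z_i by m - i yields commuting reflections
  -- z_m and z_(m - i); their quotient is the unique involution y₀.
  translate : ∀ m i → ¬ m ≈ 0ℤ [ + d ] → ¬ i ≈ 0ℤ [ + d ] → ¬ m ≈ i [ + d ] → e (m - i) ≈ e m + e 0ℤ [ + n ]
  translate m i m≉0 i≉0 m≉i = lc h (solve 3 (λ a b c → a :- (b :+ c) := a :- b :- c) refl (e (m - i)) (e m) (e 0ℤ))
    where
    zm zi zp : _
    zm = reflection m≉0
    zi = reflection i≉0
    zp = reflection {m - i} (λ x → m≉i (lc x (solve 2 (λ a b → a :- b := a :- b :- con 0ℤ) refl m i)))
    p : ℤ
    p = m - i
    shifted : e m - (e p - 0ℤ) ≈ e p - (e m - 0ℤ) [ + n ]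
    shifted = proj₁ (law pos {m - i} (val-ref zi (val-rot y₀ val[])) (val-≈ (val-rot y₀ (val-ref zi val[])) (lc 2e₀≈0
        (solve 2 (λ a b → a :+ (b :- con 0ℤ) :- (b :- (a :+ con 0ℤ)) := a :+ a :- con 0ℤ) refl (e 0ℤ) (e i))))
      (step i m (χ-ref zi) (χ-ref zm) (≡⇒≈ (solve 2 (λ a b → a := con 1ℤ :* b :+ (a :- b)) refl m i)) (step 0ℤ p χ0 (χ-ref zp) (≡⇒≈
          (solve 2 (λ a b → a :- b := con 1ℤ :* con 0ℤ :+ (a :- con 1ℤ :* b)) refl m i)) (done ≈-refl)))
      (step 0ℤ p χ0 (χ-ref zp) (≡⇒≈ (solve 2 (λ a b → a :- b := con 1ℤ :* con 0ℤ :+ (a :- b)) refl m i)) (step i m (χ-ref zi) (χ-ref zm) (≡⇒≈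
          (solve 2 (λ a b → a := con 1ℤ :* b :+ (a :- b :- con 1ℤ :* con 0ℤ)) refl m i)) (done ≈-refl)))
      (val-ref zm (val-ref zp val[])) (val-ref zp (val-ref zm val[])))
    h : e p - e m ≈ e 0ℤ [ + n ]
    h = 2-torsion-unique (lc (⊖ shifted) (solve 2 (λ a b → a :- b :+ (a :- b) :- con 0ℤ := :- (b :- (a :- con 0ℤ)) :- :- (a :- (b :- con 0ℤ))) refl (e p)
        (e m)))
      (λ x → i≉0 (lc (⊖ distinct (trans zp (sym zm)) (lc x (solve 2 (λ a b → a :- b := a :- b :- con 0ℤ) refl (e p) (e m))))
          (solve 2 (λ a b → a :- con 0ℤ := :- (b :- a) :- :- b) refl i m)))
      2e₀≈0 (nonunit y₀)

  valency<4 : ¬ 4 ℕ.≤ d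
  -- The indices 1 - 2 and 1 - 3 would carry the same reflection, with exponent e 1 + e 0.
  valency<4 4≤d = ≉ 1 (s≤s z≤n) (s≤s (s≤s z≤n)) (lc (distinct (trans (reflection (λ x → ≉ 1 (s≤s z≤n) (s≤s (s≤s z≤n)) (lc (⊖ x) (refl))))
      (sym (reflection (λ x → ≉ 2 (s≤s z≤n) (s≤s (s≤s (s≤s z≤n))) (lc (⊖ x) (refl))))))
        (lc (translate 1ℤ (+ 2) (≉ 1 (s≤s z≤n) (s≤s (s≤s z≤n))) (≉ 2 (s≤s z≤n) (s≤s (s≤s (s≤s z≤n)))) (λ x → ≉ 1 (s≤s z≤n) (s≤s (s≤s z≤n))
            (lc (⊖ x) (refl))) ⊕ ⊖ translate 1ℤ (+ 3) (≉ 1 (s≤s z≤n) (s≤s (s≤s z≤n))) (≉ 3 (s≤s z≤n) (s≤s (s≤s (s≤s (s≤s z≤n))))) (λ x → ≉ 2 (s≤s z≤n)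
            (s≤s (s≤s (s≤s z≤n))) (lc (⊖ x) (refl)))) (solve 4 (λ a b c d → a :- b := a :+ :- b :- (c :+ d :+ :- (c :+ d))) refl (e (1ℤ - + 2))
            (e (1ℤ - + 3)) (e 1ℤ) (e 0ℤ)))) (refl))
    where
    ≉ : ∀ a → 0 ℕ.< a → a ℕ.< 4 → ¬ + a ≈ 0ℤ [ + d ]
    ≉ a 0<a a<4 = below-modulus≉0 0<a (ℕ.<-≤-trans a<4 4≤d)

order-2⇒n≡2 : ∀ {n} → 2 ℕ.≤ n → ∀ {x} → x + x ≈ 0ℤ [ + n ] → (∃[ q ] 1ℤ ≈ q * x [ + n ]) → n ≡ 2
order-2⇒n≡2 2≤n {x} h (q , hq) = ℕ.≤-antisym (ℕ.∣⇒≤ (≈0⇒∣ (lc ((+ 2) ⊙ hq ⊕ q ⊙ h)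
    (solve 2 (λ a b → con (+ 2) :- con 0ℤ := con (+ 2) :* con 1ℤ :+ a :* (b :+ b) :- (con (+ 2) :* (a :* b) :+ a :* con 0ℤ)) refl q x)))) 2≤n

q₂-exponent : ℕ → ℤ
q₂-exponent 0 = + 0
q₂-exponent _ = + 1

q₂-kind : ℕ → Bool
q₂-kind 2 = false
q₂-kind _ = true

-- The two reflections differ by e 0, so the 2-torsion element e 0 generates ℤ modulo n, and n = 2.
single-rotation₃ : ∀ {n} (S : System n 3) → 2 ℕ.≤ n → System.s S 0ℤ ≡ false → System.χ S 0ℤ ≈ 0ℤ [ + 3 ] →
  (∀ j → System.s S j ≡ false → j ≈ 0ℤ [ + 3 ]) → n ≡ 2 × Model S q₂-exponent q₂-kind
single-rotation₃ {n} S 2≤n y₀ χ0 only =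
  order-2⇒n≡2 2≤n 2e₀≈0 (span₁ (e 0ℤ) (e 1ℤ)
    (λ k y → 1ℤ , ≈-trans (e-cong (only k y)) (≡⇒≈ (solve 1 (λ a → a := con 1ℤ :* a) refl (e 0ℤ))))
    (λ k z → ref-case k z (mod3 k)) 1ℤ) ,
  record { sign = pos ; t = 1ℤ ; u = e 0ℤ ; j = e 1ℤ ; kinds = kinds ; rotations = rots ; reflections = refs }
  where
  open System S
  open Generic S
  open SingleRotation S y₀ χ0 only
  e₂ : e (+ 2) ≈ e 1ℤ + e 0ℤ [ + n ]
  e₂ = ≈-trans (e-cong by-computation) (translate 1ℤ (+ 2) distinct-by-computation distinct-by-computation distinct-by-computation)
  ref-case : ∀ k → s k ≡ true → k ≈ 0ℤ [ + 3 ] ⊎ k ≈ 1ℤ [ + 3 ] ⊎ k ≈ -1ℤ [ + 3 ] → ∃[ q ] e k ≈ e 1ℤ + q * e 0ℤ [ + n ]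
  ref-case k z (inj₁ h) = bool-absurd (trans (s-cong h) y₀) z
  ref-case k z (inj₂ (inj₁ h)) = 0ℤ , ≈-trans (e-cong h) (≡⇒≈ (solve 2 (λ a b → a := a :+ con 0ℤ :* b) refl (e 1ℤ) (e 0ℤ)))
  ref-case k z (inj₂ (inj₂ h)) = 1ℤ , ≈-trans (e-cong (≈-trans h (by-computation { -1ℤ} {+ 2}))) (lc e₂
      (solve 3 (λ a b c → a :- (b :+ con 1ℤ :* c) := a :- (b :+ c)) refl (e (+ 2)) (e 1ℤ) (e 0ℤ)))
  kinds : ∀ i → i ℕ.< 3 → s (1ℤ * + i + 1ℤ) ≡ q₂-kind i
  kinds 0 _ = reflection distinct-by-computation
  kinds 1 _ = reflection distinct-by-computation
  kinds 2 _ = trans (s-cong by-computation) y₀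
  kinds (suc (suc (suc _))) (s≤s (s≤s (s≤s ())))
  rots : ∀ i → i ℕ.< 3 → q₂-kind i ≡ false → e (1ℤ * + i + 1ℤ) ≈ e 0ℤ * q₂-exponent i [ + n ]
  rots 2 _ _ = ≈-trans (e-cong by-computation) (≡⇒≈ (solve 1 (λ a → a := a :* con (+ 1)) refl (e 0ℤ)))
  rots (suc (suc (suc _))) (s≤s (s≤s (s≤s ()))) _
  refs : ∀ i → i ℕ.< 3 → q₂-kind i ≡ true → e (1ℤ * + i + 1ℤ) ≈ e 0ℤ * q₂-exponent i + e 1ℤ [ + n ]
  refs 0 _ _ = ≡⇒≈ (solve 2 (λ a b → a := b :* con (+ 0) :+ a) refl (e 1ℤ) (e 0ℤ))
  refs 1 _ _ = lc e₂ (solve 3 (λ a b c → a :- (b :* con (+ 1) :+ c) := a :- (c :+ b)) refl (e (+ 2)) (e 0ℤ) (e 1ℤ))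
  refs (suc (suc (suc _))) (s≤s (s≤s (s≤s ()))) _

-- Pattern YYZZ

quotient-eq : ∀ {a b m} (h : a ≈ b [ m ]) → a ≡ b + _≈_[_].quotient h * m
quotient-eq {a} {b} {m} (mod≈ q eq) = trans (solve 2 (λ a b → a := b :+ (a :- b)) refl a b) (cong (_+_ b) eq)

∣-antisym-≈ : ∀ {a b} → + a ≈ 0ℤ [ + b ] → + b ≈ 0ℤ [ + a ] → a ≡ b
∣-antisym-≈ h k = ℕ.∣-antisym (≈0⇒∣ k) (≈0⇒∣ h)

out-of-range : ∀ c {i d} → d ≡ c → ¬ c ℕ.+ i ℕ.< d
out-of-range c {i} refl lt = ℕ.<⇒≱ lt (ℕ.m≤m+n c i)

pos-divmod : ∀ {N r} q c → N ≡ r ℕ.+ q ℕ.* c → + N ≡ + r + + q * + c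
pos-divmod {_} {r} q c refl = trans (pos-+ r (q ℕ.* c)) (cong (_+_ (+ r)) (pos-* q c))

p₄-exponent : ℕ → ℤ
p₄-exponent 0 = - (+ 1)
p₄-exponent 1 = + 1
p₄-exponent 2 = + 0
p₄-exponent _ = + 2

p₄-kind : ℕ → Bool
p₄-kind 0 = false
p₄-kind 1 = false
p₄-kind _ = true

module YYZZ {n d : ℕ} (S : System n d) (y₀ : System.s S 0ℤ ≡ false) (χ0 : System.χ S 0ℤ ≈ 1ℤ [ + 4 ])
  (z₂ : System.s S (+ 2) ≡ true) (z₃ : System.s S (+ 3) ≡ true) (P : Periodicity.Period S (+ 4)) (d∣ : + d ≈ 0ℤ [ + 4 ]) where
  open System S
  open Generic S
  open Periodicity S

  f : ℤ
  f = χ 0ℤ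

  same-kind : ∀ {k l} → k ≈ l [ + 4 ] → s k ≡ s l
  same-kind {k} {l} h = trans (s-cong (≡⇒≈ (quotient-eq h))) (type-period-* (_≈_[_].quotient h) (λ m → proj₁ (P m)) l)

  χ-class : ∀ {k l} → k ≈ l [ + 4 ] → χ k ≈ χ l + (k - l) [ + d ]
  χ-class {k} {l} h@(mod≈ q eq) = ≈-trans (χ-cong (≡⇒≈ (quotient-eq h))) (lc (proj₂ (period-* q P l) ⊕ ⊖ ≡⇒≈ eq)
      (solve 5 (λ a b c d e → a :- (b :+ (c :- d)) := a :+ :- (c :- d) :- (b :+ e :* con (+ 4) :+ :- (e :* con (+ 4)))) refl (χ (l + q * + 4))
      (χ l) k l q))

  y₁ : s 1ℤ ≡ false
  y₁ = trans (sym (same-kind χ0)) (trans (s-χ 0ℤ) y₀)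

  χ-even : ∀ {k} → k ≈ 0ℤ [ + 4 ] → χ k ≈ f + k [ + d ]
  χ-even {k} h = lc (χ-class h) (solve 3 (λ a b c → a :- (b :+ c) := a :- (b :+ (c :- con 0ℤ))) refl (χ k) f k)

  χ-odd : ∀ {k} → k ≈ 1ℤ [ + 4 ] → χ k ≈ k - f [ + d ]
  χ-odd {k} h = lc (χ-class {k} {f} (≈-trans h (≈-sym χ0)) ⊕ χχ 0ℤ)
      (solve 4 (λ a b c d → a :- (b :- c) := a :+ d :- (d :+ (b :- c) :+ con 0ℤ)) refl (χ k) k f (χ f))

  -- The reversal k ↦ f - k exchanges the classes 0 and 1 of rotations and the classes 2 and 3 of
  -- reflections modulo 4. It is the partner of the translation by 4 in `double-period`.
  reversal : ∀ k → s (-1ℤ * k + f) ≡ s k × χ (-1ℤ * k + f) ≈ -1ℤ * χ k + f [ + d ]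
  reversal k = go (mod4 k)
    where
    k' : ℤ
    k' = -1ℤ * k + f
    both-reflections : s k' ≡ true → s k ≡ true → s k' ≡ s k × χ k' ≈ -1ℤ * χ k + f [ + d ]
    both-reflections h' h = trans h' (sym h) , ≈-trans (χ-ref h') (lc (χ-ref h)
        (solve 3 (λ a b c → con -1ℤ :* a :+ b :- (con -1ℤ :* c :+ b) := c :- a) refl k f (χ k)))
    go : k ≈ 0ℤ [ + 4 ] ⊎ k ≈ 1ℤ [ + 4 ] ⊎ k ≈ + 2 [ + 4 ] ⊎ k ≈ -1ℤ [ + 4 ] → s k' ≡ s k × χ k' ≈ -1ℤ * χ k + f [ + d ]
    go (inj₁ h) = trans (same-kind k'≈1) (trans y₁ (sym (trans (same-kind h) y₀))) , (lc (χ-odd k'≈1 ⊕ χ-even h ⊕ ≡⇒≈ {k'} refl)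
        (solve 5 (λ a b c d e → a :- (con -1ℤ :* b :+ c) := a :+ b :+ d :- (d :- c :+ (c :+ e) :+ (con -1ℤ :* e :+ c))) refl (χ k') (χ k) f k' k))
      where
      k'≈1 : k' ≈ 1ℤ [ + 4 ]
      k'≈1 = lc (⊖ h ⊕ χ0) (solve 2 (λ a b → con -1ℤ :* a :+ b :- con 1ℤ := :- a :+ b :- (:- con 0ℤ :+ con 1ℤ)) refl k f)
    go (inj₂ (inj₁ h)) = trans (same-kind k'≈0) (trans y₀ (sym (trans (same-kind h) y₁))) , (lc (χ-even k'≈0 ⊕ χ-odd h ⊕ ≡⇒≈ {k'} refl)
        (solve 5 (λ a b c d e → a :- (con -1ℤ :* b :+ c) := a :+ b :+ d :- (c :+ d :+ (e :- c) :+ (con -1ℤ :* e :+ c))) refl (χ k') (χ k) f k' k))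
      where
      k'≈0 : k' ≈ 0ℤ [ + 4 ]
      k'≈0 = lc (⊖ h ⊕ χ0) (solve 2 (λ a b → con -1ℤ :* a :+ b :- con 0ℤ := :- a :+ b :- (:- con 1ℤ :+ con 1ℤ)) refl k f)
    go (inj₂ (inj₂ (inj₁ h))) = both-reflections (trans (same-kind (lc (⊖ h ⊕ χ0 ⊕ ⊖ modulus≈0)
        (solve 2 (λ a b → con -1ℤ :* a :+ b :- con (+ 3) := :- a :+ b :+ :- con (+ 4) :- (:- con (+ 2) :+ con 1ℤ :+ :- con 0ℤ)) refl k f))) z₃)
        (trans (same-kind h) z₂)
    go (inj₂ (inj₂ (inj₂ h))) = both-reflections (trans (same-kind (lc (⊖ h ⊕ χ0)
        (solve 2 (λ a b → con -1ℤ :* a :+ b :- con (+ 2) := :- a :+ b :- (:- con -1ℤ :+ con 1ℤ)) refl k f))) z₂)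
        (trans (same-kind (lc (h ⊕ ⊖ modulus≈0) (solve 1 (λ a → a :- con (+ 3) := a :+ :- con (+ 4) :- (con -1ℤ :+ :- con 0ℤ)) refl k))) z₃)

  8≈0 : + 8 ≈ 0ℤ [ + d ]
  8≈0 = double-period {+ 4} {f} kinds (hom pos (+ 4) kinds inverses) (λ k → proj₁ (reversal k)) (hom neg f (λ k → proj₁ (reversal k))
      (λ k → proj₂ (reversal k))) y₀
    where
    kinds : ∀ k → s (1ℤ * k + + 4) ≡ s k
    kinds k = trans (s-cong (≡⇒≈ (solve 1 (λ a → con 1ℤ :* a :+ con (+ 4) := a :+ con (+ 4)) refl k))) (proj₁ (P k))
    inverses : ∀ k → χ (1ℤ * k + + 4) ≈ 1ℤ * χ k + + 4 [ + d ]
    inverses k = ≈-trans (χ-cong (≡⇒≈ (solve 1 (λ a → con 1ℤ :* a :+ con (+ 4) := a :+ con (+ 4)) refl k))) (lc (proj₂ (P k))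
        (solve 2 (λ a b → a :- (con 1ℤ :* b :+ con (+ 4)) := a :- (b :+ con (+ 4))) refl (χ (k + + 4)) (χ k)))

  yf : s f ≡ false
  yf = trans (s-χ 0ℤ) y₀

  zf+1 : s (f + 1ℤ) ≡ true
  zf+1 = trans (same-kind (lc χ0 (solve 1 (λ a → a :+ con 1ℤ :- con (+ 2) := a :- con 1ℤ) refl f))) z₂

  f+3≈0 : f + + 3 ≈ 0ℤ [ + 4 ]
  f+3≈0 = lc (χ0 ⊕ modulus≈0) (solve 1 (λ a → a :+ con (+ 3) :- con 0ℤ := a :+ con (+ 4) :- (con 1ℤ :+ con 0ℤ)) refl f)

  -- Shifting z₂ y₀ = y_(χ 0) z₂ by 1.
  shifted : e (+ 3) - (e 1ℤ + 0ℤ) ≈ e (f + 1ℤ) - (e (f + + 3) + 0ℤ) [ + n ] × (1ℤ - f) - 1ℤ * f ≈ (f + (f + + 3)) - 1ℤ * + 2 [ + d ]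
  shifted = let x , _ , c = law pos {1ℤ} (val-ref z₂ (val-rot y₀ val[])) (val-≈ (val-rot yf (val-ref z₂ val[])) (lc (e-χ y₀) (solve 3 (λ a b c → a :+ (b :- con 0ℤ) :- (b :- (c :+ con 0ℤ)) := a :- :- c) refl (e f) (e (+ 2)) (e 0ℤ))))
                 (step (+ 2) (+ 3) (χ-ref z₂) (χ-ref z₃) ≈-refl (step f (1ℤ - f) ≈-refl (χ-odd ≈-refl) ≈-refl (done ≈-refl)))
                 (step 0ℤ (f + 1ℤ) (χχ 0ℤ) (χ-ref zf+1) (≡⇒≈ (solve 1 (λ a → a :+ con 1ℤ := con 1ℤ :* a :+ con 1ℤ) refl f))
                     (step (+ 2) (f + (f + + 3)) (χ-ref z₂) (χ-even f+3≈0) (≡⇒≈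
                     (solve 1 (λ a → a :+ con (+ 3) := con 1ℤ :* con (+ 2) :+ (a :+ con 1ℤ :- con 1ℤ :* con 0ℤ)) refl f)) (done ≈-refl)))
                 (val-ref z₃ (val-rot y₁ val[])) (val-ref zf+1 (val-rot (trans (same-kind f+3≈0) y₀) val[]))
            in x , c

  -- The offsets in `shifted` say 4f = 0. With f = 1 + 4q this reads 4 + 16q = 0, and 8 = 0 is
  -- known.
  4≈0 : + 4 ≈ 0ℤ [ + d ]
  4≈0 = let q = _≈_[_].quotient χ0 in (lc (⊖ proj₂ shifted ⊕ (-[1+ 3 ]) ⊙ ≡⇒≈ (quotient-eq χ0) ⊕ (-[1+ 1 ] * q) ⊙ 8≈0)
      (solve 2 (λ a b → con (+ 4) :- con 0ℤ := :- (con 1ℤ :- a :- con 1ℤ :* a) :+ con (-[1+ 3 ]) :* a :+ con (-[1+ 1 ]) :* b :* con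
      (+ 8) :- (:- (a :+ (a :+ con (+ 3)) :- con 1ℤ :* con (+ 2)) :+ con (-[1+ 3 ]) :* (con 1ℤ :+ b :* con (+ 4)) :+ con
      (-[1+ 1 ]) :* b :* con 0ℤ)) refl f q))

  d≡4 : d ≡ 4
  d≡4 = ∣-antisym-≈ d∣ 4≈0

  e₁ : e 1ℤ ≈ - e 0ℤ [ + n ]
  e₁ = ≈-trans (e-cong (≈-sym (≈-coarsen 4≈0 χ0))) (e-χ y₀)

  e₃ : e (+ 3) ≈ e (+ 2) - + 2 * e 0ℤ [ + n ]
  e₃ = lc (proj₁ shifted ⊕ e-cong {f + 1ℤ} {+ 2} (≈-coarsen 4≈0 (lc χ0 (solve 1 (λ a → a :+ con 1ℤ :- con (+ 2) := a :- con 1ℤ) refl f))) ⊕ ⊖ e-cong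
      (≈-coarsen 4≈0 f+3≈0) ⊕ e₁) (solve 6 (λ a b c d e f →
      a :- (b :- con (+ 2) :* c) := a :- (d :+ con 0ℤ) :+ e :+ :- f :+ d :- (e :- (f :+ con 0ℤ) :+ b :+ :- c :+ :- c)) refl (e (+ 3)) (e (+ 2))
      (e 0ℤ) (e 1ℤ) (e (f + 1ℤ)) (e (f + + 3)))

  model : Model S p₄-exponent p₄-kind
  model = record { sign = pos ; t = 0ℤ ; u = - e 0ℤ ; j = e (+ 2) ; kinds = kinds ; rotations = rots ; reflections = refs }
    where
    kinds : ∀ i → i ℕ.< d → s (1ℤ * + i + 0ℤ) ≡ p₄-kind i
    kinds 0 _ = y₀
    kinds 1 _ = y₁
    kinds 2 _ = z₂
    kinds 3 _ = z₃
    kinds (suc (suc (suc (suc _)))) lt = ⊥-elim (out-of-range 4 d≡4 lt)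
    rots : ∀ i → i ℕ.< d → p₄-kind i ≡ false → e (1ℤ * + i + 0ℤ) ≈ - e 0ℤ * p₄-exponent i [ + n ]
    rots 0 _ _ = ≡⇒≈ (solve 1 (λ a → a := :- a :* :- con (+ 1)) refl (e 0ℤ))
    rots 1 _ _ = lc e₁ (solve 2 (λ a b → a :- :- b :* con (+ 1) := a :- :- b) refl (e 1ℤ) (e 0ℤ))
    rots (suc (suc (suc (suc _)))) lt _ = ⊥-elim (out-of-range 4 d≡4 lt)
    refs : ∀ i → i ℕ.< d → p₄-kind i ≡ true → e (1ℤ * + i + 0ℤ) ≈ - e 0ℤ * p₄-exponent i + e (+ 2) [ + n ]
    refs 2 _ _ = ≡⇒≈ (solve 2 (λ a b → a := :- b :* con (+ 0) :+ a) refl (e (+ 2)) (e 0ℤ))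
    refs 3 _ _ = lc e₃ (solve 3 (λ a b c → a :- (:- b :* con (+ 2) :+ c) := a :- (c :- con (+ 2) :* b)) refl (e (+ 3)) (e 0ℤ) (e (+ 2)))
    refs (suc (suc (suc (suc _)))) lt _ = ⊥-elim (out-of-range 4 d≡4 lt)

  -- The offsets of 1, y₀, y₀², … under the shift by 1 run through 1, -1, 2 cyclically, and y₀ⁿ = 1.
  3∣n : 3 ℕ.∣ n
  3∣n = go (n ℕ.% 3) (ℕ.m%n<n n 3) (ℕ.m≡m%n+[m/n]*n n 3)
    where
    f≈1 : f ≈ 1ℤ [ + d ]
    f≈1 = ≈-coarsen 4≈0 χ0
    χ1 : χ 1ℤ ≈ 0ℤ [ + d ]
    χ1 = ≈-trans (χ-cong (≈-sym f≈1)) (χχ 0ℤ)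
    first : ∀ {W W' c'} → Shift 1ℤ -1ℤ W W' c' → Shift 1ℤ 1ℤ (0ℤ ∷ W) (1ℤ ∷ W') c'
    first r = step 1ℤ 0ℤ f≈1 χ1 ≈-refl r
    second : ∀ {W W' c'} → Shift 1ℤ (+ 2) W W' c' → Shift 1ℤ -1ℤ (0ℤ ∷ W) (+ 3 ∷ W') c'
    second r = step 1ℤ (+ 3) f≈1 (χ-ref z₃) (≈-coarsen 4≈0 by-computation) r
    third : Shift 1ℤ (+ 2) (0ℤ ∷ []) (+ 2 ∷ []) 1ℤ
    third = step 1ℤ (+ 2) f≈1 (χ-ref z₂) ≈-refl (done ≈-refl)
    cube : Shift 1ℤ 1ℤ (0ℤ ∷ 0ℤ ∷ 0ℤ ∷ []) (1ℤ ∷ + 3 ∷ + 2 ∷ []) 1ℤ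
    cube = first (second third)
    val-y₀ : Val (0ℤ ∷ []) (e 0ℤ) false
    val-y₀ = val-≈ (val-rot y₀ val[]) (≡⇒≈ (solve 1 (λ a → a :+ con 0ℤ := a) refl (e 0ℤ)))
    val-cube : Val (0ℤ ∷ 0ℤ ∷ 0ℤ ∷ []) (+ 3 * e 0ℤ) false
    val-cube = val-≈ (val-rot y₀ (val-rot y₀ val-y₀)) (≡⇒≈ (solve 1 (λ a → a :+ (a :+ a) := con (+ 3) :* a) refl (e 0ℤ)))
    closes : ∀ r q {W c} → n ≡ r ℕ.+ q ℕ.* 3 → Shift 1ℤ 1ℤ (power r (0ℤ ∷ [])) W c → 1ℤ ≈ c [ + d ]
    closes r q {W} eq sh = let _ , _ , c = law pos val[] (val-≈ (val-++ (val-power q val-cube) (val-power r val-y₀))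
                                     (lc ((- e 0ℤ) ⊙ ≡⇒≈ (pos-divmod q 3 eq) ⊕ e 0ℤ ⊙ modulus≈0)
                                         (solve 4 (λ a b c d → a :* (con (+ 3) :* b) :+ c :* b :- con 0ℤ := :- b :* d :+ b :* d :- (:- b :*
                                         (c :+ a :* con (+ 3)) :+ b :* con 0ℤ)) refl (+ q) (e 0ℤ) (+ r) (+ n))))
                                   (done ≈-refl) (shift-++ (shift-power q cube) sh) val[] (val-exists (power q (1ℤ ∷ + 3 ∷ + 2 ∷ []) ++ W))
                           in c
    go : ∀ r → r ℕ.< 3 → n ≡ r ℕ.+ (n ℕ./ 3) ℕ.* 3 → 3 ℕ.∣ n
    go 0 _ eq = ℕ.divides (n ℕ./ 3) eq
    go 1 _ eq = ⊥-elim (distinct-by-computation {1ℤ} { -1ℤ} {+ 4} (≈-coarsen d∣ (closes 1 (n ℕ./ 3) eq (first (done ≈-refl)))))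
    go 2 _ eq = ⊥-elim (distinct-by-computation {1ℤ} {+ 2} {+ 4} (≈-coarsen d∣ (closes 2 (n ℕ./ 3) eq (first (second (done ≈-refl))))))
    go (suc (suc (suc _))) (s≤s (s≤s (s≤s ()))) _

-- Pattern YYZ

q₄-exponent : ℕ → ℤ
q₄-exponent 0 = + 0
q₄-exponent 1 = + 1
q₄-exponent _ = - (+ 1)

q₄-kind : ℕ → Bool
q₄-kind 0 = true
q₄-kind _ = false

p₅-exponent : ℤ → ℕ → ℤ
p₅-exponent m 0 = - (+ 1)
p₅-exponent m 1 = + 1
p₅-exponent m 2 = + 0
p₅-exponent m 3 = m + + 1
p₅-exponent m 4 = m - + 1
p₅-exponent m _ = m + + 2

p₅-kind : ℕ → Bool
p₅-kind 2 = true
p₅-kind 5 = true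
p₅-kind _ = false

module PatternYYZ {n d : ℕ} (S : System n d) (y₀ : System.s S 0ℤ ≡ false) (χ0 : System.χ S 0ℤ ≈ 1ℤ [ + 3 ])
  (z₂ : System.s S (+ 2) ≡ true) (P : Periodicity.Period S (+ 3)) where
  open System S
  open Generic S
  open Periodicity S

  f : ℤ
  f = χ 0ℤ

  same-kind : ∀ {k l} → k ≈ l [ + 3 ] → s k ≡ s l
  same-kind {k} {l} h = trans (s-cong (≡⇒≈ (quotient-eq h))) (type-period-* (_≈_[_].quotient h) (λ m → proj₁ (P m)) l)

  χ-class : ∀ {k l} → k ≈ l [ + 3 ] → χ k ≈ χ l + (k - l) [ + d ]
  χ-class {k} {l} h@(mod≈ q eq) = ≈-trans (χ-cong (≡⇒≈ (quotient-eq h))) (lc (proj₂ (period-* q P l) ⊕ ⊖ ≡⇒≈ eq)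
      (solve 5 (λ a b c d e → a :- (b :+ (c :- d)) := a :+ :- (c :- d) :- (b :+ e :* con (+ 3) :+ :- (e :* con (+ 3)))) refl (χ (l + q * + 3))
      (χ l) k l q))

  y₁ : s 1ℤ ≡ false
  y₁ = trans (sym (same-kind χ0)) (trans (s-χ 0ℤ) y₀)

  χ-zero : ∀ {k} → k ≈ 0ℤ [ + 3 ] → χ k ≈ f + k [ + d ]
  χ-zero {k} h = lc (χ-class h) (solve 3 (λ a b c → a :- (b :+ c) := a :- (b :+ (c :- con 0ℤ))) refl (χ k) f k)

  χ-one : ∀ {k} → k ≈ 1ℤ [ + 3 ] → χ k ≈ k - f [ + d ]
  χ-one {k} h = lc (χ-class {k} {f} (≈-trans h (≈-sym χ0)) ⊕ χχ 0ℤ)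
      (solve 4 (λ a b c d → a :- (b :- c) := a :+ d :- (d :+ (b :- c) :+ con 0ℤ)) refl (χ k) k f (χ f))

  reversal : ∀ k → s (-1ℤ * k + f) ≡ s k × χ (-1ℤ * k + f) ≈ -1ℤ * χ k + f [ + d ]
  reversal k = go (mod3 k)
    where
    k' : ℤ
    k' = -1ℤ * k + f
    both-reflections : s k' ≡ true → s k ≡ true → s k' ≡ s k × χ k' ≈ -1ℤ * χ k + f [ + d ]
    both-reflections h' h = trans h' (sym h) , ≈-trans (χ-ref h') (lc (χ-ref h)
        (solve 3 (λ a b c → con -1ℤ :* a :+ b :- (con -1ℤ :* c :+ b) := c :- a) refl k f (χ k)))
    go : k ≈ 0ℤ [ + 3 ] ⊎ k ≈ 1ℤ [ + 3 ] ⊎ k ≈ -1ℤ [ + 3 ] → s k' ≡ s k × χ k' ≈ -1ℤ * χ k + f [ + d ]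
    go (inj₁ h) = trans (same-kind k'≈1) (trans y₁ (sym (trans (same-kind h) y₀))) , (lc (χ-one k'≈1 ⊕ χ-zero h ⊕ ≡⇒≈ {k'} refl)
        (solve 5 (λ a b c d e → a :- (con -1ℤ :* b :+ c) := a :+ b :+ d :- (d :- c :+ (c :+ e) :+ (con -1ℤ :* e :+ c))) refl (χ k') (χ k) f k' k))
      where
      k'≈1 : k' ≈ 1ℤ [ + 3 ]
      k'≈1 = lc (⊖ h ⊕ χ0) (solve 2 (λ a b → con -1ℤ :* a :+ b :- con 1ℤ := :- a :+ b :- (:- con 0ℤ :+ con 1ℤ)) refl k f)
    go (inj₂ (inj₁ h)) = trans (same-kind k'≈0) (trans y₀ (sym (trans (same-kind h) y₁))) , (lc (χ-zero k'≈0 ⊕ χ-one h ⊕ ≡⇒≈ {k'} refl)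
        (solve 5 (λ a b c d e → a :- (con -1ℤ :* b :+ c) := a :+ b :+ d :- (c :+ d :+ (e :- c) :+ (con -1ℤ :* e :+ c))) refl (χ k') (χ k) f k' k))
      where
      k'≈0 : k' ≈ 0ℤ [ + 3 ]
      k'≈0 = lc (⊖ h ⊕ χ0) (solve 2 (λ a b → con -1ℤ :* a :+ b :- con 0ℤ := :- a :+ b :- (:- con 1ℤ :+ con 1ℤ)) refl k f)
    go (inj₂ (inj₂ h)) = both-reflections (trans (same-kind (lc (⊖ h ⊕ χ0)
        (solve 2 (λ a b → con -1ℤ :* a :+ b :- con (+ 2) := :- a :+ b :- (:- con -1ℤ :+ con 1ℤ)) refl k f))) z₂)
        (trans (same-kind (lc (h ⊕ ⊖ modulus≈0) (solve 1 (λ a → a :- con (+ 2) := a :+ :- con (+ 3) :- (con -1ℤ :+ :- con 0ℤ)) refl k))) z₂)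

  6≈0 : + 6 ≈ 0ℤ [ + d ]
  6≈0 = double-period {+ 3} {f} kinds (hom pos (+ 3) kinds inverses) (λ k → proj₁ (reversal k)) (hom neg f (λ k → proj₁ (reversal k))
      (λ k → proj₂ (reversal k))) y₀
    where
    kinds : ∀ k → s (1ℤ * k + + 3) ≡ s k
    kinds k = trans (s-cong (≡⇒≈ (solve 1 (λ a → con 1ℤ :* a :+ con (+ 3) := a :+ con (+ 3)) refl k))) (proj₁ (P k))
    inverses : ∀ k → χ (1ℤ * k + + 3) ≈ 1ℤ * χ k + + 3 [ + d ]
    inverses k = ≈-trans (χ-cong (≡⇒≈ (solve 1 (λ a → con 1ℤ :* a :+ con (+ 3) := a :+ con (+ 3)) refl k))) (lc (proj₂ (P k))
        (solve 2 (λ a b → a :- (con 1ℤ :* b :+ con (+ 3)) := a :- (b :+ con (+ 3))) refl (χ (k + + 3)) (χ k)))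

3-or-6 : ∀ {d} → + 6 ≈ 0ℤ [ + d ] → + d ≈ 0ℤ [ + 3 ] → d ≡ 3 ⊎ d ≡ 6
3-or-6 h k = go (≈0⇒∣ h) (≈0⇒∣ k)
  where
  go : ∀ {d} → d ℕ.∣ 6 → 3 ℕ.∣ d → d ≡ 3 ⊎ d ≡ 6
  go (ℕ.divides r eq) (ℕ.divides 0 refl) = ⊥-elim (zero≢ (trans eq (ℕ.*-zeroʳ r)))
    where
    zero≢ : 6 ≢ 0
    zero≢ ()
  go _ (ℕ.divides 1 refl) = inj₁ refl
  go _ (ℕ.divides 2 refl) = inj₂ refl
  go h (ℕ.divides (suc (suc (suc q))) refl) = ⊥-elim (ℕ.<⇒≱ (s≤s (s≤s (s≤s (s≤s (s≤s (s≤s (s≤s z≤n))))))) (ℕ.∣⇒≤ h))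

∣4⇒≡4 : ∀ {n} → 2 ℕ.≤ n → n ℕ.∣ 4 → ¬ + 2 ≈ 0ℤ [ + n ] → n ≡ 4
∣4⇒≡4 {1} (s≤s ()) _ _
∣4⇒≡4 {2} _ _ h = ⊥-elim (h by-computation)
∣4⇒≡4 {3} _ (ℕ.divides 0 ()) _
∣4⇒≡4 {3} _ (ℕ.divides 1 ()) _
∣4⇒≡4 {3} _ (ℕ.divides (suc (suc q)) ()) _
∣4⇒≡4 {4} _ _ _ = refl
∣4⇒≡4 {suc (suc (suc (suc (suc n))))} _ h _ = ⊥-elim (ℕ.<⇒≱ (s≤s (s≤s (s≤s (s≤s (s≤s z≤n))))) (ℕ.∣⇒≤ h))

module YYZ₃ {n} (S : System n 3) (y₀ : System.s S 0ℤ ≡ false) (χ0 : System.χ S 0ℤ ≈ 1ℤ [ + 3 ]) (z₂ : System.s S (+ 2) ≡ true) where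
  open System S
  open Generic S

  χ1 : χ 1ℤ ≈ 0ℤ [ + 3 ]
  χ1 = ≈-trans (χ-cong (≈-sym χ0)) (χχ 0ℤ)

  y₁ : s 1ℤ ≡ false
  y₁ = trans (s-cong (≈-sym χ0)) (trans (s-χ 0ℤ) y₀)

  e₁ : e 1ℤ ≈ - e 0ℤ [ + n ]
  e₁ = ≈-trans (e-cong (≈-sym χ0)) (e-χ y₀)

  -- (y₁ z₂)² = 1 is the shift of y₀⁴ by 1.
  4e₀≈0 : + 4 * e 0ℤ ≈ 0ℤ [ + n ]
  4e₀≈0 = let x , _ = law pos { -1ℤ} (val-≈ (val-rot y₁ (val-ref z₂ (val-rot y₁ (val-ref z₂ val[])))) (≡⇒≈ (solve 2 (λ a b → a :+ (b :- (a :+ (b :- con 0ℤ))) := con 0ℤ) refl (e 1ℤ) (e (+ 2))))) val[]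
                (step 0ℤ 1ℤ χ1 χ0 ≈-refl (step (+ 2) 1ℤ (χ-ref z₂) χ0 by-computation (step 0ℤ 1ℤ χ1 χ0 ≈-refl
                    (step (+ 2) 1ℤ (χ-ref z₂) χ0 by-computation (done ≈-refl)))))
                (done ≈-refl) (val-rot y₀ (val-rot y₀ (val-rot y₀ (val-rot y₀ val[])))) val[]
          in (lc x (solve 1 (λ a → con (+ 4) :* a :- con 0ℤ := a :+ (a :+ (a :+ (a :+ con 0ℤ))) :- con 0ℤ) refl (e 0ℤ)))

  model : Model S q₄-exponent q₄-kind
  model = record { sign = pos ; t = + 2 ; u = e 0ℤ ; j = e (+ 2) ; kinds = kinds ; rotations = rots ; reflections = refs }
    where
    kinds : ∀ i → i ℕ.< 3 → s (1ℤ * + i + + 2) ≡ q₄-kind i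
    kinds 0 _ = z₂
    kinds 1 _ = trans (s-cong by-computation) y₀
    kinds 2 _ = trans (s-cong by-computation) y₁
    kinds (suc (suc (suc _))) (s≤s (s≤s (s≤s ())))
    rots : ∀ i → i ℕ.< 3 → q₄-kind i ≡ false → e (1ℤ * + i + + 2) ≈ e 0ℤ * q₄-exponent i [ + n ]
    rots 1 _ _ = ≈-trans (e-cong by-computation) (≡⇒≈ (solve 1 (λ a → a := a :* con (+ 1)) refl (e 0ℤ)))
    rots 2 _ _ = ≈-trans (e-cong by-computation) (lc e₁ (solve 2 (λ a b → a :- b :* :- con (+ 1) := a :- :- b) refl (e 1ℤ) (e 0ℤ)))
    rots (suc (suc (suc _))) (s≤s (s≤s (s≤s ()))) _
    refs : ∀ i → i ℕ.< 3 → q₄-kind i ≡ true → e (1ℤ * + i + + 2) ≈ e 0ℤ * q₄-exponent i + e (+ 2) [ + n ]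
    refs 0 _ _ = ≡⇒≈ (solve 2 (λ a b → a := b :* con (+ 0) :+ a) refl (e (+ 2)) (e 0ℤ))
    refs (suc (suc (suc _))) (s≤s (s≤s (s≤s ()))) _

  unit : ∃[ q ] 1ℤ ≈ q * e 0ℤ [ + n ]
  unit = span₁ (e 0ℤ) (e (+ 2)) (λ k y → rot-case k y (mod3 k)) (λ k z → ref-case k z (mod3 k)) 1ℤ
    where
    rot-case : ∀ k → s k ≡ false → k ≈ 0ℤ [ + 3 ] ⊎ k ≈ 1ℤ [ + 3 ] ⊎ k ≈ -1ℤ [ + 3 ] → ∃[ q ] e k ≈ q * e 0ℤ [ + n ]
    rot-case k y (inj₁ h) = 1ℤ , ≈-trans (e-cong h) (≡⇒≈ (solve 1 (λ a → a := con 1ℤ :* a) refl (e 0ℤ)))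
    rot-case k y (inj₂ (inj₁ h)) = -1ℤ , ≈-trans (e-cong h) (lc e₁ (solve 2 (λ a b → a :- con -1ℤ :* b := a :- :- b) refl (e 1ℤ) (e 0ℤ)))
    rot-case k y (inj₂ (inj₂ h)) = bool-absurd y (trans (s-cong (≈-trans h (by-computation { -1ℤ} {+ 2}))) z₂)
    ref-case : ∀ k → s k ≡ true → k ≈ 0ℤ [ + 3 ] ⊎ k ≈ 1ℤ [ + 3 ] ⊎ k ≈ -1ℤ [ + 3 ] → ∃[ q ] e k ≈ e (+ 2) + q * e 0ℤ [ + n ]
    ref-case k z (inj₁ h) = bool-absurd (trans (s-cong h) y₀) z
    ref-case k z (inj₂ (inj₁ h)) = bool-absurd (trans (s-cong h) y₁) z
    ref-case k z (inj₂ (inj₂ h)) = 0ℤ , ≈-trans (e-cong (≈-trans h (by-computation { -1ℤ} {+ 2}))) (≡⇒≈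
        (solve 2 (λ a b → a := a :+ con 0ℤ :* b) refl (e (+ 2)) (e 0ℤ)))

  -- The exponent e 0 generates and is killed by 4, so n divides 4; n = 2 would identify y₀ with its
  -- inverse y₁.
  n≡4 : 2 ℕ.≤ n → n ≡ 4
  n≡4 2≤n = ∣4⇒≡4 2≤n (≈0⇒∣ 4≈0) ¬2
    where
    4≈0 : + 4 ≈ 0ℤ [ + n ]
    4≈0 = let q , h = unit in (lc ((+ 4) ⊙ h ⊕ q ⊙ 4e₀≈0)
        (solve 2 (λ a b → con (+ 4) :- con 0ℤ := con (+ 4) :* con 1ℤ :+ a :* (con (+ 4) :* b) :- (con (+ 4) :* (a :* b) :+ a :* con 0ℤ)) refl q
        (e 0ℤ)))
    ¬2 : ¬ + 2 ≈ 0ℤ [ + n ]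
    ¬2 h = distinct-by-computation (distinct (trans y₁ (sym y₀)) (lc (e₁ ⊕ (- e 0ℤ) ⊙ h)
        (solve 2 (λ a b → a :- b := a :+ :- b :* con (+ 2) :- (:- b :+ :- b :* con 0ℤ)) refl (e 1ℤ) (e 0ℤ))))

module YYZ₆ {n} (S : System n 6) (y₀ : System.s S 0ℤ ≡ false) (z₂ : System.s S (+ 2) ≡ true) (P : Periodicity.Period S (+ 3)) where
  open System S
  open Generic S
  open Periodicity S

  y₃ : s (+ 3) ≡ false
  y₃ = trans (proj₁ (P 0ℤ)) y₀

  z₅ : s (+ 5) ≡ true
  z₅ = trans (proj₁ (P (+ 2))) z₂

  χ2 : χ (+ 2) ≈ + 2 [ + 6 ]
  χ2 = χ-ref z₂

  χ5 : χ (+ 5) ≈ + 5 [ + 6 ]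
  χ5 = χ-ref z₅

  -- The rotations y₀ and y₃ would both have order 4, with the unique involution as their common
  -- square. So y₃ y₀⁻¹ is that involution y₀² as well, and y₃ = y₀³ = y₀⁻¹ = y₄.
  module Impossible (χ0 : χ 0ℤ ≈ + 4 [ + 6 ]) where
    χ3 : χ (+ 3) ≈ 1ℤ [ + 6 ]
    χ3 = ≈-trans (proj₂ (P 0ℤ)) (≈-trans (χ0 ⊕ ≈-refl) by-computation)
    χ1 : χ 1ℤ ≈ + 3 [ + 6 ]
    χ1 = ≈-trans (χ-cong (≈-sym χ3)) (χχ (+ 3))
    χ4 : χ (+ 4) ≈ 0ℤ [ + 6 ]
    χ4 = ≈-trans (χ-cong (≈-sym χ0)) (χχ 0ℤ)
    y₄ : s (+ 4) ≡ false
    y₄ = trans (s-cong (≈-sym χ0)) (trans (s-χ 0ℤ) y₀)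
    y₁ : s 1ℤ ≡ false
    y₁ = trans (s-cong (≈-sym χ3)) (trans (s-χ (+ 3)) y₃)
    e₄ : e (+ 4) ≈ - e 0ℤ [ + n ]
    e₄ = ≈-trans (e-cong (≈-sym χ0)) (e-χ y₀)
    e₁ : e 1ℤ ≈ - e (+ 3) [ + n ]
    e₁ = ≈-trans (e-cong (≈-sym χ3)) (e-χ y₃)
    shifted₀ : e (+ 4) + (e (+ 4) + 0ℤ) ≈ e 0ℤ + (e 0ℤ + 0ℤ) [ + n ]
    shifted₀ = proj₁ (law pos {+ 2} (val-ref z₂ (val-rot y₀ val[])) (val-≈ (val-rot y₄ (val-ref z₂ val[])) (lc e₄
        (solve 3 (λ a b c → a :+ (b :- con 0ℤ) :- (b :- (c :+ con 0ℤ)) := a :- :- c) refl (e (+ 4)) (e (+ 2)) (e 0ℤ))))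
      (step (+ 2) 0ℤ χ2 χ4 ≈-refl (step (+ 4) 0ℤ χ0 χ4 by-computation (done ≈-refl)))
      (step 0ℤ (+ 4) χ4 χ0 by-computation (step (+ 2) (+ 4) χ2 χ0 by-computation (done ≈-refl)))
      (val-rot y₄ (val-rot y₄ val[])) (val-rot y₀ (val-rot y₀ val[])))
    shifted₃ : e 1ℤ + (e 1ℤ + 0ℤ) ≈ e (+ 3) + (e (+ 3) + 0ℤ) [ + n ]
    shifted₃ = proj₁ (law pos {+ 2} (val-ref z₅ (val-rot y₃ val[])) (val-≈ (val-rot y₁ (val-ref z₅ val[])) (lc e₁
        (solve 3 (λ a b c → a :+ (b :- con 0ℤ) :- (b :- (c :+ con 0ℤ)) := a :- :- c) refl (e 1ℤ) (e (+ 5)) (e (+ 3)))))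
      (step (+ 5) (+ 3) χ5 χ1 by-computation (step 1ℤ (+ 3) χ3 χ1 by-computation (done ≈-refl)))
      (step (+ 3) 1ℤ χ1 χ3 by-computation (step (+ 5) 1ℤ χ5 χ3 by-computation (done ≈-refl)))
      (val-rot y₁ (val-rot y₁ val[])) (val-rot y₃ (val-rot y₃ val[])))
    2e : ℤ → ℤ
    2e k = e k + e k
    4e₀ : 2e 0ℤ + 2e 0ℤ ≈ 0ℤ [ + n ]
    4e₀ = lc (⊖ shifted₀ ⊕ (+ 2) ⊙ e₄) (solve 2 (λ a b → a :+ a :+ (a :+ a) :- con 0ℤ := :- (b :+ (b :+ con 0ℤ)) :+ con
        (+ 2) :* b :- (:- (a :+ (a :+ con 0ℤ)) :+ con (+ 2) :* :- a)) refl (e 0ℤ) (e (+ 4)))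
    4e₃ : 2e (+ 3) + 2e (+ 3) ≈ 0ℤ [ + n ]
    4e₃ = lc (⊖ shifted₃ ⊕ (+ 2) ⊙ e₁) (solve 2 (λ a b → a :+ a :+ (a :+ a) :- con 0ℤ := :- (b :+ (b :+ con 0ℤ)) :+ con
        (+ 2) :* b :- (:- (a :+ (a :+ con 0ℤ)) :+ con (+ 2) :* :- a)) refl (e (+ 3)) (e 1ℤ))
    2e₀≉0 : ¬ 2e 0ℤ ≈ 0ℤ [ + n ]
    2e₀≉0 h = distinct-by-computation (distinct (trans y₄ (sym y₀)) (lc (e₄ ⊕ ⊖ h)
        (solve 2 (λ a b → a :- b := a :+ :- (b :+ b) :- (:- b :+ :- con 0ℤ)) refl (e (+ 4)) (e 0ℤ))))
    2e₃≉0 : ¬ 2e (+ 3) ≈ 0ℤ [ + n ]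
    2e₃≉0 h = distinct-by-computation (distinct (trans y₁ (sym y₃)) (lc (e₁ ⊕ ⊖ h)
        (solve 2 (λ a b → a :- b := a :+ :- (b :+ b) :- (:- b :+ :- con 0ℤ)) refl (e 1ℤ) (e (+ 3)))))
    2e₀≈2e₃ : 2e 0ℤ ≈ 2e (+ 3) [ + n ]
    2e₀≈2e₃ = 2-torsion-unique 4e₀ 2e₀≉0 4e₃ 2e₃≉0
    absurd : ⊥
    absurd = distinct-by-computation (distinct (trans y₃ (sym y₄)) (lc (⊖ e₄ ⊕ 2-torsion-unique {e (+ 3) - e 0ℤ} {e 0ℤ + e 0ℤ} (lc (⊖ 2e₀≈2e₃)
        (solve 2 (λ a b → a :- b :+ (a :- b) :- con 0ℤ := :- (b :+ b) :- :- (a :+ a)) refl (e (+ 3)) (e 0ℤ)))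
          (λ h → distinct-by-computation (distinct (trans y₃ (sym y₀)) (lc h (solve 2 (λ a b → a :- b := a :- b :- con 0ℤ) refl (e (+ 3))
              (e 0ℤ))))) 4e₀ 2e₀≉0 ⊕ 4e₀) (solve 3 (λ a b c → a :- b := :- b :+ (a :- c) :+ (c :+ c :+ (c :+ c)) :- (:- (:- c) :+ (c :+ c) :+ con 0ℤ)) refl (e
              (+ 3)) (e (+ 4)) (e 0ℤ))))

  module Main (χ0 : χ 0ℤ ≈ 1ℤ [ + 6 ]) where
    χ1 : χ 1ℤ ≈ 0ℤ [ + 6 ]
    χ1 = ≈-trans (χ-cong (≈-sym χ0)) (χχ 0ℤ)
    χ3 : χ (+ 3) ≈ + 4 [ + 6 ]
    χ3 = ≈-trans (proj₂ (P 0ℤ)) (χ0 ⊕ ≈-refl)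
    χ4 : χ (+ 4) ≈ + 3 [ + 6 ]
    χ4 = ≈-trans (χ-cong (≈-sym χ3)) (χχ (+ 3))
    y₁ : s 1ℤ ≡ false
    y₁ = trans (s-cong (≈-sym χ0)) (trans (s-χ 0ℤ) y₀)
    y₄ : s (+ 4) ≡ false
    y₄ = trans (s-cong (≈-sym χ3)) (trans (s-χ (+ 3)) y₃)
    e₁ : e 1ℤ ≈ - e 0ℤ [ + n ]
    e₁ = ≈-trans (e-cong (≈-sym χ0)) (e-χ y₀)
    e₄ : e (+ 4) ≈ - e (+ 3) [ + n ]
    e₄ = ≈-trans (e-cong (≈-sym χ3)) (e-χ y₃)

    shift-y₀y₃ : Shift 1ℤ 1ℤ (0ℤ ∷ + 3 ∷ []) (1ℤ ∷ + 2 ∷ []) (+ 4)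
    shift-y₀y₃ = step 1ℤ 0ℤ χ0 χ1 ≈-refl (step (+ 4) (+ 2) χ3 χ2 ≈-refl (done by-computation))

    -- Shifting y₀ y₃ = y₃ y₀ by 1 gives y₁ z₂ = y₄ z₅.
    e₅ : e (+ 5) ≈ e (+ 2) - e 0ℤ + e (+ 3) [ + n ]
    e₅ = let x , _ = law pos {1ℤ} (val-rot y₀ (val-rot y₃ val[])) (val-≈ (val-rot y₃ (val-rot y₀ val[])) (≡⇒≈ (solve 2 (λ a b → a :+ (b :+ con 0ℤ) := b :+ (a :+ con 0ℤ)) refl (e (+ 3)) (e 0ℤ))))
               shift-y₀y₃ (step (+ 4) (+ 3) χ3 χ4 ≈-refl (step 1ℤ (+ 5) χ0 χ5 by-computation (done ≈-refl)))
               (val-rot y₁ (val-ref z₂ val[])) (val-rot y₄ (val-ref z₅ val[]))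
         in (lc (⊖ x ⊕ e₁ ⊕ ⊖ e₄) (solve 6 (λ a b c d e f → a :- (b :- c :+ d) := :- (e :+ (b :- con 0ℤ)) :+ e :+ :- f :- (:- (f :+ (a :- con 0ℤ)) :+ :- c :+ :- (:- d))) refl (e (+ 5)) (e (+ 2)) (e 0ℤ) (e (+ 3)) (e 1ℤ) (e (+ 4))))

    -- The exponent of y₀ y₃; it will turn out to be n/2, the m in the description of M₅.
    h : ℤ
    h = e 0ℤ + e (+ 3)

    -- Shifting z₂ y₀ = y₁ z₂ by 2 gives y₄ y₁ = y₃ y₀, and the left side is the inverse of the
    -- right side.
    h+h≈0 : h + h ≈ 0ℤ [ + n ]
    h+h≈0 = let x , _ = law pos {+ 2} (val-ref z₂ (val-rot y₀ val[])) (val-≈ (val-rot y₁ (val-ref z₂ val[])) (lc e₁ (solve 3 (λ a b c → a :+ (b :- con 0ℤ) :- (b :- (c :+ con 0ℤ)) := a :- :- c) refl (e 1ℤ) (e (+ 2)) (e 0ℤ))))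
                  (step (+ 2) (+ 3) χ2 χ4 ≈-refl (step 1ℤ 0ℤ χ0 χ1 ≈-refl (done ≈-refl)))
                  (step 0ℤ (+ 4) χ1 χ3 ≈-refl (step (+ 2) 1ℤ χ2 χ0 by-computation (done ≈-refl)))
                  (val-rot y₄ (val-rot y₁ val[])) (val-rot y₃ (val-rot y₀ val[]))
            in (lc (⊖ x ⊕ e₁ ⊕ e₄) (solve 4 (λ a b c d → a :+ b :+ (a :+ b) :- con 0ℤ := :- (c :+ (d :+ con 0ℤ)) :+ d :+ c :- (:- (b :+ (a :+ con 0ℤ)) :+ :- a :+ :- b)) refl (e 0ℤ) (e (+ 3)) (e (+ 4)) (e 1ℤ)))

    h≉0 : ¬ h ≈ 0ℤ [ + n ]
    h≉0 x = distinct-by-computation (distinct (trans y₃ (sym y₁)) (lc (x ⊕ ⊖ e₁)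
        (solve 3 (λ a b c → a :- b := c :+ a :+ :- b :- (con 0ℤ :+ :- (:- c))) refl (e (+ 3)) (e 1ℤ) (e 0ℤ))))

    generate : ∃[ q ] ∃[ r ] 1ℤ ≈ q * e 0ℤ + r * h [ + n ]
    generate = span₂ (e 0ℤ) h (e (+ 2)) (λ k y → rot-case (k %ℕ 6) (n%ℕd<d k 6) y (residue k 6)) (λ k z → ref-case (k %ℕ 6) (n%ℕd<d k 6) z
        (residue k 6)) 1ℤ
      where
      rot-case : ∀ r → r ℕ.< 6 → ∀ {k} → s k ≡ false → k ≈ + r [ + 6 ] → ∃[ q ] ∃[ r ] e k ≈ q * e 0ℤ + r * h [ + n ]
      rot-case 0 _ y x = 1ℤ , 0ℤ , ≈-trans (e-cong x) (≡⇒≈ (solve 2 (λ a b → a := con 1ℤ :* a :+ con 0ℤ :* b) refl (e 0ℤ) h))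
      rot-case 1 _ y x = -1ℤ , 0ℤ , ≈-trans (e-cong x) (lc e₁ (solve 3 (λ a b c → a :- (con -1ℤ :* b :+ con 0ℤ :* c) := a :- :- b) refl (e 1ℤ)
          (e 0ℤ) h))
      rot-case 2 _ y x = bool-absurd y (trans (s-cong x) z₂)
      rot-case 3 _ y x = -1ℤ , 1ℤ , ≈-trans (e-cong x) (≡⇒≈ (solve 2 (λ a b → a := con -1ℤ :* b :+ con 1ℤ :* (b :+ a)) refl (e (+ 3)) (e 0ℤ)))
      rot-case 4 _ y x = 1ℤ , -1ℤ , ≈-trans (e-cong x) (lc e₄ (solve 3 (λ a b c → a :- (con 1ℤ :* b :+ con -1ℤ :* (b :+ c)) := a :- :- c) refl (e
          (+ 4)) (e 0ℤ) (e (+ 3))))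
      rot-case 5 _ y x = bool-absurd y (trans (s-cong x) z₅)
      rot-case (suc (suc (suc (suc (suc (suc _)))))) (s≤s (s≤s (s≤s (s≤s (s≤s (s≤s ())))))) _ _
      ref-case : ∀ r → r ℕ.< 6 → ∀ {k} → s k ≡ true → k ≈ + r [ + 6 ] → ∃[ q ] ∃[ r ] e k ≈ e (+ 2) + (q * e 0ℤ + r * h) [ + n ]
      ref-case 0 _ z x = bool-absurd (trans (s-cong x) y₀) z
      ref-case 1 _ z x = bool-absurd (trans (s-cong x) y₁) z
      ref-case 2 _ z x = 0ℤ , 0ℤ , ≈-trans (e-cong x) (≡⇒≈ (solve 3 (λ a b c → a := a :+ (con 0ℤ :* b :+ con 0ℤ :* c)) refl (e (+ 2)) (e 0ℤ) h))
      ref-case 3 _ z x = bool-absurd (trans (s-cong x) y₃) z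
      ref-case 4 _ z x = bool-absurd (trans (s-cong x) y₄) z
      ref-case 5 _ z x = - (+ 2) , 1ℤ , ≈-trans (e-cong x) (lc e₅
          (solve 4 (λ a b c d → a :- (b :+ (:- con (+ 2) :* c :+ con 1ℤ :* (c :+ d))) := a :- (b :- c :+ d)) refl (e (+ 5)) (e (+ 2)) (e 0ℤ)
          (e (+ 3))))
      ref-case (suc (suc (suc (suc (suc (suc _)))))) (s≤s (s≤s (s≤s (s≤s (s≤s (s≤s ())))))) _ _

    -- The offsets of 1, y₀, y₀², … under the shift by 1 run through 1, -1, 4, 2 cyclically.
    first : ∀ {W W' c'} → Shift 1ℤ -1ℤ W W' c' → Shift 1ℤ 1ℤ (0ℤ ∷ W) (1ℤ ∷ W') c'
    first r = step 1ℤ 0ℤ χ0 χ1 ≈-refl r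
    second : ∀ {W W' c'} → Shift 1ℤ (+ 4) W W' c' → Shift 1ℤ -1ℤ (0ℤ ∷ W) (+ 5 ∷ W') c'
    second r = step 1ℤ (+ 5) χ0 χ5 by-computation r
    third : ∀ {W W' c'} → Shift 1ℤ (+ 2) W W' c' → Shift 1ℤ (+ 4) (0ℤ ∷ W) (+ 4 ∷ W') c'
    third r = step 1ℤ (+ 3) χ0 χ4 ≈-refl r
    fourth : Shift 1ℤ (+ 2) (0ℤ ∷ []) (+ 2 ∷ []) 1ℤ
    fourth = step 1ℤ (+ 2) χ0 χ2 ≈-refl (done ≈-refl)
    quad quad' : List ℤ
    quad = 0ℤ ∷ 0ℤ ∷ 0ℤ ∷ 0ℤ ∷ []
    quad' = 1ℤ ∷ + 5 ∷ + 4 ∷ + 2 ∷ []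
    shift-quad : Shift 1ℤ 1ℤ quad quad' 1ℤ
    shift-quad = first (second (third fourth))
    val-y₀ : Val (0ℤ ∷ []) (e 0ℤ) false
    val-y₀ = val-≈ (val-rot y₀ val[]) (≡⇒≈ (solve 1 (λ a → a :+ con 0ℤ := a) refl (e 0ℤ)))
    val-quad : Val quad (+ 4 * e 0ℤ) false
    val-quad = val-≈ (val-rot y₀ (val-rot y₀ (val-rot y₀ val-y₀))) (≡⇒≈ (solve 1 (λ a → a :+ (a :+ (a :+ a)) := con (+ 4) :* a) refl (e 0ℤ)))

    4∣n : ∃[ n' ] n ≡ n' ℕ.* 4
    4∣n = n ℕ./ 4 , go (n ℕ.% 4) (ℕ.m%n<n n 4) (ℕ.m≡m%n+[m/n]*n n 4)
      where
      closes : ∀ r q {W c} → n ≡ r ℕ.+ q ℕ.* 4 → Shift 1ℤ 1ℤ (power r (0ℤ ∷ [])) W c → 1ℤ ≈ c [ + 6 ]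
      closes r q {W} eq sh = let _ , _ , c = law pos val[] (val-≈ (val-++ (val-power q val-quad) (val-power r val-y₀))
                                       (lc ((- e 0ℤ) ⊙ ≡⇒≈ (pos-divmod q 4 eq) ⊕ e 0ℤ ⊙ modulus≈0)
                                           (solve 4 (λ a b c d → a :* (con (+ 4) :* b) :+ c :* b :- con 0ℤ := :- b :* d :+ b :* d :- (:- b :*
                                           (c :+ a :* con (+ 4)) :+ b :* con 0ℤ)) refl (+ q) (e 0ℤ) (+ r) (+ n))))
                                     (done ≈-refl) (shift-++ (shift-power q shift-quad) sh) val[] (val-exists (power q quad' ++ W))
                             in c
      go : ∀ r → r ℕ.< 4 → n ≡ r ℕ.+ (n ℕ./ 4) ℕ.* 4 → n ≡ (n ℕ./ 4) ℕ.* 4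
      go 0 _ eq = eq
      go 1 _ eq = ⊥-elim (distinct-by-computation {1ℤ} { -1ℤ} {+ 6} (closes 1 (n ℕ./ 4) eq (first (done ≈-refl))))
      go 2 _ eq = ⊥-elim (distinct-by-computation {1ℤ} {+ 4} {+ 6} (closes 2 (n ℕ./ 4) eq (first (second (done ≈-refl)))))
      go 3 _ eq = ⊥-elim (distinct-by-computation {1ℤ} {+ 2} {+ 6} (closes 3 (n ℕ./ 4) eq (first (second (third (done ≈-refl))))))
      go (suc (suc (suc (suc _)))) (s≤s (s≤s (s≤s (s≤s ())))) _

    module Halves (n' : ℕ) (n≡ : n ≡ n' ℕ.* 4) where
      m : ℤ
      m = + 2 * + n'

      n≡2m : + n ≡ + 2 * m
      n≡2m = trans (cong +_ n≡) (trans (pos-* n' 4) (solve 1 (λ a → a :* con (+ 4) := con (+ 2) :* (con (+ 2) :* a)) refl (+ n')))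

      h≈m : h ≈ m [ + n ]
      h≈m = 2-torsion-unique h+h≈0 h≉0 m+m≈0 m≉0
        where
        m+m≈0 : m + m ≈ 0ℤ [ + n ]
        m+m≈0 = lc (⊖ ≡⇒≈ n≡2m ⊕ modulus≈0) (solve 2 (λ a b → a :+ a :- con 0ℤ := :- b :+ b :- (:- (con (+ 2) :* a) :+ con 0ℤ)) refl m (+ n))
        m≉0 : ¬ m ≈ 0ℤ [ + n ]
        m≉0 x = let q , eq = 2-torsion-half h+h≈0 h≉0 in h≉0 (lc (≡⇒≈ (halve q eq) ⊕ q ⊙ modulus≈0 ⊕ x)
            (solve 4 (λ a b c d → a :- con 0ℤ := a :+ b :* c :+ d :- (d :+ b :* c :+ b :* con 0ℤ :+ con 0ℤ)) refl h q (+ n) m))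
          where
          open import Data.Integer.Properties using (*-cancelˡ-≡)
          halve : ∀ q → h + h ≡ + n + + 2 * (q * + n) → h ≡ m + q * + n
          halve q eq = *-cancelˡ-≡ (+ 2) h (m + q * + n) (trans (solve 1 (λ a → con (+ 2) :* a := a :+ a) refl h)
              (trans eq (trans (cong (_+ + 2 * (q * + n)) n≡2m)
              (solve 3 (λ a b c → con (+ 2) :* a :+ con (+ 2) :* (b :* c) := con (+ 2) :* (a :+ b :* c)) refl m q (+ n)))))

      even : ∀ {a b} → a ≈ b [ + n ] → a ≈ b [ + 2 ]
      even = ≈-coarsen (≈-trans (≡⇒≈ n≡2m) (lc (m ⊙ modulus≈0) (solve 1 (λ a → con (+ 2) :* a :- con 0ℤ := a :* con (+ 2) :- a :* con 0ℤ) refl m)))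

      -- The numbers e 0 and h generate ℤ modulo n; as n and h = m = 2n' are even, e 0 is odd.
      e₀-odd : ∃[ f ] e 0ℤ ≡ + 2 * f + 1ℤ
      e₀-odd = let f , x = parity (e 0ℤ) in f , go f x
        where
        go : ∀ f → e 0ℤ ≡ + 2 * f ⊎ e 0ℤ ≡ + 2 * f + 1ℤ → e 0ℤ ≡ + 2 * f + 1ℤ
        go f (inj₂ x) = x
        go f (inj₁ x) = let q , r , g = generate in ⊥-elim (distinct-by-computation {1ℤ} {0ℤ} {+ 2}
          (lc (even g ⊕ q ⊙ ≡⇒≈ x ⊕ r ⊙ even h≈m ⊕ (q * f) ⊙ modulus≈0 ⊕ (r * + n') ⊙ modulus≈0)
              (solve 6 (λ a b c d e f → con 1ℤ :- con 0ℤ := con 1ℤ :+ a :* b :+ c :* d :+ a :* e :* con (+ 2) :+ c :* f :* con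
              (+ 2) :- (a :* b :+ c :* d :+ a :* (con (+ 2) :* e) :+ c :* (con (+ 2) :* f) :+ a :* e :* con 0ℤ :+ c :* f :* con 0ℤ)) refl q
              (e 0ℤ) r h f (+ n'))))

      me₀≈m : m * e 0ℤ ≈ m [ + n ]
      me₀≈m = let f , x = e₀-odd in (lc (m ⊙ ≡⇒≈ x ⊕ (- f) ⊙ ≡⇒≈ n≡2m ⊕ f ⊙ modulus≈0)
          (solve 4 (λ a b c d → a :* b :- a := a :* b :+ :- c :* d :+ c :* d :- (a :* (con (+ 2) :* c :+ con 1ℤ) :+ :- c :*
          (con (+ 2) :* a) :+ c :* con 0ℤ)) refl m (e 0ℤ) f (+ n)))

      2m≈0 : + 2 * m ≈ 0ℤ [ + n ]
      2m≈0 = lc (⊖ ≡⇒≈ n≡2m ⊕ modulus≈0) (solve 2 (λ a b → con (+ 2) :* a :- con 0ℤ := :- b :+ b :- (:- (con (+ 2) :* a) :+ con 0ℤ)) refl m (+ n))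

      -- If n' = 2k, then (y₀⁴)^k = a^m = y₀ y₃. Under the shift by 1 the left side ends at offset 1
      -- but the right side at offset 4.
      n'-odd : ∃[ k ] n' ≡ k ℕ.* 2 ℕ.+ 1
      n'-odd = n' ℕ./ 2 , go (n' ℕ.% 2) (ℕ.m%n<n n' 2) (ℕ.m≡m%n+[m/n]*n n' 2)
        where
        k : ℕ
        k = n' ℕ./ 2
        go : ∀ r → r ℕ.< 2 → n' ≡ r ℕ.+ k ℕ.* 2 → n' ≡ k ℕ.* 2 ℕ.+ 1
        go 1 _ eq = trans eq (ℕ.+-comm 1 (k ℕ.* 2))
        go (suc (suc _)) (s≤s (s≤s ())) _
        go 0 _ eq = ⊥-elim (distinct-by-computation {1ℤ} {+ 4} {+ 6} (proj₂ (proj₂ (law pos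
          (val-≈ (val-power k val-quad) (lc (me₀≈m ⊕ ⊖ h≈m ⊕ (-[1+ 1 ] * e 0ℤ) ⊙ ≡⇒≈ (pos-divmod k 2 eq))
              (solve 5 (λ a b c d e → a :* (con (+ 4) :* b) :- c := con (+ 2) :* d :* b :+ :- c :+ con (-[1+ 1 ]) :* b :* d :- (e :+ :- e :+ con
              (-[1+ 1 ]) :* b :* (con (+ 0) :+ a :* con (+ 2)))) refl (+ k) (e 0ℤ) h (+ n') m)))
          (val-≈ (val-rot y₀ (val-rot y₃ val[])) (≡⇒≈ (solve 2 (λ a b → a :+ (b :+ con 0ℤ) := a :+ b) refl (e 0ℤ) (e (+ 3)))))
          (shift-power k shift-quad) shift-y₀y₃ (val-exists (power k quad')) (val-rot y₁ (val-ref z₂ val[]))))))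

      -- For n = 4 and e 0 odd, e 3 = 2 - e 0 would equal e 0.
      n'≢1 : n' ≢ 1
      n'≢1 refl = let f , x = e₀-odd in distinct-by-computation (distinct (trans y₃ (sym y₀))
        (lc (h≈m ⊕ (- (+ 2)) ⊙ ≡⇒≈ x ⊕ f ⊙ ≡⇒≈ n≡2m ⊕ (- f) ⊙ modulus≈0)
            (solve 4 (λ a b c d → a :- b := b :+ a :+ :- con (+ 2) :* b :+ c :* d :+ :- c :* d :- (con (+ 2) :+ :- con (+ 2) :*
            (con (+ 2) :* c :+ con 1ℤ) :+ c :* con (+ 4) :+ :- c :* con 0ℤ)) refl (e (+ 3)) (e 0ℤ) f (+ n))))

      model : Model S (p₅-exponent m) p₅-kind
      model = record { sign = pos ; t = 0ℤ ; u = - e 0ℤ ; j = e (+ 2) ; kinds = kinds ; rotations = rots ; reflections = refs }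
        where
        kinds : ∀ i → i ℕ.< 6 → s (1ℤ * + i + 0ℤ) ≡ p₅-kind i
        kinds 0 _ = y₀
        kinds 1 _ = y₁
        kinds 2 _ = z₂
        kinds 3 _ = y₃
        kinds 4 _ = y₄
        kinds 5 _ = z₅
        kinds (suc (suc (suc (suc (suc (suc _)))))) lt = ⊥-elim (out-of-range 6 refl lt)
        rots : ∀ i → i ℕ.< 6 → p₅-kind i ≡ false → e (1ℤ * + i + 0ℤ) ≈ - e 0ℤ * p₅-exponent m i [ + n ]
        rots 0 _ _ = ≡⇒≈ (solve 1 (λ a → a := :- a :* :- con (+ 1)) refl (e 0ℤ))
        rots 1 _ _ = lc e₁ (solve 2 (λ a b → a :- :- b :* con (+ 1) := a :- :- b) refl (e 1ℤ) (e 0ℤ))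
        rots 3 _ _ = lc (h≈m ⊕ me₀≈m ⊕ 2m≈0) (solve 3 (λ a b c → a :- :- b :* (c :+ con (+ 1)) := b :+ a :+ c :* b :+ con (+ 2) :* c :- (c :+ c :+ con 0ℤ)) refl (e
            (+ 3)) (e 0ℤ) m)
        rots 4 _ _ = lc (e₄ ⊕ ⊖ h≈m ⊕ me₀≈m) (solve 4 (λ a b c d → a :- :- b :* (c :- con (+ 1)) := a :+ :- (b :+ d) :+ c :* b :- (:- d :+ :- c :+ c)) refl (e
            (+ 4)) (e 0ℤ) m (e (+ 3)))
        rots (suc (suc (suc (suc (suc (suc _)))))) lt _ = ⊥-elim (out-of-range 6 refl lt)
        refs : ∀ i → i ℕ.< 6 → p₅-kind i ≡ true → e (1ℤ * + i + 0ℤ) ≈ - e 0ℤ * p₅-exponent m i + e (+ 2) [ + n ]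
        refs 2 _ _ = ≡⇒≈ (solve 2 (λ a b → a := :- b :* con (+ 0) :+ a) refl (e (+ 2)) (e 0ℤ))
        refs 5 _ _ = lc (e₅ ⊕ h≈m ⊕ me₀≈m ⊕ 2m≈0) (solve 5 (λ a b c d e → a :- (:- b :* (c :+ con (+ 2)) :+ d) := a :+ (b :+ e) :+ c :* b :+ con
            (+ 2) :* c :- (d :- b :+ e :+ c :+ c :+ con 0ℤ)) refl (e (+ 5)) (e 0ℤ) m (e (+ 2)) (e (+ 3)))
        refs (suc (suc (suc (suc (suc (suc _)))))) lt _ = ⊥-elim (out-of-range 6 refl lt)

  result : χ 0ℤ ≈ 1ℤ [ + 3 ] → ∃[ k ] (1 ℕ.≤ k × n ≡ 8 ℕ.* k ℕ.+ 4 × Model S (p₅-exponent (+ (4 ℕ.* k ℕ.+ 2))) p₅-kind)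
  result (mod≈ q eq) = go (parity q)
    where
    go : ∃[ r ] (q ≡ + 2 * r ⊎ q ≡ + 2 * r + 1ℤ) → ∃[ k ] (1 ℕ.≤ k × n ≡ 8 ℕ.* k ℕ.+ 4 × Model S (p₅-exponent (+ (4 ℕ.* k ℕ.+ 2))) p₅-kind)
    -- Odd q means χ 0 = 4 modulo 6, even q means χ 0 = 1.
    go (r , inj₂ refl) = ⊥-elim (Impossible.absurd (lc (≡⇒≈ eq ⊕ r ⊙ modulus≈0)
        (solve 2 (λ a b → a :- con (+ 4) := a :- con 1ℤ :+ b :* con (+ 6) :- ((con (+ 2) :* b :+ con 1ℤ) :* con (+ 3) :+ b :* con 0ℤ)) refl (χ 0ℤ) r)))
    go (r , inj₁ refl) = conclude 4∣n
      where
      open Main (lc (≡⇒≈ eq ⊕ r ⊙ modulus≈0) (solve 2 (λ a b → a :- con 1ℤ := a :- con 1ℤ :+ b :* con (+ 6) :- (con (+ 2) :* b :* con (+ 3) :+ b :* con 0ℤ)) refl (χ 0ℤ) r))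
      conclude : ∃[ n' ] n ≡ n' ℕ.* 4 → ∃[ k ] (1 ℕ.≤ k × n ≡ 8 ℕ.* k ℕ.+ 4 × Model S (p₅-exponent (+ (4 ℕ.* k ℕ.+ 2))) p₅-kind)
      conclude (n' , n≡) = let k , x = Halves.n'-odd n' n≡ in k , positive k x , trans n≡ (trans (cong (ℕ._* 4) x) (arith k)) , subst
          (λ m → Model S (p₅-exponent m) p₅-kind) (half k x) (Halves.model n' n≡)
        where
        positive : ∀ k → n' ≡ k ℕ.* 2 ℕ.+ 1 → 1 ℕ.≤ k
        positive zero x = ⊥-elim (Halves.n'≢1 n' n≡ x)
        positive (suc k) _ = s≤s z≤n
        arith : ∀ k → (k ℕ.* 2 ℕ.+ 1) ℕ.* 4 ≡ 8 ℕ.* k ℕ.+ 4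
        arith = solveℕ 1 (λ k → (k ⊠ conℕ 2 ⊞ conℕ 1) ⊠ conℕ 4 :≡ conℕ 8 ⊠ k ⊞ conℕ 4) refl
        half : ∀ k → n' ≡ k ℕ.* 2 ℕ.+ 1 → + 2 * + n' ≡ + (4 ℕ.* k ℕ.+ 2)
        half k refl = trans (sym (pos-* 2 (k ℕ.* 2 ℕ.+ 1))) (cong +_ (solveℕ 1 (λ k → conℕ 2 ⊠ (k ⊠ conℕ 2 ⊞ conℕ 1) :≡ conℕ 4 ⊠ k ⊞ conℕ 2) refl k))

-- Rotations along a coset

p₆-exponent : ℤ → ℕ → ℤ
p₆-exponent m 0 = + 0
p₆-exponent m 1 = m - + 2
p₆-exponent m 2 = + 1
p₆-exponent m 3 = - (+ 2)
p₆-exponent m 4 = m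
p₆-exponent m _ = - (+ 1)

p₆-kind : ℕ → Bool
p₆-kind 2 = false
p₆-kind 5 = false
p₆-kind _ = true

module CosetPattern {n d : ℕ} (S : System n d) (y₀ : System.s S 0ℤ ≡ false) (moved : ¬ System.χ S 0ℤ ≈ 0ℤ [ + d ])
  (2χ0≈0 : System.χ S 0ℤ + System.χ S 0ℤ ≈ 0ℤ [ + d ]) (periods : ∀ j → System.s S j ≡ false → Periodicity.Period S j) where
  open System S
  open Generic S
  open Periodicity S

  rot-- : ∀ {j k} → s j ≡ false → s k ≡ false → s (j - k) ≡ false
  rot-- {j} {k} yj yk = trans (type-period-neg (λ m → proj₁ (periods k yk m)) j) yj

  rot-neg : ∀ {k} → s k ≡ false → s (- k) ≡ false
  rot-neg {k} y = trans (s-cong (≡⇒≈ (solve 1 (λ a → :- a := con 0ℤ :- a) refl k))) (rot-- y₀ y)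

  χ-rot : ∀ {k} → s k ≡ false → χ k ≈ χ 0ℤ + k [ + d ]
  χ-rot {k} y = ≈-trans (χ-cong (≡⇒≈ (solve 1 (λ a → a := con 0ℤ :+ a) refl k))) (proj₂ (periods k y 0ℤ))

  reversal : ∀ k → s (-1ℤ * k + 0ℤ) ≡ s k × χ (-1ℤ * k + 0ℤ) ≈ -1ℤ * χ k + 0ℤ [ + d ]
  reversal k = go (rotation-or-reflection k)
    where
    k' : ℤ
    k' = -1ℤ * k + 0ℤ
    go : s k ≡ false ⊎ s k ≡ true → s k' ≡ s k × χ k' ≈ -1ℤ * χ k + 0ℤ [ + d ]
    go (inj₁ y) = trans y' (sym y) , (lc (χ-rot y' ⊕ χ-rot y ⊕ 2χ0≈0)
        (solve 4 (λ a b c d → a :- (con -1ℤ :* b :+ con 0ℤ) := a :+ b :+ (c :+ c) :- (c :+ (con -1ℤ :* d :+ con 0ℤ) :+ (c :+ d) :+ con 0ℤ)) refl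
        (χ k') (χ k) (χ 0ℤ) k))
      where
      y' : s k' ≡ false
      y' = trans (s-cong (≡⇒≈ (solve 1 (λ a → con -1ℤ :* a :+ con 0ℤ := :- a) refl k))) (rot-neg y)
    go (inj₂ z) = trans z' (sym z) , ≈-trans (χ-ref z') (lc (χ-ref z)
        (solve 2 (λ a b → con -1ℤ :* a :+ con 0ℤ :- (con -1ℤ :* b :+ con 0ℤ) := b :- a) refl k (χ k)))
      where
      z' : s k' ≡ true
      z' = ¬rotation (λ y → bool-absurd (trans (s-cong (≡⇒≈ (solve 1 (λ a → a := :- (con -1ℤ :* a :+ con 0ℤ)) refl k))) (rot-neg y)) z)

  Ψ : Hom -1ℤ 0ℤ
  Ψ = hom neg 0ℤ (λ k → proj₁ (reversal k)) (λ k → proj₂ (reversal k))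

  -- Each rotation index is a period, so these indices form a subgroup of ℤ; it contains d.
  generator : ∃[ r ] (NonZero r × s (+ r) ≡ false × (∀ k → s k ≡ false → k ≈ 0ℤ [ + r ]))
  generator = subgroup-generator (λ k → s k ≡ false) (λ k → s k ≟ᵇ false) rot-- d (trans (s-cong modulus≈0) y₀)

  module Big (r : ℕ) (3≤r : 3 ℕ.≤ r) (yr : s (+ r) ≡ false) (multiple : ∀ k → s k ≡ false → k ≈ 0ℤ [ + r ]) where
    ρ : ℤ
    ρ = + r

    2ρ≈0 : + 2 * ρ ≈ 0ℤ [ + d ]
    2ρ≈0 = double-period {ρ} {0ℤ} kinds (hom pos ρ kinds inverses) (λ k → proj₁ (reversal k)) Ψ y₀
      where
      kinds : ∀ k → s (1ℤ * k + ρ) ≡ s k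
      kinds k = trans (s-cong (≡⇒≈ (solve 2 (λ a b → con 1ℤ :* a :+ b := a :+ b) refl k ρ))) (proj₁ (periods ρ yr k))
      inverses : ∀ k → χ (1ℤ * k + ρ) ≈ 1ℤ * χ k + ρ [ + d ]
      inverses k = ≈-trans (χ-cong (≡⇒≈ (solve 2 (λ a b → con 1ℤ :* a :+ b := a :+ b) refl k ρ))) (lc (proj₂ (periods ρ yr k))
          (solve 3 (λ a b c → a :- (con 1ℤ :* b :+ c) := a :- (b :+ c)) refl (χ (k + ρ)) (χ k) ρ))

    -- The index χ 0 is a multiple of r, and 2r = 0 modulo d; an even multiple would make χ 0 = 0.
    χ0 : χ 0ℤ ≈ ρ [ + d ]
    χ0 = let c , eq = ≈0⇒multiple (multiple (χ 0ℤ) (trans (s-χ 0ℤ) y₀)) in go c eq (parity c)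
      where
      go : ∀ c → χ 0ℤ ≡ c * ρ → ∃[ b ] (c ≡ + 2 * b ⊎ c ≡ + 2 * b + 1ℤ) → χ 0ℤ ≈ ρ [ + d ]
      go c eq (b , inj₁ x) = ⊥-elim (moved (lc (≡⇒≈ eq ⊕ ρ ⊙ ≡⇒≈ x ⊕ b ⊙ 2ρ≈0)
          (solve 4 (λ a b c d → a :- con 0ℤ := a :+ b :* c :+ d :* (con (+ 2) :* b) :- (c :* b :+ b :* (con (+ 2) :* d) :+ d :* con 0ℤ)) refl (χ 0ℤ) ρ c b)))
      go c eq (b , inj₂ x) = lc (≡⇒≈ eq ⊕ ρ ⊙ ≡⇒≈ x ⊕ b ⊙ 2ρ≈0)
          (solve 4 (λ a b c d → a :- b := a :+ b :* c :+ d :* (con (+ 2) :* b) :- (c :* b :+ b :* (con (+ 2) :* d :+ con 1ℤ) :+ d :* con 0ℤ)) refl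
          (χ 0ℤ) ρ c b)

    ρ≉0 : ¬ ρ ≈ 0ℤ [ + d ]
    ρ≉0 h = moved (≈-trans χ0 h)

    χρ : χ ρ ≈ 0ℤ [ + d ]
    χρ = ≈-trans (χ-cong (≈-sym χ0)) (χχ 0ℤ)

    χ-rot′ : ∀ {k} → s k ≡ false → χ k ≈ k + ρ [ + d ]
    χ-rot′ {k} y = lc (χ-rot y ⊕ χ0) (solve 4 (λ a b c d → a :- (b :+ c) := a :+ d :- (d :+ b :+ c)) refl (χ k) k ρ (χ 0ℤ))

    reflection : ∀ a → 0 ℕ.< a → a ℕ.< r → ∀ {k} → (k ≈ 0ℤ [ ρ ] → + a ≈ 0ℤ [ ρ ]) → s k ≡ true
    reflection a 0<a a<r h = ¬rotation (λ y → below-modulus≉0 0<a a<r (h (multiple _ y)))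

    1<r : 1 ℕ.< r
    1<r = ℕ.<-trans (s≤s (s≤s z≤n)) 3≤r

    -- Passing between a reflection and a rotation costs a jump by r; neighbours are never both
    -- rotations because r > 1.
    letter : ∀ k → ∃[ b ] ((b ≡ 0ℤ ⊎ b ≡ 1ℤ) × χ (k + 1ℤ) ≈ χ k + 1ℤ + ρ * b [ + d ])
    letter k = go (rotation-or-reflection k) (rotation-or-reflection (k + 1ℤ))
      where
      go : s k ≡ false ⊎ s k ≡ true → s (k + 1ℤ) ≡ false ⊎ s (k + 1ℤ) ≡ true → ∃[ b ] ((b ≡ 0ℤ ⊎ b ≡ 1ℤ) × χ (k + 1ℤ) ≈ χ k + 1ℤ + ρ * b [ + d ])
      go (inj₁ y) (inj₁ y') = bool-absurd (trans (s-cong (≡⇒≈ (solve 1 (λ a → con 1ℤ := a :+ con 1ℤ :- a) refl k))) (rot-- y' y))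
          (reflection 1 (s≤s z≤n) 1<r (λ x → x))
      go (inj₁ y) (inj₂ z') = 1ℤ , inj₂ refl , (lc (χ-ref z' ⊕ ⊖ χ-rot′ y ⊕ ⊖ 2ρ≈0)
          (solve 4 (λ a b c d → a :- (b :+ con 1ℤ :+ c :* con 1ℤ) := a :+ :- b :+ :- (con
          (+ 2) :* c) :- (d :+ con 1ℤ :+ :- (d :+ c) :+ :- con 0ℤ)) refl (χ (k + 1ℤ)) (χ k) ρ k))
      go (inj₂ z) (inj₁ y') = 1ℤ , inj₂ refl , (lc (χ-rot′ y' ⊕ ⊖ χ-ref z)
          (solve 4 (λ a b c d → a :- (b :+ con 1ℤ :+ c :* con 1ℤ) := a :+ :- b :- (d :+ con 1ℤ :+ c :+ :- d)) refl (χ (k + 1ℤ)) (χ k) ρ k))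
      go (inj₂ z) (inj₂ z') = 0ℤ , inj₁ refl , (lc (χ-ref z' ⊕ ⊖ χ-ref z)
          (solve 4 (λ a b c d → a :- (b :+ con 1ℤ :+ c :* con 0ℤ) := a :+ :- b :- (d :+ con 1ℤ :+ :- d)) refl (χ (k + 1ℤ)) (χ k) ρ k))

    -- Under the shift by 1 all offsets are 1 or 1 + r, and passing a word adds the same amount to both.
    Parity : List ℤ → Set
    Parity W = ∃[ b ] ((∃[ W' ] Shift 1ℤ 1ℤ W W' (1ℤ + ρ * b)) × (∃[ W' ] Shift 1ℤ (1ℤ + ρ) W W' (1ℤ + ρ + ρ * b)))

    word-parity : ∀ W → Parity W
    word-parity [] = 0ℤ , ([] , done (≡⇒≈ (solve 1 (λ a → con 1ℤ := con 1ℤ :+ a :* con 0ℤ) refl ρ))) , ([] , done (≡⇒≈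
        (solve 1 (λ a → con 1ℤ :+ a := con 1ℤ :+ a :+ a :* con 0ℤ) refl ρ)))
    word-parity (k ∷ W) = go (letter k) (word-parity W)
      where
      χ₁ : ∀ {b} → χ (k + 1ℤ) ≈ χ k + 1ℤ + ρ * b [ + d ] → χ (k + 1ℤ + ρ) ≈ χ k + 1ℤ + ρ * b + ρ [ + d ]
      χ₁ x = ≈-trans (proj₂ (periods ρ yr (k + 1ℤ))) (x ⊕ ≈-refl)
      go : ∃[ b ] ((b ≡ 0ℤ ⊎ b ≡ 1ℤ) × χ (k + 1ℤ) ≈ χ k + 1ℤ + ρ * b [ + d ]) → Parity W → Parity (k ∷ W)
      go (b , inj₁ refl , x) (b' , (W' , sh) , (W'' , sh')) = b' ,
        (_ , step (χ k) (χ k + 1ℤ + ρ * 0ℤ) ≈-refl x (≡⇒≈ (solve 1 (λ a → a :+ con 1ℤ := con 1ℤ :* a :+ con 1ℤ) refl k)) (shift-start (≡⇒≈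
            (solve 2 (λ a b → a :+ con 1ℤ :+ b :* con 0ℤ :- con 1ℤ :* a := con 1ℤ) refl (χ k) ρ)) sh)) ,
        (_ , step (χ k) (χ k + 1ℤ + ρ * 0ℤ + ρ) ≈-refl (χ₁ x) (≡⇒≈ (solve 2 (λ a b → a :+ con 1ℤ :+ b := con 1ℤ :* a :+ (con 1ℤ :+ b)) refl k ρ))
            (shift-start (≡⇒≈ (solve 2 (λ a b → a :+ con 1ℤ :+ b :* con 0ℤ :+ b :- con 1ℤ :* a := con 1ℤ :+ b) refl (χ k) ρ)) sh'))
      go (b , inj₂ refl , x) (b' , (W' , sh) , (W'' , sh')) = 1ℤ + b' ,
        (_ , step (χ k) (χ k + 1ℤ + ρ * 1ℤ) ≈-refl x (≡⇒≈ (solve 1 (λ a → a :+ con 1ℤ := con 1ℤ :* a :+ con 1ℤ) refl k)) (shift-start (≡⇒≈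
            (solve 2 (λ a b → a :+ con 1ℤ :+ b :* con 1ℤ :- con 1ℤ :* a := con 1ℤ :+ b) refl (χ k) ρ)) (shift-end (≡⇒≈
            (solve 2 (λ a b → con 1ℤ :+ a :+ a :* b := con 1ℤ :+ a :* (con 1ℤ :+ b)) refl ρ b')) sh'))) ,
        (_ , step (χ k) (χ k + 1ℤ + ρ * 1ℤ + ρ) ≈-refl (χ₁ x) (≡⇒≈ (solve 2 (λ a b → a :+ con 1ℤ :+ b := con 1ℤ :* a :+ (con 1ℤ :+ b)) refl k ρ))
            (shift-start (lc 2ρ≈0 (solve 2 (λ a b → a :+ con 1ℤ :+ b :* con 1ℤ :+ b :- con 1ℤ :* a :- con 1ℤ := con (+ 2) :* b :- con 0ℤ) refl (χ k) ρ))
            (shift-end (lc (⊖ 2ρ≈0) (solve 2 (λ a b → con 1ℤ :+ a :* b :- (con 1ℤ :+ a :+ a :* (con 1ℤ :+ b)) := :- (con (+ 2) :* a) :- :- con 0ℤ) refl ρ b')) sh)))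

    A : List ℤ
    A = proj₁ (generates 1ℤ false)

    -- A word for a changes the offsets 1 and 1 + r by the same multiple of r, and twice this
    -- multiple is 0 modulo d.
    square : ∃[ W' ] Shift 1ℤ 1ℤ (A ++ A) W' 1ℤ
    square = go (word-parity A)
      where
      go : Parity A → ∃[ W' ] Shift 1ℤ 1ℤ (A ++ A) W' 1ℤ
      go (b , (W' , sh) , (W'' , sh')) = by-parity (parity b)
        where
        by-parity : ∃[ c ] (b ≡ + 2 * c ⊎ b ≡ + 2 * c + 1ℤ) → ∃[ W' ] Shift 1ℤ 1ℤ (A ++ A) W' 1ℤ
        by-parity (c , inj₁ x) = W' ++ W' , shift-++ (shift-end 1+ρb≈1 sh) (shift-end 1+ρb≈1 sh)
          where
          1+ρb≈1 : 1ℤ + ρ * b ≈ 1ℤ [ + d ]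
          1+ρb≈1 = lc (ρ ⊙ ≡⇒≈ x ⊕ c ⊙ 2ρ≈0) (solve 3 (λ a b c → con 1ℤ :+ a :* b :- con 1ℤ := a :* b :+ c :* (con (+ 2) :* a) :- (a :* (con (+ 2) :* c) :+ c :* con 0ℤ)) refl ρ b c)
        by-parity (c , inj₂ x) = W' ++ W'' , shift-++ (shift-end (lc (ρ ⊙ ≡⇒≈ x ⊕ c ⊙ 2ρ≈0)
            (solve 3 (λ a b c → con 1ℤ :+ a :* b :- (con 1ℤ :+ a) := a :* b :+ c :* (con (+ 2) :* a) :- (a :*
            (con (+ 2) :* c :+ con 1ℤ) :+ c :* con 0ℤ)) refl ρ b c)) sh)
          (shift-end (lc (ρ ⊙ ≡⇒≈ x ⊕ (c + 1ℤ) ⊙ 2ρ≈0) (solve 3 (λ a b c → con 1ℤ :+ a :+ a :* b :- con 1ℤ := a :* b :+ (c :+ con 1ℤ) :*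
              (con (+ 2) :* a) :- (a :* (con (+ 2) :* c :+ con 1ℤ) :+ (c :+ con 1ℤ) :* con 0ℤ)) refl ρ b c)) sh')

    -- An even power of a is a power of `A ++ A`, which brings the offset 1 back to 1. So a rotation
    -- that takes the offset 1 to 1 + r has odd exponent.
    odd-offset : ∀ {W W' p} → Val W p false → Shift 1ℤ 1ℤ W W' (1ℤ + ρ) → ∀ i → ¬ p ≈ + 2 * + i [ + n ]
    odd-offset {W} {W'} {p} v sh i x =
      let a = proj₂ (generates 1ℤ false)
          V , sq = square
          _ , _ , c = law pos (val-≈ v x) (val-≈ (val-power i (val-++ a a)) (≡⇒≈
              (solve 1 (λ a → a :* (con 1ℤ :+ con 1ℤ) := con (+ 2) :* a) refl (+ i)))) sh (shift-power i sq) (val-exists W') (val-exists (power i V))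
      in ρ≉0 (lc c (solve 1 (λ a → a :- con 0ℤ := con 1ℤ :+ a :- con 1ℤ) refl ρ))

    z₁ : s 1ℤ ≡ true
    z₁ = reflection 1 (s≤s z≤n) 1<r (λ x → x)

    z₂ : s (+ 2) ≡ true
    z₂ = reflection 2 (s≤s z≤n) 3≤r (λ x → x)

    +ρ : ∀ {k} → s k ≡ true → s (k + ρ) ≡ true
    +ρ {k} z = trans (proj₁ (periods ρ yr k)) z

    val-y₀ : Val (0ℤ ∷ []) (e 0ℤ) false
    val-y₀ = val-≈ (val-rot y₀ val[]) (≡⇒≈ (solve 1 (λ a → a :+ con 0ℤ := a) refl (e 0ℤ)))

    shift-y₀ : Shift 1ℤ 1ℤ (0ℤ ∷ []) (1ℤ ∷ []) (1ℤ + ρ)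
    shift-y₀ = step ρ 1ℤ χ0 (χ-ref z₁) ≈-refl (done (lc (⊖ 2ρ≈0)
        (solve 1 (λ a → con 1ℤ :- con 1ℤ :* a :- (con 1ℤ :+ a) := :- (con (+ 2) :* a) :- :- con 0ℤ) refl ρ)))

    shift-y₀² : Shift 1ℤ 1ℤ (0ℤ ∷ 0ℤ ∷ []) (1ℤ ∷ 1ℤ + ρ ∷ []) 1ℤ
    shift-y₀² = shift-++ shift-y₀ (step ρ (1ℤ + ρ) χ0 (χ-ref (+ρ z₁)) (≡⇒≈ (solve 1 (λ a → con 1ℤ :+ a := con 1ℤ :* con 0ℤ :+ (con 1ℤ :+ a)) refl ρ))
        (done (≡⇒≈ (solve 1 (λ a → con 1ℤ :+ a :- con 1ℤ :* a := con 1ℤ) refl ρ))))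

    shift-z₁z₁₊ρ : Shift 1ℤ 1ℤ (1ℤ ∷ 1ℤ + ρ ∷ []) (+ 2 ∷ + 2 + ρ ∷ []) 1ℤ
    shift-z₁z₁₊ρ = step 1ℤ (+ 2) (χ-ref z₁) (χ-ref z₂) ≈-refl
      (step (1ℤ + ρ) (+ 2 + ρ) (χ-ref (+ρ z₁)) (χ-ref (+ρ z₂)) (≡⇒≈
          (solve 1 (λ a → con (+ 2) :+ a := con 1ℤ :* (con 1ℤ :+ a) :+ (con (+ 2) :- con 1ℤ :* con 1ℤ)) refl ρ)) (done (≡⇒≈
          (solve 1 (λ a → con (+ 2) :+ a :- con 1ℤ :* (con 1ℤ :+ a) := con 1ℤ) refl ρ))))

    e₀-odd : ∃[ g ] e 0ℤ ≈ + (1 ℕ.+ g ℕ.* 2) [ + n ]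
    e₀-odd = N ℕ./ 2 , go (N ℕ.% 2) (ℕ.m%n<n N 2) (ℕ.m≡m%n+[m/n]*n N 2)
      where
      N : ℕ
      N = e 0ℤ %ℕ n
      go : ∀ b → b ℕ.< 2 → N ≡ b ℕ.+ (N ℕ./ 2) ℕ.* 2 → e 0ℤ ≈ + (1 ℕ.+ (N ℕ./ 2) ℕ.* 2) [ + n ]
      go 1 _ eq = ≈-trans (residue (e 0ℤ) n) (≡⇒≈ (cong +_ eq))
      go 0 _ eq = ⊥-elim (odd-offset val-y₀ shift-y₀ (N ℕ./ 2) (≈-trans (residue (e 0ℤ) n)
          (≡⇒≈ (trans (cong +_ eq) (trans (pos-* (N ℕ./ 2) 2) (ℤ*-comm (+ (N ℕ./ 2)) (+ 2)))))))
        where open import Data.Integer.Properties using () renaming (*-comm to ℤ*-comm)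
      go (suc (suc _)) (s≤s (s≤s ())) _

    -- For r at least 4 the indices r - 3, r - 2, r - 1 are reflections. Let T be the exponent of V
    -- = z_(r-3) z_(r-2); then y₀^T = V^(e 0) with e 0 odd. For odd T the shift by 1 takes the left
    -- side to offset 1 + r and the right side to 1. For even T it yields (z₁ z_(1+r))^(T/2) = V'^(e
    -- 0); a second shift by 1 brings the left side back to offset 1, but takes the right side to 1
    -- + r.
    r<4 : ¬ 4 ℕ.≤ r
    r<4 4≤r = by-parity (τ ℕ.% 2) (ℕ.m%n<n τ 2) (ℕ.m≡m%n+[m/n]*n τ 2)
      where
      z₋₁ : s (ρ - 1ℤ) ≡ true
      z₋₁ = reflection 1 (s≤s z≤n) 1<r (λ x → (lc (⊖ x ⊕ modulus≈0)
          (solve 1 (λ a → con 1ℤ :- con 0ℤ := :- (a :- con 1ℤ) :+ a :- (:- con 0ℤ :+ con 0ℤ)) refl ρ)))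
      z₋₂ : s (ρ - + 2) ≡ true
      z₋₂ = reflection 2 (s≤s z≤n) 3≤r (λ x → (lc (⊖ x ⊕ modulus≈0)
          (solve 1 (λ a → con (+ 2) :- con 0ℤ := :- (a :- con (+ 2)) :+ a :- (:- con 0ℤ :+ con 0ℤ)) refl ρ)))
      z₋₃ : s (ρ - + 3) ≡ true
      z₋₃ = reflection 3 (s≤s z≤n) 4≤r (λ x → (lc (⊖ x ⊕ modulus≈0)
          (solve 1 (λ a → con (+ 3) :- con 0ℤ := :- (a :- con (+ 3)) :+ a :- (:- con 0ℤ :+ con 0ℤ)) refl ρ)))
      z-1 : s -1ℤ ≡ true
      z-1 = reflection 1 (s≤s z≤n) 1<r (λ x → (lc (⊖ x) (refl)))
      V V' : List ℤ
      V = ρ - + 3 ∷ ρ - + 2 ∷ []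
      V' = ρ - + 2 ∷ ρ - 1ℤ ∷ []
      T T' : ℤ
      T = e (ρ - + 3) - e (ρ - + 2)
      T' = e (ρ - + 2) - e (ρ - 1ℤ)
      val-V : Val V T false
      val-V = val-≈ (val-ref z₋₃ (val-ref z₋₂ val[])) (≡⇒≈ (solve 2 (λ a b → a :- (b :- con 0ℤ) := a :- b) refl (e (ρ - + 3)) (e (ρ - + 2))))
      val-V' : Val V' T' false
      val-V' = val-≈ (val-ref z₋₂ (val-ref z₋₁ val[])) (≡⇒≈ (solve 2 (λ a b → a :- (b :- con 0ℤ) := a :- b) refl (e (ρ - + 2)) (e (ρ - 1ℤ))))
      shift-V : Shift 1ℤ 1ℤ V V' 1ℤ
      shift-V = step (ρ - + 3) (ρ - + 2) (χ-ref z₋₃) (χ-ref z₋₂) (≡⇒≈ (solve 1 (λ a → a :- con (+ 2) := con 1ℤ :* (a :- con (+ 3)) :+ con 1ℤ) refl ρ))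
        (step (ρ - + 2) (ρ - 1ℤ) (χ-ref z₋₂) (χ-ref z₋₁) (≡⇒≈
            (solve 1 (λ a → a :- con 1ℤ := con 1ℤ :* (a :- con (+ 2)) :+ (a :- con (+ 2) :- con 1ℤ :* (a :- con (+ 3)))) refl ρ)) (done (≡⇒≈
            (solve 1 (λ a → a :- con 1ℤ :- con 1ℤ :* (a :- con (+ 2)) := con 1ℤ) refl ρ))))
      shift-V' : Shift 1ℤ 1ℤ V' (ρ - 1ℤ ∷ ρ ∷ []) (1ℤ + ρ)
      shift-V' = step (ρ - + 2) (ρ - 1ℤ) (χ-ref z₋₂) (χ-ref z₋₁) (≡⇒≈ (solve 1 (λ a → a :- con 1ℤ := con 1ℤ :* (a :- con (+ 2)) :+ con 1ℤ) refl ρ))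
        (step (ρ - 1ℤ) 0ℤ (χ-ref z₋₁) χρ (≡⇒≈ (solve 1 (λ a → a := con 1ℤ :* (a :- con 1ℤ) :+ (a :- con 1ℤ :- con 1ℤ :* (a :- con (+ 2)))) refl ρ))
            (done (lc (⊖ 2ρ≈0) (solve 1 (λ a → con 0ℤ :- con 1ℤ :* (a :- con 1ℤ) :- (con 1ℤ :+ a) := :- (con (+ 2) :* a) :- :- con 0ℤ) refl ρ))))
      shift-V'₊ρ : Shift 1ℤ (1ℤ + ρ) V' (-1ℤ ∷ 0ℤ ∷ []) 1ℤ
      shift-V'₊ρ = step (ρ - + 2) -1ℤ (χ-ref z₋₂) (χ-ref z-1) (lc (⊖ 2ρ≈0)
          (solve 1 (λ a → con -1ℤ :- (con 1ℤ :* (a :- con (+ 2)) :+ (con 1ℤ :+ a)) := :- (con (+ 2) :* a) :- :- con 0ℤ) refl ρ))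
        (step (ρ - 1ℤ) ρ (χ-ref z₋₁) χ0 (≡⇒≈ (solve 1 (λ a → con 0ℤ := con 1ℤ :* (a :- con 1ℤ) :+ (con -1ℤ :- con 1ℤ :* (a :- con (+ 2)))) refl ρ))
            (done (≡⇒≈ (solve 1 (λ a → a :- con 1ℤ :* (a :- con 1ℤ) := con 1ℤ) refl ρ))))
      τ ε g : ℕ
      τ = T %ℕ n
      g = proj₁ e₀-odd
      -- An odd natural number congruent to e 0, usable as the exponent of a power of a word.
      ε = 1 ℕ.+ g ℕ.* 2
      common : ∀ {p} → p ≈ T * e 0ℤ [ + n ] → Val (power ε V) p false
      common {p} x = val-≈ (val-power ε val-V) (lc (⊖ x ⊕ (- T) ⊙ proj₂ e₀-odd)
          (solve 4 (λ a b c d → a :* b :- c := :- c :+ :- b :* d :- (:- (b :* d) :+ :- b :* a)) refl (+ ε) T p (e 0ℤ)))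
      val-y₀² : Val (0ℤ ∷ 0ℤ ∷ []) (+ 2 * e 0ℤ) false
      val-y₀² = val-≈ (val-++ val-y₀ val-y₀) (≡⇒≈ (solve 1 (λ a → a :+ a := con (+ 2) :* a) refl (e 0ℤ)))
      T≈ : ∀ b i → τ ≡ b ℕ.+ i ℕ.* 2 → T ≈ + b + + i * + 2 [ + n ]
      T≈ b i eq = ≈-trans (residue T n) (≡⇒≈ (pos-divmod i 2 eq))
      by-parity : ∀ b → b ℕ.< 2 → τ ≡ b ℕ.+ (τ ℕ./ 2) ℕ.* 2 → ⊥
      by-parity 1 _ eq = let i = τ ℕ./ 2
                             _ , _ , c = law pos (val-++ (val-power i val-y₀²) val-y₀) (common (lc ((- e 0ℤ) ⊙ T≈ 1 i eq)
                                 (solve 3 (λ a b c → a :* (con (+ 2) :* b) :+ b :- c :* b := :- b :* c :- :- b :* (con (+ 1) :+ a :* con (+ 2))) refl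
                                 (+ i) (e 0ℤ) T)))
                               (shift-++ (shift-power i shift-y₀²) shift-y₀) (shift-power ε shift-V)
                                   (val-exists (power i (1ℤ ∷ 1ℤ + ρ ∷ []) ++ 1ℤ ∷ [])) (val-exists (power ε V'))
                         in ρ≉0 (lc c (solve 1 (λ a → a :- con 0ℤ := con 1ℤ :+ a :- con 1ℤ) refl ρ))
      by-parity 0 _ eq = let i = τ ℕ./ 2
                             val-z = val-≈ (val-ref z₁ (val-ref (+ρ z₁) val[])) (≡⇒≈ (solve 2 (λ a b → a :- (b :- con 0ℤ) := a :- b) refl (e 1ℤ)
                                 (e (1ℤ + ρ))))
                             q , _ = law pos (val-power i val-y₀²) (common (lc ((- e 0ℤ) ⊙ T≈ 0 i eq)
                                 (solve 3 (λ a b c → a :* (con (+ 2) :* b) :- c :* b := :- b :* c :- :- b :* (con (+ 0) :+ a :* con (+ 2))) refl (+ i)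
                                 (e 0ℤ) T)))
                               (shift-power i shift-y₀²) (shift-power ε shift-V) (val-power i val-z) (val-power ε val-V')
                             _ , _ , c = law pos (val-≈ (val-power i val-z) q)
                               (val-≈ (val-++ val-V' (val-power g (val-++ val-V' val-V'))) (lc ((- T') ⊙ ≡⇒≈ (pos-divmod {ε} {1} g 2 refl))
                                   (solve 3 (λ a b c → a :+ b :* (a :+ a) :- c :* a := :- a :* c :- :- a :* (con 1ℤ :+ b :* con (+ 2))) refl T' (+ g)
                                   (+ ε))))
                               (shift-power i shift-z₁z₁₊ρ) (shift-++ shift-V' (shift-power g (shift-++ shift-V'₊ρ shift-V')))
                               (val-exists (power i (+ 2 ∷ + 2 + ρ ∷ []))) (val-exists ((ρ - 1ℤ ∷ ρ ∷ []) ++ power g (-1ℤ ∷ 0ℤ ∷ ρ - 1ℤ ∷ ρ ∷ [])))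
                         in ρ≉0 (lc (⊖ c) (solve 1 (λ a → a :- con 0ℤ := :- con 1ℤ :- :- (con 1ℤ :+ a)) refl ρ))
      by-parity (suc (suc _)) (s≤s (s≤s ())) _

-- Subtracting q n from the involution gives a representative whose double is exactly n, hence a
-- natural number.
2-torsion⇒half : ∀ {a n} → a + a ≈ 0ℤ [ + n ] → ¬ a ≈ 0ℤ [ + n ] → ∃[ M ] (n ≡ 2 ℕ.* M × a ≈ + M [ + n ])
2-torsion⇒half {a} {n} h a≉0 = let q , eq = 2-torsion-half h a≉0 in go (a - q * + n) (n≡2m q eq) (lc (q ⊙ modulus≈0)
    (solve 3 (λ a b c → a :- (a :- b :* c) := b :* c :- b :* con 0ℤ) refl a q (+ n)))
  where
  n≡2m : ∀ q → a + a ≡ + n + + 2 * (q * + n) → + n ≡ + 2 * (a - q * + n)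
  n≡2m q eq = trans (solve 2 (λ a b → a := a :+ con (+ 2) :* (b :* a) :- con (+ 2) :* (b :* a)) refl (+ n) q)
      (trans (cong (_- + 2 * (q * + n)) (sym eq)) (solve 3 (λ a b c → a :+ a :- con (+ 2) :* (b :* c) := con (+ 2) :* (a :- b :* c)) refl a q (+ n)))
  go : ∀ m → + n ≡ + 2 * m → a ≈ m [ + n ] → ∃[ M ] (n ≡ 2 ℕ.* M × a ≈ + M [ + n ])
  go (+ M) eq x = M , +-injective (trans eq (sym (pos-* 2 M))) , x
  go -[1+ M ] ()

module CosetSix {n} (S : System n 6) (y₀ : System.s S 0ℤ ≡ false) (moved : ¬ System.χ S 0ℤ ≈ 0ℤ [ + 6 ])
  (2χ0≈0 : System.χ S 0ℤ + System.χ S 0ℤ ≈ 0ℤ [ + 6 ]) (periods : ∀ j → System.s S j ≡ false → Periodicity.Period S j)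
  (y₃ : System.s S (+ 3) ≡ false) (multiple : ∀ k → System.s S k ≡ false → k ≈ 0ℤ [ + 3 ]) where
  open System S
  open Generic S
  open CosetPattern S y₀ moved 2χ0≈0 periods
  open Big 3 (s≤s (s≤s (s≤s z≤n))) y₃ multiple

  z₄ : s (+ 4) ≡ true
  z₄ = +ρ z₁
  z₅ : s (+ 5) ≡ true
  z₅ = +ρ z₂

  e₃ : e (+ 3) ≈ - e 0ℤ [ + n ]
  e₃ = ≈-trans (e-cong (≈-sym χ0)) (e-χ y₀)

  v b₁ b₂ : ℤ
  v = Hom.z Ψ
  b₁ = e 1ℤ - e (+ 4)
  b₂ = e (+ 2) - e (+ 5)

  val-z₁z₄ : Val (1ℤ ∷ + 4 ∷ []) b₁ false
  val-z₁z₄ = val-≈ (val-ref z₁ (val-ref z₄ val[])) (≡⇒≈ (solve 2 (λ a b → a :- (b :- con 0ℤ) := a :- b) refl (e 1ℤ) (e (+ 4))))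

  val-z₂z₅ : Val (+ 2 ∷ + 5 ∷ []) b₂ false
  val-z₂z₅ = val-≈ (val-ref z₂ (val-ref z₅ val[])) (≡⇒≈ (solve 2 (λ a b → a :- (b :- con 0ℤ) := a :- b) refl (e (+ 2)) (e (+ 5))))

  -- The reversal fixes the index 0, so v e 0 = e 0 and y₀^(2(v - 1)) = 1, with shift (z₁ z₄)^(v -
  -- 1) = 1. So v fixes b₁, while the reversal sends z₁ z₄ to z₅ z₂.
  b₂≈-b₁ : b₂ ≈ - b₁ [ + n ]
  b₂≈-b₁ = lc (⊖ fixes ⊕ ⊖ Hom.ref≈ Ψ 1ℤ (+ 4) z₁ z₄ ⊕ e-cong by-computation ⊕ ⊖ e-cong by-computation ⊕ ≡⇒≈ {b₂} refl)
      (solve 7 (λ a b c d e f g → a :- :- b := :- ((c :- con 1ℤ) :* b) :+ :- (d :- e) :+ d :+ :- e :+ a :- (:- con 0ℤ :+ :- (c :* b) :+ f :+ :- g :+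
      (g :- f))) refl b₂ b₁ v (e -1ℤ) (e -[1+ 3 ]) (e (+ 5)) (e (+ 2)))
    where
    fixes : (v - 1ℤ) * b₁ ≈ 0ℤ [ + n ]
    fixes = let N = (v - 1ℤ) %ℕ n
                x , _ = law pos (val-≈ (val-power N (val-++ val-y₀ val-y₀)) (lc ((-[1+ 1 ] * e 0ℤ) ⊙ residue (v - 1ℤ) n ⊕
                    (- (+ 2)) ⊙ Hom.rot≈ Ψ 0ℤ y₀) (solve 3 (λ a b c → a :* (b :+ b) :- con 0ℤ := con (-[1+ 1 ]) :* b :* (c :- con 1ℤ) :+ :- con
                    (+ 2) :* b :- (con (-[1+ 1 ]) :* b :* a :+ :- con (+ 2) :* (c :* b))) refl (+ N) (e 0ℤ) v))) val[]
                  (shift-power N shift-y₀²) (done ≈-refl) (val-power N val-z₁z₄) val[]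
            in (lc (x ⊕ b₁ ⊙ residue (v - 1ℤ) n) (solve 3 (λ a b c → (a :- con 1ℤ) :* b :- con 0ℤ := c :* b :+ b :* (a :- con 1ℤ) :- (con 0ℤ :+ b :* c)) refl v b₁ (+ N)))

  -- The product z₁ z₄ z₂ z₅ is now 1, and its shift by 1 is z₂ z₅ y₃ y₃.
  b₂≈2e₀ : b₂ ≈ + 2 * e 0ℤ [ + n ]
  b₂≈2e₀ = let x , _ = law pos (val-≈ (val-++ val-z₁z₄ val-z₂z₅) (lc b₂≈-b₁ (solve 2 (λ a b → a :+ b :- con 0ℤ := b :- :- a) refl b₁ b₂))) val[]
                 (shift-++ shift-z₁z₁₊ρ (step (+ 2) 0ℤ (χ-ref z₂) χρ ≈-refl (step (+ 5) 0ℤ (χ-ref z₅) χρ ≈-refl (done ≈-refl)))) (done ≈-refl)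
                 (val-++ val-z₂z₅ (val-rot y₃ (val-rot y₃ val[]))) val[]
           in (lc (x ⊕ (-[1+ 1 ]) ⊙ e₃) (solve 3 (λ a b c → a :- con (+ 2) :* b := a :+ (c :+ (c :+ con 0ℤ)) :+ con (-[1+ 1 ]) :* c :- (con 0ℤ :+ con (-[1+ 1 ]) :* :- b)) refl b₂ (e 0ℤ) (e (+ 3))))

  D : ℤ
  D = e (+ 2) - e (+ 4)

  -- Shifting x₀ x₁ x₂ = x₁ x₂ x₀ by 1.
  D+D≈0 : D + D ≈ 0ℤ [ + n ]
  D+D≈0 = let x , _ = law pos {1ℤ} (val-rot y₀ (val-ref z₁ (val-ref z₂ val[]))) (val-≈ (val-ref z₁ (val-ref z₂ (val-rot y₀ val[]))) (≡⇒≈ (solve 3 (λ a b c → a :- (b :- (c :+ con 0ℤ)) := c :+ (a :- (b :- con 0ℤ))) refl (e 1ℤ) (e (+ 2)) (e 0ℤ))))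
                 (step (+ 3) 1ℤ χ0 (χ-ref z₁) ≈-refl (step 1ℤ (+ 5) (χ-ref z₁) (χ-ref z₅) by-computation
                     (step (+ 2) (+ 3) (χ-ref z₂) χ0 by-computation (done ≈-refl))))
                 (step 1ℤ (+ 2) (χ-ref z₁) (χ-ref z₂) ≈-refl (step (+ 2) 0ℤ (χ-ref z₂) χρ ≈-refl (step (+ 3) (+ 4) χ0 (χ-ref z₄) by-computation
                     (done ≈-refl))))
                 (val-ref z₁ (val-ref z₅ (val-rot y₀ val[]))) (val-ref z₂ (val-rot y₃ (val-ref z₄ val[])))
          in (lc (⊖ x ⊕ e₃ ⊕ b₂≈-b₁) (solve 6 (λ a b c d e f → a :- b :+ (a :- b) :- con 0ℤ := :- (c :- (d :- (e :+ con 0ℤ))) :+ f :+ (a :- d) :- (:- (a :- (f :+ (b :- con 0ℤ))) :+ :- e :+ :- (c :- b))) refl (e (+ 2)) (e (+ 4)) (e 1ℤ) (e (+ 5)) (e 0ℤ) (e (+ 3))))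

  D≉0 : ¬ D ≈ 0ℤ [ + n ]
  D≉0 x = distinct-by-computation (distinct (trans z₂ (sym z₄)) (lc x (solve 2 (λ a b → a :- b := a :- b :- con 0ℤ) refl (e (+ 2)) (e (+ 4)))))

  module Halves (M : ℕ) (n≡2M : n ≡ 2 ℕ.* M) (D≈M : D ≈ + M [ + n ]) where
    m : ℤ
    m = + M

    2m≈0 : + 2 * m ≈ 0ℤ [ + n ]
    2m≈0 = ≈-trans (≡⇒≈ (trans (sym (pos-* 2 M)) (cong +_ (sym n≡2M)))) modulus≈0

    z₁z₂ : e 1ℤ - e (+ 2) ≈ m - + 2 * e 0ℤ [ + n ]
    z₁z₂ = lc (⊖ D≈M ⊕ b₂≈-b₁ ⊕ ⊖ b₂≈2e₀ ⊕ ⊖ 2m≈0) (solve 6 (λ a b c d e f → a :- b :- (c :- con (+ 2) :* d) := :- (b :- e) :+ f :+ :- f :+ :- (con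
        (+ 2) :* c) :- (:- c :+ :- (a :- e) :+ :- (con (+ 2) :* d) :+ :- con 0ℤ)) refl (e 1ℤ) (e (+ 2)) m (e 0ℤ) (e (+ 4)) b₂)

    -- If M were even, the exponent m - 2 e 0 of z₁ z₂ would be even; but under the shift by 1 this
    -- word takes the offset 1 to 1 + 3.
    M-odd : ∃[ k ] M ≡ 1 ℕ.+ k ℕ.* 2
    M-odd = M ℕ./ 2 , go (M ℕ.% 2) (ℕ.m%n<n M 2) (ℕ.m≡m%n+[m/n]*n M 2)
      where
      k : ℕ
      k = M ℕ./ 2
      go : ∀ b → b ℕ.< 2 → M ≡ b ℕ.+ k ℕ.* 2 → M ≡ 1 ℕ.+ k ℕ.* 2
      go 1 _ eq = eq
      go (suc (suc _)) (s≤s (s≤s ())) _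
      go 0 _ eq = let i = (+ k - e 0ℤ) %ℕ n in ⊥-elim (odd-offset
        (val-≈ (val-ref z₁ (val-ref z₂ val[])) (≡⇒≈ (solve 2 (λ a b → a :- (b :- con 0ℤ) := a :- b) refl (e 1ℤ) (e (+ 2)))))
        (step 1ℤ (+ 2) (χ-ref z₁) (χ-ref z₂) ≈-refl (step (+ 2) 0ℤ (χ-ref z₂) χρ ≈-refl (done by-computation))) i
        (lc (z₁z₂ ⊕ ≡⇒≈ (pos-divmod k 2 eq) ⊕ (+ 2) ⊙ residue (+ k - e 0ℤ) n) (solve 6 (λ a b c d e f → a :- b :- con (+ 2) :* c := a :- b :+ d :+ con
            (+ 2) :* (e :- f) :- (d :- con (+ 2) :* f :+ (con (+ 0) :+ e :* con (+ 2)) :+ con (+ 2) :* c)) refl (e 1ℤ) (e (+ 2)) (+ i) m (+ k)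
            (e 0ℤ))))

    me₀≈m : m * e 0ℤ ≈ m [ + n ]
    me₀≈m = let g , x = e₀-odd in (lc (m ⊙ x ⊕ m ⊙ ≡⇒≈ (pos-divmod {1 ℕ.+ g ℕ.* 2} {1} g 2 refl) ⊕ (+ g) ⊙ 2m≈0)
        (solve 4 (λ a b c d → a :* b :- a := a :* b :+ a :* c :+ d :* (con (+ 2) :* a) :- (a :* c :+ a :* (con 1ℤ :+ d :* con
        (+ 2)) :+ d :* con 0ℤ)) refl m (e 0ℤ) (+ (1 ℕ.+ g ℕ.* 2)) (+ g)))

    -- For n = 2 the inverse rotations y₀ and y₃ would coincide.
    M≢1 : M ≢ 1
    M≢1 refl = distinct-by-computation (distinct (trans y₃ (sym y₀)) (lc (e₃ ⊕ (- e 0ℤ) ⊙ 2m≈0)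
        (solve 2 (λ a b → a :- b := a :+ :- b :* con (+ 2) :- (:- b :+ :- b :* con 0ℤ)) refl (e (+ 3)) (e 0ℤ))))

    model : Model S (p₆-exponent m) p₆-kind
    model = record { sign = pos ; t = + 4 ; u = e 0ℤ ; j = e (+ 4) ; kinds = kinds ; rotations = rots ; reflections = refs }
      where
      kinds : ∀ i → i ℕ.< 6 → s (1ℤ * + i + + 4) ≡ p₆-kind i
      kinds 0 _ = z₄
      kinds 1 _ = z₅
      kinds 2 _ = trans (s-cong by-computation) y₀
      kinds 3 _ = trans (s-cong by-computation) z₁
      kinds 4 _ = trans (s-cong by-computation) z₂
      kinds 5 _ = trans (s-cong by-computation) y₃
      kinds (suc (suc (suc (suc (suc (suc _)))))) lt = ⊥-elim (out-of-range 6 refl lt)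
      rots : ∀ i → i ℕ.< 6 → p₆-kind i ≡ false → e (1ℤ * + i + + 4) ≈ e 0ℤ * p₆-exponent m i [ + n ]
      rots 2 _ _ = ≈-trans (e-cong by-computation) (≡⇒≈ (solve 1 (λ a → a := a :* con (+ 1)) refl (e 0ℤ)))
      rots 5 _ _ = ≈-trans (e-cong by-computation) (lc e₃ (solve 2 (λ a b → a :- b :* :- con (+ 1) := a :- :- b) refl (e (+ 3)) (e 0ℤ)))
      rots (suc (suc (suc (suc (suc (suc _)))))) lt _ = ⊥-elim (out-of-range 6 refl lt)
      refs : ∀ i → i ℕ.< 6 → p₆-kind i ≡ true → e (1ℤ * + i + + 4) ≈ e 0ℤ * p₆-exponent m i + e (+ 4) [ + n ]
      refs 0 _ _ = ≡⇒≈ (solve 2 (λ a b → a := b :* con (+ 0) :+ a) refl (e (+ 4)) (e 0ℤ))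
      refs 1 _ _ = lc (⊖ b₂≈2e₀ ⊕ D≈M ⊕ ⊖ me₀≈m) (solve 5 (λ a b c d e → a :- (b :* (c :- con (+ 2)) :+ d) := :- (e :- a) :+
          (e :- d) :+ :- (c :* b) :- (:- (con (+ 2) :* b) :+ c :+ :- c)) refl (e (+ 5)) (e 0ℤ) m (e (+ 4)) (e (+ 2)))
      refs 3 _ _ = ≈-trans (e-cong by-computation) (lc (b₂≈-b₁ ⊕ ⊖ b₂≈2e₀)
          (solve 4 (λ a b c d → a :- (b :* :- con (+ 2) :+ c) := d :+ :- d :- (:- (a :- c) :+ :- (con (+ 2) :* b))) refl (e 1ℤ) (e 0ℤ) (e (+ 4)) b₂))
      refs 4 _ _ = ≈-trans (e-cong by-computation) (lc (D≈M ⊕ ⊖ me₀≈m)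
          (solve 4 (λ a b c d → a :- (b :* c :+ d) := a :- d :+ :- (c :* b) :- (c :+ :- c)) refl (e (+ 2)) (e 0ℤ) m (e (+ 4))))
      refs (suc (suc (suc (suc (suc (suc _)))))) lt _ = ⊥-elim (out-of-range 6 refl lt)

  result : ∃[ k ] (1 ℕ.≤ k × n ≡ 4 ℕ.* k ℕ.+ 2 × Model S (p₆-exponent (+ (2 ℕ.* k ℕ.+ 1))) p₆-kind)
  result = conclude (2-torsion⇒half D+D≈0 D≉0)
    where
    Result : Set
    Result = ∃[ k ] (1 ℕ.≤ k × n ≡ 4 ℕ.* k ℕ.+ 2 × Model S (p₆-exponent (+ (2 ℕ.* k ℕ.+ 1))) p₆-kind)
    conclude : ∃[ M ] (n ≡ 2 ℕ.* M × D ≈ + M [ + n ]) → Result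
    conclude (M , n≡ , x) = go M-odd
      where
      open Halves M n≡ x
      go : ∃[ k ] M ≡ 1 ℕ.+ k ℕ.* 2 → Result
      go (zero , eq) = ⊥-elim (M≢1 eq)
      go (k@(suc _) , eq) = k , s≤s z≤n , trans n≡ (trans (cong (2 ℕ.*_) eq)
          (solveℕ 1 (λ k → conℕ 2 ⊠ (conℕ 1 ⊞ k ⊠ conℕ 2) :≡ conℕ 4 ⊠ k ⊞ conℕ 2) refl k)) ,
        subst (λ M → Model S (p₆-exponent (+ M)) p₆-kind) (trans eq (solveℕ 1 (λ k → conℕ 1 ⊞ k ⊠ conℕ 2 :≡ conℕ 2 ⊠ k ⊞ conℕ 1) refl k)) model

coset-six : ∀ {n d} (S : System n d) (y₀ : System.s S 0ℤ ≡ false) → ¬ System.χ S 0ℤ ≈ 0ℤ [ + d ] →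
  System.χ S 0ℤ + System.χ S 0ℤ ≈ 0ℤ [ + d ] → (∀ j → System.s S j ≡ false → Periodicity.Period S j) →
  System.s S (+ 3) ≡ false → (∀ k → System.s S k ≡ false → k ≈ 0ℤ [ + 3 ]) → d ≡ 6 →
  ∃[ k ] (1 ℕ.≤ k × n ≡ 4 ℕ.* k ℕ.+ 2 × Model S (p₆-exponent (+ (2 ℕ.* k ℕ.+ 1))) p₆-kind)
coset-six S y₀ moved x periods y₃ multiple refl = CosetSix.result S y₀ moved x periods y₃ multiple

-- With rotations exactly at the multiples of r: r = 1 leaves no reflections, r = 2 alternates, and
-- r at least 4 is excluded. For r = 3 the valency divides 6 and is a multiple of 3; valency 3 would
-- make the half turn trivial.
coset-pattern : ∀ {n d} (S : System n d) → System.s S 0ℤ ≡ false → ¬ System.χ S 0ℤ ≈ 0ℤ [ + d ] →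
  System.χ S 0ℤ + System.χ S 0ℤ ≈ 0ℤ [ + d ] → (∀ j → System.s S j ≡ false → Periodicity.Period S j) →
  (System.s S 1ℤ ≡ true × Periodicity.TypePeriod S (+ 2)) ⊎
  (d ≡ 6 × ∃[ k ] (1 ℕ.≤ k × n ≡ 4 ℕ.* k ℕ.+ 2 × Model S (p₆-exponent (+ (2 ℕ.* k ℕ.+ 1))) p₆-kind))
coset-pattern {n} {d} S y₀ moved x periods = by-generator generator
  where
  open System S
  open Generic S
  open Periodicity S
  open CosetPattern S y₀ moved x periods
  Result : Set
  Result = (s 1ℤ ≡ true × TypePeriod (+ 2)) ⊎ (d ≡ 6 × ∃[ k ] (1 ℕ.≤ k × n ≡ 4 ℕ.* k ℕ.+ 2 × Model S (p₆-exponent (+ (2 ℕ.* k ℕ.+ 1))) p₆-kind))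
  by-generator : ∃[ r ] (NonZero r × s (+ r) ≡ false × (∀ k → s k ≡ false → k ≈ 0ℤ [ + r ])) → Result
  by-generator (0 , r≢0 , _) = ⊥-elim (ℕ.≢-nonZero⁻¹ 0 {{r≢0}} refl)
  by-generator (1 , _ , y , _) = ⊥-elim (no-unit-type-period y₀ (λ m → proj₁ (periods _ y m)))
  by-generator (2 , _ , y , multiple) = inj₁ (¬rotation (λ y₁ → distinct-by-computation (multiple _ y₁)) , λ m → proj₁ (periods _ y m))
  by-generator (3 , _ , y , multiple) = inj₂ (d≡6 , coset-six S y₀ moved x periods y multiple d≡6)
    where
    open Big 3 (s≤s (s≤s (s≤s z≤n))) y multiple
    d≡6 : d ≡ 6
    d≡6 = go (3-or-6 2ρ≈0 (multiple (+ d) (trans (s-cong modulus≈0) y₀)))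
      where
      go : d ≡ 3 ⊎ d ≡ 6 → d ≡ 6
      go (inj₁ eq) = ⊥-elim (ρ≉0 (subst (λ d → + 3 ≈ 0ℤ [ + d ]) (sym eq) by-computation))
      go (inj₂ eq) = eq
  by-generator (suc (suc (suc (suc r))) , _ , y , multiple) = ⊥-elim (Big.r<4 _ (s≤s (s≤s (s≤s z≤n))) y multiple (s≤s (s≤s (s≤s (s≤s z≤n)))))

-- Alternating pattern

-- The quotient of a system by index period v and exponent modulus g, when multiples of g are the powers of z_i z_i'
-- for a pair of reflections with i ≈ i' (mod v).
module QuotientSystem {n d : ℕ} (S : System n d) (g v : ℕ) (g≢0 : NonZero g) (v≢0 : NonZero v)
  (n∣ : + n ≈ 0ℤ [ + g ]) (d∣ : + d ≈ 0ℤ [ + v ])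
  (s-cong′ : ∀ {k l} → k ≈ l [ + v ] → System.s S k ≡ System.s S l)
  (e-cong′ : ∀ {k l} → k ≈ l [ + v ] → System.e S k ≈ System.e S l [ + g ])
  (χ-cong′ : ∀ {k l} → k ≈ l [ + v ] → System.χ S k ≈ System.χ S l [ + v ])
  (distinct′ : ∀ {k l} → System.s S k ≡ System.s S l → System.e S k ≈ System.e S l [ + g ] → k ≈ l [ + v ])
  (nonunit′ : ∀ {k} → System.s S k ≡ false → ¬ System.e S k ≈ 0ℤ [ + g ])
  (i i' : ℤ) (zi : System.s S i ≡ true) (zi' : System.s S i' ≡ true) (i≈i' : i ≈ i' [ + v ])
  (kernel : ∀ {a b} → a ≈ b [ + g ] → ∃[ q ] a ≈ b + q * (System.e S i - System.e S i') [ + n ]) where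

  open System S
  open Generic S using (n-nonZero; shift-power)
  module Q = Words (+ g) e s
  module R = Shifts (+ v) χ

  Val→ : ∀ {W p t} → Val W p t → Q.Val W p t
  Val→ (val x y) = Q.val (≈-coarsen n∣ x) y

  Shift→ : ∀ {σ c W W' c'} → Shift σ c W W' c' → R.Shift σ c W W' c'
  Shift→ (done x) = R.done (≈-coarsen d∣ x)
  Shift→ (step l l' x y z r) = R.step l l' (≈-coarsen d∣ x) (≈-coarsen d∣ y) (≈-coarsen d∣ z) (Shift→ r)

  letter-val : ∀ {k l W p t} → k ≈ l [ + v ] → ∀ b → s k ≡ b → Q.Val W p t → Q.Val (l ∷ W) (if b then e k - p else e k + p) (b xor t)
  letter-val {k} {l} {W} {p} h false eq x = Q.val-≈ (Q.val-rot (trans (sym (s-cong′ h)) eq) x) (lc (⊖ e-cong′ h)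
      (solve 3 (λ a b c → a :+ b :- (c :+ b) := :- c :- :- a) refl (e l) p (e k)))
  letter-val {k} {l} {W} {p} h true eq x = Q.val-≈ (Q.val-ref (trans (sym (s-cong′ h)) eq) x) (lc (⊖ e-cong′ h)
      (solve 3 (λ a b c → a :- b :- (c :- b) := :- c :- :- a) refl (e l) p (e k)))

  -- Two images of a word from congruent offsets agree letter by letter modulo v, so they have the
  -- same product modulo g and the same final offset.
  functional : ∀ {σ c c̃ W A B a b} → c ≈ c̃ [ + v ] → R.Shift σ c W A a → R.Shift σ c̃ W B b → Q.Val B (exponent A) (kind A) × a ≈ b [ + v ]
  functional h (R.done x) (R.done y) = Q.val[] , ≈-trans (≈-sym x) (≈-trans h y)
  functional {σ} {c} {c̃} h (R.step {k = k} {k' = k'} l l' x y z r) (R.step {k' = j'} m m' x̃ ỹ z̃ r̃) =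
    let kj = lc (z ⊕ h ⊕ ⊖ z̃) (solve 6 (λ a b c d e f → a :- b := a :+ c :+ :- b :- (d :* e :+ c :+ f :+ :- (d :* e :+ f))) refl k' j' c σ k c̃)
        w , ends = functional (lc (σ ⊙ x ⊕ (- σ) ⊙ x̃ ⊕ ⊖ y ⊕ χ-cong′ kj ⊕ ỹ)
            (solve 8 (λ a b c d e f g h → a :- b :* c :- (d :- b :* e) := b :* f :+ :- b :* f :+ :- g :+ g :+ h :- (b :* c :+ :- b :* e :+ :- a :+ h :+ d)) refl l' σ l m' m
            (χ k) (χ k') (χ j'))) r r̃
    in letter-val kj (s k') refl w , ends

  -- Modulo v the pair i, i' is one reflection written twice. Its image is x_k x_(χ k) up to indices
  -- modulo v, hence trivial, and the offset returns to c.
  zero-word : ∀ {σ} c → R.Shift σ c (i ∷ i' ∷ []) (σ * i + c ∷ χ (σ * i + c) + σ * (i' - i) ∷ []) c × Q.Val (σ * i + c ∷ χ (σ * i + c) + σ *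
      (i' - i) ∷ []) 0ℤ false
  zero-word {σ} c = R.step i (χ k) (≈-coarsen d∣ (χ-ref zi)) ≈-refl ≈-refl
      (R.step i' k (≈-coarsen d∣ (χ-ref zi')) χk' (≡⇒≈ (solve 4 (λ a b c d → a :+ b :* (c :- d) := b :* c :+ (a :- b :* d)) refl (χ k) σ i' i))
          (R.done (lc (σ ⊙ i≈i' ⊕ ≡⇒≈ {k} refl) (solve 5 (λ a b c d e → a :- b :* c :- d := b :* e :+ a :- (b :* c :+ (b :* e :+ d))) refl k σ i' c i)))) ,
          value
    where
    k k' : ℤ
    k = σ * i + c
    k' = χ k + σ * (i' - i)
    χk≈k' : χ k ≈ k' [ + v ]
    χk≈k' = lc (σ ⊙ i≈i') (solve 4 (λ a b c d → a :- (a :+ b :* (c :- d)) := b :* d :- b :* c) refl (χ k) σ i' i)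
    χk' : χ k' ≈ k [ + v ]
    χk' = ≈-trans (χ-cong′ (≈-sym χk≈k')) (≈-coarsen d∣ (χχ k))
    value : Q.Val (k ∷ k' ∷ []) 0ℤ false
    value = go (s k) refl
      where
      go : ∀ b → s k ≡ b → Q.Val (k ∷ k' ∷ []) 0ℤ false
      go false y = Q.val-≈ (Q.val-rot y (Q.val-rot (trans (sym (s-cong′ χk≈k')) (trans (s-χ k) y)) Q.val[]))
          (lc (⊖ e-cong′ χk≈k' ⊕ ≈-coarsen n∣ (e-χ y)) (solve 3 (λ a b c → a :+ (b :+ con 0ℤ) :- con 0ℤ := :- c :+ c :- (:- b :+ :- a)) refl (e k)
          (e k') (e (χ k))))
      go true z = Q.val-≈ (Q.val-ref z (Q.val-ref (trans (sym (s-cong′ χk≈k')) (trans (s-χ k) z)) Q.val[]))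
          (lc (e-cong′ (≈-trans (≈-sym (≈-coarsen d∣ (χ-ref z))) χk≈k')) (solve 2 (λ a b → a :- (b :- con 0ℤ) :- con 0ℤ := a :- b) refl (e k) (e k')))

  R-shift-power : ∀ {σ c W W'} N → R.Shift σ c W W' c → R.Shift σ c (power N W) (power N W') c
  R-shift-power zero r = R.done ≈-refl
  R-shift-power (suc N) r = R.shift-++ r (R-shift-power N r)

  -- Words equal modulo g become equal modulo n once a power of z_i z_i' is put in front of one of
  -- them, and this power has trivial image in the quotient. So `law` of `S` applies to images
  -- computed in `S`, which `functional` compares with the given ones.
  law′ : ∀ {σ} → Sign σ → ∀ {c W₁ W₁' c₁ W₂ W₂' c₂ p t q₁ u₁ q₂ u₂} →
      Q.Val W₁ p t → Q.Val W₂ p t → R.Shift σ c W₁ W₁' c₁ → R.Shift σ c W₂ W₂' c₂ →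
      Q.Val W₁' q₁ u₁ → Q.Val W₂' q₂ u₂ → q₁ ≈ q₂ [ + g ] × u₁ ≡ u₂ × c₁ ≈ c₂ [ + v ]
  law′ {σ} sgn {c} {W₁} {W₁'} {c₁} {W₂} {W₂'} {c₂} {p} {t} {q₁} {u₁} {q₂} {u₂} (Q.val x₁ y₁) (Q.val x₂ y₂) sh₁ sh₂ (Q.val x₁' y₁') (Q.val x₂' y₂') =
    let q , h = kernel {exponent W₁} {exponent W₂} (lc (x₁ ⊕ ⊖ x₂) (solve 3 (λ a b c → a :- b := a :+ :- b :- (c :+ :- c)) refl (exponent W₁) (exponent W₂) p))
        N = q %ℕ n
        β = e i - e i'
        V = power N (i ∷ i' ∷ []) ++ W₂
        βval = val-≈ (val-ref zi (val-ref zi' val[])) (≡⇒≈ (solve 2 (λ a b → a :- (b :- con 0ℤ) := a :- b) refl (e i) (e i')))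
        zshift , zval = zero-word {σ} c
        Z = σ * i + c ∷ χ (σ * i + c) + σ * (i' - i) ∷ []
        I₁ , a₁ = image σ c W₁
        I₂ , a₂ = image σ c V
        le , lk , la = law sgn (val {W₁} h y₁) (val-≈ (val-++ (val-power N βval) (val {W₂} ≈-refl y₂)) (lc ((- β) ⊙ residue q n)
            (solve 4 (λ a b c d → a :* b :+ c :- (c :+ d :* b) := :- b :* d :- :- b :* a) refl (+ N) β (exponent W₂) q)))
               (shift-image σ c W₁) (shift-image σ c V) (val-exists I₁) (val-exists I₂)
        Q.val f₁ k₁ , b₁ = functional ≈-refl (Shift→ (shift-image σ c W₁)) sh₁
        Q.val f₂ k₂ , b₂ = functional ≈-refl (Shift→ (shift-image σ c V)) (R.shift-++ (R-shift-power N zshift) sh₂)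
        Q.val z₂ w₂ = Q.val-++ (Q.val-power N zval) (Q.val x₂' y₂')
    in (lc (⊖ x₁' ⊕ f₁ ⊕ ≈-coarsen n∣ le ⊕ ⊖ f₂ ⊕ z₂) (solve 7 (λ a b c d e f g → a :- b := :- c :+ c :+ d :+ :- e :+ e :- (:- a :+ d :+ f :+ :- f :+ (g :* con 0ℤ :+ b))) refl q₁ q₂ (exponent W₁') (exponent I₁) (exponent (power N Z ++ W₂')) (exponent I₂) (+ N))) ,
       trans (sym y₁') (trans k₁ (trans lk (trans (sym k₂) w₂))) ,
       ≈-trans (≈-sym b₁) (≈-trans (≈-coarsen d∣ la) b₂)

  quotient-system : System g v
  quotient-system = record
    { e = e ; χ = χ ; s = s ; n≢0 = g≢0 ; d≢0 = v≢0 ; s-cong = s-cong′ ; e-cong = e-cong′ ; χ-cong = χ-cong′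
    ; χχ = λ k → ≈-coarsen d∣ (χχ k) ; s-χ = s-χ ; χ-ref = λ h → ≈-coarsen d∣ (χ-ref h) ; e-χ = λ h → ≈-coarsen n∣ (e-χ h)
    ; distinct = distinct′ ; nonunit = nonunit′ ; generates = λ p t → let W , x = generates p t in W , Val→ x ; law = law′ }

p₃-exponent : ℕ → ℕ → ℤ
p₃-exponent m i = if isEven i then + (i ℕ.+ ℕ.⌊ i /2⌋ ℕ.* m) else + i

isEven⇒ : ∀ i → isEven i ≡ true → i ≡ 2 ℕ.* ℕ.⌊ i /2⌋
isEven⇒ zero _ = refl
isEven⇒ (suc (suc i)) h = trans (cong (λ k → suc (suc k)) (isEven⇒ i h)) (sym (ℕ.*-suc 2 ℕ.⌊ i /2⌋))

¬isEven⇒ : ∀ i → isEven i ≡ false → i ≡ 1 ℕ.+ 2 ℕ.* ℕ.⌊ i /2⌋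
¬isEven⇒ (suc zero) _ = refl
¬isEven⇒ (suc (suc i)) h = trans (cong (λ k → suc (suc k)) (¬isEven⇒ i h)) (cong suc (sym (ℕ.*-suc 2 ℕ.⌊ i /2⌋)))

isEven⇒ℤ : ∀ i → isEven i ≡ true → + i ≡ + 2 * + ℕ.⌊ i /2⌋
isEven⇒ℤ i h = trans (cong +_ (isEven⇒ i h)) (pos-* 2 ℕ.⌊ i /2⌋)

¬isEven⇒ℤ : ∀ i → isEven i ≡ false → + i ≡ 1ℤ + + 2 * + ℕ.⌊ i /2⌋
¬isEven⇒ℤ i h = trans (cong +_ (¬isEven⇒ i h)) (trans (pos-+ 1 (2 ℕ.* ℕ.⌊ i /2⌋)) (cong (_+_ 1ℤ) (pos-* 2 ℕ.⌊ i /2⌋)))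

module AlternatingPattern {n d : ℕ} (S : System n d) (z₀ : System.s S 0ℤ ≡ true) (y₁ : System.s S 1ℤ ≡ false)
  (T2 : Periodicity.TypePeriod S (+ 2)) where
  open System S
  open Generic S
  open Periodicity S

  same-kind : ∀ {k l} → k ≈ l [ + 2 ] → s k ≡ s l
  same-kind {k} {l} h = trans (s-cong (≡⇒≈ (quotient-eq h))) (type-period-* (_≈_[_].quotient h) T2 l)

  Even Odd : ℤ → Set
  Even k = k ≈ 0ℤ [ + 2 ]
  Odd k = k ≈ 1ℤ [ + 2 ]

  even⇒ref : ∀ {k} → Even k → s k ≡ true
  even⇒ref h = trans (same-kind h) z₀

  odd⇒rot : ∀ {k} → Odd k → s k ≡ false
  odd⇒rot h = trans (same-kind h) y₁

  even-or-odd : ∀ k → Even k ⊎ Odd k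
  even-or-odd k = go (parity k)
    where
    go : ∃[ q ] (k ≡ + 2 * q ⊎ k ≡ + 2 * q + 1ℤ) → Even k ⊎ Odd k
    go (q , inj₁ x) = inj₁ (lc (≡⇒≈ x ⊕ q ⊙ modulus≈0)
        (solve 2 (λ a b → a :- con 0ℤ := a :+ b :* con (+ 2) :- (con (+ 2) :* b :+ b :* con 0ℤ)) refl k q))
    go (q , inj₂ x) = inj₂ (lc (≡⇒≈ x ⊕ q ⊙ modulus≈0)
        (solve 2 (λ a b → a :- con 1ℤ := a :+ b :* con (+ 2) :- (con (+ 2) :* b :+ con 1ℤ :+ b :* con 0ℤ)) refl k q))

  rot⇒odd : ∀ {k} → s k ≡ false → Odd k
  rot⇒odd {k} y = go (even-or-odd k)
    where
    go : Even k ⊎ Odd k → Odd k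
    go (inj₁ h) = bool-absurd y (even⇒ref h)
    go (inj₂ h) = h

  ref⇒even : ∀ {k} → s k ≡ true → Even k
  ref⇒even {k} z = go (even-or-odd k)
    where
    go : Even k ⊎ Odd k → Even k
    go (inj₁ h) = h
    go (inj₂ h) = bool-absurd (odd⇒rot h) z

  d-even : + d ≈ 0ℤ [ + 2 ]
  d-even = ref⇒even (trans (s-cong modulus≈0) z₀)

  χ-odd : ∀ {l} → Odd l → Odd (χ l)
  χ-odd {l} o = rot⇒odd (trans (s-χ l) (odd⇒rot o))

  w : ℤ → ℤ
  w l = χ l - l

  w-even : ∀ {l} → Odd l → Even (w l)
  w-even {l} o = lc (χ-odd o ⊕ ⊖ o) (solve 2 (λ a b → a :- b :- con 0ℤ := a :+ :- b :- (con 1ℤ :+ :- con 1ℤ)) refl (χ l) l)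

  -- Shifting z_i y_j = y_(χ j) z_i by l - j, where i = m - (l - j).
  module Conjugation {m l j} (em : Even m) (ol : Odd l) (oj : Odd j) where
    i p q : ℤ
    i = m - (l - j)
    p = l + w j
    q = i + (χ p - j)
    op : Odd p
    op = lc (ol ⊕ w-even oj) (solve 2 (λ a b → a :+ b :- con 1ℤ := a :+ b :- (con 1ℤ :+ con 0ℤ)) refl l (w j))
    zi : s i ≡ true
    zi = even⇒ref (lc (em ⊕ ⊖ ol ⊕ oj) (solve 3 (λ a b c → a :- (b :- c) :- con 0ℤ := a :+ :- b :+ c :- (con 0ℤ :+ :- con 1ℤ :+ con 1ℤ)) refl m l j))
    zm : s m ≡ true
    zm = even⇒ref em
    zq : s q ≡ true
    zq = even⇒ref (lc (em ⊕ ⊖ ol ⊕ χ-odd op) (solve 4 (λ a b c d → a :- (b :- c) :+ (d :- c) :- con 0ℤ := a :+ :- b :+ d :- (con 0ℤ :+ :- con 1ℤ :+ con 1ℤ)) refl m l j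
        (χ p)))
    yj : s j ≡ false
    yj = odd⇒rot oj
    shifted : e m - (e l + 0ℤ) ≈ e p + (e q - 0ℤ) [ + n ] × χ l - 1ℤ * χ j ≈ q - 1ℤ * i [ + d ]
    shifted = let x , _ , c = law pos {l - j} (val-ref zi (val-rot yj val[])) (val-≈ (val-rot (trans (s-χ j) yj) (val-ref zi val[])) (lc (e-χ yj) (solve 3 (λ a b c → a :+ (b :- con 0ℤ) :- (b :- (c :+ con 0ℤ)) := a :- :- c) refl (e (χ j)) (e i) (e j))))
                    (step i m (χ-ref zi) (χ-ref zm) (≡⇒≈ (solve 3 (λ a b c → a := con 1ℤ :* (a :- (b :- c)) :+ (b :- c)) refl m l j))
                        (step (χ j) (χ l) ≈-refl ≈-refl (≡⇒≈ (solve 3 (λ a b c → a := con 1ℤ :* b :+ (c :- con 1ℤ :* (c :- (a :- b)))) refl l j m))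
                        (done ≈-refl)))
                    (step j (χ p) (χχ j) ≈-refl (≡⇒≈ (solve 3 (λ a b c → a :+ (b :- c) := con 1ℤ :* b :+ (a :- c)) refl l (χ j) j))
                        (step i q (χ-ref zi) (χ-ref zq) (≡⇒≈ (solve 3 (λ a b c → a :+ (b :- c) := con 1ℤ :* a :+ (b :- con 1ℤ :* c)) refl i (χ p) j))
                        (done ≈-refl)))
                    (val-ref zm (val-rot (odd⇒rot ol) val[])) (val-rot (odd⇒rot op) (val-ref zq val[]))
              in x , c
    χp : χ p ≈ χ l - w j [ + d ]
    χp = lc (⊖ proj₂ shifted) (solve 5 (λ a b c d e → a :- (b :- (c :- d)) := :- (b :- con 1ℤ :* c) :- :- (e :+ (a :- d) :- con 1ℤ :* e)) refl (χ p)
        (χ l) (χ j) j i)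
    translate : e (m + w l - w j) ≈ e m - (e l + e p) [ + n ]
    translate = lc (⊖ proj₁ shifted ⊕ ⊖ e-cong (lc (χp ⊕ ≡⇒≈ {q} refl ⊕ ⊖ ≡⇒≈ {w l} refl ⊕ ≡⇒≈ {w j} refl)
        (solve 9 (λ a b c d e f g h i → a :- (b :+ c :- d) := e :+ a :+ :- c :+ d :- (f :- (g :- h) :+ (b :- (i :- h) :+ (e :- h)) :+ :- (f :- i) :+
        (g :- h))) refl q m (w l) (w j) (χ p) (χ l) (χ j) j l)))
        (solve 5 (λ a b c d e → a :- (b :- (c :+ d)) := :- (b :- (c :+ con 0ℤ)) :+ :- e :- (:- (d :+ (e :- con 0ℤ)) :+ :- a)) refl (e
        (m + w l - w j)) (e m) (e l) (e p) (e q))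

  -- The final offsets in the conjugation relation. The minus sign is what keeps levels from being
  -- periods here.
  χ-reflect : ∀ {l j} → Odd l → Odd j → χ (l + w j) ≈ χ l - w j [ + d ]
  χ-reflect ol oj = Conjugation.χp {0ℤ} ≈-refl ol oj

  ε₂ : ℤ → ℤ → ℤ
  ε₂ j l = e l + e (l + w j)

  even-translate : ∀ {m l j} → Even m → Odd l → Odd j → e (m + (w j - w l)) ≈ e m + ε₂ j l [ + n ]
  even-translate {m} {l} {j} em ol oj = lc (⊖ Conjugation.translate {m'} {l} {j} (lc (em ⊕ w-even oj ⊕ ⊖ w-even ol)
      (solve 3 (λ a b c → a :+ (b :- c) :- con 0ℤ := a :+ b :+ :- c :- (con 0ℤ :+ con 0ℤ :+ :- con 0ℤ)) refl m (w j) (w l))) ol oj ⊕ e-cong (≡⇒≈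
      (solve 3 (λ a b c → a :+ (b :- c) :+ c :- b := a) refl m (w j) (w l))))
      (solve 5 (λ a b c d e → a :- (b :+ (c :+ d)) := :- e :+ e :- (:- (a :- (c :+ d)) :+ b)) refl (e m') (e m) (e l) (e (l + w j))
      (e (m' + w l - w j)))
    where
    m' : ℤ
    m' = m + (w j - w l)

  -- In contrast to `Period`, inverses move backwards; the exponents of all generators change by one
  -- constant.
  record Translation (v : ℤ) : Set where
    field
      even : Even v
      e-translate : ∀ k → e (k + v) - e k ≈ e v - e 0ℤ [ + n ]
      χ-translate : ∀ k → s k ≡ false → χ (k + v) ≈ χ k - v [ + d ]
  open Translation

  -- Since w (χ l) = - w l, applying `χ-reflect` with χ l and then with j accounts for the inverses.
  -- For reflections the change of exponent is `even-translate`; rotations need a detour through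
  -- reflections.
  w-translation : ∀ {j l} → Odd j → Odd l → Translation (w j - w l)
  w-translation {j} {l} oj ol = record { even = ev ; e-translate = λ k → go k (even-or-odd k) ; χ-translate = λ k y → χ-part k (rot⇒odd y) }
    where
    v : ℤ
    v = w j - w l
    ev : Even v
    ev = lc (w-even oj ⊕ ⊖ w-even ol) (solve 2 (λ a b → a :- b :- con 0ℤ := a :+ :- b :- (con 0ℤ :+ :- con 0ℤ)) refl (w j) (w l))
    wχ : w (χ l) ≈ - w l [ + d ]
    wχ = lc (χχ l) (solve 3 (λ a b c → a :- b :- :- (b :- c) := a :- c) refl (χ (χ l)) (χ l) l)
    at-0 : e v - e 0ℤ ≈ ε₂ j l [ + n ]
    at-0 = lc (even-translate {0ℤ} ≈-refl ol oj ⊕ ⊖ e-cong (≡⇒≈ (solve 1 (λ a → con 0ℤ :+ a := a) refl v)))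
        (solve 4 (λ a b c d → a :- b :- c := d :+ :- d :- (b :+ c :+ :- a)) refl (e v) (e 0ℤ) (ε₂ j l) (e (0ℤ + v)))
    module At {k} (ok : Odd k) where
      k' : ℤ
      k' = k + w (χ l)
      ok' : Odd k'
      ok' = lc (ok ⊕ w-even (χ-odd ol)) (solve 2 (λ a b → a :+ b :- con 1ℤ := a :+ b :- (con 1ℤ :+ con 0ℤ)) refl k (w (χ l)))
      χk' : χ k' ≈ χ k - w (χ l) [ + d ]
      χk' = χ-reflect ok (χ-odd ol)
      k'+wj : k' + w j ≈ k + v [ + d ]
      k'+wj = lc wχ (solve 4 (λ a b c d → a :+ b :+ c :- (a :+ (c :- d)) := b :- :- d) refl k (w (χ l)) (w j) (w l))
    χ-part : ∀ k → Odd k → χ (k + v) ≈ χ k - v [ + d ]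
    χ-part k ok = lc (⊖ χ-cong k'+wj ⊕ χ-reflect ok' oj ⊕ χk' ⊕ ⊖ wχ ⊕ ≡⇒≈ {v} refl)
        (solve 8 (λ a b c d e f g h → a :- (b :- c) := :- d :+ d :+ e :+ :- f :+ c :- (:- a :+ (e :- g) :+ (b :- f) :+ :- (:- h) :+ (g :- h))) refl
        (χ (k + v)) (χ k) v (χ (k' + w j)) (χ k') (w (χ l)) (w j) (w l))
      where open At ok
    go : ∀ k → Even k ⊎ Odd k → e (k + v) - e k ≈ e v - e 0ℤ [ + n ]
    go k (inj₁ ek) = lc (even-translate ek ol oj ⊕ ⊖ at-0) (solve 5 (λ a b c d e → a :- b :- (c :- d) := a :+ :- (c :- d) :- (b :+ e :+ :- e)) refl (e
        (k + v)) (e k) (e v) (e 0ℤ) (ε₂ j l))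
    go k (inj₂ ok) = lc (⊖ e-cong k'+wj ⊕ ⊖ split ⊕ ⊖ at-0 ⊕ ≡⇒≈ {ε₂ (χ l) k} refl ⊕ ⊖ ≡⇒≈ {ε₂ j k'} refl)
        (solve 9 (λ a b c d e f g h i → a :- b :- (c :- d) := :- e :+ :- (f :+ g) :+ :- (c :- d) :+ g :+ :- h :- (:- a :+ :- h :+ :- f :+
        (b :+ i) :+ :- (i :+ e))) refl (e (k + v)) (e k) (e v) (e 0ℤ) (e (k' + w j)) (ε₂ j l) (ε₂ (χ l) k) (ε₂ j k') (e k'))
      where
      open At ok
      v₁ : ℤ
      v₁ = w (χ l) - w k
      ev₁ : Even v₁
      ev₁ = lc (w-even (χ-odd ol) ⊕ ⊖ w-even ok) (solve 2 (λ a b → a :- b :- con 0ℤ := a :+ :- b :- (con 0ℤ :+ :- con 0ℤ)) refl (w (χ l)) (w k))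
      total : v₁ + (w j - w l) ≈ 0ℤ + (w j - w k') [ + d ]
      total = lc (⊖ wχ ⊕ χk' ⊕ ≡⇒≈ {w k'} refl ⊕ ⊖ ≡⇒≈ {w k} refl)
          (solve 8 (λ a b c d e f g h → a :- b :+ (c :- d) :- (con 0ℤ :+ (c :- e)) := :- a :+ f :+ e :+ :- b :- (:- (:- d) :+ (g :- a) :+
          (f :- (h :+ a)) :+ :- (g :- h))) refl (w (χ l)) (w k) (w j) (w l) (w k') (χ k') (χ k) k)
      -- Moving the reflection z₀ by w (χ l) - w k and then by w j - w l is moving it by w j - w k'.
      -- Written out with the definition of ε₂, this compares e (k + v) with e k for the rotation
      -- y_k.
      split : ε₂ j l + ε₂ (χ l) k ≈ ε₂ j k' [ + n ]
      split = lc (⊖ even-translate {v₁} ev₁ ol oj ⊕ ⊖ even-translate {0ℤ} ≈-refl ok (χ-odd ol) ⊕ e-cong (≡⇒≈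
          (solve 1 (λ a → con 0ℤ :+ a := a) refl v₁)) ⊕ even-translate {0ℤ} ≈-refl ok' oj ⊕ e-cong total)
          (solve 8 (λ a b c d e f g h → a :+ b :- c := :- d :+ :- e :+ e :+ f :+ d :- (:- (g :+ a) :+ :- (h :+ b) :+ g :+ (h :+ c) :+ f)) refl
          (ε₂ j l) (ε₂ (χ l) k) (ε₂ j k') (e (v₁ + (w j - w l))) (e (0ℤ + v₁)) (e (0ℤ + (w j - w k'))) (e v₁) (e 0ℤ))

  translation-cong-index : ∀ v {k l} → k ≈ l [ + d ] → (e (k + v) - e k ≈ e v - e 0ℤ [ + n ] × (s k ≡ false → χ (k + v) ≈ χ k - v [ + d ])) →
    (e (l + v) - e l ≈ e v - e 0ℤ [ + n ] × (s l ≡ false → χ (l + v) ≈ χ l - v [ + d ]))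
  translation-cong-index v {k} {l} h (x , f) =
    (lc (x ⊕ e-cong h ⊕ ⊖ e-cong k+v) (solve 6 (λ a b c d e f → a :- b :- (c :- d) := e :- f :+ f :+ :- e :- (c :- d :+ b :+ :- a)) refl (e (l + v))
        (e l) (e v) (e 0ℤ) (e (k + v)) (e k))) ,
    λ y → (lc (f (trans (s-cong h) y) ⊕ χ-cong h ⊕ ⊖ χ-cong k+v)
        (solve 5 (λ a b c d e → a :- (b :- c) := d :+ e :+ :- d :- (e :- c :+ b :+ :- a)) refl (χ (l + v)) (χ l) v (χ (k + v)) (χ k)))
    where
    k+v : k + v ≈ l + v [ + d ]
    k+v = lc h (solve 3 (λ a b c → a :+ b :- (c :+ b) := a :- c) refl k v l)

  translation? : ∀ v → Dec (Translation v)
  translation? v = map′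
    (λ { (ev , f) → let g = ∀-residues d _ (translation-cong-index v) f in record { even = ev ; e-translate = λ k → proj₁ (g k) ; χ-translate = λ k →
        proj₂ (g k) } })
    (λ T → even T , λ i → e-translate T _ , χ-translate T _)
    ((v ≈? 0ℤ [ + 2 ]) ×-dec all? (λ i → (_ ≈? _ [ + n ]) ×-dec ((s (+ toℕ i) ≟ᵇ false) →-dec (_ ≈? _ [ + d ]))))

  translation-- : ∀ {u v} → Translation u → Translation v → Translation (u - v)
  translation-- {u} {v} T U = record { even = ev ; e-translate = λ k → (lc (step-e k ⊕ ⊖ step-e 0ℤ ⊕ e-cong (≡⇒≈
      (solve 2 (λ a b → con 0ℤ :+ (a :- b) := a :- b) refl u v)))
      (solve 7 (λ a b c d e f g → a :- b :- (c :- d) := a :- b :+ :- (e :- d) :+ e :- (f :- d :- (g :- d) :+ :- (f :- d :- (g :- d)) :+ c)) refl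
      (e (k + (u - v))) (e k) (e (u - v)) (e 0ℤ) (e (0ℤ + (u - v))) (e u) (e v)))
      ; χ-translate = λ k y → (lc (⊖ χ-translate U (k + (u - v)) (trans (same-kind (lc ev
          (solve 3 (λ a b c → a :+ (b :- c) :- a := b :- c :- con 0ℤ) refl k u v))) y) ⊕ χ-cong (≡⇒≈
          (solve 3 (λ a b c → a :+ (b :- c) :+ c := a :+ b) refl k u v)) ⊕ χ-translate T k y)
          (solve 6 (λ a b c d e f → a :- (b :- (c :- d)) := :- e :+ e :+ f :- (:- (a :- d) :+ f :+ (b :- c))) refl (χ (k + (u - v))) (χ k) u v
          (χ (k + (u - v) + v)) (χ (k + u)))) }
    where
    ev : Even (u - v)
    ev = lc (even T ⊕ ⊖ even U) (solve 2 (λ a b → a :- b :- con 0ℤ := a :+ :- b :- (con 0ℤ :+ :- con 0ℤ)) refl u v)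
    step-e : ∀ k → e (k + (u - v)) - e k ≈ (e u - e 0ℤ) - (e v - e 0ℤ) [ + n ]
    step-e k = lc (⊖ e-translate U (k + (u - v)) ⊕ e-translate T k ⊕ e-cong (≡⇒≈ (solve 3 (λ a b c → a :+ (b :- c) :+ c := a :+ b) refl k u v)))
        (solve 7 (λ a b c d e f g → a :- b :- (c :- d :- (e :- d)) := :- (f :- a) :+ (g :- b) :+ f :- (:- (e :- d) :+ (c :- d) :+ g)) refl (e
        (k + (u - v))) (e k) (e u) (e 0ℤ) (e v) (e (k + (u - v) + v)) (e (k + u)))

  translation-d : Translation (+ d)
  translation-d = record { even = d-even
    ; e-translate = λ k → (lc (e-cong (lc modulus≈0 (solve 2 (λ a b → a :+ b :- a := b :- con 0ℤ) refl k (+ d))) ⊕ ⊖ e-cong modulus≈0)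
        (solve 4 (λ a b c d → a :- b :- (c :- d) := a :+ :- c :- (b :+ :- d)) refl (e (k + + d)) (e k) (e (+ d)) (e 0ℤ)))
    ; χ-translate = λ k _ → (lc (χ-cong (lc modulus≈0 (solve 2 (λ a b → a :+ b :- a := b :- con 0ℤ) refl k (+ d))) ⊕ modulus≈0)
        (solve 3 (λ a b c → a :- (b :- c) := a :+ c :- (b :+ con 0ℤ)) refl (χ (k + + d)) (χ k) (+ d))) }

  translation-generator : ∃[ v ] (NonZero v × Translation (+ v) × (∀ u → Translation u → u ≈ 0ℤ [ + v ]))
  translation-generator = subgroup-generator Translation translation? translation-- d translation-d

  module Multiples {v : ℤ} (T : Translation v) where
    ε : ℤ
    ε = e v - e 0ℤ

    e-multiple : ∀ q k → e (k + q * v) ≈ e k + q * ε [ + n ]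
    e-multiple (+ i) k = nat i k
      where
      nat : ∀ i k → e (k + + i * v) ≈ e k + + i * ε [ + n ]
      nat zero k = ≈-trans (e-cong (≡⇒≈ (solve 2 (λ a b → a :+ con (+ 0) :* b := a) refl k v))) (≡⇒≈
          (solve 2 (λ a b → a := a :+ con (+ 0) :* b) refl (e k) ε))
      nat (suc i) k = ≈-trans (e-cong (≡⇒≈ (solve 3 (λ a b c → a :+ (con 1ℤ :+ b) :* c := a :+ b :* c :+ c) refl k (+ i) v)))
          (lc (e-translate T (k + + i * v) ⊕ nat i k)
          (solve 5 (λ a b c d e → a :- (b :+ (con 1ℤ :+ c) :* d) := a :- e :+ e :- (d :+ (b :+ c :* d))) refl (e ((k + + i * v) + v)) (e k)
          (+ i) ε (e (k + + i * v))))
    e-multiple -[1+ i ] k = lc (⊖ e-multiple p k' ⊕ e-cong (lc (v ⊙ ≡⇒≈ q≡)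
        (solve 4 (λ a b c d → a :+ b :* c :+ d :* c :- a := c :* b :- c :* :- d) refl k q v p)) ⊕ (- ε) ⊙ ≡⇒≈ q≡)
        (solve 6 (λ a b c d e f → a :- (b :+ c :* d) := :- e :+ e :+ :- d :* c :- (:- (a :+ f :* d) :+ b :+ :- d :* :- f)) refl (e k') (e k) q ε
        (e (k' + p * v)) p)
      where
      p q k' : ℤ
      p = + suc i
      q = -[1+ i ]
      k' = k + q * v
      q≡ : q ≡ - p
      q≡ = refl

    even-multiple : ∀ q → Even (q * v)
    even-multiple q = lc (q ⊙ even T) (solve 2 (λ a b → a :* b :- con 0ℤ := a :* b :- a :* con 0ℤ) refl q v)

    χ-multiple : ∀ q k → s k ≡ false → χ (k + q * v) ≈ χ k - q * v [ + d ]
    χ-multiple q k y = ≈-trans (χ-cong (lc (v ⊙ residue q d) (solve 4 (λ a b c d → a :+ b :* c :- (a :+ d :* c) := c :* b :- c :* d) refl k q v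
        (+ (q %ℕ d))))) (lc (nat (q %ℕ d) ⊕ v ⊙ residue q d)
        (solve 5 (λ a b c d e → a :- (b :- c :* d) := a :+ d :* c :- (b :- e :* d :+ d :* e)) refl (χ (k + + (q %ℕ d) * v)) (χ k) q v
        (+ (q %ℕ d))))
      where
      nat : ∀ i → χ (k + + i * v) ≈ χ k - + i * v [ + d ]
      nat zero = ≈-trans (χ-cong (≡⇒≈ (solve 2 (λ a b → a :+ con (+ 0) :* b := a) refl k v))) (≡⇒≈
          (solve 2 (λ a b → a := a :- con (+ 0) :* b) refl (χ k) v))
      nat (suc i) = ≈-trans (χ-cong (≡⇒≈ (solve 3 (λ a b c → a :+ (con 1ℤ :+ b) :* c := a :+ b :* c :+ c) refl k (+ i) v)))
          (lc (χ-translate T (k + + i * v) (trans (same-kind (lc (even-multiple (+ i))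
          (solve 3 (λ a b c → a :+ b :* c :- a := b :* c :- con 0ℤ) refl k (+ i) v))) y) ⊕ nat i)
          (solve 5 (λ a b c d e → a :- (b :- (con 1ℤ :+ c) :* d) := a :+ e :- (e :- d :+ (b :- c :* d))) refl (χ ((k + + i * v) + v)) (χ k)
          (+ i) v (χ (k + + i * v))))

  odd-difference : ∀ {j l} → Odd j → Odd l → ∀ {v} → (∀ u → Translation u → u ≈ 0ℤ [ + v ]) → w j ≈ w l [ + v ]
  odd-difference {j} {l} oj ol least = lc (least _ (w-translation oj ol)) (solve 2 (λ a b → a :- b := a :- b :- con 0ℤ) refl (w j) (w l))

  module Minimal (v : ℕ) (v≢0 : NonZero v) (T : Translation (+ v)) (least : ∀ u → Translation u → u ≈ 0ℤ [ + v ])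
    (g : ℕ) (α : ℤ) (hα : + g ≈ α * (e (+ v) - e 0ℤ) [ + n ]) (g∣ε : e (+ v) - e 0ℤ ≈ 0ℤ [ + g ]) (g∣n : + n ≈ 0ℤ [ + g ]) where
    open Multiples T public

    d∣ : + d ≈ 0ℤ [ + v ]
    d∣ = least _ translation-d

    g≢0 : NonZero g
    g≢0 = ℕ.≢-nonZero (λ { refl → ℕ.≢-nonZero⁻¹ n {{n≢0}} (cong ∣_∣ (trans (proj₂ (≈0⇒multiple g∣n))
        (solve 1 (λ a → a :* con 0ℤ := con 0ℤ) refl q))) })
      where
      q : ℤ
      q = proj₁ (≈0⇒multiple g∣n)

    -- As g is a multiple of ε modulo n, so is every multiple of g: a change of exponent by a
    -- multiple of g is achieved by a translation by a multiple of v.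
    kernel : ∀ {a b} → a ≈ b [ + g ] → ∃[ q ] a ≈ b + q * ε [ + n ]
    kernel {a} {b} (mod≈ c eq) = c * α , (lc (≡⇒≈ eq ⊕ c ⊙ hα)
        (solve 6 (λ a b c d e f → a :- (b :+ c :* d :* e) := a :- b :+ c :* f :- (c :* f :+ c :* (d :* e))) refl a b c α ε (+ g)))

    kinds : ∀ {k l} → k ≈ l [ + v ] → s k ≡ s l
    kinds h = same-kind (≈-coarsen (even T) h)

    e-quotient : ∀ {k l} → k ≈ l [ + v ] → e k ≈ e l [ + g ]
    e-quotient {k} {l} h@(mod≈ q _) = ≈-trans (≈-coarsen g∣n (≈-trans (e-cong (≡⇒≈ (quotient-eq h))) (e-multiple q l))) (lc (q ⊙ g∣ε)
        (solve 3 (λ a b c → a :+ b :* c :- a := b :* c :- b :* con 0ℤ) refl (e l) q ε))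

    χ-quotient : ∀ {k l} → k ≈ l [ + v ] → χ k ≈ χ l [ + v ]
    χ-quotient {k} {l} h@(mod≈ q eq) = go (rotation-or-reflection l)
      where
      go : s l ≡ false ⊎ s l ≡ true → χ k ≈ χ l [ + v ]
      go (inj₁ y) = ≈-trans (≈-coarsen d∣ (≈-trans (χ-cong (≡⇒≈ (quotient-eq h))) (χ-multiple q l y))) (lc ((- q) ⊙ modulus≈0)
          (solve 3 (λ a b c → a :- b :* c :- a := :- b :* c :- :- b :* con 0ℤ) refl (χ l) q (+ v)))
      go (inj₂ z) = lc (≈-coarsen d∣ (χ-ref (trans (kinds h) z)) ⊕ ⊖ ≈-coarsen d∣ (χ-ref z) ⊕ h)
          (solve 4 (λ a b c d → a :- b := a :+ :- b :+ c :- (c :+ :- d :+ d)) refl (χ k) (χ l) k l)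

    reach : ∀ k q → e (k + q * + v) ≈ e k + q * ε [ + n ] × s (k + q * + v) ≡ s k
    reach k q = e-multiple q k , same-kind (lc (even-multiple q) (solve 3 (λ a b c → a :+ b :* c :- a := b :* c :- con 0ℤ) refl k q (+ v)))

    -- Exponents equal modulo g differ by some q ε modulo n, which is the change of exponent from l
    -- to l + q v.
    distinct-quotient : ∀ {k l} → s k ≡ s l → e k ≈ e l [ + g ] → k ≈ l [ + v ]
    distinct-quotient {k} {l} sk h = let q , x = kernel h in
      ≈-trans (≈-coarsen d∣ (distinct (trans sk (sym (proj₂ (reach l q)))) (≈-trans x (≈-sym (proj₁ (reach l q)))))) (lc (q ⊙ modulus≈0)
          (solve 3 (λ a b c → a :+ b :* c :- a := b :* c :- b :* con 0ℤ) refl l q (+ v)))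

    nonunit-quotient : ∀ {k} → s k ≡ false → ¬ e k ≈ 0ℤ [ + g ]
    nonunit-quotient {k} y h = let q , x = kernel h in
      nonunit (trans (proj₂ (reach k (- q))) y) (≈-trans (proj₁ (reach k (- q))) (lc x
          (solve 3 (λ a b c → a :+ :- b :* c :- con 0ℤ := a :- (con 0ℤ :+ b :* c)) refl (e k) q ε)))

    -- The reflections z_v and z₀ agree modulo v, and their product a^ε generates the kernel.
    Q : System g v
    Q = QuotientSystem.quotient-system S g v g≢0 v≢0 g∣n d∣ kinds e-quotient χ-quotient distinct-quotient nonunit-quotient
      (+ v) 0ℤ (even⇒ref (even T)) z₀ modulus≈0 kernel

    -- Differences of levels are translations, hence vanish modulo v: this is the gain from dividing
    -- by the least translation.
    χ-class : ∀ {j l} → Odd j → Odd l → χ j ≈ χ l + (j - l) [ + v ]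
    χ-class {j} {l} oj ol = lc (odd-difference oj ol least) (solve 4 (λ a b c d → a :- (b :+ (c :- d)) := a :- c :- (b :- d)) refl (χ j) (χ l) j l)

    reversal : ∀ k → s (-1ℤ * k + 0ℤ) ≡ s k × χ (-1ℤ * k + 0ℤ) ≈ -1ℤ * χ k + 0ℤ [ + v ]
    reversal k = sk , go (even-or-odd k)
      where
      k' : ℤ
      k' = -1ℤ * k + 0ℤ
      k'≈k : k' ≈ k [ + 2 ]
      k'≈k = lc ((- k) ⊙ modulus≈0) (solve 1 (λ a → con -1ℤ :* a :+ con 0ℤ :- a := :- a :* con (+ 2) :- :- a :* con 0ℤ) refl k)
      sk : s k' ≡ s k
      sk = same-kind k'≈k
      go : Even k ⊎ Odd k → χ k' ≈ -1ℤ * χ k + 0ℤ [ + v ]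
      go (inj₁ ek) = lc (≈-coarsen d∣ (χ-ref (even⇒ref (≈-trans k'≈k ek))) ⊕ ≈-coarsen d∣ (χ-ref (even⇒ref ek)))
          (solve 3 (λ a b c → a :- (con -1ℤ :* b :+ con 0ℤ) := a :+ b :- (con -1ℤ :* c :+ con 0ℤ :+ c)) refl (χ k') (χ k) k)
      go (inj₂ ok) = lc (χ-class (≈-trans k'≈k ok) ok ⊕ ⊖ χ-class (χ-odd ok) ok ⊕ ≈-coarsen d∣ (χχ k))
          (solve 4 (λ a b c d → a :- (con -1ℤ :* b :+ con 0ℤ) := a :+ :- c :+ c :- (b :+ (con -1ℤ :* d :+ con 0ℤ :- d) :+ :- (b :+
          (b :- d)) :+ d)) refl (χ k') (χ k) (χ (χ k)) k)

    Ψ : Generic.Hom Q -1ℤ 0ℤ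
    Ψ = Generic.hom Q neg 0ℤ (λ k → proj₁ (reversal k)) (λ k → proj₂ (reversal k))

    -- In the quotient all rotations have the same level, so 2 is a period and k ↦ -k a reversal;
    -- `double-period` applies.
    4≈0 : + 4 ≈ 0ℤ [ + v ]
    4≈0 = Generic.double-period Q {+ 2} {0ℤ} kinds₂ (Generic.hom Q pos (+ 2) kinds₂ inverses₂) (λ k → proj₁ (reversal k)) Ψ y₁
      where
      kinds₂ : ∀ k → s (1ℤ * k + + 2) ≡ s k
      kinds₂ k = same-kind (lc modulus≈0 (solve 1 (λ a → con 1ℤ :* a :+ con (+ 2) :- a := con (+ 2) :- con 0ℤ) refl k))
      inverses₂ : ∀ k → χ (1ℤ * k + + 2) ≈ 1ℤ * χ k + + 2 [ + v ]
      inverses₂ k = go (even-or-odd k)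
        where
        k+2 : ∀ {r} → k ≈ r [ + 2 ] → 1ℤ * k + + 2 ≈ r [ + 2 ]
        k+2 {r} h = lc (h ⊕ modulus≈0) (solve 2 (λ a b → con 1ℤ :* a :+ con (+ 2) :- b := a :+ con (+ 2) :- (b :+ con 0ℤ)) refl k r)
        go : Even k ⊎ Odd k → χ (1ℤ * k + + 2) ≈ 1ℤ * χ k + + 2 [ + v ]
        go (inj₁ ek) = lc (≈-coarsen d∣ (χ-ref (even⇒ref (k+2 ek))) ⊕ ⊖ ≈-coarsen d∣ (χ-ref (even⇒ref ek)))
            (solve 3 (λ a b c → a :- (con 1ℤ :* b :+ con (+ 2)) := a :+ :- b :- (con 1ℤ :* c :+ con (+ 2) :+ :- c)) refl (χ (1ℤ * k + + 2)) (χ k) k)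
        go (inj₂ ok) = lc (χ-class (k+2 ok) ok) (solve 3 (λ a b c → a :- (con 1ℤ :* b :+ con (+ 2)) := a :- (b :+ (con 1ℤ :* c :+ con (+ 2) :- c))) refl (χ
            (1ℤ * k + + 2)) (χ k) k)

    2≤g : 2 ℕ.≤ g
    2≤g = go g≢0 (nonunit-quotient y₁)
      where
      go : ∀ {g} → NonZero g → ¬ e 1ℤ ≈ 0ℤ [ + g ] → 2 ℕ.≤ g
      go {0} h _ = ⊥-elim (ℕ.≢-nonZero⁻¹ 0 {{h}} refl)
      go {1} _ h = ⊥-elim (h (mod≈ (e 1ℤ) (solve 1 (λ a → a :- con 0ℤ := a :* con (+ 1)) refl (e 1ℤ))))
      go {suc (suc _)} _ _ = s≤s (s≤s z≤n)

  odd≈1 : ∀ {a} → ¬ a ≈ 0ℤ [ + 2 ] → ∃[ f ] a ≡ + 2 * f + 1ℤ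
  odd≈1 {a} h = let f , x = parity a in f , go f x
    where
    go : ∀ f → a ≡ + 2 * f ⊎ a ≡ + 2 * f + 1ℤ → a ≡ + 2 * f + 1ℤ
    go f (inj₁ x) = ⊥-elim (h (lc (≡⇒≈ x ⊕ f ⊙ modulus≈0)
        (solve 2 (λ a b → a :- con 0ℤ := a :+ b :* con (+ 2) :- (con (+ 2) :* b :+ b :* con 0ℤ)) refl a f)))
    go f (inj₂ x) = x

  module Two (T : Translation (+ 2)) (α : ℤ) (hα : + 2 ≈ α * (e (+ 2) - e 0ℤ) [ + n ]) (ε-even : e (+ 2) - e 0ℤ ≈ 0ℤ [ + 2 ])
    (n-even : + n ≈ 0ℤ [ + 2 ]) (e₁-odd : ¬ e 1ℤ ≈ 0ℤ [ + 2 ]) where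
    open Multiples T

    M ε' : ℤ
    M = proj₁ (≈0⇒multiple n-even)
    ε' = proj₁ (≈0⇒multiple ε-even)

    n≡ : + n ≡ M * + 2
    n≡ = proj₂ (≈0⇒multiple n-even)

    Mε≈0 : M * ε ≈ 0ℤ [ + n ]
    Mε≈0 = lc (M ⊙ ≡⇒≈ (proj₂ (≈0⇒multiple ε-even)) ⊕ (- ε') ⊙ ≡⇒≈ n≡ ⊕ ε' ⊙ modulus≈0)
        (solve 4 (λ a b c d → a :* b :- con 0ℤ := a :* b :+ :- c :* d :+ c :* d :- (a :* (c :* con (+ 2)) :+ :- c :*
        (a :* con (+ 2)) :+ c :* con 0ℤ)) refl M ε ε' (+ n))

    -- Since ε is even, α may be changed by M = n/2. If α and M were both even, then 4 would divide
    -- n and 2 = α ε would vanish modulo 4.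
    α-odd : ∃[ β ] + 2 ≈ (+ 2 * β + 1ℤ) * ε [ + n ]
    α-odd = go (parity α) (parity M)
      where
      go : ∃[ β ] (α ≡ + 2 * β ⊎ α ≡ + 2 * β + 1ℤ) → ∃[ M' ] (M ≡ + 2 * M' ⊎ M ≡ + 2 * M' + 1ℤ) → ∃[ β ] + 2 ≈ (+ 2 * β + 1ℤ) * ε [ + n ]
      go (β , inj₂ x) _ = β , (lc (hα ⊕ ε ⊙ ≡⇒≈ x)
          (solve 3 (λ a b c → con (+ 2) :- (con (+ 2) :* a :+ con 1ℤ) :* b := con (+ 2) :+ b :* c :- (c :* b :+ b :*
          (con (+ 2) :* a :+ con 1ℤ))) refl β ε α))
      go (β , inj₁ x) (M' , inj₂ y) = β + M' , (lc (hα ⊕ ε ⊙ ≡⇒≈ x ⊕ ⊖ Mε≈0 ⊕ ε ⊙ ≡⇒≈ y)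
          (solve 5 (λ a b c d e → con (+ 2) :- (con (+ 2) :* (a :+ b) :+ con 1ℤ) :* c := con
          (+ 2) :+ c :* d :+ :- (e :* c) :+ c :* e :- (d :* c :+ c :* (con (+ 2) :* a) :+ :- con 0ℤ :+ c :*
          (con (+ 2) :* b :+ con 1ℤ))) refl β M' ε α M))
      go (β , inj₁ x) (M' , inj₁ y) = ⊥-elim (distinct-by-computation {+ 2} {0ℤ} {+ 4}
        (lc (≈-coarsen 4∣n hα ⊕ ε ⊙ ≡⇒≈ x ⊕ (+ 2 * β) ⊙ ≡⇒≈ (proj₂ (≈0⇒multiple ε-even)) ⊕ (β * ε') ⊙ modulus≈0)
            (solve 4 (λ a b c d → con (+ 2) :- con 0ℤ := con (+ 2) :+ a :* b :+ con (+ 2) :* c :* a :+ c :* d :* con (+ 4) :- (b :* a :+ a :*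
            (con (+ 2) :* c) :+ con (+ 2) :* c :* (d :* con (+ 2)) :+ c :* d :* con 0ℤ)) refl ε α β ε')))
        where
        4∣n : + n ≈ 0ℤ [ + 4 ]
        4∣n = lc (≡⇒≈ n≡ ⊕ (+ 2) ⊙ ≡⇒≈ y ⊕ M' ⊙ modulus≈0)
            (solve 3 (λ a b c → a :- con 0ℤ := a :+ con (+ 2) :* b :+ c :* con (+ 4) :- (b :* con (+ 2) :+ con (+ 2) :*
            (con (+ 2) :* c) :+ c :* con 0ℤ)) refl (+ n) M M')

    module Base (β f : ℤ) (hβ : + 2 ≈ (+ 2 * β + 1ℤ) * ε [ + n ]) (e₁≡ : e 1ℤ ≡ + 2 * f + 1ℤ) where
      i t u : ℤ
      -- Chosen so that u = e 1 + i ε satisfies 2u = ε: one has 2 e 1 = (2f + 1)(2β + 1) ε, and 2i =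
      -- 1 - (2f + 1)(2β + 1).
      i = - (+ 2 * (f * β) + f + β)
      t = i * + 2
      u = e (1ℤ + t)

      2u≈ε : + 2 * u ≈ ε [ + n ]
      2u≈ε = lc ((+ 2) ⊙ e-multiple i 1ℤ ⊕ (+ 2) ⊙ ≡⇒≈ e₁≡ ⊕ ((+ 2 * f) + 1ℤ) ⊙ hβ ⊕ (+ 2 * ε) ⊙ ≡⇒≈ {i} refl)
          (solve 6 (λ a b c d e f → con (+ 2) :* a :- b := con (+ 2) :* a :+ con (+ 2) :* c :+ (con (+ 2) :* d :+ con 1ℤ) :* con (+ 2) :+ con
          (+ 2) :* b :* e :- (con (+ 2) :* (c :+ e :* b) :+ con (+ 2) :* (con (+ 2) :* d :+ con 1ℤ) :+ (con (+ 2) :* d :+ con 1ℤ) :*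
          ((con (+ 2) :* f :+ con 1ℤ) :* b) :+ con (+ 2) :* b :* :- (con (+ 2) :* (d :* f) :+ d :+ f))) refl u ε (e 1ℤ) f i β)

      model : Model S +_ isEven
      model = record { sign = pos ; t = t ; u = u ; j = e t
        ; kinds = λ k _ → kind-at k (isEven k) refl
        ; rotations = λ k _ h → let q = + ℕ.⌊ k /2⌋ in ≈-trans (e-cong (lc (≡⇒≈ (¬isEven⇒ℤ k h))
            (solve 3 (λ a b c → con 1ℤ :* a :+ b :- (con 1ℤ :+ b :+ c :* con (+ 2)) := a :- (con 1ℤ :+ con (+ 2) :* c)) refl (+ k) t q)))
            (lc (e-multiple q (1ℤ + t) ⊕ (- q) ⊙ 2u≈ε ⊕ (- u) ⊙ ≡⇒≈ (¬isEven⇒ℤ k h))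
            (solve 5 (λ a b c d e → a :- b :* c := a :+ :- d :* (con (+ 2) :* b) :+ :- b :* c :- (b :+ d :* e :+ :- d :* e :+ :- b :*
            (con 1ℤ :+ con (+ 2) :* d))) refl (e ((1ℤ + t) + q * + 2)) u (+ k) q ε))
        ; reflections = λ k _ h → let q = + ℕ.⌊ k /2⌋ in ≈-trans (e-cong (lc (≡⇒≈ (isEven⇒ℤ k h))
            (solve 3 (λ a b c → con 1ℤ :* a :+ b :- (b :+ c :* con (+ 2)) := a :- con (+ 2) :* c) refl (+ k) t q)))
            (lc (e-multiple q t ⊕ (- q) ⊙ 2u≈ε ⊕ (- u) ⊙ ≡⇒≈ (isEven⇒ℤ k h))
            (solve 6 (λ a b c d e f → a :- (b :* c :+ d) := a :+ :- e :* (con (+ 2) :* b) :+ :- b :* c :- (d :+ e :* f :+ :- e :* f :+ :- b :*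
            (con (+ 2) :* e))) refl (e (t + q * + 2)) u (+ k) (e t) q ε)) }
        where
        kind-at : ∀ k b → isEven k ≡ b → s (1ℤ * + k + t) ≡ isEven k
        kind-at k true h = trans (even⇒ref (let q = + ℕ.⌊ k /2⌋ in (lc (≡⇒≈ (isEven⇒ℤ k h) ⊕ (q + i) ⊙ modulus≈0) (solve 3 (λ a b c → con 1ℤ :* a :+ b :* con (+ 2) :- con 0ℤ := a :+ (c :+ b) :* con (+ 2) :- (con (+ 2) :* c :+ (c :+ b) :* con 0ℤ)) refl (+ k) i q)))) (sym h)
        kind-at k false h = trans (odd⇒rot (let q = + ℕ.⌊ k /2⌋ in (lc (≡⇒≈ (¬isEven⇒ℤ k h) ⊕ (q + i) ⊙ modulus≈0) (solve 3 (λ a b c → con 1ℤ :* a :+ b :* con (+ 2) :- con 1ℤ := a :+ (c :+ b) :* con (+ 2) :- (con 1ℤ :+ con (+ 2) :* c :+ (c :+ b) :* con 0ℤ)) refl (+ k) i q)))) (sym h)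

    -- The d/2 translations of one round change the exponent by (d/2) ε = 0, and multiplying by α
    -- turns this into d = 0 modulo n. Conversely n/2 translations change no exponent, so n = 0
    -- modulo d.
    d≡n : d ≡ n
    d≡n = ∣-antisym-≈ d∣ n∣
      where
      δ : ℤ
      δ = proj₁ (≈0⇒multiple d-even)
      δ≡ : + d ≡ δ * + 2
      δ≡ = proj₂ (≈0⇒multiple d-even)
      d∣ : + d ≈ 0ℤ [ + n ]
      d∣ = lc (≡⇒≈ δ≡ ⊕ δ ⊙ hα ⊕ (- α) ⊙ e-multiple δ 1ℤ ⊕ α ⊙ e-cong (lc (⊖ ≡⇒≈ δ≡ ⊕ modulus≈0)
          (solve 2 (λ a b → con 1ℤ :+ a :* con (+ 2) :- con 1ℤ := :- b :+ b :- (:- (a :* con (+ 2)) :+ con 0ℤ)) refl δ (+ d))))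
          (solve 6 (λ a b c d e f → a :- con 0ℤ := a :+ b :* con (+ 2) :+ :- c :* d :+ c :* d :- (b :* con (+ 2) :+ b :* (c :* e) :+ :- c :*
          (f :+ b :* e) :+ c :* f)) refl (+ d) δ α (e (1ℤ + δ * + 2)) ε (e 1ℤ))
      n∣ : + n ≈ 0ℤ [ + d ]
      n∣ = lc (≡⇒≈ n≡ ⊕ distinct (same-kind (lc (M ⊙ modulus≈0)
          (solve 1 (λ a → con 1ℤ :+ a :* con (+ 2) :- con 1ℤ := a :* con (+ 2) :- a :* con 0ℤ) refl M))) (lc (e-multiple M 1ℤ ⊕ Mε≈0)
          (solve 4 (λ a b c d → a :- b := a :+ c :* d :- (b :+ c :* d :+ con 0ℤ)) refl (e (1ℤ + M * + 2)) (e 1ℤ) M ε)))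
          (solve 2 (λ a b → a :- con 0ℤ := a :+ (con 1ℤ :+ b :* con (+ 2)) :- (b :* con (+ 2) :+ con 1ℤ)) refl (+ n) M)

    result : 2 ℕ.∣ n × d ≡ n × Model S +_ isEven
    result = let β , hβ = α-odd ; f , x = odd≈1 e₁-odd in ≈0⇒∣ n-even , d≡n , Base.model β f hβ x

-- Least translation 4, with the origin placed so that χ k = -k for odd k

module FourCentred {n d : ℕ} (S : System n d) (z₀ : System.s S 0ℤ ≡ true) (y₁ : System.s S 1ℤ ≡ false)
  (T2 : Periodicity.TypePeriod S (+ 2))
  (T : AlternatingPattern.Translation S z₀ y₁ T2 (+ 4)) (χ-neg : ∀ k → k ≈ 1ℤ [ + 2 ] → System.χ S k ≈ - k [ + d ]) (α : ℤ)
      (hα : + 4 ≈ α * (System.e S (+ 4) - System.e S 0ℤ) [ + n ])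
  (4∣ε : System.e S (+ 4) - System.e S 0ℤ ≈ 0ℤ [ + 4 ]) (4∣n : + n ≈ 0ℤ [ + 4 ]) (4∣d : + d ≈ 0ℤ [ + 4 ])
  (e₁-odd : ¬ System.e S 1ℤ ≈ 0ℤ [ + 2 ]) (τ≈2 : System.e S (+ 2) - System.e S 0ℤ ≈ + 2 [ + 4 ]) where
  open System S
  open AlternatingPattern S z₀ y₁ T2
  open Generic S
  open Periodicity S
  open Multiples T

  τ τ' f : ℤ
  τ = e (+ 2) - e 0ℤ
  τ' = 1ℤ + + 2 * _≈_[_].quotient τ≈2
  f = proj₁ (odd≈1 e₁-odd)

  e₁≡ : e 1ℤ ≡ + 2 * f + 1ℤ
  e₁≡ = proj₂ (odd≈1 e₁-odd)

  τ≡2τ' : τ ≡ + 2 * τ'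
  τ≡2τ' = let q = _≈_[_].quotient τ≈2 in trans (quotient-eq τ≈2)
      (solve 1 (λ a → con (+ 2) :+ a :* con (+ 4) := con (+ 2) :* (con 1ℤ :+ con (+ 2) :* a)) refl q)

  e-+4 : ∀ k → e (k + + 4) ≈ e k + ε [ + n ]
  e-+4 k = lc (Translation.e-translate T k) (solve 3 (λ a b c → a :- (b :+ c) := a :- b :- c) refl (e (k + + 4)) (e k) ε)

  e-neg : ∀ k → Odd k → e (- k) ≈ - e k [ + n ]
  e-neg k ok = ≈-trans (e-cong (≈-sym (χ-neg k ok))) (e-χ (odd⇒rot ok))

  e₃ : e (+ 3) ≈ ε - e 1ℤ [ + n ]
  e₃ = lc (e-+4 -1ℤ ⊕ e-neg 1ℤ ≈-refl) (solve 4 (λ a b c d → a :- (b :- c) := a :+ d :- (d :+ b :+ :- c)) refl (e (+ 3)) ε (e 1ℤ) (e -1ℤ))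

  reversal : ∀ k → s (-1ℤ * k + 0ℤ) ≡ s k × χ (-1ℤ * k + 0ℤ) ≈ -1ℤ * χ k + 0ℤ [ + d ]
  reversal k = same-kind k'≈k , go (even-or-odd k)
    where
    k' : ℤ
    k' = -1ℤ * k + 0ℤ
    k'≈k : k' ≈ k [ + 2 ]
    k'≈k = lc ((- k) ⊙ modulus≈0) (solve 1 (λ a → con -1ℤ :* a :+ con 0ℤ :- a := :- a :* con (+ 2) :- :- a :* con 0ℤ) refl k)
    go : Even k ⊎ Odd k → χ k' ≈ -1ℤ * χ k + 0ℤ [ + d ]
    go (inj₁ ek) = lc (χ-ref (even⇒ref (≈-trans k'≈k ek)) ⊕ χ-ref (even⇒ref ek))
        (solve 3 (λ a b c → a :- (con -1ℤ :* b :+ con 0ℤ) := a :+ b :- (con -1ℤ :* c :+ con 0ℤ :+ c)) refl (χ k') (χ k) k)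
    go (inj₂ ok) = lc (χ-neg k' (≈-trans k'≈k ok) ⊕ χ-neg k ok)
        (solve 3 (λ a b c → a :- (con -1ℤ :* b :+ con 0ℤ) := a :+ b :- (:- (con -1ℤ :* c :+ con 0ℤ) :+ :- c)) refl (χ k') (χ k) k)

  Ψ : Hom -1ℤ 0ℤ
  Ψ = hom neg 0ℤ (λ k → proj₁ (reversal k)) (λ k → proj₂ (reversal k))

  v X : ℤ
  v = Hom.z Ψ
  X = + 2 * τ - ε

  v-rot : ∀ k → Odd k → v * e k ≈ - e k [ + n ]
  v-rot k ok = lc (⊖ Hom.rot≈ Ψ k (odd⇒rot ok) ⊕ e-cong (≡⇒≈ (solve 1 (λ a → con -1ℤ :* a :+ con 0ℤ := :- a) refl k)) ⊕ e-neg k ok)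
      (solve 4 (λ a b c d → a :* b :- :- b := :- c :+ c :+ d :- (:- (a :* b) :+ d :+ :- b)) refl v (e k) (e (-1ℤ * k + 0ℤ)) (e (- k)))

  -- The reversal sends z₂ z₀ to z_(-2) z₀, and e (-2) = e 2 - ε.
  vτ : v * τ ≈ τ - ε [ + n ]
  vτ = lc (⊖ Hom.ref≈ Ψ (+ 2) 0ℤ (even⇒ref by-computation) z₀ ⊕ ⊖ (e-+4 -[1+ 1 ]) ⊕ ⊖ ≡⇒≈ {τ} refl)
      (solve 6 (λ a b c d e f → a :* b :- (b :- c) := :- (d :- e) :+ :- f :+ :- b :- (:- (a :* b) :+ :- (d :+ c) :+ :- (f :- e))) refl v τ ε
      (e -[1+ 1 ]) (e 0ℤ) (e (+ 2)))

  -- v acts as -1 on the rotations, so it kills X times anything in their span, which is everything.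
  e₁X≈0 : e 1ℤ * X ≈ 0ℤ [ + n ]
  e₁X≈0 = lc ((- e 1ℤ) ⊙ vτ ⊕ τ ⊙ v-rot 1ℤ ≈-refl)
      (solve 4 (λ a b c d → a :* (con (+ 2) :* b :- c) :- con 0ℤ := :- a :* (d :* b) :+ b :* (d :* a) :- (:- a :* (b :- c) :+ b :* :- a)) refl (e 1ℤ) τ ε v)

  εX≈0 : ε * X ≈ 0ℤ [ + n ]
  εX≈0 = lc ((- ε) ⊙ vτ ⊕ τ ⊙ vε) (solve 3 (λ a b c → a :* (con (+ 2) :* b :- a) :- con 0ℤ := :- a :* (c :* b) :+ b :* (c :* a) :- (:- a :* (b :- a) :+ b :* :- a)) refl ε τ v)
    where
    vε : v * ε ≈ - ε [ + n ]
    vε = lc ((- v) ⊙ e-+4 1ℤ ⊕ ⊖ e-+4 1ℤ ⊕ ⊖ v-rot 1ℤ ≈-refl ⊕ v-rot (+ 5) by-computation)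
        (solve 4 (λ a b c d → a :* b :- :- b := :- a :* c :+ :- c :+ :- (a :* d) :+ a :* c :- (:- a :*
        (d :+ b) :+ :- (d :+ b) :+ :- (:- d) :+ :- c)) refl v ε (e (+ 5)) (e 1ℤ))

  2τ≈ε : + 2 * τ ≈ ε [ + n ]
  2τ≈ε = lc X≈0 (solve 2 (λ a b → con (+ 2) :* a :- b := con (+ 2) :* a :- b :- con 0ℤ) refl τ ε)
    where
    -- With e 1 = 2f + 1 one has e 1² = 1 + 4(f² + f), and 4 = α ε. Both e 1² and 4 kill X, hence so
    -- does 1.
    X≈0 : X ≈ 0ℤ [ + n ]
    X≈0 = lc (e 1ℤ ⊙ e₁X≈0 ⊕ (- ((e 1ℤ * X))) ⊙ ≡⇒≈ e₁≡ ⊕ (- ((((+ 2 * f) + 1ℤ) * X))) ⊙ ≡⇒≈ e₁≡ ⊕ (- ((((f * f) + f) * α))) ⊙ εX≈0 ⊕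
        (- ((((f * f) + f) * X))) ⊙ hα) (solve 5 (λ a b c d e → a :- con 0ℤ := b :* (b :* a) :+ :- (b :* a) :* b :+ :- ((con
        (+ 2) :* c :+ con 1ℤ) :* a) :* b :+ :- ((c :* c :+ c) :* d) :* (e :* a) :+ :- ((c :* c :+ c) :* a) :* con
        (+ 4) :- (b :* con 0ℤ :+ :- (b :* a) :* (con (+ 2) :* c :+ con 1ℤ) :+ :- ((con (+ 2) :* c :+ con 1ℤ) :* a) :*
        (con (+ 2) :* c :+ con 1ℤ) :+ :- ((c :* c :+ c) :* d) :* con 0ℤ :+ :- ((c :* c :+ c) :* a) :* (d :* e))) refl X (e 1ℤ) f α ε)

  -- Shifting (y₁²)^τ' = (z₂ z₀)^e₁ by 2.
  ε≈4e₁ : ε ≈ + 4 * e 1ℤ [ + n ]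
  ε≈4e₁ = lc (⊖ 2τ≈ε ⊕ (+ 2) ⊙ ≡⇒≈ τ≡2τ' ⊕ α ⊙ 4τ'Δ≈0 ⊕ (τ' - e 1ℤ) ⊙ hα ⊕ (- ((α * (τ' - e 1ℤ)))) ⊙ 2τ≈ε ⊕ (+ 2 * (α * (τ' - e 1ℤ))) ⊙ ≡⇒≈ τ≡2τ')
      (solve 5 (λ a b c d e → a :- con (+ 4) :* b := :- (con (+ 2) :* c) :+ con (+ 2) :* c :+ d :* (con (+ 4) :* (e :* (e :- b))) :+ (e :- b) :* con
      (+ 4) :+ :- (d :* (e :- b)) :* (con (+ 2) :* c) :+ con (+ 2) :* (d :* (e :- b)) :* c :- (:- a :+ con (+ 2) :*
      (con (+ 2) :* e) :+ d :* con 0ℤ :+ (e :- b) :* (d :* a) :+ :- (d :* (e :- b)) :* a :+ con (+ 2) :* (d :* (e :- b)) :*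
      (con (+ 2) :* e))) refl ε (e 1ℤ) τ α τ')
    where
    z₂ : s (+ 2) ≡ true
    z₂ = even⇒ref by-computation
    z₄ : s (+ 4) ≡ true
    z₄ = even⇒ref by-computation
    y₃ : s (+ 3) ≡ false
    y₃ = odd⇒rot by-computation
    y₋₁ : s -1ℤ ≡ false
    y₋₁ = odd⇒rot by-computation
    N₁ N₂ : ℕ
    N₁ = τ' %ℕ n
    N₂ = e 1ℤ %ℕ n
    shifted : + N₁ * (e (+ 3) + e -1ℤ) ≈ + N₂ * (e (+ 4) - e (+ 2)) [ + n ]
    shifted = proj₁ (law pos {+ 2}
      (val-≈ (val-power N₁ (val-rot y₁ (val-rot y₁ val[]))) (lc ((- ((+ 2 * e 1ℤ))) ⊙ residue τ' n ⊕ (- e 1ℤ) ⊙ ≡⇒≈ τ≡2τ')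
          (solve 4 (λ a b c d → a :* (b :+ (b :+ con 0ℤ)) :- b :* c := :- (con (+ 2) :* b) :* d :+ :- b :* c :- (:- (con (+ 2) :* b) :* a :+ :- b :*
          (con (+ 2) :* d))) refl (+ N₁) (e 1ℤ) τ τ')))
      (val-≈ (val-power N₂ (val-ref z₂ (val-ref z₀ val[]))) (lc ((- ((e (+ 2) - e 0ℤ))) ⊙ residue (e 1ℤ) n)
          (solve 4 (λ a b c d → a :* (b :- (c :- con 0ℤ)) :- d :* (b :- c) := :- (b :- c) :* d :- :- (b :- c) :* a) refl (+ N₂) (e (+ 2)) (e 0ℤ)
          (e 1ℤ))))
      (shift-power N₁ (step -1ℤ -[1+ 2 ] (χ-neg 1ℤ ≈-refl) (χ-neg (+ 3) by-computation) ≈-refl (step -1ℤ 1ℤ (χ-neg 1ℤ ≈-refl)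
          (χ-neg -1ℤ by-computation) ≈-refl (done ≈-refl))))
      (shift-power N₂ (step (+ 2) (+ 4) (χ-ref z₂) (χ-ref z₄) ≈-refl (step 0ℤ (+ 2) (χ-ref z₀) (χ-ref z₂) ≈-refl (done ≈-refl))))
      (val-power N₁ (val-≈ (val-rot y₃ (val-rot y₋₁ val[])) (≡⇒≈ (solve 2 (λ a b → a :+ (b :+ con 0ℤ) := a :+ b) refl (e (+ 3)) (e -1ℤ)))))
      (val-power N₂ (val-≈ (val-ref z₄ (val-ref z₂ val[])) (≡⇒≈ (solve 2 (λ a b → a :- (b :- con 0ℤ) := a :- b) refl (e (+ 4)) (e (+ 2)))))))
    a b : ℤ
    a = e (+ 3) + e -1ℤ
    b = e (+ 4) - e (+ 2)
    unreduced : τ' * a ≈ e 1ℤ * b [ + n ]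
    unreduced = lc (shifted ⊕ a ⊙ residue τ' n ⊕ (- b) ⊙ residue (e 1ℤ) n)
        (solve 6 (λ a b c d e f → a :* b :- c :* d := e :* b :+ b :* a :+ :- d :* c :- (f :* d :+ b :* e :+ :- d :* f)) refl τ' a (e 1ℤ) b (+ N₁)
        (+ N₂))
    a≈ : a ≈ ε - + 2 * e 1ℤ [ + n ]
    a≈ = lc (e₃ ⊕ e-neg 1ℤ ≈-refl ⊕ ≡⇒≈ {a} refl)
        (solve 5 (λ a b c d e → a :- (b :- con (+ 2) :* c) := d :+ e :+ a :- (b :- c :+ :- c :+ (d :+ e))) refl a ε (e 1ℤ) (e (+ 3)) (e -1ℤ))
    b≈ : b ≈ τ [ + n ]
    b≈ = lc (⊖ 2τ≈ε ⊕ ≡⇒≈ {b} refl ⊕ ≡⇒≈ {τ} refl)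
        (solve 5 (λ a b c d e → a :- b := :- (con (+ 2) :* b) :+ a :+ b :- (:- (c :- d) :+ (c :- e) :+ (e :- d))) refl b τ (e (+ 4)) (e 0ℤ) (e (+ 2)))
    -- Here a = ε - 2 e 1 and b = τ, while ε = 2τ = 4τ'. Since 4 = α ε, the factor τ' can then be
    -- removed: 4 (τ' - e 1) = α ε (τ' - e 1) = 4 α τ' (τ' - e 1) = 0.
    4τ'Δ≈0 : + 4 * (τ' * (τ' - e 1ℤ)) ≈ 0ℤ [ + n ]
    4τ'Δ≈0 = lc (unreduced ⊕ (- τ') ⊙ a≈ ⊕ e 1ℤ ⊙ b≈ ⊕ τ' ⊙ 2τ≈ε ⊕ (-[1+ 1 ] * τ') ⊙ ≡⇒≈ τ≡2τ' ⊕ e 1ℤ ⊙ ≡⇒≈ τ≡2τ')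
        (solve 6 (λ a b c d e f → con (+ 4) :* (a :* (a :- b)) :- con 0ℤ := a :* c :+ :- a :* c :+ b :* d :+ a :* (con (+ 2) :* e) :+ con
        (-[1+ 1 ]) :* a :* e :+ b :* e :- (b :* d :+ :- a :* (f :- con (+ 2) :* b) :+ b :* e :+ a :* f :+ con (-[1+ 1 ]) :* a :*
        (con (+ 2) :* a) :+ b :* (con (+ 2) :* a))) refl τ' (e 1ℤ) a b τ ε)

  -- The defect δ measures how far the reflections are from the progression k u. It is 2-torsion: δ
  -- = 0 gives M₂, and δ = n/2 gives M₃.
  u δ : ℤ
  u = e 1ℤ
  δ = τ - + 2 * u

  δ+δ≈0 : δ + δ ≈ 0ℤ [ + n ]
  δ+δ≈0 = lc (2τ≈ε ⊕ ε≈4e₁) (solve 3 (λ a b c → a :- con (+ 2) :* b :+ (a :- con (+ 2) :* b) :- con 0ℤ := con (+ 2) :* a :+ c :- (c :+ con (+ 4) :* b)) refl τ u ε)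

  e-class : ∀ {k r} → k ≈ r [ + 4 ] → e k ≈ e r + (k - r) * u [ + n ]
  e-class {k} {r} h@(mod≈ q eq) = ≈-trans (e-cong (≡⇒≈ (quotient-eq h))) (lc (e-multiple q r ⊕ q ⊙ ε≈4e₁ ⊕ (- u) ⊙ ≡⇒≈ eq)
      (solve 7 (λ a b c d e f g → a :- (b :+ (c :- d) :* e) := a :+ f :* g :+ :- e :* (c :- d) :- (b :+ f :* g :+ f :* (con (+ 4) :* e) :+ :- e :*
      (f :* con (+ 4)))) refl (e (r + q * + 4)) (e r) k r u q ε))

  e-odd : ∀ {k} → Odd k → e k ≈ u * k [ + n ]
  e-odd {k} ok = go (mod4 k)
    where
    wrong : ∀ r → k ≈ r [ + 4 ] → r ≈ 0ℤ [ + 2 ] → ⊥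
    wrong r h h' = distinct-by-computation {1ℤ} {0ℤ} {+ 2} (≈-trans (≈-sym ok) (≈-trans (≈-coarsen by-computation h) h'))
    go : k ≈ 0ℤ [ + 4 ] ⊎ k ≈ 1ℤ [ + 4 ] ⊎ k ≈ + 2 [ + 4 ] ⊎ k ≈ -1ℤ [ + 4 ] → e k ≈ u * k [ + n ]
    go (inj₁ h) = ⊥-elim (wrong _ h ≈-refl)
    go (inj₂ (inj₁ h)) = lc (e-class h) (solve 3 (λ a b c → a :- b :* c := a :- (b :+ (c :- con 1ℤ) :* b)) refl (e k) u k)
    go (inj₂ (inj₂ (inj₁ h))) = ⊥-elim (wrong _ h by-computation)
    go (inj₂ (inj₂ (inj₂ h))) = lc (e-class h ⊕ e-neg 1ℤ ≈-refl)
        (solve 4 (λ a b c d → a :- b :* c := a :+ d :- (d :+ (c :- con -1ℤ) :* b :+ :- b)) refl (e k) u k (e -1ℤ))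

  kind-at : ∀ k b → isEven k ≡ b → s (1ℤ * + k + 0ℤ) ≡ isEven k
  kind-at k true h = trans (even⇒ref (let q = + ℕ.⌊ k /2⌋ in (lc (≡⇒≈ (isEven⇒ℤ k h) ⊕ q ⊙ modulus≈0) (solve 2 (λ a b → con 1ℤ :* a :+ con 0ℤ :- con 0ℤ := a :+ b :* con (+ 2) :- (con (+ 2) :* b :+ b :* con 0ℤ)) refl (+ k) q)))) (sym h)
  kind-at k false h = trans (odd⇒rot (let q = + ℕ.⌊ k /2⌋ in (lc (≡⇒≈ (¬isEven⇒ℤ k h) ⊕ q ⊙ modulus≈0) (solve 2 (λ a b → con 1ℤ :* a :+ con 0ℤ :- con 1ℤ := a :+ b :* con (+ 2) :- (con 1ℤ :+ con (+ 2) :* b :+ b :* con 0ℤ)) refl (+ k) q)))) (sym h)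

  odd-index : ∀ k → isEven k ≡ false → e (1ℤ * + k + 0ℤ) ≈ u * + k [ + n ]
  odd-index k h = let q = + ℕ.⌊ k /2⌋ in ≈-trans (e-cong (≡⇒≈ (solve 1 (λ a → con 1ℤ :* a :+ con 0ℤ := a) refl (+ k))))
      (e-odd (lc (≡⇒≈ (¬isEven⇒ℤ k h) ⊕ q ⊙ modulus≈0)
      (solve 2 (λ a b → a :- con 1ℤ := a :+ b :* con (+ 2) :- (con 1ℤ :+ con (+ 2) :* b :+ b :* con 0ℤ)) refl (+ k) q)))

  even-index : ∀ k → isEven k ≡ true → e (1ℤ * + k + 0ℤ) ≈ u * + k + + ℕ.⌊ k /2⌋ * δ + e 0ℤ [ + n ]
  even-index k h = ≈-trans (e-cong (≡⇒≈ (solve 1 (λ a → con 1ℤ :* a :+ con 0ℤ := a) refl (+ k)))) (go (parity q))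
    where
    q : ℤ
    q = + ℕ.⌊ k /2⌋
    k≡ : ∀ {m} → + k ≈ + 2 * q [ m ]
    k≡ = ≡⇒≈ (isEven⇒ℤ k h)
    go : ∃[ r ] (q ≡ + 2 * r ⊎ q ≡ + 2 * r + 1ℤ) → e (+ k) ≈ u * + k + q * δ + e 0ℤ [ + n ]
    go (r , inj₁ x) = lc (e-class {+ k} {0ℤ} (lc (k≡ ⊕ (+ 2) ⊙ ≡⇒≈ x ⊕ r ⊙ modulus≈0)
        (solve 3 (λ a b c → a :- con 0ℤ := a :+ con (+ 2) :* b :+ c :* con (+ 4) :- (con (+ 2) :* b :+ con (+ 2) :*
        (con (+ 2) :* c) :+ c :* con 0ℤ)) refl (+ k) q r)) ⊕ (- δ) ⊙ ≡⇒≈ x ⊕ (- r) ⊙ δ+δ≈0)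
        (solve 7 (λ a b c d e f g → a :- (b :* c :+ d :* e :+ f) := a :+ :- e :* d :+ :- g :* (e :+ e) :- (f :+ (c :- con 0ℤ) :* b :+ :- e :*
        (con (+ 2) :* g) :+ :- g :* con 0ℤ)) refl (e (+ k)) u (+ k) q δ (e 0ℤ) r)
    go (r , inj₂ x) = lc (e-class {+ k} {+ 2} (lc (k≡ ⊕ (+ 2) ⊙ ≡⇒≈ x ⊕ r ⊙ modulus≈0)
        (solve 3 (λ a b c → a :- con (+ 2) := a :+ con (+ 2) :* b :+ c :* con (+ 4) :- (con (+ 2) :* b :+ con (+ 2) :*
        (con (+ 2) :* c :+ con 1ℤ) :+ c :* con 0ℤ)) refl (+ k) q r)) ⊕ (- δ) ⊙ ≡⇒≈ x ⊕ (- r) ⊙ δ+δ≈0 ⊕ ⊖ ≡⇒≈ {δ} refl)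
        (solve 8 (λ a b c d e f g h → a :- (b :* c :+ d :* e :+ f) := a :+ :- e :* d :+ :- g :* (e :+ e) :+ :- e :- (h :+
        (c :- con (+ 2)) :* b :+ :- e :* (con (+ 2) :* g :+ con 1ℤ) :+ :- g :* con 0ℤ :+ :- (h :- f :- con (+ 2) :* b))) refl (e (+ k)) u
        (+ k) q δ (e 0ℤ) r (e (+ 2)))

  d≡n : d ≡ n
  d≡n = ∣-antisym-≈ d∣ n∣
    where
    c c' : ℤ
    c = proj₁ (≈0⇒multiple 4∣d)
    c' = proj₁ (≈0⇒multiple 4∣n)
    c≡ : + d ≡ c * + 4
    c≡ = proj₂ (≈0⇒multiple 4∣d)
    c'≡ : + n ≡ c' * + 4
    c'≡ = proj₂ (≈0⇒multiple 4∣n)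
    d∣ : + d ≈ 0ℤ [ + n ]
    d∣ = lc (≡⇒≈ c≡ ⊕ c ⊙ hα ⊕ (- α) ⊙ e-multiple c 1ℤ ⊕ α ⊙ e-cong (lc (⊖ ≡⇒≈ c≡ ⊕ modulus≈0)
        (solve 2 (λ a b → con 1ℤ :+ a :* con (+ 4) :- con 1ℤ := :- b :+ b :- (:- (a :* con (+ 4)) :+ con 0ℤ)) refl c (+ d))))
        (solve 6 (λ a b c d e f → a :- con 0ℤ := a :+ b :* con (+ 4) :+ :- c :* d :+ c :* d :- (b :* con (+ 4) :+ b :* (c :* e) :+ :- c :*
        (f :+ b :* e) :+ c :* f)) refl (+ d) c α (e (1ℤ + c * + 4)) ε (e 1ℤ))
    n∣ : + n ≈ 0ℤ [ + d ]
    n∣ = (lc (≡⇒≈ c'≡ ⊕ distinct (same-kind (lc ((+ 2 * c') ⊙ modulus≈0)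
        (solve 1 (λ a → con 1ℤ :+ a :* con (+ 4) :- con 1ℤ := con (+ 2) :* a :* con (+ 2) :- con (+ 2) :* a :* con 0ℤ) refl c')))
      (lc (e-multiple c' 1ℤ ⊕ c' ⊙ ε≈4e₁ ⊕ (- e 1ℤ) ⊙ ≡⇒≈ c'≡ ⊕ e 1ℤ ⊙ modulus≈0)
          (solve 5 (λ a b c d e → a :- b := a :+ c :* d :+ :- b :* e :+ b :* e :- (b :+ c :* d :+ c :* (con (+ 4) :* b) :+ :- b :*
          (c :* con (+ 4)) :+ b :* con 0ℤ)) refl (e (1ℤ + c' * + 4)) (e 1ℤ) c' ε (+ n))))
          (solve 2 (λ a b → a :- con 0ℤ := a :+ (con 1ℤ :+ b :* con (+ 4)) :- (b :* con (+ 4) :+ con 1ℤ)) refl (+ n) c'))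

  2∣n : 2 ℕ.∣ n
  2∣n = ≈0⇒∣ (≈-coarsen {m = + 4} by-computation 4∣n)

  Result : Set
  Result = (2 ℕ.∣ n × d ≡ n × Model S +_ isEven) ⊎ (8 ℕ.∣ n × d ≡ n × Model S (p₃-exponent ℕ.⌊ n /2⌋) isEven)

  result : Result
  result = go (δ ≈? 0ℤ [ + n ])
    where
    third : ∃[ M ] (n ≡ 2 ℕ.* M × δ ≈ + M [ + n ]) → Result
    third (M , n≡ , δ≈M) = inj₂ (≈0⇒∣ 8∣n , d≡n , subst (λ m → Model S (p₃-exponent m) isEven) (trans (half-double M) (cong ℕ.⌊_/2⌋ (sym n≡))) record
        { sign = pos ; t = 0ℤ ; u = u ; j = e 0ℤ ; kinds = λ k _ → kind-at k _ refl
        ; rotations = λ k _ h → ≈-trans (odd-index k h) (≡⇒≈ (cong (u *_) (sym (cong (if_then + (k ℕ.+ ℕ.⌊ k /2⌋ ℕ.* M) else + k) h))))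
        ; reflections = λ k _ h → ≈-trans (even-index k h)
            (≈-trans (uδ k) (≡⇒≈ (cong (λ b → u * (if b then + (k ℕ.+ ℕ.⌊ k /2⌋ ℕ.* M) else + k) + e 0ℤ) (sym h)))) })
      where
      half-double : ∀ M → M ≡ ℕ.⌊ 2 ℕ.* M /2⌋
      half-double M = trans (ℕ.n≡⌊n+n/2⌋ M) (cong (λ k → ℕ.⌊ M ℕ.+ k /2⌋) (sym (ℕ.+-identityʳ M)))
      m : ℤ
      m = + M
      n≡2m : + n ≡ + 2 * m
      n≡2m = trans (cong +_ n≡) (pos-* 2 M)
      8∣n : + n ≈ 0ℤ [ + 8 ]
      8∣n = let mod≈ q x = m≈0 in (lc (≡⇒≈ n≡2m ⊕ (+ 2) ⊙ ≡⇒≈ x ⊕ q ⊙ modulus≈0)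
          (solve 3 (λ a b c → a :- con 0ℤ := a :+ con (+ 2) :* (b :- con 0ℤ) :+ c :* con (+ 8) :- (con (+ 2) :* b :+ con (+ 2) :*
          (c :* con (+ 4)) :+ c :* con 0ℤ)) refl (+ n) m q))
        where
        -- Modulo 4, m = δ = τ - 2u = 2 - 2(2f + 1) = 0, which makes n = 2m a multiple of 8.
        m≈0 : m ≈ 0ℤ [ + 4 ]
        m≈0 = lc (⊖ ≈-coarsen 4∣n δ≈M ⊕ τ≈2 ⊕ (- (+ 2)) ⊙ ≡⇒≈ e₁≡ ⊕ (- f) ⊙ modulus≈0)
            (solve 4 (λ a b c d → a :- con 0ℤ := :- (b :- con (+ 2) :* c) :+ b :+ :- con (+ 2) :* c :+ :- d :* con (+ 4) :- (:- a :+ con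
            (+ 2) :+ :- con (+ 2) :* (con (+ 2) :* d :+ con 1ℤ) :+ :- d :* con 0ℤ)) refl m τ u f)
      uδ : ∀ k → u * + k + + ℕ.⌊ k /2⌋ * δ + e 0ℤ ≈ u * + (k ℕ.+ ℕ.⌊ k /2⌋ ℕ.* M) + e 0ℤ [ + n ]
      uδ k = let q = + ℕ.⌊ k /2⌋ in (lc (q ⊙ δ≈M ⊕ (- u) ⊙ ≡⇒≈ (pos-divmod ℕ.⌊ k /2⌋ M refl) ⊕ (- ((q * m))) ⊙ ≡⇒≈ e₁≡ ⊕ (q * f) ⊙ ≡⇒≈ n≡2m ⊕
          (- ((q * f))) ⊙ modulus≈0) (solve 9 (λ a b c d e f g h i →
          a :* b :+ c :* d :+ e :- (a :* f :+ e) := c :* d :+ :- a :* f :+ :- (c :* g) :* a :+ c :* h :* i :+ :- (c :* h) :* i :- (c :* g :+ :- a :*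
          (b :+ c :* g) :+ :- (c :* g) :* (con (+ 2) :* h :+ con 1ℤ) :+ c :* h :* (con (+ 2) :* g) :+ :- (c :* h) :* con 0ℤ)) refl u (+ k) q δ
          (e 0ℤ) (+ (k ℕ.+ ℕ.⌊ k /2⌋ ℕ.* M)) m f (+ n)))
    go : Dec (δ ≈ 0ℤ [ + n ]) → Result
    go (yes δ≈0) = inj₁ (2∣n , d≡n , record
      { sign = pos ; t = 0ℤ ; u = u ; j = e 0ℤ ; kinds = λ k _ → kind-at k _ refl ; rotations = λ k _ h → odd-index k h
      ; reflections = λ k _ h → let q = + ℕ.⌊ k /2⌋ in ≈-trans (even-index k h) (lc (q ⊙ δ≈0)
          (solve 5 (λ a b c d e → a :* b :+ c :* d :+ e :- (a :* b :+ e) := c :* d :- c :* con 0ℤ) refl u (+ k) q δ (e 0ℤ))) })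
    go (no δ≉0) = third (2-torsion⇒half δ+δ≈0 δ≉0)

AlternatingResult : ∀ {n d} → System n d → Set
AlternatingResult {n} {d} S = (2 ℕ.∣ n × d ≡ n × Model S +_ isEven) ⊎ (8 ℕ.∣ n × d ≡ n × Model S (p₃-exponent ℕ.⌊ n /2⌋) isEven)

module FourReduction {n d : ℕ} (S : System n d) (z₀ : System.s S 0ℤ ≡ true) (y₁ : System.s S 1ℤ ≡ false)
  (T2 : Periodicity.TypePeriod S (+ 2))
  (T : AlternatingPattern.Translation S z₀ y₁ T2 (+ 4)) (least : ∀ u → AlternatingPattern.Translation S z₀ y₁ T2 u → u ≈ 0ℤ [ + 4 ])
  (g : ℕ) (α : ℤ) (hα : + g ≈ α * (System.e S (+ 4) - System.e S 0ℤ) [ + n ]) (g∣ε : System.e S (+ 4) - System.e S 0ℤ ≈ 0ℤ [ + g ])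
      (g∣n : + n ≈ 0ℤ [ + g ]) where
  open System S
  open AlternatingPattern S z₀ y₁ T2
  open Minimal 4 _ T least g α hα g∣ε g∣n
  module Q′ = System Q
  open Generic Q using (shift-power; span₁; Hom)

  y₃ : s (+ 3) ≡ false
  y₃ = odd⇒rot by-computation
  z₂ : s (+ 2) ≡ true
  z₂ = even⇒ref by-computation

  -- Otherwise y₁ and y₃ would both be the unique involution of the quotient.
  χ1≉1 : ¬ χ 1ℤ ≈ 1ℤ [ + 4 ]
  χ1≉1 h = distinct-by-computation {1ℤ} {+ 3} {+ 4} (distinct-quotient (trans y₁ (sym y₃)) (2-torsion-unique (double h y₁) (nonunit-quotient y₁)
      (double (lc (χ-class {+ 3} {1ℤ} by-computation ≈-refl ⊕ h)
          (solve 2 (λ a b → a :- con (+ 3) := a :+ b :- (b :+ (con (+ 3) :- con 1ℤ) :+ con 1ℤ)) refl (χ (+ 3)) (χ 1ℤ))) y₃) (nonunit-quotient y₃)))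
    where
    double : ∀ {k} → χ k ≈ k [ + 4 ] → s k ≡ false → e k + e k ≈ 0ℤ [ + g ]
    double {k} h y = lc (⊖ e-quotient h ⊕ ≈-coarsen g∣n (e-χ y)) (solve 2 (λ a b → a :+ a :- con 0ℤ := :- b :+ b :- (:- a :+ :- a)) refl (e k)
        (e (χ k)))

  module Twisted (χ1 : χ 1ℤ ≈ + 3 [ + 4 ]) where
    χ3 : χ (+ 3) ≈ 1ℤ [ + 4 ]
    χ3 = lc (χ-class {+ 3} {1ℤ} by-computation ≈-refl ⊕ χ1 ⊕ modulus≈0)
        (solve 2 (λ a b → a :- con 1ℤ := a :+ b :+ con (+ 4) :- (b :+ (con (+ 3) :- con 1ℤ) :+ con (+ 3) :+ con 0ℤ)) refl (χ (+ 3)) (χ 1ℤ))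
    χ0 : χ 0ℤ ≈ 0ℤ [ + 4 ]
    χ0 = ≈-coarsen d∣ (χ-ref z₀)
    χ2 : χ (+ 2) ≈ + 2 [ + 4 ]
    χ2 = ≈-coarsen d∣ (χ-ref z₂)

    e₃ : e (+ 3) ≈ - e 1ℤ [ + g ]
    e₃ = ≈-trans (e-quotient (≈-sym χ1)) (≈-coarsen g∣n (e-χ y₁))

    B v : ℤ
    B = e (+ 2) - e 0ℤ
    v = Hom.z Ψ

    shift-y₁² : Q′.Shift 1ℤ 1ℤ (1ℤ ∷ 1ℤ ∷ []) (+ 2 ∷ 0ℤ ∷ []) 1ℤ
    shift-y₁² = Q′.step (+ 3) (+ 2) χ1 χ2 ≈-refl (Q′.step (+ 3) 0ℤ χ1 χ0 ≈-refl (Q′.done by-computation))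

    shift-z₂z₀ : Q′.Shift 1ℤ 1ℤ (+ 2 ∷ 0ℤ ∷ []) (+ 3 ∷ + 3 ∷ []) 1ℤ
    shift-z₂z₀ = Q′.step (+ 2) 1ℤ χ2 χ3 ≈-refl (Q′.step 0ℤ 1ℤ χ0 χ3 by-computation (Q′.done ≈-refl))

    val-z₂z₀ : Q′.Val (+ 2 ∷ 0ℤ ∷ []) B false
    val-z₂z₀ = Q′.val-≈ (Q′.val-ref z₂ (Q′.val-ref z₀ Q′.val[])) (≡⇒≈ (solve 2 (λ a b → a :- (b :- con 0ℤ) := a :- b) refl (e (+ 2)) (e 0ℤ)))

    -- Modulo 4 the reversal fixes the indices 0 and 2, so v B = B. It inverts y₁, so y₁^(2(v + 1))
    -- = 1, whose shift by 1 is (z₂ z₀)^(v + 1) = 1. Thus B = v B = -B.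
    2B≈0 : B + B ≈ 0ℤ [ + g ]
    2B≈0 = lc (anti ⊕ vB) (solve 2 (λ a b → a :+ a :- con 0ℤ := (b :+ con 1ℤ) :* a :+ a :- (con 0ℤ :+ b :* a)) refl B v)
      where
      vB : B ≈ v * B [ + g ]
      vB = lc (Hom.ref≈ Ψ (+ 2) 0ℤ z₂ z₀ ⊕ ⊖ e-quotient by-computation ⊕ ≡⇒≈ {B} refl)
          (solve 5 (λ a b c d e → a :- b :* a := c :- d :+ :- c :+ a :- (b :* a :+ :- e :+ (e :- d))) refl B v (e -[1+ 1 ]) (e 0ℤ) (e (+ 2)))
      ve₁ : v * e 1ℤ ≈ - e 1ℤ [ + g ]
      ve₁ = lc (⊖ Hom.rot≈ Ψ 1ℤ y₁ ⊕ e-quotient by-computation ⊕ e₃)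
          (solve 4 (λ a b c d → a :* b :- :- b := :- c :+ c :+ d :- (:- (a :* b) :+ d :+ :- b)) refl v (e 1ℤ) (e -1ℤ) (e (+ 3)))
      anti : (v + 1ℤ) * B ≈ 0ℤ [ + g ]
      anti = let N = _%ℕ_ (v + 1ℤ) g {{g≢0}}
                 r = residue (v + 1ℤ) g {{g≢0}}
                 x , _ = Q′.law pos (Q′.val-≈ (Q′.val-power N (Q′.val-rot y₁ (Q′.val-rot y₁ Q′.val[]))) (lc ((-[1+ 1 ] * e 1ℤ) ⊙ r ⊕ (+ 2) ⊙ ve₁)
                     (solve 3 (λ a b c → a :* (b :+ (b :+ con 0ℤ)) :- con 0ℤ := con (-[1+ 1 ]) :* b :* (c :+ con 1ℤ) :+ con (+ 2) :*
                     (c :* b) :- (con (-[1+ 1 ]) :* b :* a :+ con (+ 2) :* :- b)) refl (+ N) (e 1ℤ) v))) Q′.val[]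
                   (shift-power N shift-y₁²) (Q′.done ≈-refl) (Q′.val-power N val-z₂z₀) Q′.val[]
             in (lc (x ⊕ B ⊙ r) (solve 3 (λ a b c → (a :+ con 1ℤ) :* b :- con 0ℤ := c :* b :+ b :* (a :+ con 1ℤ) :- (con 0ℤ :+ b :* c)) refl v B (+ N)))

    A : ℤ
    A = e 1ℤ + e 1ℤ

    -- Shifting (z₂ z₀)² = 1 by 1 gives y₃⁴ = 1.
    2A≈0 : A + A ≈ 0ℤ [ + g ]
    2A≈0 = let x , _ = Q′.law pos (Q′.val-≈ (Q′.val-++ val-z₂z₀ val-z₂z₀) 2B≈0) Q′.val[] (Q′.shift-++ shift-z₂z₀ shift-z₂z₀) (Q′.done ≈-refl)
                   (Q′.val-rot y₃ (Q′.val-rot y₃ (Q′.val-rot y₃ (Q′.val-rot y₃ Q′.val[])))) Q′.val[]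
           in (lc (⊖ x ⊕ (+ 4) ⊙ e₃) (solve 2 (λ a b → a :+ a :+ (a :+ a) :- con 0ℤ := :- (b :+ (b :+ (b :+ (b :+ con 0ℤ)))) :+ con (+ 4) :* b :- (:- con 0ℤ :+ con (+ 4) :* :- a)) refl (e 1ℤ) (e (+ 3))))

    A≉0 : ¬ A ≈ 0ℤ [ + g ]
    A≉0 h = distinct-by-computation {1ℤ} {+ 3} {+ 4} (distinct-quotient (trans y₁ (sym y₃)) (lc (⊖ e₃ ⊕ h)
        (solve 2 (λ a b → a :- b := :- b :+ (a :+ a) :- (:- (:- a) :+ con 0ℤ)) refl (e 1ℤ) (e (+ 3)))))

    B≈A : B ≈ A [ + g ]
    B≈A = 2-torsion-unique 2B≈0 (λ h → distinct-by-computation {+ 2} {0ℤ} {+ 4} (distinct-quotient (trans z₂ (sym z₀)) (lc h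
        (solve 2 (λ a b → a :- b := a :- b :- con 0ℤ) refl (e (+ 2)) (e 0ℤ))))) 2A≈0 A≉0

    unit : ∃[ q ] 1ℤ ≈ q * e 1ℤ [ + g ]
    unit = span₁ (e 1ℤ) (e 0ℤ) (λ k y → rot-case k y (mod4 k)) (λ k z → ref-case k z (mod4 k)) 1ℤ
      where
      -1≈3 : -1ℤ ≈ + 3 [ + 4 ]
      -1≈3 = by-computation
      Cases : ℤ → Set
      Cases k = k ≈ 0ℤ [ + 4 ] ⊎ k ≈ 1ℤ [ + 4 ] ⊎ k ≈ + 2 [ + 4 ] ⊎ k ≈ -1ℤ [ + 4 ]
      rot-case : ∀ k → s k ≡ false → Cases k → ∃[ q ] e k ≈ q * e 1ℤ [ + g ]
      rot-case k y (inj₁ h) = bool-absurd y (trans (kinds h) z₀)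
      rot-case k y (inj₂ (inj₁ h)) = 1ℤ , ≈-trans (e-quotient h) (≡⇒≈ (solve 1 (λ a → a := con 1ℤ :* a) refl (e 1ℤ)))
      rot-case k y (inj₂ (inj₂ (inj₁ h))) = bool-absurd y (trans (kinds h) z₂)
      rot-case k y (inj₂ (inj₂ (inj₂ h))) = -1ℤ , ≈-trans (e-quotient (≈-trans h -1≈3)) (lc e₃
          (solve 2 (λ a b → a :- con -1ℤ :* b := a :- :- b) refl (e (+ 3)) (e 1ℤ)))
      ref-case : ∀ k → s k ≡ true → Cases k → ∃[ q ] e k ≈ e 0ℤ + q * e 1ℤ [ + g ]
      ref-case k z (inj₁ h) = 0ℤ , ≈-trans (e-quotient h) (≡⇒≈ (solve 2 (λ a b → a := a :+ con 0ℤ :* b) refl (e 0ℤ) (e 1ℤ)))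
      ref-case k z (inj₂ (inj₁ h)) = bool-absurd (trans (kinds h) y₁) z
      ref-case k z (inj₂ (inj₂ (inj₁ h))) = + 2 , ≈-trans (e-quotient h) (lc B≈A
          (solve 3 (λ a b c → a :- (b :+ con (+ 2) :* c) := a :- b :- (c :+ c)) refl (e (+ 2)) (e 0ℤ) (e 1ℤ)))
      ref-case k z (inj₂ (inj₂ (inj₂ h))) = bool-absurd (trans (kinds (≈-trans h -1≈3)) y₃) z

    g≡4 : g ≡ 4
    g≡4 = ∣4⇒≡4 2≤g (≈0⇒∣ (let q , h = unit in (lc ((+ 4) ⊙ h ⊕ q ⊙ 2A≈0) (solve 2 (λ a b → con (+ 4) :- con 0ℤ := con (+ 4) :* con 1ℤ :+ a :* (b :+ b :+ (b :+ b)) :- (con (+ 4) :* (a :* b) :+ a :* con 0ℤ)) refl q (e 1ℤ)))))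
      (λ h → A≉0 (lc (e 1ℤ ⊙ h) (solve 1 (λ a → a :+ a :- con 0ℤ := a :* con (+ 2) :- a :* con 0ℤ) refl (e 1ℤ))))

    to4 : ∀ {a b} → a ≈ b [ + g ] → a ≈ b [ + 4 ]
    to4 {a} {b} = subst (λ g → a ≈ b [ + g ]) g≡4

    4∣n : + n ≈ 0ℤ [ + 4 ]
    4∣n = to4 g∣n

    e₁-odd : ¬ e 1ℤ ≈ 0ℤ [ + 2 ]
    e₁-odd h@(mod≈ q eq) = A≉0 (subst (λ g → A ≈ 0ℤ [ + g ]) (sym g≡4) (lc ((+ 2) ⊙ ≡⇒≈ eq ⊕ q ⊙ modulus≈0)
        (solve 2 (λ a b → a :+ a :- con 0ℤ := con (+ 2) :* (a :- con 0ℤ) :+ b :* con (+ 4) :- (con (+ 2) :* (b :* con (+ 2)) :+ b :* con 0ℤ)) refl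
        (e 1ℤ) q)))

    B≈2 : e (+ 2) - e 0ℤ ≈ + 2 [ + 4 ]
    B≈2 = let f , x = odd≈1 e₁-odd in (lc (to4 B≈A ⊕ (+ 2) ⊙ ≡⇒≈ x ⊕ f ⊙ modulus≈0)
        (solve 4 (λ a b c d → a :- b :- con (+ 2) := a :- b :+ con (+ 2) :* c :+ d :* con (+ 4) :- (c :+ c :+ con (+ 2) :*
        (con (+ 2) :* d :+ con 1ℤ) :+ d :* con 0ℤ)) refl (e (+ 2)) (e 0ℤ) (e 1ℤ) f))

    e-odd : ∀ k → Odd k → ¬ e k ≈ 0ℤ [ + 2 ]
    e-odd k ok h = go (mod4 k)
      where
      4→2 : ∀ {a b} → a ≈ b [ + g ] → a ≈ b [ + 2 ]
      4→2 x = ≈-coarsen {m = + 4} by-computation (to4 x)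
      wrong : ∀ {r} → k ≈ r [ + 4 ] → r ≈ 0ℤ [ + 2 ] → ⊥
      wrong x y = distinct-by-computation {1ℤ} {0ℤ} {+ 2} (≈-trans (≈-sym ok) (≈-trans (≈-coarsen {m = + 4} by-computation x) y))
      go : k ≈ 0ℤ [ + 4 ] ⊎ k ≈ 1ℤ [ + 4 ] ⊎ k ≈ + 2 [ + 4 ] ⊎ k ≈ -1ℤ [ + 4 ] → ⊥
      go (inj₁ x) = wrong x ≈-refl
      go (inj₂ (inj₁ x)) = e₁-odd (≈-trans (≈-sym (4→2 (e-quotient x))) h)
      go (inj₂ (inj₂ (inj₁ x))) = wrong x by-computation
      go (inj₂ (inj₂ (inj₂ x))) = e₁-odd (lc (4→2 (e-quotient (≈-trans x (by-computation { -1ℤ} {+ 3}))) ⊕ 4→2 e₃ ⊕ ⊖ h)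
          (solve 3 (λ a b c → a :- con 0ℤ := b :+ c :+ :- b :- (c :+ :- a :+ :- con 0ℤ)) refl (e 1ℤ) (e k) (e (+ 3))))

    e-even : ∀ k → Even k → e (k + + 2) - e k ≈ + 2 [ + 4 ]
    e-even k ek = go (mod4 k)
      where
      wrong : ∀ {r} → k ≈ r [ + 4 ] → r ≈ 1ℤ [ + 2 ] → e (k + + 2) - e k ≈ + 2 [ + 4 ]
      wrong x y = ⊥-elim (distinct-by-computation {0ℤ} {1ℤ} {+ 2} (≈-trans (≈-sym ek) (≈-trans (≈-coarsen {m = + 4} by-computation x) y)))
      go : k ≈ 0ℤ [ + 4 ] ⊎ k ≈ 1ℤ [ + 4 ] ⊎ k ≈ + 2 [ + 4 ] ⊎ k ≈ -1ℤ [ + 4 ] → e (k + + 2) - e k ≈ + 2 [ + 4 ]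
      go (inj₁ x) = lc (B≈2 ⊕ ⊖ to4 (e-quotient x) ⊕ to4 (e-quotient (x ⊕ ≈-refl {+ 2})))
          (solve 4 (λ a b c d → a :- b :- con (+ 2) := c :- d :+ :- b :+ a :- (con (+ 2) :+ :- d :+ c)) refl (e (k + + 2)) (e k) (e (+ 2)) (e 0ℤ))
      go (inj₂ (inj₁ x)) = wrong x ≈-refl
      go (inj₂ (inj₂ (inj₁ x))) = lc (⊖ B≈2 ⊕ ⊖ to4 (e-quotient x) ⊕ to4 (e-quotient (≈-trans (x ⊕ ≈-refl {+ 2}) (by-computation {+ 4} {0ℤ}))) ⊕
          ⊖ modulus≈0) (solve 4 (λ a b c d → a :- b :- con (+ 2) := :- (c :- d) :+ :- b :+ a :+ :- con
          (+ 4) :- (:- con (+ 2) :+ :- c :+ d :+ :- con 0ℤ)) refl (e (k + + 2)) (e k) (e (+ 2)) (e 0ℤ))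
      go (inj₂ (inj₂ (inj₂ x))) = wrong x by-computation

    C≈0 : χ 1ℤ + 1ℤ ≈ 0ℤ [ + 4 ]
    C≈0 = lc (χ1 ⊕ modulus≈0) (solve 1 (λ a → a :+ con 1ℤ :- con 0ℤ := a :+ con (+ 4) :- (con (+ 3) :+ con 0ℤ)) refl (χ 1ℤ))

    q C h : ℤ
    q = proj₁ (≈0⇒multiple C≈0)
    C = χ 1ℤ + 1ℤ
    -- Half of C: for odd k one has χ k = C - k, and moving the origin to h turns this into χ k =
    -- -k.
    h = q * + 2

    C≡ : C ≡ q * + 4
    C≡ = proj₂ (≈0⇒multiple C≈0)

    χ-formula : ∀ k → Odd k → χ k ≈ C - k [ + d ]
    χ-formula k ok = go (mod4 k)
      where
      from : ∀ {l} → Odd l → k ≈ l [ + 4 ] → χ k ≈ χ l - (k - l) [ + d ]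
      from {l} ol x@(mod≈ p eq) = ≈-trans (χ-cong (≡⇒≈ (quotient-eq x))) (lc (χ-multiple p l (odd⇒rot ol) ⊕ ≡⇒≈ eq)
          (solve 5 (λ a b c d e → a :- (b :- (c :- d)) := a :+ (c :- d) :- (b :- e :* con (+ 4) :+ e :* con (+ 4))) refl (χ (l + p * + 4))
          (χ l) k l p))
      wrong : ∀ {r} → k ≈ r [ + 4 ] → r ≈ 0ℤ [ + 2 ] → χ k ≈ C - k [ + d ]
      wrong x y = ⊥-elim (distinct-by-computation {1ℤ} {0ℤ} {+ 2} (≈-trans (≈-sym ok) (≈-trans (≈-coarsen {m = + 4} by-computation x) y)))
      go : k ≈ 0ℤ [ + 4 ] ⊎ k ≈ 1ℤ [ + 4 ] ⊎ k ≈ + 2 [ + 4 ] ⊎ k ≈ -1ℤ [ + 4 ] → χ k ≈ C - k [ + d ]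
      go (inj₁ x) = wrong x ≈-refl
      go (inj₂ (inj₁ x)) = lc (from ≈-refl x) (solve 3 (λ a b c → a :- (b :+ con 1ℤ :- c) := a :- (b :- (c :- con 1ℤ))) refl (χ k) (χ 1ℤ) k)
      go (inj₂ (inj₂ (inj₁ x))) = wrong x by-computation
      go (inj₂ (inj₂ (inj₂ x))) = lc (from (χ-odd ≈-refl) (lc (x ⊕ ⊖ χ1 ⊕ ⊖ modulus≈0)
          (solve 2 (λ a b → a :- b := a :+ :- b :+ :- con (+ 4) :- (con -1ℤ :+ :- con (+ 3) :+ :- con 0ℤ)) refl k (χ 1ℤ))) ⊕ χχ 1ℤ)
          (solve 4 (λ a b c d → a :- (b :+ con 1ℤ :- c) := a :+ d :- (d :- (c :- b) :+ con 1ℤ)) refl (χ k) (χ 1ℤ) k (χ (χ 1ℤ)))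

    S′ : System n d
    S′ = reindex S pos h

    +h : ∀ {k r} → k ≈ r [ + 2 ] → 1ℤ * k + h ≈ r [ + 2 ]
    +h {k} {r} x = lc (x ⊕ q ⊙ modulus≈0) (solve 3 (λ a b c → con 1ℤ :* a :+ b :* con (+ 2) :- c := a :+ b :* con (+ 2) :- (c :+ b :* con 0ℤ)) refl k q r)

    T2′ : ∀ m → s (1ℤ * (m + + 2) + h) ≡ s (1ℤ * m + h)
    T2′ m = same-kind (lc modulus≈0 (solve 2 (λ a b → con 1ℤ :* (a :+ con (+ 2)) :+ b :- (con 1ℤ :* a :+ b) := con (+ 2) :- con 0ℤ) refl m h))

    ε-at : ∀ k → e (1ℤ * (k + + 4) + h) ≈ e (1ℤ * k + h) + ε [ + n ]
    ε-at k = ≈-trans (e-cong (≡⇒≈ (solve 2 (λ a b → con 1ℤ :* (a :+ con (+ 4)) :+ b := con 1ℤ :* a :+ b :+ con 1ℤ :* con (+ 4)) refl k h)))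
        (lc (e-multiple 1ℤ (1ℤ * k + h)) (solve 3 (λ a b c → a :- (b :+ c) := a :- (b :+ con 1ℤ :* c)) refl (e ((1ℤ * k + h) + 1ℤ * + 4))
        (e (1ℤ * k + h)) ε))

    ε′≈ε : e (1ℤ * + 4 + h) - e (1ℤ * 0ℤ + h) ≈ ε [ + n ]
    ε′≈ε = lc (ε-at 0ℤ) (solve 3 (λ a b c → a :- b :- c := a :- (b :+ c)) refl (e (1ℤ * + 4 + h)) (e (1ℤ * 0ℤ + h)) ε)

    T′ : AlternatingPattern.Translation S′ (even⇒ref (+h ≈-refl)) (odd⇒rot (+h ≈-refl)) T2′ (+ 4)
    T′ = record { even = by-computation
      ; e-translate = λ k → (lc (ε-at k ⊕ ⊖ ε′≈ε) (solve 5 (λ a b c d e → a :- b :- (c :- d) := a :+ :- (c :- d) :- (b :+ e :+ :- e)) refl (e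
          (1ℤ * (k + + 4) + h)) (e (1ℤ * k + h)) (e (1ℤ * + 4 + h)) (e (1ℤ * 0ℤ + h)) ε))
      ; χ-translate = λ k y → (lc (χ-cong (≡⇒≈ (solve 2 (λ a b → con 1ℤ :* (a :+ con (+ 4)) :+ b := con 1ℤ :* a :+ b :+ con 1ℤ :* con (+ 4)) refl k h)) ⊕
          χ-multiple 1ℤ (1ℤ * k + h) y) (solve 4 (λ a b c d → con 1ℤ :* (a :- b) :- (con 1ℤ :* (c :- b) :- con (+ 4)) := a :+ d :- (d :+ (c :- con 1ℤ :* con (+ 4)))) refl (χ
          (1ℤ * (k + + 4) + h)) h (χ (1ℤ * k + h)) (χ ((1ℤ * k + h) + 1ℤ * + 4)))) }

    result : AlternatingResult S
    result = pull-back (FourCentred.result S′ _ _ T2′ T′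
      (λ k ok → (lc (χ-formula (1ℤ * k + h) (+h ok) ⊕ ≡⇒≈ C≡ ⊕ (- (+ 2)) ⊙ ≡⇒≈ {h} refl)
          (solve 5 (λ a b c d e → con 1ℤ :* (a :- b) :- :- c := a :+ d :+ :- con (+ 2) :* b :- (d :- (con 1ℤ :* c :+ b) :+ e :* con (+ 4) :+ :- con
          (+ 2) :* (e :* con (+ 2)))) refl (χ (1ℤ * k + h)) h k C q)))
      α (lc (subst (λ g → + g ≈ α * ε [ + n ]) g≡4 hα ⊕ (- α) ⊙ ε′≈ε)
          (solve 4 (λ a b c d → con (+ 4) :- a :* (b :- c) := con (+ 4) :+ :- a :* (b :- c) :- (a :* d :+ :- a :* d)) refl α (e (1ℤ * + 4 + h))
          (e (1ℤ * 0ℤ + h)) ε))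
      (≈-trans (≈-coarsen 4∣n ε′≈ε) (to4 g∣ε)) 4∣n d∣ (e-odd (1ℤ * 1ℤ + h) (+h ≈-refl))
      (lc (e-even (1ℤ * 0ℤ + h) (+h ≈-refl) ⊕ ⊖ ≈-coarsen 4∣n (e-cong (≡⇒≈
          (solve 1 (λ a → con 1ℤ :* con 0ℤ :+ a :+ con (+ 2) := con 1ℤ :* con (+ 2) :+ a) refl h))))
          (solve 3 (λ a b c → a :- b :- con (+ 2) := c :- b :+ :- c :- (con (+ 2) :+ :- a)) refl (e (1ℤ * + 2 + h)) (e (1ℤ * 0ℤ + h))
          (e ((1ℤ * 0ℤ + h) + + 2)))))
      where
      pull-back : AlternatingResult S′ → AlternatingResult S
      pull-back (inj₁ (x , y , M)) = inj₁ (x , y , model-reindex S pos h M)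
      pull-back (inj₂ (x , y , M)) = inj₂ (x , y , model-reindex S pos h M)

  result : AlternatingResult S
  result = go (mod4 (χ 1ℤ))
    where
    wrong : ∀ {r} → χ 1ℤ ≈ r [ + 4 ] → r ≈ 0ℤ [ + 2 ] → AlternatingResult S
    wrong x y = ⊥-elim (distinct-by-computation {1ℤ} {0ℤ} {+ 2} (≈-trans (≈-sym (χ-odd ≈-refl)) (≈-trans (≈-coarsen {m = + 4} by-computation x) y)))
    go : χ 1ℤ ≈ 0ℤ [ + 4 ] ⊎ χ 1ℤ ≈ 1ℤ [ + 4 ] ⊎ χ 1ℤ ≈ + 2 [ + 4 ] ⊎ χ 1ℤ ≈ -1ℤ [ + 4 ] → AlternatingResult S
    go (inj₁ x) = wrong x ≈-refl
    go (inj₂ (inj₁ x)) = ⊥-elim (χ1≉1 x)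
    go (inj₂ (inj₂ (inj₁ x))) = wrong x by-computation
    go (inj₂ (inj₂ (inj₂ x))) = Twisted.result (≈-trans x by-computation)

alternating-pattern : ∀ {n d} (S : System n d) → System.s S 0ℤ ≡ true → System.s S 1ℤ ≡ false → Periodicity.TypePeriod S (+ 2) → AlternatingResult S
alternating-pattern {n} {d} S z₀ y₁ T2 = by-generator translation-generator
  where
  open System S
  open AlternatingPattern S z₀ y₁ T2
  2-or-4 : ∀ {v} → v ℕ.∣ 4 → + v ≈ 0ℤ [ + 2 ] → v ≡ 2 ⊎ v ≡ 4
  2-or-4 {0} h _ = ⊥-elim (ℕ.1+n≢0 (ℕ.0∣⇒≡0 h))
  2-or-4 {1} _ h = ⊥-elim (distinct-by-computation h)
  2-or-4 {2} _ _ = inj₁ refl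
  2-or-4 {3} _ h = ⊥-elim (distinct-by-computation h)
  2-or-4 {4} _ _ = inj₂ refl
  2-or-4 {suc (suc (suc (suc (suc _))))} h _ = ⊥-elim (ℕ.<⇒≱ (s≤s (s≤s (s≤s (s≤s (s≤s z≤n))))) (ℕ.∣⇒≤ h))
  Bezout : ℕ → Set
  Bezout v = ∃[ g ] ((∃[ α ] + g ≈ α * (e (+ v) - e 0ℤ) [ + n ]) × e (+ v) - e 0ℤ ≈ 0ℤ [ + g ] × + n ≈ 0ℤ [ + g ] × g ≡ _)
  by-generator : ∃[ v ] (NonZero v × Translation (+ v) × (∀ u → Translation u → u ≈ 0ℤ [ + v ])) → AlternatingResult S
  by-generator (v , v≢0 , T , least) = by-gcd (bezout (e (+ v) - e 0ℤ) n)
    where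
    by-gcd : Bezout v → AlternatingResult S
    by-gcd (g , (α , hα) , g∣ε , g∣n , _) = by-value (2-or-4 (≈0⇒∣ (Minimal.4≈0 v v≢0 T least g α hα g∣ε g∣n)) (Translation.even T)) T least hα g∣ε
      where
      by-value : v ≡ 2 ⊎ v ≡ 4 → Translation (+ v) → (∀ u → Translation u → u ≈ 0ℤ [ + v ]) → + g ≈ α * (e (+ v) - e 0ℤ) [ + n ] → e
          (+ v) - e 0ℤ ≈ 0ℤ [ + g ] → AlternatingResult S
      by-value (inj₂ refl) T least hα g∣ε = FourReduction.result S z₀ y₁ T2 T least g α hα g∣ε g∣n
      by-value (inj₁ refl) T least hα g∣ε = inj₁ (Two.result T α (subst (λ g → + g ≈ α * (e (+ 2) - e 0ℤ) [ + n ]) g≡2 hα) (to2 g∣ε) (to2 g∣n)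
          (λ h → nonunit-quotient y₁ (subst (λ g → e 1ℤ ≈ 0ℤ [ + g ]) (sym g≡2) h)))
        where
        open Minimal 2 v≢0 T least g α hα g∣ε g∣n
        e-odd : ∀ {k} → Odd k → e k ≈ e 1ℤ [ + g ]
        e-odd ok = e-quotient ok
        -- Modulo g all rotations have exponent e 1, so y₁ is its own inverse there, and e 1
        -- generates.
        g≡2 : g ≡ 2
        g≡2 = order-2⇒n≡2 2≤g (lc (⊖ e-odd (χ-odd {1ℤ} ≈-refl) ⊕ ≈-coarsen g∣n (e-χ y₁))
            (solve 2 (λ a b → a :+ a :- con 0ℤ := :- b :+ b :- (:- a :+ :- a)) refl (e 1ℤ) (e (χ 1ℤ))))
          (Generic.span₁ Q (e 1ℤ) (e 0ℤ) (λ k y → 1ℤ , ≈-trans (e-odd (rot⇒odd y)) (≡⇒≈ (solve 1 (λ a → a := con 1ℤ :* a) refl (e 1ℤ))))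
            (λ k z → 0ℤ , ≈-trans (e-quotient (ref⇒even z)) (≡⇒≈ (solve 2 (λ a b → a := a :+ con 0ℤ :* b) refl (e 0ℤ) (e 1ℤ)))) 1ℤ)
        to2 : ∀ {a b} → a ≈ b [ + g ] → a ≈ b [ + 2 ]
        to2 {a} {b} = subst (λ g → a ≈ b [ + g ]) g≡2

-- From Cayley maps to systems

pos-∸ : ∀ {m n} → n ℕ.≤ m → + (m ℕ.∸ n) ≡ + m - + n
pos-∸ {m} {n} n≤m = trans (sym (⊖-≥ n≤m)) (sym (m-n≡m⊖n m n))

signed-sum : Bool → ℤ → ℤ → ℤ
signed-sum t p q = if t then p - q else p + q

signed-sum-assoc : ∀ t u p q r → signed-sum (t xor u) (signed-sum t p q) r ≡ signed-sum t p (signed-sum u q r)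
signed-sum-assoc false false p q r = solve 3 (λ a b c → a :+ b :+ c := a :+ (b :+ c)) refl p q r
signed-sum-assoc false true p q r = solve 3 (λ a b c → a :+ b :- c := a :+ (b :- c)) refl p q r
signed-sum-assoc true false p q r = solve 3 (λ a b c → a :- b :- c := a :- (b :+ c)) refl p q r
signed-sum-assoc true true p q r = solve 3 (λ a b c → a :- b :+ c := a :- (b :- c)) refl p q r

small-residues : ∀ {n a b} → a ℕ.< n → b ℕ.< n → + a ≈ + b [ + n ] → a ≡ b
small-residues {n} {a} {b} a<n b<n h = go (ℕ.≤-total a b)
  where
  gap : ∀ {a b} → a ℕ.≤ b → b ℕ.< n → + b ≈ + a [ + n ] → a ≡ b
  gap {a} {b} a≤b b<n x = ℕ.≤-antisym a≤b (ℕ.m∸n≡0⇒m≤n (zero-below (b ℕ.∸ a) (ℕ.≤-<-trans (ℕ.m∸n≤m b a) b<n) (≈0⇒∣ (≈-trans (≡⇒≈ (pos-∸ a≤b)) (lc x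
      (solve 2 (λ a b → a :- b :- con 0ℤ := a :- b) refl (+ b) (+ a)))))))
    where
    zero-below : ∀ c → c ℕ.< n → n ℕ.∣ c → c ≡ 0
    zero-below zero _ _ = refl
    zero-below (suc c) lt d = ⊥-elim (ℕ.<⇒≱ lt (ℕ.∣⇒≤ d))
  go : a ℕ.≤ b ⊎ b ℕ.≤ a → a ≡ b
  go (inj₁ le) = gap le b<n (≈-sym h)
  go (inj₂ le) = sym (gap le a<n h)

%ℕ-cong : ∀ {a b} d .{{_ : NonZero d}} → a ≈ b [ + d ] → a %ℕ d ≡ b %ℕ d
%ℕ-cong {a} {b} d h = small-residues (n%ℕd<d a d) (n%ℕd<d b d) (≈-trans (≈-sym (residue a d)) (≈-trans h (residue b d)))

-- The dihedral group with integer exponents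

module _ {n : ℕ} .{{_ : NonZero n}} where

  toℕ-mod : ∀ m → + toℕ (m ℕ.mod n) ≈ + m [ + n ]
  toℕ-mod m = ≈-trans (≡⇒≈ (cong +_ (toℕ-fromℕ< (ℕ.m%n<n m n)))) (≈-sym (residue (+ m) n))

  toℕ-expo : ∀ z → + toℕ (expo {n} z) ≈ z [ + n ]
  toℕ-expo z = ≈-trans (toℕ-mod (z %ℕ n)) (≈-sym (residue z n))

  toℕ-injective-≈ : ∀ {i j : Fin n} → + toℕ i ≈ + toℕ j [ + n ] → i ≡ j
  toℕ-injective-≈ {i} {j} h = toℕ-injective (small-residues (toℕ<n i) (toℕ<n j) h)

  expo-cong : ∀ {a b} → a ≈ b [ + n ] → expo {n} a ≡ expo b
  expo-cong {a} {b} h = toℕ-injective-≈ (≈-trans (toℕ-expo a) (≈-trans h (≈-sym (toℕ-expo b))))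

  expo-injective : ∀ a b → expo {n} a ≡ expo b → a ≈ b [ + n ]
  expo-injective a b eq = ≈-trans (≈-sym (toℕ-expo a)) (≈-trans (≡⇒≈ (cong (λ i → + toℕ i) eq)) (toℕ-expo b))

  expo-toℕ : ∀ (i : Fin n) → expo (+ toℕ i) ≡ i
  expo-toℕ i = toℕ-injective-≈ (toℕ-expo (+ toℕ i))

  el : ℤ → Bool → Dih n
  el p t = expo p , t

  el-toℕ : ∀ (g : Dih n) → el (+ toℕ (proj₁ g)) (proj₂ g) ≡ g
  el-toℕ (i , t) = cong (_, t) (expo-toℕ i)

  el-cong : ∀ {p q t u} → p ≈ q [ + n ] → t ≡ u → el p t ≡ el q u
  el-cong h refl = cong (_, _) (expo-cong h)

  el-injective : ∀ p q {t u} → el p t ≡ el q u → p ≈ q [ + n ] × t ≡ u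
  el-injective p q eq = expo-injective p q (cong proj₁ eq) , cong proj₂ eq

  el-· : ∀ p t q u → el p t · el q u ≡ el (signed-sum t p q) (t xor u)
  el-· p false q u = cong (_, u) (toℕ-injective-≈ (≈-trans (toℕ-mod _) (≈-trans (≡⇒≈ (pos-+ i j))
      (lc (toℕ-expo p ⊕ toℕ-expo q ⊕ ⊖ toℕ-expo (p + q)) (solve 5 (λ a b c d e → a :+ b :- c := a :+ b :+ :- c :- (d :+ e :+ :- (d :+ e))) refl (+ i)
          (+ j) (+ toℕ (expo {n} (p + q))) p q)))))
    where
    i j : ℕ
    i = toℕ (expo {n} p)
    j = toℕ (expo {n} q)
  el-· p true q u = cong (_, not u) (toℕ-injective-≈ (≈-trans (toℕ-mod _)
      (≈-trans (≡⇒≈ (trans (pos-+ i (n ℕ.∸ j)) (cong (_+_ (+ i)) (pos-∸ (ℕ.<⇒≤ (toℕ<n (expo {n} q)))))))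
      (lc (toℕ-expo p ⊕ ⊖ toℕ-expo q ⊕ ⊖ toℕ-expo (p - q) ⊕ modulus≈0)
          (solve 6 (λ a b c d e f → a :+ (b :- c) :- d := a :+ :- c :+ :- d :+ b :- (e :+ :- f :+ :- (e :- f) :+ con 0ℤ)) refl (+ i) (+ n) (+ j)
          (+ toℕ (expo {n} (p - q))) p q)))))
    where
    i j : ℕ
    i = toℕ (expo {n} p)
    j = toℕ (expo {n} q)

  el-rot⁻¹ : ∀ p → el p false ⁻¹ ≡ el (- p) false
  el-rot⁻¹ p = cong (_, false) (toℕ-injective-≈ (≈-trans (toℕ-mod _) (≈-trans (≡⇒≈ (pos-∸ (ℕ.<⇒≤ (toℕ<n (expo {n} p)))))
      (lc (⊖ toℕ-expo p ⊕ ⊖ toℕ-expo (- p) ⊕ modulus≈0)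
          (solve 4 (λ a b c d → a :- b :- c := :- b :+ :- c :+ a :- (:- d :+ :- (:- d) :+ con 0ℤ)) refl (+ n) (+ j) (+ toℕ (expo {n} (- p))) p)))))
    where
    j : ℕ
    j = toℕ (expo {n} p)

  Dih-elim : (P : Dih n → Set) → (∀ p t → P (el p t)) → ∀ g → P g
  Dih-elim P f g = subst P (el-toℕ g) (f (+ toℕ (proj₁ g)) (proj₂ g))

  ·-assoc : ∀ (f g h : Dih n) → (f · g) · h ≡ f · (g · h)
  ·-assoc = Dih-elim _ λ p t → Dih-elim _ λ q u → Dih-elim _ λ r w →
    trans (cong (_· el r w) (el-· p t q u)) (trans (el-· (signed-sum t p q) (t xor u) r w)
      (trans (cong₂ el (signed-sum-assoc t u p q r) (xor-assoc t u w))
        (sym (trans (cong (el p t ·_) (el-· q u r w)) (el-· p t (signed-sum u q r) (u xor w))))))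

  ·-identityˡ : ∀ (g : Dih n) → 1ᴰ · g ≡ g
  ·-identityˡ = Dih-elim _ λ p t → trans (el-· 0ℤ false p t) (el-cong (≡⇒≈ (solve 1 (λ a → con 0ℤ :+ a := a) refl p)) refl)

  ·-identityʳ : ∀ (g : Dih n) → g · 1ᴰ ≡ g
  ·-identityʳ = Dih-elim _ λ { p false → trans (el-· p false 0ℤ false) (el-cong (≡⇒≈ (solve 1 (λ a → a :+ con 0ℤ := a) refl p)) refl) ; p true → trans
      (el-· p true 0ℤ false) (el-cong (≡⇒≈ (solve 1 (λ a → a :- con 0ℤ := a) refl p)) refl) }

  ·-inverseˡ : ∀ (g : Dih n) → (g ⁻¹) · g ≡ 1ᴰ
  ·-inverseˡ = Dih-elim _ λ { p false → trans (cong (_· el p false) (el-rot⁻¹ p)) (trans (el-· (- p) false p false) (el-cong (≡⇒≈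
      (solve 1 (λ a → :- a :+ a := con 0ℤ) refl p)) refl)) ; p true → trans (el-· p true p true) (el-cong (≡⇒≈
      (solve 1 (λ a → a :- a := con 0ℤ) refl p)) refl) }

  ·-inverseʳ : ∀ (g : Dih n) → g · (g ⁻¹) ≡ 1ᴰ
  ·-inverseʳ = Dih-elim _ λ { p false → trans (cong (el p false ·_) (el-rot⁻¹ p)) (trans (el-· p false (- p) false) (el-cong (≡⇒≈
      (solve 1 (λ a → a :+ :- a := con 0ℤ) refl p)) refl)) ; p true → trans (el-· p true p true) (el-cong (≡⇒≈
      (solve 1 (λ a → a :- a := con 0ℤ) refl p)) refl) }

  ⁻¹-involutive : ∀ (g : Dih n) → (g ⁻¹) ⁻¹ ≡ g
  ⁻¹-involutive = Dih-elim _ λ { p false → trans (cong _⁻¹ (el-rot⁻¹ p)) (trans (el-rot⁻¹ (- p)) (el-cong (≡⇒≈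
      (solve 1 (λ a → :- (:- a) := a) refl p)) refl)) ; p true → refl }

csuc-expo : ∀ {d} .{{_ : NonZero d}} k → csuc (expo {d} k) ≡ expo (k + 1ℤ)
csuc-expo {zero} {{nz}} k = ⊥-elim (ℕ.≢-nonZero⁻¹ 0 {{nz}} refl)
csuc-expo {suc d} k = toℕ-injective-≈ (≈-trans (toℕ-mod (suc j)) (lc (toℕ-expo k ⊕ ⊖ toℕ-expo (k + 1ℤ))
    (solve 3 (λ a b c → con 1ℤ :+ a :- b := a :+ :- b :- (c :+ :- (c :+ con 1ℤ))) refl (+ j) (+ toℕ (expo {suc d} (k + 1ℤ))) k)))
  where
  j : ℕ
  j = toℕ (expo {suc d} k)

csuc-injective : ∀ {d} .{{_ : NonZero d}} {i j : Fin d} → csuc i ≡ csuc j → i ≡ j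
csuc-injective {d} {i} {j} eq = toℕ-injective-≈ (lc (expo-injective (+ toℕ i + 1ℤ) (+ toℕ j + 1ℤ) (trans (sym (as-expo i)) (trans eq (as-expo j))))
    (solve 2 (λ a b → a :- b := a :+ con 1ℤ :- (b :+ con 1ℤ)) refl (+ toℕ i) (+ toℕ j)))
  where
  as-expo : ∀ i → csuc i ≡ expo (+ toℕ i + 1ℤ)
  as-expo i = trans (cong csuc (sym (expo-toℕ i))) (csuc-expo (+ toℕ i))

module _ {n d : ℕ} .{{_ : NonZero n}} .{{_ : NonZero d}} (x : Fin d → Dih n) (C : IsCayleyData d x) where
  open IsCayleyData C using (inv-closed) renaming (distinct to x-injective)

  invIdx-spec : ∀ k → x (invIdx x k) ≡ x k ⁻¹
  invIdx-spec k with any? (λ j → x j ≟D (x k ⁻¹))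
  ... | yes (_ , eq) = eq
  ... | no none = ⊥-elim (none (inv-closed k))

  invIdx-unique : ∀ {j k} → x j ≡ x k ⁻¹ → invIdx x k ≡ j
  invIdx-unique {j} {k} eq = x-injective (trans (invIdx-spec k) (sym eq))

  invIdx-involutive : ∀ k → invIdx x (invIdx x k) ≡ k
  invIdx-involutive k = invIdx-unique (sym (trans (cong _⁻¹ (invIdx-spec k)) (⁻¹-involutive (x k))))

-- Map automorphisms followed along walks

module Walks {n d : ℕ} .{{_ : NonZero n}} .{{_ : NonZero d}} (x : Fin d → Dih n) (eˣ : ℤ → ℤ) (sˣ : ℤ → Bool) (χˣ : ℤ → ℤ)
  (letter : ∀ k → x (expo k) ≡ el (eˣ k) (sˣ k)) (inverse : ∀ k → invIdx x (expo k) ≡ expo (χˣ k)) where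
  open Words (+ n) eˣ sˣ
  open Shifts (+ d) χˣ

  D : Set
  D = Dih n × Fin d

  -- Treats both orientations at once: one step of the rotation at the source corresponds to the
  -- index step σ at the target, so a reversing automorphism is described without the inverse of R.
  record Automorphism (σ : ℤ) (f : D → D) : Set where
    field
      rotate : ∀ {g k h c} → f (g , expo k) ≡ (h , expo c) → f (g , expo (k + 1ℤ)) ≡ (h , expo (c + σ))
      reverse : ∀ δ → f (Map.L (CM d x) δ) ≡ Map.L (CM d x) (f δ)

  OIso⇒automorphism : (φ : OIso (CM d x) (CM d x)) → Automorphism 1ℤ (Inverse.to (OIso.bij φ))
  OIso⇒automorphism φ = record
    { rotate = λ {g} {k} {h} {c} eq → trans (cong (λ i → f (g , i)) (sym (csuc-expo k))) (trans (OIso.pres-R φ (g , expo k))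
        (trans (cong (Map.R (CM d x)) eq) (cong (h ,_) (csuc-expo c))))
    ; reverse = OIso.pres-L φ }
    where
    f = Inverse.to (OIso.bij φ)

  RIso⇒automorphism : (φ : RIso (CM d x) (CM d x)) → Automorphism -1ℤ (Inverse.to (RIso.bij φ))
  RIso⇒automorphism φ = record
    { rotate = λ {g} {k} {h} {c} eq → back c (f (g , expo (k + 1ℤ))) (trans (cong (λ i → Map.R (CM d x) (f (g , i))) (sym (csuc-expo k)))
        (trans (RIso.rev-R φ (g , expo k)) eq))
    ; reverse = RIso.pres-L φ }
    where
    f = Inverse.to (RIso.bij φ)
    back : ∀ {h} c (δ : D) → Map.R (CM d x) δ ≡ (h , expo c) → δ ≡ (h , expo (c - 1ℤ))
    back c (h , j) eq = cong₂ _,_ (cong proj₁ eq) (csuc-injective (trans (cong proj₂ eq)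
        (sym (trans (csuc-expo (c - 1ℤ)) (expo-cong (≡⇒≈ {c - 1ℤ + 1ℤ}  {c} (solve 1 (λ a → a :- con 1ℤ :+ con 1ℤ := a) refl c)))))))

  record Carries (σ : ℤ) (f : D → D) (g h : Dih n) (c : ℤ) : Set where
    constructor carries
    field
      at : ∀ k → f (g , expo k) ≡ (h , expo (σ * k + c))
  open Carries

  -- Rotating around g, the image of a single dart determines the images of all darts at g.
  carries-from : ∀ {σ f} → Automorphism σ f → ∀ {g h} k₀ c₀ → f (g , expo k₀) ≡ (h , expo c₀) → Carries σ f g h (c₀ - σ * k₀)
  carries-from {σ} {f} A {g} {h} k₀ c₀ eq = carries λ k → let i = (k - k₀) %ℕ d ; r = residue (k - k₀) d in
      trans (cong (λ j → f (g , j)) (expo-cong (lc {k}  {k₀ + + i} r (solve 3 (λ a b c → a :- (b :+ c) := a :- b :- c) refl k k₀ (+ i)))))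
        (trans (iterate i) (cong (h ,_) (expo-cong (lc {c₀ + σ * + i}  {σ * k + (c₀ - σ * k₀)} ((- σ) ⊙ r)
            (solve 5 (λ a b c d e → a :+ b :* c :- (b :* d :+ (a :- b :* e)) := :- b :* (d :- e) :- :- b :* c) refl c₀ σ (+ i) k k₀)))))
    where
    iterate : ∀ i → f (g , expo (k₀ + + i)) ≡ (h , expo (c₀ + σ * + i))
    iterate zero = trans (cong (λ j → f (g , j)) (expo-cong (≡⇒≈ {k₀ + + 0}  {k₀} (solve 1 (λ a → a :+ con (+ 0) := a) refl k₀))))
        (trans eq (cong (h ,_) (expo-cong (≡⇒≈ {c₀}  {c₀ + σ * + 0} (solve 2 (λ a b → a := a :+ b :* con (+ 0)) refl c₀ σ)))))
    iterate (suc i) = trans (cong (λ j → f (g , j)) (expo-cong (≡⇒≈ {k₀ + (1ℤ + + i)}  {k₀ + + i + 1ℤ}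
        (solve 2 (λ a b → a :+ (con 1ℤ :+ b) := a :+ b :+ con 1ℤ) refl k₀ (+ i)))))
      (trans (Automorphism.rotate A {g} {k₀ + + i} {h} {c₀ + σ * + i} (iterate i))
          (cong (h ,_) (expo-cong (≡⇒≈ {c₀ + σ * + i + σ}  {c₀ + σ * (1ℤ + + i)}
          (solve 3 (λ a b c → a :+ b :* c :+ b := a :+ b :* (con 1ℤ :+ c)) refl c₀ σ (+ i))))))

  automorphism-∘ : ∀ {σ τ f f'} → Automorphism σ f → Automorphism τ f' → Automorphism (τ * σ) (f' ∘ f)
  automorphism-∘ {σ} {τ} {f} {f'} A B = record
    { rotate = λ {g} {k} {h} {c} eq → go g k h c (f (g , expo k)) refl eq
    ; reverse = λ δ → trans (cong f' (Automorphism.reverse A δ)) (Automorphism.reverse B (f δ)) }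
    where
    go : ∀ g k h c (δ : D) → f (g , expo k) ≡ δ → f' (f (g , expo k)) ≡ (h , expo c) → f' (f (g , expo (k + 1ℤ))) ≡ (h , expo (c + τ * σ))
    go g k h c (h₁ , j) eq eq' = let i = + toℕ j in
      trans (cong f' (Automorphism.rotate A {g} {k} {h₁} {i} (trans eq (cong (h₁ ,_) (sym (expo-toℕ j))))))
        (trans (at (carries-from B {h₁} {h} i c (trans (cong f' (trans (cong (h₁ ,_) (expo-toℕ j)) (sym eq))) eq')) (i + σ))
          (cong (h ,_) (expo-cong (≡⇒≈ {τ * (i + σ) + (c - τ * i)}  {c + τ * σ}
              (solve 4 (λ a b c d → a :* (b :+ c) :+ (d :- a :* b) := d :+ a :* c) refl τ i σ c)))))

  P : List ℤ → Dih n
  P W = el (exponent W) (kind W)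

  P-∷ : ∀ k W → P (k ∷ W) ≡ x (expo k) · P W
  P-∷ k W = sym (trans (cong (_· P W) (letter k)) (el-· (eˣ k) (sˣ k) (exponent W) (kind W)))

  carries-cong : ∀ {σ f g h c c'} → c ≈ c' [ + d ] → Carries σ f g h c → Carries σ f g h c'
  carries-cong {σ} {f} {g} {h} {c} {c'} x (carries K) = carries λ k → trans (K k) (cong (h ,_) (expo-cong (lc {σ * k + c}  {σ * k + c'} x
      (solve 4 (λ a b c d → a :* b :+ c :- (a :* b :+ d) := c :- d) refl σ k c c'))))

  carries-subst : ∀ {σ f g g' h h' c} → g ≡ g' → h ≡ h' → Carries σ f g h c → Carries σ f g' h' c
  carries-subst refl refl K = K

  -- Along one edge, the dart k at g goes to the dart k' at h, so its reverse goes to the reverse;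
  -- this single dart fixes the offset at the next vertex.
  walk : ∀ {σ f} → Automorphism σ f → ∀ {g h c W W' c'} → Carries σ f g h c → Shift σ c W W' c' → Carries σ f (g · P W) (h · P W') c'
  walk A {g} {h} K (done eq) = carries-subst (sym (·-identityʳ g)) (sym (·-identityʳ h)) (carries-cong eq K)
  walk {σ} {f} A {g} {h} {c} K (step {k = k} {k' = k'} {W = W} {W' = W'} l l' χk χk' eq r) =
    carries-subst (trans (·-assoc g (x (expo k)) (P W)) (cong (g ·_) (sym (P-∷ k W)))) (trans (·-assoc h (x (expo k')) (P W'))
        (cong (h ·_) (sym (P-∷ k' W')))) (walk A K₁ r)
    where
    image-k : f (g , expo k) ≡ (h , expo k')
    image-k = trans (at K k) (cong (h ,_) (expo-cong (≈-sym eq)))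
    moved : f (g · x (expo k) , expo l) ≡ (h · x (expo k') , expo l')
    moved = trans (cong (λ i → f (g · x (expo k) , i)) (sym (trans (inverse k) (expo-cong χk))))
      (trans (Automorphism.reverse A (g , expo k)) (trans (cong (Map.L (CM d x)) image-k) (cong (h · x (expo k') ,_) (trans (inverse k')
          (expo-cong χk')))))
    K₁ : Carries σ f (g · x (expo k)) (h · x (expo k')) (l' - σ * l)
    K₁ = carries-from A l l' moved

  walk-from-e : ∀ {σ f} → Automorphism σ f → ∀ {c W W' c'} → Carries σ f 1ᴰ 1ᴰ c → Shift σ c W W' c' → Carries σ f (P W) (P W') c'
  walk-from-e A {W = W} {W' = W'} K r = carries-subst (·-identityˡ (P W)) (·-identityˡ (P W')) (walk A K r)

module FromMap {n d : ℕ} (2≤n : 2 ℕ.≤ n) (d≢0 : NonZero d) .{{n-nz : NonZero n}} (x : Fin d → Dih n) (ok : ReflRegCM d x) where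
  private
    instance
      d-nonZero : NonZero d
      d-nonZero = d≢0
  open IsCayleyData (proj₁ ok) using (no-unit; generates) renaming (distinct to x-injective)

  eˣ χˣ : ℤ → ℤ
  eˣ k = + toℕ (proj₁ (x (expo k)))
  χˣ k = + toℕ (invIdx x (expo k))

  sˣ : ℤ → Bool
  sˣ k = proj₂ (x (expo k))

  letter : ∀ k → x (expo k) ≡ el (eˣ k) (sˣ k)
  letter k = sym (el-toℕ (x (expo k)))

  inverse : ∀ k → invIdx x (expo k) ≡ expo (χˣ k)
  inverse k = sym (expo-toℕ (invIdx x (expo k)))

  letter-χ : ∀ k → el (eˣ (χˣ k)) (sˣ (χˣ k)) ≡ el (eˣ k) (sˣ k) ⁻¹
  letter-χ k = trans (sym (letter (χˣ k))) (trans (cong x (sym (inverse k))) (trans (invIdx-spec x (proj₁ ok) (expo k)) (cong _⁻¹ (letter k))))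

  module W = Walks x eˣ sˣ χˣ letter inverse
  open Words (+ n) eˣ sˣ
  open Shifts (+ d) χˣ

  s-χ′ : ∀ k → sˣ (χˣ k) ≡ sˣ k
  s-χ′ k = trans (cong proj₂ (letter-χ k)) (kind⁻¹ (el (eˣ k) (sˣ k)))
    where
    kind⁻¹ : ∀ (g : Dih n) → proj₂ (g ⁻¹) ≡ proj₂ g
    kind⁻¹ (i , false) = refl
    kind⁻¹ (i , true) = refl

  distinct′ : ∀ {k l} → sˣ k ≡ sˣ l → eˣ k ≈ eˣ l [ + n ] → k ≈ l [ + d ]
  distinct′ {k} {l} eq h = expo-injective k l (x-injective (trans (letter k) (trans (el-cong h eq) (sym (letter l)))))

  χ-ref′ : ∀ {k} → sˣ k ≡ true → χˣ k ≈ k [ + d ]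
  χ-ref′ {k} z = let h , _ = el-injective (eˣ (χˣ k)) (eˣ k) (trans (letter-χ k) (trans (cong (λ t → el (eˣ k) t ⁻¹) z) (cong (el (eˣ k)) (sym z)))) in distinct′ {χˣ k} {k}
      (s-χ′ k) h

  e-χ′ : ∀ {k} → sˣ k ≡ false → eˣ (χˣ k) ≈ - eˣ k [ + n ]
  e-χ′ {k} y = proj₁ (el-injective (eˣ (χˣ k)) (- eˣ k) (trans (letter-χ k) (trans (cong (λ t → el (eˣ k) t ⁻¹) y) (el-rot⁻¹ (eˣ k)))))

  generates′ : ∀ p t → ∃[ W ] Val W p t
  generates′ p t = let ks , eq = generates (el p t) ; h , k = el-injective (exponent (map index ks)) p (trans (word ks) eq) in map index ks , val h k
    where
    index : Fin d → ℤ
    index i = + toℕ i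
    word : ∀ ks → W.P (map index ks) ≡ prod (map x ks)
    word [] = refl
    word (i ∷ ks) = trans (W.P-∷ (+ toℕ i) (map index ks)) (cong₂ _·_ (cong x (expo-toℕ i)) (word ks))

  -- Regularity moves the dart with index 0 at 1 to index c. For the reversing case the given
  -- reflection is followed by the rotation-preserving automorphism that brings the image of this
  -- dart to the desired place.
  automorphism : ∀ {σ} → Sign σ → ∀ c → ∃[ f ] (W.Automorphism σ f × W.Carries σ f 1ᴰ 1ᴰ c)
  automorphism pos c = let φ , eq = proj₁ (proj₂ ok) (1ᴰ , expo 0ℤ) (1ᴰ , expo c) ; A = W.OIso⇒automorphism φ in
    _ , A , W.carries-cong {1ℤ} {_} {1ᴰ} {1ᴰ} {c - 1ℤ * 0ℤ} {c} (≡⇒≈ (solve 1 (λ a → a :- con 1ℤ :* con 0ℤ := a) refl c)) (W.carries-from A 0ℤ c eq)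
  automorphism neg c =
    let ρ = proj₂ (proj₂ ok)
        φ , eq = proj₁ (proj₂ ok) (Inverse.to (RIso.bij ρ) (1ᴰ , expo 0ℤ)) (1ᴰ , expo c)
        A = W.automorphism-∘ (W.RIso⇒automorphism ρ) (W.OIso⇒automorphism φ)
    in _ , A , W.carries-cong { -1ℤ} {_} {1ᴰ} {1ᴰ} {c - -1ℤ * 0ℤ} {c} (≡⇒≈ (solve 1 (λ a → a :- con -1ℤ :* con 0ℤ := a) refl c)) (W.carries-from A 0ℤ c eq)

  -- Words with the same product lead from 1 to the same vertex, where the automorphism has only one
  -- image and one offset.
  law′ : ∀ {σ} → Sign σ → ∀ {c W₁ W₁' c₁ W₂ W₂' c₂ p t q₁ u₁ q₂ u₂} →
      Val W₁ p t → Val W₂ p t → Shift σ c W₁ W₁' c₁ → Shift σ c W₂ W₂' c₂ →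
      Val W₁' q₁ u₁ → Val W₂' q₂ u₂ → q₁ ≈ q₂ [ + n ] × u₁ ≡ u₂ × c₁ ≈ c₂ [ + d ]
  law′ {σ} sgn {c} {W₁} {W₁'} {c₁} {W₂} {W₂'} {c₂} {p} {t} {q₁} {u₁} {q₂} {u₂} (val x₁ y₁) (val x₂ y₂) sh₁ sh₂ (val x₁' y₁') (val x₂' y₂') =
    (lc (⊖ x₁' ⊕ x₂' ⊕ proj₁ elements) (solve 4 (λ a b c d → a :- b := :- c :+ d :+ c :- (:- a :+ b :+ d)) refl q₁ q₂ (exponent W₁')
        (exponent W₂'))) ,
    trans (sym y₁') (trans (proj₂ elements) y₂') ,
    (lc (expo-injective (σ * 0ℤ + c₁) (σ * 0ℤ + c₂) (cong proj₂ same))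
        (solve 3 (λ a b c → a :- b := c :* con 0ℤ :+ a :- (c :* con 0ℤ :+ b)) refl c₁ c₂ σ))
    where
    f = proj₁ (automorphism sgn c)
    A = proj₁ (proj₂ (automorphism sgn c))
    K = proj₂ (proj₂ (automorphism sgn c))
    same-start : W.P W₁ ≡ W.P W₂
    same-start = el-cong (≈-trans x₁ (≈-sym x₂)) (trans y₁ (sym y₂))
    same : (W.P W₁' , expo {d} (σ * 0ℤ + c₁)) ≡ (W.P W₂' , expo {d} (σ * 0ℤ + c₂))
    same = trans (sym (W.Carries.at (W.walk-from-e A K sh₁) 0ℤ)) (trans (cong (λ g → f (g , expo 0ℤ)) same-start)
        (W.Carries.at (W.walk-from-e A K sh₂) 0ℤ))
    elements : exponent W₁' ≈ exponent W₂' [ + n ] × kind W₁' ≡ kind W₂'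
    elements = el-injective (exponent W₁') (exponent W₂') (cong proj₁ same)

  system : System n d
  system = record
    { e = eˣ ; χ = χˣ ; s = sˣ ; n≢0 = ℕ.>-nonZero (ℕ.<-≤-trans (s≤s z≤n) 2≤n) ; d≢0 = d≢0
    ; s-cong = λ h → cong (λ i → proj₂ (x i)) (expo-cong h)
    ; e-cong = λ h → ≡⇒≈ (cong (λ i → + toℕ (proj₁ (x i))) (expo-cong h))
    ; χ-cong = λ h → ≡⇒≈ (cong (λ i → + toℕ (invIdx x i)) (expo-cong h))
    ; χχ = λ k → expo-injective (χˣ (χˣ k)) k (trans (sym (inverse (χˣ k))) (trans (cong (invIdx x) (sym (inverse k))) (invIdx-involutive x (proj₁ ok)
        (expo k))))
    ; s-χ = s-χ′ ; χ-ref = λ {k} → χ-ref′ {k} ; e-χ = λ {k} → e-χ′ {k} ; distinct = λ {k} {l} → distinct′ {k} {l}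
    ; nonunit = λ {k} y h → no-unit (expo k) (trans (letter k) (el-cong h y))
    ; generates = generates′ ; law = law′ }

OIso-sym : ∀ {M N} → OIso M N → OIso N M
OIso-sym {M} {N} φ = record
  { bij = mk↔ₛ′ from to (λ δ → Inverse.strictlyInverseʳ bij δ) (λ δ → Inverse.strictlyInverseˡ bij δ)
  ; pres-R = λ δ → flip (R N) (R M) pres-R δ ; pres-L = λ δ → flip (L N) (L M) pres-L δ }
  where
  open OIso φ
  to = Inverse.to bij
  from = Inverse.from bij
  flip : (a : Dart N → Dart N) (b : Dart M → Dart M) → (∀ δ → to (b δ) ≡ a (to δ)) → ∀ δ → from (a δ) ≡ b (from δ)
  flip a b h δ = trans (cong (λ z → from (a z)) (sym (Inverse.strictlyInverseˡ bij δ))) (trans (cong from (sym (h (from δ))))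
      (Inverse.strictlyInverseʳ bij _))

-- The condition on f has the form R f R = f; for the inverse bijection an R must be cancelled,
-- hence the injectivity.
RIso-sym : ∀ {M N} → (∀ {δ δ'} → R N δ ≡ R N δ' → δ ≡ δ') → RIso M N → RIso N M
RIso-sym {M} {N} R-injective φ = record
  { bij = mk↔ₛ′ from to (λ δ → Inverse.strictlyInverseʳ bij δ) (λ δ → Inverse.strictlyInverseˡ bij δ)
  ; rev-R = λ δ → trans (sym (Inverse.strictlyInverseʳ bij _))
      (cong from (R-injective (trans (rev-R (from (R N δ))) (Inverse.strictlyInverseˡ bij _))))
  ; pres-L = λ δ → trans (cong (λ z → from (L N z)) (sym (Inverse.strictlyInverseˡ bij δ))) (trans (cong from (sym (pres-L (from δ))))
      (Inverse.strictlyInverseʳ bij _)) }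
  where
  open RIso φ
  to = Inverse.to bij
  from = Inverse.from bij

module HomIso {n d : ℕ} .{{_ : NonZero n}} .{{_ : NonZero d}} (x x' : Fin d → Dih n) (C : IsCayleyData d x)
  (θ θ⁻ : Dih n → Dih n) (θ-· : ∀ g h → θ (g · h) ≡ θ g · θ h) (θ-⁻¹ : ∀ g → θ (g ⁻¹) ≡ θ g ⁻¹)
  (θθ⁻ : ∀ g → θ (θ⁻ g) ≡ g) (θ⁻θ : ∀ g → θ⁻ (θ g) ≡ g) {σ : ℤ} (sgn : Sign σ) (t : ℤ)
  (letters : ∀ i → θ (x' i) ≡ x (expo (σ * + toℕ i + t))) where
  open IsCayleyData C using (inv-closed) renaming (distinct to x-injective)

  τ τ⁻ : Fin d → Fin d
  τ i = expo (σ * + toℕ i + t)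
  τ⁻ i = expo (σ * (+ toℕ i - t))

  ττ⁻ : ∀ i → τ (τ⁻ i) ≡ i
  ττ⁻ i = let j = + toℕ i ; m = + toℕ (τ⁻ i) in trans (expo-cong (lc {σ * m + t}  {j} (σ ⊙ toℕ-expo (σ * (j - t)) ⊕ (j - t) ⊙ ≡⇒≈ (sign² sgn))
      (solve 4 (λ a b c d → a :* b :+ c :- d := a :* b :+ (d :- c) :* (a :* a) :- (a :* (a :* (d :- c)) :+ (d :- c) :* con 1ℤ)) refl σ m t j)))
      (expo-toℕ i)

  τ⁻τ : ∀ i → τ⁻ (τ i) ≡ i
  τ⁻τ i = let j = + toℕ i ; m = + toℕ (τ i) in trans (expo-cong (lc {σ * (m - t)}  {j} (σ ⊙ toℕ-expo (σ * j + t) ⊕ j ⊙ ≡⇒≈ (sign² sgn))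
      (solve 4 (λ a b c d → a :* (b :- c) :- d := a :* b :+ d :* (a :* a) :- (a :* (a :* d :+ c) :+ d :* con 1ℤ)) refl σ m t j))) (expo-toℕ i)

  invIdx-τ : ∀ i → τ (invIdx x' i) ≡ invIdx x (τ i)
  invIdx-τ i with any? (λ j → x' j ≟D (x' i ⁻¹))
  ... | yes (j , eq) = sym (invIdx-unique x C (trans (sym (letters j)) (trans (cong θ eq) (trans (θ-⁻¹ (x' i)) (cong _⁻¹ (letters i))))))
  -- Closure under inverses is transported from x: the inverse of x (τ i) pulls back to an inverse
  -- of x' i.
  ... | no none = let j , eq = inv-closed (τ i) in ⊥-elim (none (τ⁻ j ,
        trans (sym (θ⁻θ _)) (trans (cong θ⁻ (trans (letters (τ⁻ j)) (trans (cong x (ττ⁻ j)) (trans eq (trans (cong _⁻¹ (sym (letters i)))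
            (sym (θ-⁻¹ (x' i)))))))) (θ⁻θ _))))

  bijection : Dart (CM d x') ↔ Dart (CM d x)
  bijection = mk↔ₛ′ (λ (g , i) → θ g , τ i) (λ (g , i) → θ⁻ g , τ⁻ i)
    (λ (g , i) → cong₂ _,_ (θθ⁻ g) (ττ⁻ i)) (λ (g , i) → cong₂ _,_ (θ⁻θ g) (τ⁻τ i))

  L-part : ∀ δ → Inverse.to bijection (L (CM d x') δ) ≡ L (CM d x) (Inverse.to bijection δ)
  L-part (g , i) = cong₂ _,_ (trans (θ-· g (x' i)) (cong (θ g ·_) (letters i))) (invIdx-τ i)

  toℕ-csuc : ∀ i → + toℕ (csuc i) ≈ + toℕ i + 1ℤ [ + d ]
  toℕ-csuc i = ≈-trans (≡⇒≈ (cong (λ j → + toℕ j) (trans (cong csuc (sym (expo-toℕ i))) (csuc-expo (+ toℕ i))))) (toℕ-expo (+ toℕ i + 1ℤ))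

  iso : MapIso (CM d x) (CM d x')
  iso = go sgn refl
    where
    go : ∀ {σ'} → Sign σ' → σ ≡ σ' → MapIso (CM d x) (CM d x')
    go pos refl = inj₁ (OIso-sym record { bij = bijection ; pres-L = L-part
      ; pres-R = λ (g , i) → cong (θ g ,_) (sym (trans (csuc-expo (1ℤ * + toℕ i + t))
          (expo-cong (lc {1ℤ * + toℕ i + t + 1ℤ}  {1ℤ * + toℕ (csuc i) + t} (⊖ toℕ-csuc i)
          (solve 3 (λ a b c → con 1ℤ :* a :+ b :+ con 1ℤ :- (con 1ℤ :* c :+ b) := :- c :- :- (a :+ con 1ℤ)) refl (+ toℕ i) t
          (+ toℕ (csuc i))))))) })
    go neg refl = inj₂ (RIso-sym (λ {δ} {δ'} eq → cong₂ _,_ (cong proj₁ eq)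
        (csuc-injective (cong proj₂ eq))) record { bij = bijection ; pres-L = L-part
      ; rev-R = λ (g , i) → cong (θ g ,_) (trans (csuc-expo (-1ℤ * + toℕ (csuc i) + t))
          (expo-cong (lc { -1ℤ * + toℕ (csuc i) + t + 1ℤ}  { -1ℤ * + toℕ i + t} (⊖ toℕ-csuc i)
          (solve 3 (λ a b c → con -1ℤ :* a :+ b :+ con 1ℤ :- (con -1ℤ :* c :+ b) := :- a :- :- (c :+ con 1ℤ)) refl (+ toℕ (csuc i)) t
          (+ toℕ i))))) })

-- Isomorphisms onto the listed maps

-- All exponents of rotations are multiples of u, and those of reflections are j plus such
-- multiples, so u generates ℤ modulo n.
model-unit : ∀ {n d} (S : System n d) {e₀ s₀} (M : Model S e₀ s₀) → ∃[ q ] 1ℤ ≈ q * Model.u M [ + n ]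
model-unit {n} {d} S {e₀} {s₀} M = span₁ u j
    (λ k y → let i , lt , h = index k in e₀ i , ≈-trans (e-cong h) (≈-trans (rotations i lt (trans (sym (kinds i lt)) (trans (sym (s-cong h)) y)))
        (≡⇒≈ (solve 2 (λ a b → a :* b := b :* a) refl u (e₀ i)))))
    (λ k z → let i , lt , h = index k in e₀ i , ≈-trans (e-cong h) (≈-trans (reflections i lt (trans (sym (kinds i lt)) (trans (sym (s-cong h)) z)))
        (≡⇒≈ (solve 3 (λ a b c → a :* b :+ c := c :+ b :* a) refl u (e₀ i) j)))) 1ℤ
  where
  open System S
  open Generic S
  open Model M
  ρ : ℤ
  ρ = Model.σ M
  index : ∀ k → ∃[ i ] (i ℕ.< d × k ≈ ρ * + i + t [ + d ])
  index k = let i = (ρ * (k - t)) %ℕ d in i , n%ℕd<d (ρ * (k - t)) d ,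
    (lc (ρ ⊙ residue (ρ * (k - t)) d ⊕ (- ((k - t))) ⊙ ≡⇒≈ (sign² sign))
        (solve 4 (λ a b c d → a :- (b :* c :+ d) := b :* (b :* (a :- d)) :+ :- (a :- d) :* (b :* b) :- (b :* c :+ :- (a :- d) :* con 1ℤ)) refl k ρ
        (+ i) t))

module AffineAutomorphism {n : ℕ} .{{_ : NonZero n}} (u u' j : ℤ) (uu' : u * u' ≈ 1ℤ [ + n ]) where

  offset : Bool → ℤ
  offset t = if t then j else 0ℤ

  θ θ⁻ : Dih n → Dih n
  θ (i , t) = el (u * + toℕ i + offset t) t
  θ⁻ (i , t) = el (u' * (+ toℕ i - offset t)) t

  θ-el : ∀ p t → θ (el p t) ≡ el (u * p + offset t) t
  θ-el p t = let i = + toℕ (expo {n} p) in el-cong (lc {u * i + offset t}  {u * p + offset t} (u ⊙ toℕ-expo p)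
      (solve 4 (λ a b c d → a :* b :+ c :- (a :* d :+ c) := a :* b :- a :* d) refl u i (offset t) p)) refl

  θ⁻-el : ∀ p t → θ⁻ (el p t) ≡ el (u' * (p - offset t)) t
  θ⁻-el p t = let i = + toℕ (expo {n} p) in el-cong (lc {u' * (i - offset t)}  {u' * (p - offset t)} (u' ⊙ toℕ-expo p)
      (solve 4 (λ a b c d → a :* (b :- c) :- a :* (d :- c) := a :* b :- a :* d) refl u' i (offset t) p)) refl

  θ-· : ∀ g h → θ (g · h) ≡ θ g · θ h
  θ-· = Dih-elim _ λ p t → Dih-elim _ λ q v →
      trans (cong θ (el-· p t q v)) (trans (θ-el (signed-sum t p q) (t xor v))
        (sym (trans (cong₂ _·_ (θ-el p t) (θ-el q v)) (trans (el-· (u * p + offset t) t (u * q + offset v) v)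
            (el-cong (≡⇒≈ (distribute p q t v)) refl)))))
    where
    distribute : ∀ p q t v → signed-sum t (u * p + offset t) (u * q + offset v) ≡ u * signed-sum t p q + offset (t xor v)
    distribute p q false v = solve 4 (λ a b c d → a :* b :+ con 0ℤ :+ (a :* c :+ d) := a :* (b :+ c) :+ d) refl u p q (offset v)
    distribute p q true false = solve 4 (λ a b c d → a :* b :+ c :- (a :* d :+ con 0ℤ) := a :* (b :- d) :+ c) refl u p j q
    distribute p q true true = solve 4 (λ a b c d → a :* b :+ c :- (a :* d :+ c) := a :* (b :- d) :+ con 0ℤ) refl u p j q

  θ-⁻¹ : ∀ g → θ (g ⁻¹) ≡ θ g ⁻¹
  θ-⁻¹ = Dih-elim _ λ
    { p false → trans (cong θ (el-rot⁻¹ p)) (trans (θ-el (- p) false) (sym (trans (cong _⁻¹ (θ-el p false)) (trans (el-rot⁻¹ (u * p + 0ℤ))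
        (el-cong (≡⇒≈ { - (u * p + 0ℤ)}  {u * (- p) + 0ℤ} (solve 2 (λ a b → :- (a :* b :+ con 0ℤ) := a :* :- b :+ con 0ℤ) refl u p)) refl)))))
    ; p true → trans (θ-el p true) (sym (cong _⁻¹ (θ-el p true))) }

  θθ⁻ : ∀ g → θ (θ⁻ g) ≡ g
  θθ⁻ = Dih-elim _ λ p t → trans (cong θ (θ⁻-el p t)) (trans (θ-el (u' * (p - offset t)) t) (el-cong (lc {u * (u' * (p - offset t)) + offset t}  {p}
      ((p - offset t) ⊙ uu') (solve 4 (λ a b c d → a :* (b :* (c :- d)) :+ d :- c := (c :- d) :* (a :* b) :- (c :- d) :* con 1ℤ) refl u u' p
      (offset t))) refl))

  θ⁻θ : ∀ g → θ⁻ (θ g) ≡ g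
  θ⁻θ = Dih-elim _ λ p t → trans (cong θ⁻ (θ-el p t)) (trans (θ⁻-el (u * p + offset t) t) (el-cong (lc {u' * (u * p + offset t - offset t)}  {p}
      (p ⊙ uu') (solve 4 (λ a b c d → a :* (b :* c :+ d :- d) :- c := c :* (b :* a) :- c :* con 1ℤ) refl u' u p (offset t))) refl))

model⇒iso : ∀ {n d d'} (2≤n : 2 ℕ.≤ n) (d≢0 : NonZero d) .{{_ : NonZero n}} (x : Fin d → Dih n) (ok : ReflRegCM d x) {e₀ s₀} →
  Model (FromMap.system 2≤n d≢0 x ok) e₀ s₀ → d ≡ d' → (x' : Fin d' → Dih n) → (∀ i → x' i ≡ el (e₀ (toℕ i)) (s₀ (toℕ i))) → MapIso (CM d x)
      (CM d' x')
model⇒iso {n} {d} 2≤n d≢0 x ok {e₀} {s₀} M refl x' x'≡ = HomIso.iso {{_}} {{d≢0}} x x' (proj₁ ok) θ θ⁻ θ-· θ-⁻¹ θθ⁻ θ⁻θ sign t letters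
  where
  open FromMap 2≤n d≢0 x ok using (system; letter)
  open System system using (e)
  open Model M
  unit : u * proj₁ (model-unit system M) ≈ 1ℤ [ + n ]
  unit = let q = proj₁ (model-unit system M) in (lc (⊖ proj₂ (model-unit system M))
      (solve 2 (λ a b → a :* b :- con 1ℤ := :- con 1ℤ :- :- (b :* a)) refl u q))
  open AffineAutomorphism {n} u (proj₁ (model-unit system M)) j unit
  letters : ∀ i → θ (x' i) ≡ x (expo {{d≢0}} (Model.σ M * + toℕ i + t))
  letters i = trans (cong θ (x'≡ i)) (trans (θ-el (e₀ (toℕ i)) (s₀ (toℕ i))) (trans (el-cong (≈-sym (exponents (s₀ (toℕ i)) refl))
      (sym (kinds (toℕ i) (toℕ<n i)))) (sym (letter (Model.σ M * + toℕ i + t)))))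
    where
    exponents : ∀ b → s₀ (toℕ i) ≡ b → e (Model.σ M * + toℕ i + t) ≈ u * e₀ (toℕ i) + offset (s₀ (toℕ i)) [ + n ]
    exponents false h = ≈-trans (rotations (toℕ i) (toℕ<n i) h) (≈-trans (≡⇒≈ {u * e₀ (toℕ i)}  {u * e₀ (toℕ i) + 0ℤ}
        (solve 2 (λ a b → a :* b := a :* b :+ con 0ℤ) refl u (e₀ (toℕ i)))) (≡⇒≈ (cong (λ b → u * e₀ (toℕ i) + offset b) (sym h))))
    exponents true h = ≈-trans (reflections (toℕ i) (toℕ<n i) h) (≡⇒≈ (cong (λ b → u * e₀ (toℕ i) + offset b) (sym h)))

∀Dih? : ∀ {n} {P : Dih n → Set} → (∀ g → Dec (P g)) → Dec (∀ g → P g)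
∀Dih? P? = map′ (λ { (f , g) (i , false) → f i ; (f , g) (i , true) → g i }) (λ f → (λ i → f (i , false)) , (λ i → f (i , true)))
  (all? (λ i → P? (i , false)) ×-dec all? (λ i → P? (i , true)))

-- For n = 2 the set X may consist of a rotation and a reflection, and no automorphism a ↦ a^u, b ↦
-- a^j b exchanges these kinds. All automorphisms of the Klein four-group are used; the cases are
-- few enough to be decided by computation.
module Klein where

  θ θ⁻ : Dih 2 → Dih 2 → Dih 2 → Dih 2
  θ y z (Fin.zero , false) = 1ᴰ
  θ y z (Fin.zero , true) = y
  θ y z (Fin.suc Fin.zero , true) = z
  θ y z (Fin.suc Fin.zero , false) = z · y
  θ⁻ y z g = if-equal (g ≟D 1ᴰ) 1ᴰ (if-equal (g ≟D y) (refl' 0ℤ) (if-equal (g ≟D z) (refl' 1ℤ) (rot 1ℤ)))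
    where
    if-equal : ∀ {A : Set} → Dec A → Dih 2 → Dih 2 → Dih 2
    if-equal (yes _) a b = a
    if-equal (no _) a b = b

  IsIsomorphism : Dih 2 → Dih 2 → Set
  IsIsomorphism y z = (∀ g h → θ y z (g · h) ≡ θ y z g · θ y z h) × (∀ g → θ y z (g ⁻¹) ≡ θ y z g ⁻¹) × (∀ g → θ y z (θ⁻ y z g) ≡ g) ×
      (∀ g → θ⁻ y z (θ y z g) ≡ g)

  isIsomorphism? : ∀ y z → Dec (IsIsomorphism y z)
  isIsomorphism? y z = ∀Dih? (λ g → ∀Dih? (λ h → _ ≟D _)) ×-dec ∀Dih? (λ g → _ ≟D _) ×-dec ∀Dih? (λ g → _ ≟D _) ×-dec ∀Dih? (λ g → _ ≟D _)

  isIsomorphism : ∀ y z → y ≢ 1ᴰ → z ≢ 1ᴰ → y ≢ z → IsIsomorphism y z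
  isIsomorphism = toWitness {a? = ∀Dih? (λ y → ∀Dih? (λ z → ¬? (y ≟D 1ᴰ) →-dec (¬? (z ≟D 1ᴰ) →-dec (¬? (y ≟D z) →-dec isIsomorphism? y z))))} _

  iso : (x : Fin 2 → Dih 2) → IsCayleyData 2 x → MapIso (CM 2 x) (CM 2 p₀)
  iso x C = let θ-· , θ-⁻¹ , θθ⁻ , θ⁻θ = isIsomorphism y z (no-unit Fin.zero) (no-unit (Fin.suc Fin.zero)) (λ eq → 0≢1 (distinct eq)) in
      HomIso.iso x p₀ C (θ y z) (θ⁻ y z) θ-· θ-⁻¹ θθ⁻ θ⁻θ pos 0ℤ (λ { Fin.zero → refl ; (Fin.suc Fin.zero) → refl })
    where
    open IsCayleyData C
    y z : Dih 2
    y = x Fin.zero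
    z = x (Fin.suc Fin.zero)
    0≢1 : Fin.zero ≢ Fin.suc (Fin.zero {0})
    0≢1 ()

toModEq : ∀ {n a b} → a ≈ b [ + n ] → ModEq n a b
toModEq {n} {a} {b} (mod≈ q eq) = ∣⇒∣ᵤ {+ n} {a - b} (divides q eq)

fromModEq : ∀ {n a b} → ModEq n a b → a ≈ b [ + n ]
fromModEq {n} {a} {b} h = let divides q eq = ∣ᵤ⇒∣ {+ n} {a - b} h in mod≈ q eq

MapIso-to : ∀ {n d} .{{_ : NonZero n}} → (Fin d → Dih n) → ∀ d' → (Fin d' → Dih n) → Set
MapIso-to {d = d} x d' x' = MapIso (CM d x) (CM d' x')

halve : ∀ {n} k → n ≡ k ℕ.+ k → ℕ.⌊ n /2⌋ ≡ k
halve k refl = sym (ℕ.n≡⌊n+n/2⌋ k)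

-- The only link from a system back to the map; given this link, the classification runs on `System`
-- alone.
Realises : ∀ {n d} .{{_ : NonZero n}} → (Fin d → Dih n) → System n d → Set
Realises {n} {d} x S = ∀ {d' e₀ s₀} → Model S e₀ s₀ → d ≡ d' → (x' : Fin d' → Dih n) → (∀ i → x' i ≡ el (e₀ (toℕ i)) (s₀ (toℕ i))) → MapIso (CM d x)
    (CM d' x')

-- Classification by valency

module Classify {n d : ℕ} (2≤n : 2 ℕ.≤ n) .{{_ : NonZero n}} (x : Fin d → Dih n) (S : System n d) (realises : Realises x S) where

  open System S using (s; e; χ; s-cong; χ-cong; χχ; s-χ; e-χ; e-cong; χ-ref)
  open Generic S
  open Periodicity S
  open PatternTheorem S

  at : ℤ → System n d
  at k = reindex S pos k

  χ-at : ∀ k → System.χ (at k) 0ℤ ≈ χ k - k [ + d ]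
  χ-at k = lc (χ-cong (≡⇒≈ (solve 1 (λ a → con 1ℤ :* con 0ℤ :+ a := a) refl k)))
      (solve 3 (λ a b c → con 1ℤ :* (a :- b) :- (c :- b) := a :- c) refl (χ (1ℤ * 0ℤ + k)) k (χ k))

  s-at : ∀ k l {b} → s (k + l) ≡ b → s (1ℤ * l + k) ≡ b
  s-at k l h = trans (s-cong (≡⇒≈ (solve 2 (λ a b → con 1ℤ :* a :+ b := b :+ a) refl l k))) h

  s-at₀ : ∀ {k b} → s k ≡ b → s (1ℤ * 0ℤ + k) ≡ b
  s-at₀ {k} h = trans (s-cong (≡⇒≈ (solve 1 (λ a → con 1ℤ :* con 0ℤ :+ a := a) refl k))) h

  type-period-at : ∀ k {v} → TypePeriod v → Periodicity.TypePeriod (at k) v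
  type-period-at k {v} T m = trans (s-cong (≡⇒≈ (solve 3 (λ a b c → con 1ℤ :* (a :+ b) :+ c := con 1ℤ :* a :+ c :+ b) refl m v k))) (T (1ℤ * m + k))

  period-at : ∀ k {v} → Period v → Periodicity.Period (at k) v
  period-at k {v} P m = type-period-at k (λ m → proj₁ (P m)) m ,
    (lc (χ-cong (≡⇒≈ (solve 3 (λ a b c → con 1ℤ :* (a :+ b) :+ c := con 1ℤ :* a :+ c :+ b) refl m v k)) ⊕ proj₂ (P (1ℤ * m + k)))
        (solve 5 (λ a b c d e → con 1ℤ :* (a :- b) :- (con 1ℤ :* (c :- b) :+ d) := a :+ e :- (e :+ (c :+ d))) refl (χ (1ℤ * (m + v) + k)) k
        (χ (1ℤ * m + k)) v (χ ((1ℤ * m + k) + v))))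

  iso-to : ∀ {d'} k {e₀ s₀} → Model (at k) e₀ s₀ → d ≡ d' → (x' : Fin d' → Dih n) → (∀ i → x' i ≡ el (e₀ (toℕ i)) (s₀ (toℕ i))) → MapIso (CM d x)
      (CM d' x')
  iso-to k M = realises (model-reindex S pos k M)

  module Single {k} (y : s k ≡ false) (fixed : χ k ≈ k [ + d ]) (only : ∀ j → s j ≡ false → j ≈ k [ + d ]) where
    χ0 : System.χ (at k) 0ℤ ≈ 0ℤ [ + d ]
    χ0 = ≈-trans (χ-at k) (lc fixed (solve 2 (λ a b → a :- b :- con 0ℤ := a :- b) refl (χ k) k))
    only₀ : ∀ j → System.s (at k) j ≡ false → j ≈ 0ℤ [ + d ]
    only₀ j yj = lc (only (1ℤ * j + k) yj) (solve 2 (λ a b → a :- con 0ℤ := con 1ℤ :* a :+ b :- b) refl j k)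

  AlternatingIso : Set
  AlternatingIso = (2 ℕ.∣ n × MapIso-to x n p₂) ⊎ (8 ℕ.∣ n × MapIso-to x n p₃)

  alternating-iso : ∀ k → s k ≡ false → s (k + 1ℤ) ≡ true → TypePeriod (+ 2) → AlternatingIso
  -- The alternating pattern is normalised with a reflection at 0 and a rotation at 1, hence the
  -- origin k - 1.
  alternating-iso k y z T = go (alternating-pattern (at (k - 1ℤ)) (trans (s-cong (≡⇒≈
      (solve 1 (λ a → con 1ℤ :* con 0ℤ :+ (a :- con 1ℤ) := a :+ con 1ℤ :+ :- con (+ 2)) refl k))) (trans (type-period-neg T (k + 1ℤ)) z))
      (trans (s-cong (≡⇒≈ (solve 1 (λ a → con 1ℤ :* con 1ℤ :+ (a :- con 1ℤ) := a) refl k))) y) (type-period-at (k - 1ℤ) T))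
    where
    p₂≡ : ∀ i → p₂ {n} i ≡ el (+ toℕ i) (isEven (toℕ i))
    p₂≡ i with isEven (toℕ i)
    ... | true = refl
    ... | false = refl
    p₃≡ : ∀ i → p₃ {n} i ≡ el (p₃-exponent ℕ.⌊ n /2⌋ (toℕ i)) (isEven (toℕ i))
    p₃≡ i with isEven (toℕ i)
    ... | true = refl
    ... | false = refl
    go : AlternatingResult (at (k - 1ℤ)) → AlternatingIso
    go (inj₁ (2∣n , d≡n , M)) = inj₁ (2∣n , iso-to (k - 1ℤ) M d≡n p₂ p₂≡)
    go (inj₂ (8∣n , d≡n , M)) = inj₂ (8∣n , iso-to (k - 1ℤ) M d≡n p₃ p₃≡)

  CosetIso : Set
  CosetIso = (∃[ k ] (s k ≡ false × s (k + 1ℤ) ≡ true × TypePeriod (+ 2))) ⊎ (d ≡ 6 × (∃[ k ] (1 ℕ.≤ k × n ≡ 4 ℕ.* k ℕ.+ 2)) × MapIso-to x 6 p₆)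

  coset-iso : ∀ k → s k ≡ false → ¬ χ k ≈ k [ + d ] → (χ k - k) + (χ k - k) ≈ 0ℤ [ + d ] → (∀ j → s j ≡ false → Period (j - k)) → CosetIso
  coset-iso k y moved w-doubled periods = go (coset-pattern (at k) (s-at₀ y) (λ h → moved (lc (≈-trans (≈-sym (χ-at k)) h)
      (solve 2 (λ a b → a :- b := a :- b :- con 0ℤ) refl (χ k) k)))
      (≈-trans (χ-at k ⊕ χ-at k) w-doubled) (λ j yj → period-at k (period-cong (≡⇒≈ (solve 2 (λ a b → con 1ℤ :* a :+ b :- b := a) refl j k))
          (periods (1ℤ * j + k) yj))))
    where
    go : (System.s (at k) 1ℤ ≡ true × Periodicity.TypePeriod (at k) (+ 2)) ⊎ (d ≡ 6 × ∃[ l ] (1 ℕ.≤ l × n ≡ 4 ℕ.* l ℕ.+ 2 × Model (at k)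
        (p₆-exponent (+ (2 ℕ.* l ℕ.+ 1))) p₆-kind)) → CosetIso
    go (inj₁ (z , T)) = inj₁ (k , y , trans (s-cong (≡⇒≈ (solve 1 (λ a → a :+ con 1ℤ := con 1ℤ :* con 1ℤ :+ a) refl k))) z ,
      (λ m → trans (s-cong (≡⇒≈ (solve 2 (λ a b → a :+ con (+ 2) := con 1ℤ :* (a :- b :+ con (+ 2)) :+ b) refl m k))) (trans (T (m - k)) (s-cong (≡⇒≈
          (solve 2 (λ a b → con 1ℤ :* (a :- b) :+ b := a) refl m k))))))
    go (inj₂ (d≡6 , l , 1≤l , n≡ , M)) = inj₂ (d≡6 , (l , 1≤l , n≡) , iso-to k M d≡6 p₆ p₆≡)
      where
      half : + ℕ.⌊ n /2⌋ ≡ + (2 ℕ.* l ℕ.+ 1)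
      half = cong +_ (halve _ (trans n≡ (solveℕ 1 (λ k → conℕ 4 ⊠ k ⊞ conℕ 2 :≡ (conℕ 2 ⊠ k ⊞ conℕ 1) ⊞ (conℕ 2 ⊠ k ⊞ conℕ 1)) refl l)))
      p₆≡ : ∀ i → p₆ {n} i ≡ el (p₆-exponent (+ (2 ℕ.* l ℕ.+ 1)) (toℕ i)) (p₆-kind (toℕ i))
      p₆≡ i = subst (λ m → p₆ {n} i ≡ el (p₆-exponent m (toℕ i)) (p₆-kind (toℕ i))) half (table i)
        where
        table : ∀ i → p₆ {n} i ≡ el (p₆-exponent (+ ℕ.⌊ n /2⌋) (toℕ i)) (p₆-kind (toℕ i))
        table Fin.zero = refl
        table (Fin.suc Fin.zero) = refl
        table (Fin.suc (Fin.suc Fin.zero)) = refl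
        table (Fin.suc (Fin.suc (Fin.suc Fin.zero))) = refl
        table (Fin.suc (Fin.suc (Fin.suc (Fin.suc Fin.zero)))) = refl
        table (Fin.suc (Fin.suc (Fin.suc (Fin.suc (Fin.suc Fin.zero))))) = refl

  LargeValency : Set
  LargeValency = (∃[ ℓ ] (Cond₁ n ℓ d × MapIso-to x d (p₁ ℓ d)))
    ⊎ (2 ℕ.∣ n × MapIso-to x n p₂)
    ⊎ (8 ℕ.∣ n × MapIso-to x n p₃)
    ⊎ ((∃[ k ] (1 ℕ.≤ k × n ≡ 3 ℕ.* k)) × MapIso-to x 4 p₄)
    ⊎ ((∃[ k ] (1 ℕ.≤ k × n ≡ 8 ℕ.* k ℕ.+ 4)) × MapIso-to x 6 p₅)
    ⊎ ((∃[ k ] (1 ℕ.≤ k × n ≡ 4 ℕ.* k ℕ.+ 2)) × MapIso-to x 6 p₆)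

  large-valency : 4 ℕ.≤ d → LargeValency
  large-valency 4≤d = by-rotation rotation?
    where
    alternating-case : AlternatingIso → LargeValency
    alternating-case (inj₁ r) = inj₂ (inj₁ r)
    alternating-case (inj₂ r) = inj₂ (inj₂ (inj₁ r))
    coset-case : CosetIso → LargeValency
    coset-case (inj₁ (k , y , z , T)) = alternating-case (alternating-iso k y z T)
    coset-case (inj₂ (_ , r)) = inj₂ (inj₂ (inj₂ (inj₂ (inj₂ r))))
    by-pattern : Pattern → LargeValency
    by-pattern (single k y fixed only) = ⊥-elim (SingleRotation.valency<4 (at k) (s-at₀ y) χ0 only₀ 4≤d)
      where open Single y fixed only
    by-pattern (alternating k y z T) = alternating-case (alternating-iso k y z T)
    by-pattern (coset k y moved h periods) = coset-case (coset-iso k y moved h periods)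
    by-pattern (yyz k y χk z P d∣) = go (3-or-6 (PatternYYZ.6≈0 (at k) (s-at₀ y) χ0 (s-at k (+ 2) z) (period-at k P)) d∣)
      where
      χ0 : System.χ (at k) 0ℤ ≈ 1ℤ [ + 3 ]
      χ0 = ≈-trans (≈-coarsen d∣ (χ-at k)) (lc χk (solve 2 (λ a b → a :- b :- con 1ℤ := a :- (b :+ con 1ℤ)) refl (χ k) k))
      six : ∀ {d} (T : System n d) → d ≡ 6 → System.s T 0ℤ ≡ false → System.s T (+ 2) ≡ true → Periodicity.Period T (+ 3) →
          System.χ T 0ℤ ≈ 1ℤ [ + 3 ] →
        ∃[ l ] (1 ℕ.≤ l × n ≡ 8 ℕ.* l ℕ.+ 4 × Model T (p₅-exponent (+ (4 ℕ.* l ℕ.+ 2))) p₅-kind)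
      six T refl y z P = YYZ₆.result T y z P
      go : d ≡ 3 ⊎ d ≡ 6 → LargeValency
      go (inj₁ refl) = ⊥-elim (ℕ.<⇒≱ (s≤s (s≤s (s≤s (s≤s z≤n)))) 4≤d)
      go (inj₂ d≡6) = conclude (six (at k) d≡6 (s-at₀ y) (s-at k (+ 2) z) (period-at k P) χ0)
        where
        conclude : ∃[ l ] (1 ℕ.≤ l × n ≡ 8 ℕ.* l ℕ.+ 4 × Model (at k) (p₅-exponent (+ (4 ℕ.* l ℕ.+ 2))) p₅-kind) → LargeValency
        conclude (l , 1≤l , n≡ , M) = inj₂ (inj₂ (inj₂ (inj₂ (inj₁ ((l , 1≤l , n≡) , iso-to k M d≡6 p₅ p₅≡)))))
          where
          half : + ℕ.⌊ n /2⌋ ≡ + (4 ℕ.* l ℕ.+ 2)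
          half = cong +_ (halve _ (trans n≡ (solveℕ 1 (λ k → conℕ 8 ⊠ k ⊞ conℕ 4 :≡ (conℕ 4 ⊠ k ⊞ conℕ 2) ⊞ (conℕ 4 ⊠ k ⊞ conℕ 2)) refl l)))
          table : ∀ i → p₅ {n} i ≡ el (p₅-exponent (+ ℕ.⌊ n /2⌋) (toℕ i)) (p₅-kind (toℕ i))
          table Fin.zero = refl
          table (Fin.suc Fin.zero) = refl
          table (Fin.suc (Fin.suc Fin.zero)) = refl
          table (Fin.suc (Fin.suc (Fin.suc Fin.zero))) = refl
          table (Fin.suc (Fin.suc (Fin.suc (Fin.suc Fin.zero)))) = refl
          table (Fin.suc (Fin.suc (Fin.suc (Fin.suc (Fin.suc Fin.zero))))) = refl
          p₅≡ : ∀ i → p₅ {n} i ≡ el (p₅-exponent (+ (4 ℕ.* l ℕ.+ 2)) (toℕ i)) (p₅-kind (toℕ i))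
          p₅≡ i = subst (λ m → p₅ {n} i ≡ el (p₅-exponent m (toℕ i)) (p₅-kind (toℕ i))) half (table i)
    by-pattern (yyzz k y χk z z' P d∣) = inj₂ (inj₂ (inj₂ (inj₁ (three 3∣n , iso-to k model d≡4 p₄ p₄≡))))
      where
      open YYZZ (at k) (s-at₀ y) (≈-trans (≈-coarsen d∣ (χ-at k)) (lc χk (solve 2 (λ a b → a :- b :- con 1ℤ := a :- (b :+ con 1ℤ)) refl (χ k) k)))
          (s-at k (+ 2) z) (s-at k (+ 3) z') (period-at k P) d∣
      three : 3 ℕ.∣ n → ∃[ k ] (1 ℕ.≤ k × n ≡ 3 ℕ.* k)
      three (ℕ.divides zero refl) = ⊥-elim (ℕ.<⇒≱ 2≤n z≤n)
      three (ℕ.divides (suc q) eq) = suc q , s≤s z≤n , trans eq (ℕ.*-comm (suc q) 3)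
      p₄≡ : ∀ i → p₄ {n} i ≡ el (p₄-exponent (toℕ i)) (p₄-kind (toℕ i))
      p₄≡ Fin.zero = refl
      p₄≡ (Fin.suc Fin.zero) = refl
      p₄≡ (Fin.suc (Fin.suc Fin.zero)) = refl
      p₄≡ (Fin.suc (Fin.suc (Fin.suc Fin.zero))) = refl
    by-rotation : (∃[ k ] s k ≡ false) ⊎ (∀ k → s k ≡ true) → LargeValency
    by-rotation (inj₁ (k , y)) = by-pattern (pattern-theorem k y)
    by-rotation (inj₂ all) = inj₁ (ℓ , (toModEq {n} ℓ²≈1 , ℕ.≤-trans (s≤s z≤n) 4≤d , toModEq geom-d ,
        λ d' 1≤d' d'<d h → below-modulus≉0 1≤d' d'<d (geom≈0⇒index d' (fromModEq h))) , realises model refl (p₁ ℓ d) (λ _ → refl))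
      where open AllReflections S all

module Classify₃ {n : ℕ} (2≤n : 2 ℕ.≤ n) .{{_ : NonZero n}} (x : Fin 3 → Dih n) (S : System n 3) (realises : Realises x S) where
  open Classify 2≤n x S realises
  open System S using (s; χ)
  open Generic S
  open Periodicity S
  open PatternTheorem S

  Valency₃ : Set
  Valency₃ = MapIso (CM 3 x) (CM 3 q₂) ⊎ MapIso (CM 3 x) (CM 3 q₃) ⊎ MapIso (CM 3 x) (CM 3 q₄)

  -- The parameter n of the target is determined only up to a proven equality.
  transport : ∀ {m} (m≡ : n ≡ m) .{{_ : NonZero m}} (x' : Fin 3 → Dih m) → (∀ (y' : Fin 3 → Dih n) → (∀ i → subst Dih m≡ (y' i) ≡ x' i) → MapIso
      (CM 3 x) (CM 3 y')) → MapIso (CM 3 x) (CM 3 x')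
  transport refl x' f = f x' (λ _ → refl)

  el-subst : ∀ {m} (m≡ : n ≡ m) .{{_ : NonZero m}} p t → subst Dih m≡ (el {n} p t) ≡ el {m} p t
  el-subst refl p t = refl

  subst-injective : ∀ {m} (m≡ : n ≡ m) {a b : Dih n} → subst Dih m≡ a ≡ subst Dih m≡ b → a ≡ b
  subst-injective refl eq = eq

  -- The valency 3 is always a type period, so 1 = 3 - 2 would be one too.
  no-type-period-2 : ∀ {k} → s k ≡ false → ¬ TypePeriod (+ 2)
  no-type-period-2 y T = no-unit-type-period y (type-period-- type-period-d T)

  valency₃ : Valency₃
  valency₃ = by-rotation rotation?
    where
    to : ∀ {m} (m≡ : n ≡ m) .{{_ : NonZero m}} k {e₀ s₀} → Model (at k) e₀ s₀ → (x' : Fin 3 → Dih m) → (∀ i → x' i ≡ el (e₀ (toℕ i)) (s₀ (toℕ i))) →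
        MapIso (CM 3 x) (CM 3 x')
    to m≡ k {e₀} {s₀} M x' x'≡ = transport m≡ x' (λ y' h → iso-to k M refl y' (λ i → subst-injective m≡
        (trans (h i) (trans (x'≡ i) (sym (el-subst m≡ (e₀ (toℕ i)) (s₀ (toℕ i))))))))
    coset-case : CosetIso → Valency₃
    coset-case (inj₁ (k , y , z , T)) = ⊥-elim (no-type-period-2 y T)
    coset-case (inj₂ (() , _))
    by-pattern : Pattern → Valency₃
    by-pattern (single k y fixed only) = let n≡2 , M = single-rotation₃ (at k) 2≤n (s-at₀ y) χ0 only₀ in
        inj₁ (to n≡2 k M q₂ (λ { Fin.zero → refl ; (Fin.suc Fin.zero) → refl ; (Fin.suc (Fin.suc Fin.zero)) → refl }))
      where open Single y fixed only
    by-pattern (alternating k y z T) = ⊥-elim (no-type-period-2 y T)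
    by-pattern (coset k y moved h periods) = coset-case (coset-iso k y moved h periods)
    by-pattern (yyz k y χk z P d∣) = inj₂ (inj₂ (to (n≡4 2≤n) k model q₄ (λ { Fin.zero → refl ; (Fin.suc Fin.zero) → refl ;
        (Fin.suc (Fin.suc Fin.zero)) → refl })))
      where open YYZ₃ (at k) (s-at₀ y) (≈-trans (χ-at k) (lc χk (solve 2 (λ a b → a :- b :- con 1ℤ := a :- (b :+ con 1ℤ)) refl (χ k) k)))
                (s-at k (+ 2) z)
    by-pattern (yyzz k y χk z z' P d∣) = ⊥-elim (distinct-by-computation d∣)
    by-rotation : (∃[ k ] s k ≡ false) ⊎ (∀ k → s k ≡ true) → Valency₃
    by-rotation (inj₁ (k , y)) = by-pattern (pattern-theorem k y)
    by-rotation (inj₂ all) = inj₂ (inj₁ (transport n≡3 q₃ (λ y' h → realises model refl y' (λ i → subst-injective n≡3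
        (trans (h i) (trans (table i) (sym (el-subst n≡3 (geom ℓ (toℕ i)) true))))))))
      where
      open AllReflections S all
      -- From 1 + ℓ + ℓ² = 0 and ℓ² = 1 follows ℓ = -2; squaring gives 4 = 1, which forces n = 3.
      ℓ≈-2 : ℓ ≈ - (+ 2) [ + n ]
      ℓ≈-2 = lc (geom-d ⊕ ⊖ ℓ²≈1) (solve 1 (λ a → a :- :- con (+ 2) := con 0ℤ :+ con 1ℤ :+ a :* con 1ℤ :+ a :* (a :* con 1ℤ) :+ :- (a :* a) :- (con 0ℤ :+ :- con 1ℤ)) refl ℓ)
      3≈0 : + 3 ≈ 0ℤ [ + n ]
      3≈0 = lc (ℓ²≈1 ⊕ (- ℓ) ⊙ ℓ≈-2 ⊕ (+ 2) ⊙ ℓ≈-2)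
          (solve 1 (λ a → con (+ 3) :- con 0ℤ := a :* a :+ :- a :* a :+ con (+ 2) :* a :- (con 1ℤ :+ :- a :* :- con (+ 2) :+ con (+ 2) :* :- con
          (+ 2))) refl ℓ)
      n≡3 : n ≡ 3
      n≡3 = go 2≤n (≈0⇒∣ 3≈0)
        where
        go : ∀ {n} → 2 ℕ.≤ n → n ℕ.∣ 3 → n ≡ 3
        go {1} (s≤s ()) _
        go {2} _ (ℕ.divides 0 ())
        go {2} _ (ℕ.divides 1 ())
        go {2} _ (ℕ.divides (suc (suc q)) ())
        go {3} _ _ = refl
        go {suc (suc (suc (suc _)))} _ h = ⊥-elim (ℕ.<⇒≱ (s≤s (s≤s (s≤s (s≤s z≤n)))) (ℕ.∣⇒≤ h))
      table : ∀ i → q₃ i ≡ el {3} (geom ℓ (toℕ i)) true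
      table Fin.zero = refl
      table (Fin.suc Fin.zero) = refl
      table (Fin.suc (Fin.suc Fin.zero)) = el-cong (lc {+ 2}  {0ℤ + 1ℤ + ℓ * 1ℤ} (⊖ subst (λ n → ℓ ≈ - (+ 2) [ + n ]) n≡3 ℓ≈-2 ⊕ modulus≈0)
          (solve 1 (λ a → con (+ 2) :- (con 0ℤ :+ con 1ℤ :+ a :* con 1ℤ) := :- a :+ con (+ 3) :- (:- (:- con (+ 2)) :+ con 0ℤ)) refl ℓ)) refl

-- If one of the two generators is a rotation, it is its own inverse and generates ⟨a⟩, so n = 2;
-- this is the case treated in `Klein`.
valency₂ : ∀ {n} (2≤n : 2 ℕ.≤ n) .{{_ : NonZero n}} (x : Fin 2 → Dih n) → IsCayleyData 2 x → (S : System n 2) → Realises x S → MapIso (CM 2 x)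
    (CM {n} 2 p₀)
valency₂ {n} 2≤n x C S realises = by-rotation rotation?
  where
  open System S
  open Generic S
  klein : ∀ {n} .{{_ : NonZero n}} (x : Fin 2 → Dih n) → IsCayleyData 2 x → n ≡ 2 → MapIso (CM 2 x) (CM {n} 2 p₀)
  klein x C refl = Klein.iso x C
  by-rotation : (∃[ k ] s k ≡ false) ⊎ (∀ k → s k ≡ true) → MapIso (CM 2 x) (CM {n} 2 p₀)
  by-rotation (inj₂ all) = realises (AllReflections.model S all) refl p₀ (λ { Fin.zero → refl ; (Fin.suc Fin.zero) → refl })
  by-rotation (inj₁ (k , y)) = klein x C (order-2⇒n≡2 2≤n e-doubled (span₁ (e k) (e z)
      (λ j yj → 1ℤ , ≈-trans (e-cong (same-class yj y)) (≡⇒≈ (solve 1 (λ a → a := con 1ℤ :* a) refl (e k)))) (λ j zj → 0ℤ , ≈-trans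
          (e-cong (same-class′ zj zz)) (≡⇒≈ (solve 2 (λ a b → a := a :+ con 0ℤ :* b) refl (e z) (e k)))) 1ℤ))
    where
    z : ℤ
    z = proj₁ reflection-exists
    zz : s z ≡ true
    zz = proj₂ reflection-exists
    dichotomy : ∀ i j → i ≈ j [ + 2 ] ⊎ i ≈ j + 1ℤ [ + 2 ]
    dichotomy i j = go (parity (i - j))
      where
      go : ∃[ q ] (i - j ≡ + 2 * q ⊎ i - j ≡ + 2 * q + 1ℤ) → i ≈ j [ + 2 ] ⊎ i ≈ j + 1ℤ [ + 2 ]
      go (q , inj₁ h) = inj₁ (lc (≡⇒≈ h ⊕ q ⊙ modulus≈0)
          (solve 3 (λ a b c → a :- b := a :- b :+ c :* con (+ 2) :- (con (+ 2) :* c :+ c :* con 0ℤ)) refl i j q))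
      go (q , inj₂ h) = inj₂ (lc (≡⇒≈ h ⊕ q ⊙ modulus≈0)
          (solve 3 (λ a b c → a :- (b :+ con 1ℤ) := a :- b :+ c :* con (+ 2) :- (con (+ 2) :* c :+ con 1ℤ :+ c :* con 0ℤ)) refl i j q))
    differ : ∀ {i j} → s i ≢ s j → i ≈ j + 1ℤ [ + 2 ]
    differ {i} {j} h = go (dichotomy i j)
      where
      go : i ≈ j [ + 2 ] ⊎ i ≈ j + 1ℤ [ + 2 ] → i ≈ j + 1ℤ [ + 2 ]
      go (inj₁ eq) = ⊥-elim (h (s-cong eq))
      go (inj₂ eq) = eq
    same-class : ∀ {i j} → s i ≡ false → s j ≡ false → i ≈ j [ + 2 ]
    same-class {i} {j} yi yj = lc (differ {i} {z} (λ eq → bool-absurd (trans (sym eq) yi) zz) ⊕ ⊖ differ {j} {z} (λ eq → bool-absurd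
        (trans (sym eq) yj) zz)) (solve 3 (λ a b c → a :- b := a :+ :- b :- (c :+ con 1ℤ :+ :- (c :+ con 1ℤ))) refl i j z)
    same-class′ : ∀ {i j} → s i ≡ true → s j ≡ true → i ≈ j [ + 2 ]
    same-class′ {i} {j} zi zj = lc (differ {i} {k} (λ eq → bool-absurd (trans eq y) zi) ⊕ ⊖ differ {j} {k} (λ eq → bool-absurd (trans eq y) zj))
        (solve 3 (λ a b c → a :- b := a :+ :- b :- (c :+ con 1ℤ :+ :- (c :+ con 1ℤ))) refl i j k)
    e-doubled : e k + e k ≈ 0ℤ [ + n ]
    e-doubled = lc (e-χ y ⊕ ⊖ e-cong (same-class (trans (s-χ k) y) y)) (solve 2 (λ a b → a :+ a :- con 0ℤ := b :+ :- b :- (:- a :+ :- a)) refl (e k)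
        (e (χ k)))

-- Regularity and reflexibility of families (1)–(3)

-- The data of a `System` without its automorphisms, which are now to be constructed; the two words
-- ensure generation.
record Family {n d : ℕ} .{{_ : NonZero n}} (x : Fin d → Dih n) : Set where
  field
    e χ : ℤ → ℤ
    s : ℤ → Bool
    e-cong : ∀ {k l} → k ≈ l [ + d ] → e k ≈ e l [ + n ]
    s-cong : ∀ {k l} → k ≈ l [ + d ] → s k ≡ s l
    χ-cong : ∀ {k l} → k ≈ l [ + d ] → χ k ≈ χ l [ + d ]
    letters : ∀ i → x i ≡ el (e (+ toℕ i)) (s (+ toℕ i))
    χ-rot : ∀ k → s k ≡ false → s (χ k) ≡ false × e (χ k) ≈ - e k [ + n ]
    χ-ref : ∀ k → s k ≡ true → χ k ≈ k [ + d ]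
    distinct : ∀ {k l} → s k ≡ s l → e k ≈ e l [ + n ] → k ≈ l [ + d ]
    nonunit : ∀ k → s k ≡ false → ¬ e k ≈ 0ℤ [ + n ]
    rotation-word : ∃[ W ] Words.Val (+ n) e s W 1ℤ false
    reflection-word : ∃[ W ] ∃[ q ] Words.Val (+ n) e s W q true

  -- An orientation-reversing automorphism (g , k) ↦ (φ g , - k + c g), where φ (a^p b^t) = a^(F p t) b^(G p t).
  record Reversal (r : ℤ) : Set where
    field
      F c : ℤ → Bool → ℤ
      G : ℤ → Bool → Bool
      F-cong : ∀ t {p q} → p ≈ q [ + n ] → F p t ≈ F q t [ + n ]
      G-cong : ∀ t {p q} → p ≈ q [ + n ] → G p t ≡ G q t
      c-cong : ∀ t {p q} → p ≈ q [ + n ] → c p t ≈ c q t [ + d ]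
      F-start : F 0ℤ false ≈ 0ℤ [ + n ]
      G-start : G 0ℤ false ≡ false
      c-start : c 0ℤ false ≈ r [ + d ]
      F-step : ∀ p t k → F (signed-sum t p (e k)) (t xor s k) ≈ signed-sum (G p t) (F p t) (e (- k + c p t)) [ + n ]
      G-step : ∀ p t k → G (signed-sum t p (e k)) (t xor s k) ≡ G p t xor s (- k + c p t)
      c-step : ∀ p t k → c (signed-sum t p (e k)) (t xor s k) ≈ χ (- k + c p t) + χ k [ + d ]

module FamilyMap {n d : ℕ} (2≤n : 2 ℕ.≤ n) (d≢0 : NonZero d) .{{n-nz : NonZero n}} (x : Fin d → Dih n) (Φ : Family x) where
  open Family Φ
  private
    instance
      d-nonZero : NonZero d
      d-nonZero = d≢0
      n-nonZero : NonZero n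
      n-nonZero = ℕ.>-nonZero (ℕ.<-≤-trans (s≤s z≤n) 2≤n)

  open Words (+ n) e s using (Val; val; exponent; kind; power; val-power; val-++; val-≈)
  open Shifts (+ d) χ

  letter : ∀ k → x (expo k) ≡ el (e k) (s k)
  letter k = trans (letters (expo k)) (el-cong (e-cong (toℕ-expo k)) (s-cong (toℕ-expo k)))

  letter-χ : ∀ k → el (e (χ k)) (s (χ k)) ≡ el (e k) (s k) ⁻¹
  letter-χ k = go (s k) refl
    where
    go : ∀ b → s k ≡ b → el (e (χ k)) (s (χ k)) ≡ el (e k) (s k) ⁻¹
    go false y = trans (el-cong (proj₂ (χ-rot k y)) (proj₁ (χ-rot k y))) (sym (trans (cong (λ t → el (e k) t ⁻¹) y) (el-rot⁻¹ (e k))))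
    go true z = trans (el-cong (e-cong (χ-ref k z)) (trans (s-cong (χ-ref k z)) z)) (sym (cong (λ t → el (e k) t ⁻¹) z))

  index : Fin d → ℤ
  index i = + toℕ i

  word-product : ∀ W → prod (Data.List.map x (Data.List.map expo W)) ≡ el (exponent W) (kind W)
  word-product [] = refl
  word-product (k ∷ W) = trans (cong₂ _·_ (letter k) (word-product W)) (el-· (e k) (s k) (exponent W) (kind W))

  words : ∀ p t → ∃[ W ] Val W p t
  words p false = let A , a = rotation-word ; r = p %ℕ n in power r A , val-≈ (val-power r a) (lc (⊖ residue p n)
      (solve 2 (λ a b → a :* con 1ℤ :- b := :- b :- :- a) refl (+ r) p))
  words p true = let A , a = rotation-word ; B , q , b = reflection-word ; r = (p - q) %ℕ n in
    power r A ++ B , val-≈ (val-++ (val-power r a) b) (lc (⊖ residue (p - q) n)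
        (solve 3 (λ a b c → a :* con 1ℤ :+ b :- c := :- (c :- b) :- :- a) refl (+ r) q p))

  cayley : IsCayleyData d x
  cayley = record
    { distinct = λ {i} {j} eq → let h , k = el-injective (e (index i)) (e (index j)) (trans (sym (letters i)) (trans eq (letters j))) in toℕ-injective-≈
        (distinct {index i} {index j} k h)
    ; no-unit = λ i eq → let h , k = el-injective (e (index i)) 0ℤ (trans (sym (letters i)) eq) in nonunit (index i) k h
    ; inv-closed = λ i → expo (χ (index i)) , trans (letter (χ (index i))) (trans (letter-χ (index i)) (cong _⁻¹ (sym (letters i))))
    ; generates = λ g → let W , val h k = words (+ toℕ (proj₁ g)) (proj₂ g) in Data.List.map expo W , trans (word-product W) (trans (el-cong h k)
        (el-toℕ g)) }

  inverse : ∀ k → invIdx x (expo k) ≡ expo (χ k)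
  inverse k = invIdx-unique x cayley (trans (letter (χ k)) (trans (letter-χ k) (cong _⁻¹ (sym (letter k)))))

  module W = Walks x e s χ letter inverse
  open W using (D; Automorphism; Carries; carries; P; walk-from-e; automorphism-∘; carries-cong)

  module FromReversal {r : ℤ} (ρ : Reversal r) where
    open Reversal ρ

    f : D → D
    f ((i , t) , j) = el (F (+ toℕ i) t) (G (+ toℕ i) t) , expo (- + toℕ j + c (+ toℕ i) t)

    f-el : ∀ p t k → f (el p t , expo k) ≡ (el (F p t) (G p t) , expo (- k + c p t))
    f-el p t k = let p' = + toℕ (expo {n} p) ; k' = + toℕ (expo {d} k) in
      cong₂ _,_ (el-cong (F-cong t (toℕ-expo p)) (G-cong t (toℕ-expo p))) (expo-cong (lc { - k' + c p' t}  { - k + c p t} (c-cong t (toℕ-expo p) ⊕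
          ⊖ toℕ-expo k) (solve 4 (λ a b c d → :- a :+ b :- (:- c :+ d) := b :+ :- a :- (d :+ :- c)) refl k' (c p' t) k (c p t))))

    automorphism : Automorphism -1ℤ f
    automorphism = record
      { rotate = λ {g} {k} {h} {c₀} → Dih-elim (λ g → f (g , expo k) ≡ (h , expo c₀) → f (g , expo (k + 1ℤ)) ≡ (h , expo (c₀ + -1ℤ)))
          (λ p t eq → let eq' = trans (sym (f-el p t k)) eq in trans (f-el p t (k + 1ℤ)) (cong₂ _,_ (cong proj₁ eq')
              (expo-cong (lc { - (k + 1ℤ) + c p t}  {c₀ + -1ℤ} (expo-injective (- k + c p t) c₀ (cong proj₂ eq'))
              (solve 3 (λ a b c → :- (a :+ con 1ℤ) :+ b :- (c :+ con -1ℤ) := :- a :+ b :- c) refl k (c p t) c₀))))) g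
      ; reverse = λ { (g , j) → subst (λ j → f (Map.L (CM d x) (g , j)) ≡ Map.L (CM d x) (f (g , j))) (expo-toℕ j)
          (Dih-elim (λ g → f (Map.L (CM d x) (g , expo (index j))) ≡ Map.L (CM d x) (f (g , expo (index j)))) (λ p t → reverse-el p t
          (index j)) g) } }
      where
      reverse-el : ∀ p t k → f (Map.L (CM d x) (el p t , expo k)) ≡ Map.L (CM d x) (f (el p t , expo k))
      reverse-el p t k = let k' = - k + c p t ; p' = signed-sum t p (e k) ; t' = t xor s k in
        trans (cong f (cong₂ _,_ (trans (cong (el p t ·_) (letter k)) (el-· p t (e k) (s k))) (inverse k)))
          (trans (f-el p' t' (χ k))
            (trans (cong₂ _,_ (el-cong (F-step p t k) (G-step p t k)) (expo-cong (lc { - χ k + c p' t'}  {χ k'} (c-step p t k)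
                (solve 3 (λ a b c → :- a :+ b :- c := b :- (c :+ a)) refl (χ k) (c p' t') (χ k')))))
              (sym (trans (cong (Map.L (CM d x)) (f-el p t k)) (cong₂ _,_ (trans (cong (el (F p t) (G p t) ·_) (letter k')) (el-· (F p t) (G p t)
                  (e k') (s k'))) (inverse k'))))))

    start : Carries -1ℤ f 1ᴰ 1ᴰ r
    start = carries λ k → trans (f-el 0ℤ false k) (cong₂ _,_ (el-cong F-start G-start) (expo-cong (lc { - k + c 0ℤ false}  { -1ℤ * k + r} c-start
        (solve 3 (λ a b c → :- a :+ b :- (con -1ℤ :* a :+ c) := b :- c) refl k (c 0ℤ false) r))))

  -- An automorphism fixing all darts at 1 is the identity, since the map is connected.
  rigid : ∀ {f} → Automorphism 1ℤ f → Carries 1ℤ f 1ᴰ 1ᴰ 0ℤ → ∀ δ → f δ ≡ δ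
  rigid {f} A K (g , j) = let W , val h k = words (+ toℕ (proj₁ g)) (proj₂ g) ; g≡ = trans (el-cong h k) (el-toℕ g) in
      subst (λ j → f (g , j) ≡ (g , j)) (expo-toℕ j) (subst (λ g → f (g , expo (index j)) ≡ (g , expo (index j))) g≡
        (trans (Carries.at (walk-from-e A K (stay W)) (index j)) (cong (P W ,_) (expo-cong (≡⇒≈ {1ℤ * index j + 0ℤ}  {index j}
            (solve 1 (λ a → con 1ℤ :* a :+ con 0ℤ := a) refl (index j)))))))
    where
    stay : ∀ W → Shift 1ℤ 0ℤ W W 0ℤ
    stay [] = done ≈-refl
    stay (k ∷ W) = step (χ k) (χ k) ≈-refl ≈-refl (≡⇒≈ (solve 1 (λ a → a := con 1ℤ :* a :+ con 0ℤ) refl k)) (shift-start (≡⇒≈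
        (solve 1 (λ a → a :- con 1ℤ :* a := con 0ℤ) refl (χ k))) (stay W))

  compose-start : ∀ {σ τ f f' a b} → Carries σ f 1ᴰ 1ᴰ a → Carries τ f' 1ᴰ 1ᴰ b → ∀ k → f' (f (1ᴰ , expo k)) ≡ (1ᴰ , expo (τ * (σ * k + a) + b))
  compose-start {σ} {f' = f'} {a = a} K L k = trans (cong f' (Carries.at K k)) (Carries.at L (σ * k + a))

  translation : Dih n → OIso (CM d x) (CM d x)
  translation h = record
    { bij = mk↔ₛ′ (λ { (g , i) → h · g , i }) (λ { (g , i) → (h ⁻¹) · g , i })
        (λ { (g , i) → cong (_, i) (trans (sym (·-assoc h (h ⁻¹) g)) (trans (cong (_· g) (·-inverseʳ h)) (·-identityˡ g))) })
        (λ { (g , i) → cong (_, i) (trans (sym (·-assoc (h ⁻¹) h g)) (trans (cong (_· g) (·-inverseˡ h)) (·-identityˡ g))) })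
    ; pres-R = λ _ → refl ; pres-L = λ { (g , i) → cong (_, invIdx x i) (sym (·-assoc h g (x i))) } }

  OIso-∘ : OIso (CM d x) (CM d x) → OIso (CM d x) (CM d x) → OIso (CM d x) (CM d x)
  OIso-∘ φ ψ = record
    { bij = mk↔ₛ′ (λ δ → to ψ (to φ δ)) (λ δ → from φ (from ψ δ))
        (λ δ → trans (cong (to ψ) (Inverse.strictlyInverseˡ (OIso.bij φ) _)) (Inverse.strictlyInverseˡ (OIso.bij ψ) δ))
        (λ δ → trans (cong (from φ) (Inverse.strictlyInverseʳ (OIso.bij ψ) _)) (Inverse.strictlyInverseʳ (OIso.bij φ) δ))
    ; pres-R = λ δ → trans (cong (to ψ) (OIso.pres-R φ δ)) (OIso.pres-R ψ _) ; pres-L = λ δ → trans (cong (to ψ) (OIso.pres-L φ δ))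
        (OIso.pres-L ψ _) }
    where
    to from : OIso (CM d x) (CM d x) → D → D
    to φ = Inverse.to (OIso.bij φ)
    from φ = Inverse.from (OIso.bij φ)

  -- The square of a reversal fixes all darts at 1, so it is the identity by `rigid`. Bijectivity
  -- thus comes for free: a reversal is its own inverse, and the rotation ρ₁ ρ₀ has inverse ρ₀ ρ₁.
  module TwoReversals {r : ℤ} (ρ₀ : Reversal r) (ρ₁ : Reversal (r + 1ℤ)) where
    module A = FromReversal ρ₀
    module B = FromReversal ρ₁

    involutive : ∀ {q} (ρ : Reversal q) → ∀ δ → FromReversal.f ρ (FromReversal.f ρ δ) ≡ δ
    involutive {q} ρ = rigid (automorphism-∘ automorphism automorphism) (carries λ k → trans (compose-start start start k)
        (cong (1ᴰ ,_) (expo-cong (≡⇒≈ { -1ℤ * (-1ℤ * k + q) + q}  {1ℤ * k + 0ℤ}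
        (solve 2 (λ a b → con -1ℤ :* (con -1ℤ :* a :+ b) :+ b := con 1ℤ :* a :+ con 0ℤ) refl k q)))))
      where open FromReversal ρ

    rotate⇒rev-R : ∀ (g : Dih n) j → Map.R (CM d x) (A.f (g , csuc j)) ≡ A.f (g , j)
    rotate⇒rev-R g j = go (A.f (g , j)) refl
      where
      go : ∀ δ → A.f (g , j) ≡ δ → Map.R (CM d x) (A.f (g , csuc j)) ≡ A.f (g , j)
      go (h , i) eq = trans (cong (λ j' → Map.R (CM d x) (A.f (g , j'))) (trans (cong csuc (sym (expo-toℕ j))) (csuc-expo (index j))))
        (trans (cong (Map.R (CM d x)) (Automorphism.rotate A.automorphism {g} {index j} {h} {index i} (trans (cong (λ j → A.f (g , j)) (expo-toℕ j))
            (trans eq (cong (h ,_) (sym (expo-toℕ i)))))))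
          (trans (cong (h ,_) (trans (csuc-expo (index i + -1ℤ)) (trans (expo-cong (≡⇒≈ {index i + -1ℤ + 1ℤ}  {index i}
              (solve 1 (λ a → a :+ con -1ℤ :+ con 1ℤ := a) refl (index i)))) (expo-toℕ i)))) (sym eq)))

    reflection : RIso (CM d x) (CM d x)
    reflection = record { bij = mk↔ₛ′ A.f A.f (involutive ρ₀) (involutive ρ₀) ; rev-R = λ { (g , j) →
        rotate⇒rev-R g j } ; pres-L = Automorphism.reverse A.automorphism }

    rotation : OIso (CM d x) (CM d x)
    rotation = record
      { bij = mk↔ₛ′ (λ δ → B.f (A.f δ)) (λ δ → A.f (B.f δ)) (λ δ → trans (cong B.f (involutive ρ₀ (B.f δ))) (involutive ρ₁ δ))
          (λ δ → trans (cong A.f (involutive ρ₁ (A.f δ))) (involutive ρ₀ δ))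
      ; pres-R = λ { (g , j) → pres-R g j (B.f (A.f (g , j))) refl } ; pres-L = Automorphism.reverse AB }
      where
      AB : Automorphism 1ℤ (λ δ → B.f (A.f δ))
      AB = automorphism-∘ A.automorphism B.automorphism
      pres-R : ∀ g j δ → B.f (A.f (g , j)) ≡ δ → B.f (A.f (g , csuc j)) ≡ Map.R (CM d x) (B.f (A.f (g , j)))
      pres-R g j (h , i) eq = trans (cong (λ j' → B.f (A.f (g , j'))) (trans (cong csuc (sym (expo-toℕ j))) (csuc-expo (index j))))
        (trans (Automorphism.rotate AB {g} {index j} {h} {index i} (trans (cong (λ j → B.f (A.f (g , j))) (expo-toℕ j))
            (trans eq (cong (h ,_) (sym (expo-toℕ i))))))
          (sym (trans (cong (Map.R (CM d x)) eq) (cong (h ,_) (trans (cong csuc (sym (expo-toℕ i))) (csuc-expo (index i)))))))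

    rotations : ∀ m → Σ (OIso (CM d x) (CM d x)) λ φ → ∀ k → Inverse.to (OIso.bij φ) (1ᴰ , expo k) ≡ (1ᴰ , expo (k + + m))
    rotations zero = translation 1ᴰ , λ k → cong₂ _,_ (·-identityˡ 1ᴰ) (expo-cong (≡⇒≈ {k}  {k + + 0} (solve 1 (λ a → a := a :+ con (+ 0)) refl k)))
    rotations (suc m) = let φ , h = rotations m in OIso-∘ rotation φ , λ k →
      trans (cong (Inverse.to (OIso.bij φ)) (trans (compose-start A.start B.start k)
          (cong (1ᴰ ,_) (expo-cong (≡⇒≈ { -1ℤ * (-1ℤ * k + r) + (r + 1ℤ)}  {k + 1ℤ}
          (solve 2 (λ a b → con -1ℤ :* (con -1ℤ :* a :+ b) :+ (b :+ con 1ℤ) := a :+ con 1ℤ) refl k r))))))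
        (trans (h (k + 1ℤ)) (cong (1ᴰ ,_) (expo-cong {a = k + 1ℤ + + m} {b = k + + suc m} (≡⇒≈
            (solve 2 (λ a b → a :+ con 1ℤ :+ b := a :+ (con 1ℤ :+ b)) refl k (+ m))))))

    -- Translate g to 1, rotate there, and translate 1 to h.
    regular : Regular (CM d x)
    regular (g , i) (h , j) = let m = (index j - index i) %ℕ d ; φ , eq = rotations m in
      OIso-∘ (translation (g ⁻¹)) (OIso-∘ φ (translation h)) ,
      trans (cong (λ δ → Inverse.to (OIso.bij (translation h)) (Inverse.to (OIso.bij φ) δ)) (cong₂ _,_ (·-inverseˡ g) (sym (expo-toℕ i))))
        (trans (cong (Inverse.to (OIso.bij (translation h))) (eq (index i)))
          (cong₂ _,_ (·-identityʳ h) (trans (expo-cong (lc {index i + + m}  {index j} (⊖ residue (index j - index i) d)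
              (solve 3 (λ a b c → a :+ b :- c := :- (c :- a) :- :- b) refl (index i) (+ m) (index j)))) (expo-toℕ j))))

    reflRegCM : ReflRegCM d x
    reflRegCM = cayley , regular , reflection

-- When k ↦ r - k respects kinds and inverses, the reversal is the group automorphism a ↦ a^v, b ↦
-- a^j b, with constant offset r.
hom-reversal : ∀ {n d} .{{_ : NonZero n}} {x : Fin d → Dih n} (Φ : Family x) → let open Family Φ in (v j r : ℤ) →
  (∀ k → s (- k + r) ≡ s k) → (∀ k → χ (- k + r) ≈ - χ k + r [ + d ]) →
  (∀ k → s k ≡ false → e (- k + r) ≈ v * e k [ + n ]) → (∀ k → s k ≡ true → e (- k + r) ≈ v * e k + j [ + n ]) → Reversal r
hom-reversal {n} Φ v j r kinds inverses rots refs = record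
  { F = λ p t → v * p + offset t ; G = λ p t → t ; c = λ p t → r
  ; F-cong = λ t {p} {q} h → (lc (v ⊙ h) (solve 4 (λ a b c d → a :* b :+ c :- (a :* d :+ c) := a :* b :- a :* d) refl v p
      (offset t) q)) ; G-cong = λ t h → refl ; c-cong = λ t h → ≈-refl
  ; F-start = (≡⇒≈ (solve 1 (λ a → a :* con 0ℤ :+ con 0ℤ := con 0ℤ) refl v)) ; G-start = refl ; c-start = ≈-refl
  ; F-step = λ p t k → F-step p t k (s k) refl
  ; G-step = λ p t k → cong (t xor_) (sym (kinds k))
  ; c-step = λ p t k → (lc (⊖ inverses k) (solve 3 (λ a b c → a :- (b :+ c) := :- b :- :- (:- c :+ a)) refl r (χ (- k + r)) (χ k))) }
  where
  open Family Φ
  offset : Bool → ℤ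
  offset t = if t then j else 0ℤ
  F-step : ∀ p t k b → s k ≡ b → v * signed-sum t p (e k) + offset (t xor s k) ≈ signed-sum t (v * p + offset t) (e (- k + r)) [ + n ]
  F-step p false k false y = ≈-trans (≡⇒≈ (cong (λ b → v * (p + e k) + offset b) y)) (lc (⊖ rots k y)
      (solve 4 (λ a b c d → a :* (b :+ c) :+ con 0ℤ :- (a :* b :+ con 0ℤ :+ d) := :- d :- :- (a :* c)) refl v p (e k) (e (- k + r))))
  F-step p false k true z = ≈-trans (≡⇒≈ (cong (λ b → v * (p + e k) + offset b) z)) (lc (⊖ refs k z)
      (solve 5 (λ a b c d e → a :* (b :+ c) :+ d :- (a :* b :+ con 0ℤ :+ e) := :- e :- :- (a :* c :+ d)) refl v p (e k) j (e (- k + r))))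
  F-step p true k false y = ≈-trans (≡⇒≈ (cong (λ b → v * (p - e k) + offset (not b)) y)) (lc (rots k y)
      (solve 5 (λ a b c d e → a :* (b :- c) :+ d :- (a :* b :+ d :- e) := e :- a :* c) refl v p (e k) j (e (- k + r))))
  F-step p true k true z = ≈-trans (≡⇒≈ (cong (λ b → v * (p - e k) + offset (not b)) z)) (lc (refs k z)
      (solve 5 (λ a b c d e → a :* (b :- c) :+ con 0ℤ :- (a :* b :+ d :- e) := e :- (a :* c :+ d)) refl v p (e k) j (e (- k + r))))

ℤ-induction : (P : ℤ → Set) → P 0ℤ → (∀ k → P k → P (k + 1ℤ)) → (∀ k → P (k + 1ℤ) → P k) → ∀ k → P k
ℤ-induction P P0 up down (+ zero) = P0
ℤ-induction P P0 up down (+ suc i) = subst P (cong +_ (ℕ.+-comm i 1)) (up (+ i) (ℤ-induction P P0 up down (+ i)))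
ℤ-induction P P0 up down -[1+ zero ] = down -[1+ zero ] P0
ℤ-induction P P0 up down -[1+ suc i ] = down -[1+ suc i ] (ℤ-induction P P0 up down -[1+ i ])

-- Family (1): all generators reflections

module Family₁ {n : ℕ} (2≤n : 2 ℕ.≤ n) .{{_ : NonZero n}} (ℓ : ℤ) (d : ℕ) (cond : Cond₁ n ℓ d) where

  ℓ²≈1 : ℓ * ℓ ≈ 1ℤ [ + n ]
  ℓ²≈1 = fromModEq (proj₁ cond)

  d≢0 : NonZero d
  d≢0 = ℕ.>-nonZero (proj₁ (proj₂ cond))

  -- The recursion e (k + 1) = 1 + ℓ e k, continued to negative indices; because ℓ² = 1, the
  -- continuation is e (-k) = - ℓ e k.
  e : ℤ → ℤ
  e (+ i) = geom ℓ i
  e -[1+ i ] = - (ℓ * geom ℓ (suc i))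

  e-suc : ∀ k → e (k + 1ℤ) ≈ 1ℤ + ℓ * e k [ + n ]
  e-suc (+ i) = ≡⇒≈ (trans (cong (geom ℓ) (ℕ.+-comm i 1)) (geom-suc ℓ i))
  e-suc -[1+ zero ] = lc ℓ²≈1 (solve 1 (λ a → con 0ℤ :- (con 1ℤ :+ a :* :- (a :* (con 0ℤ :+ con 1ℤ))) := a :* a :- con 1ℤ) refl ℓ)
  e-suc -[1+ suc i ] = lc (geom ℓ (suc (suc i)) ⊙ ℓ²≈1 ⊕ ≡⇒≈ (geom-suc ℓ (suc i)))
      (solve 3 (λ a b c → :- (a :* b) :- (con 1ℤ :+ a :* :- (a :* c)) := c :* (a :* a) :+ c :- (c :* con 1ℤ :+ (con 1ℤ :+ a :* b))) refl ℓ
      (geom ℓ (suc i)) (geom ℓ (suc (suc i))))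

  e-suc⁻ : ∀ k → e k ≈ ℓ * (e (k + 1ℤ) - 1ℤ) [ + n ]
  e-suc⁻ k = lc ((- ℓ) ⊙ e-suc k ⊕ (- e k) ⊙ ℓ²≈1)
      (solve 3 (λ a b c → a :- b :* (c :- con 1ℤ) := :- b :* c :+ :- a :* (b :* b) :- (:- b :* (con 1ℤ :+ b :* a) :+ :- a :* con 1ℤ)) refl (e k) ℓ
      (e (k + 1ℤ)))

  -- The recursion can be run in both directions. Hence d is a period of e, and distinctness reduces
  -- to the minimality of d.
  propagate : ∀ {k l} → e k ≈ e l [ + n ] → ∀ m → e (k + m) ≈ e (l + m) [ + n ]
  propagate {k} {l} h = ℤ-induction (λ m → e (k + m) ≈ e (l + m) [ + n ])
      (≈-trans (reindexed (solve 1 (λ a → a :+ con 0ℤ := a) refl k)) (≈-trans h (reindexed (solve 1 (λ a → a := a :+ con 0ℤ) refl l))))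
      (λ m x → ≈-trans (reindexed (solve 2 (λ a b → a :+ (b :+ con 1ℤ) := a :+ b :+ con 1ℤ) refl k m)) (≈-trans (e-suc (k + m)) (≈-trans (lc (ℓ ⊙ x)
          (solve 3 (λ a b c → con 1ℤ :+ a :* b :- (con 1ℤ :+ a :* c) := a :* b :- a :* c) refl ℓ (e (k + m)) (e (l + m))))
          (≈-trans (≈-sym (e-suc (l + m))) (reindexed (solve 2 (λ a b → a :+ b :+ con 1ℤ := a :+ (b :+ con 1ℤ)) refl l m))))))
      (λ m x → ≈-trans (e-suc⁻ (k + m)) (≈-trans (lc (ℓ ⊙ ≈-trans (reindexed (solve 2 (λ a b → a :+ b :+ con 1ℤ := a :+ (b :+ con 1ℤ)) refl k m))
          (≈-trans x (reindexed (solve 2 (λ a b → a :+ (b :+ con 1ℤ) := a :+ b :+ con 1ℤ) refl l m))))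
          (solve 3 (λ a b c → a :* (b :- con 1ℤ) :- a :* (c :- con 1ℤ) := a :* b :- a :* c) refl ℓ (e ((k + m) + 1ℤ)) (e ((l + m) + 1ℤ))))
          (≈-sym (e-suc⁻ (l + m)))))
    where
    reindexed : ∀ {i j} → i ≡ j → e i ≈ e j [ + n ]
    reindexed eq = ≡⇒≈ (cong e eq)

  e-d : e (+ d) ≈ 0ℤ [ + n ]
  e-d = fromModEq (proj₁ (proj₂ (proj₂ cond)))

  e-+d : ∀ k → e (k + + d) ≈ e k [ + n ]
  e-+d k = ≈-trans (≡⇒≈ (cong e (solve 2 (λ a b → a :+ b := b :+ a) refl k (+ d)))) (≈-trans (propagate {+ d} {0ℤ} e-d k) (≡⇒≈ (cong e
      (solve 1 (λ a → con 0ℤ :+ a := a) refl k))))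

  e-cong : ∀ {k l} → k ≈ l [ + d ] → e k ≈ e l [ + n ]
  e-cong {k} {l} (mod≈ q eq) = ≈-trans (≡⇒≈ (cong e (trans (solve 2 (λ a b → a := b :+ (a :- b)) refl k l) (cong (_+_ l) eq)))) (multiples q)
    where
    multiples : ∀ q → e (l + q * + d) ≈ e l [ + n ]
    multiples = ℤ-induction (λ q → e (l + q * + d) ≈ e l [ + n ]) (≡⇒≈ (cong e (solve 2 (λ a b → a :+ con 0ℤ :* b := a) refl l (+ d))))
      (λ q h → ≈-trans (≡⇒≈ (cong e (solve 3 (λ a b c → a :+ (b :+ con 1ℤ) :* c := a :+ b :* c :+ c) refl l q (+ d))))
          (≈-trans (e-+d (l + q * + d)) h))
      (λ q h → ≈-trans (≈-sym (e-+d (l + q * + d))) (≈-trans (≡⇒≈ (cong e (solve 3 (λ a b c → a :+ b :* c :+ c := a :+ (b :+ con 1ℤ) :* c) refl l q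
          (+ d)))) h))

  distinct : ∀ {k l} → e k ≈ e l [ + n ] → k ≈ l [ + d ]
  distinct {k} {l} h = lc (≈-trans (residue (k - l) d {{d≢0}}) (≡⇒≈ (cong +_ (minimal r (n%ℕd<d (k - l) d {{d≢0}}) vanish))))
      (solve 2 (λ a b → a :- b := a :- b :- con 0ℤ) refl k l)
    where
    r : ℕ
    r = _%ℕ_ (k - l) d {{d≢0}}
    vanish : geom ℓ r ≈ 0ℤ [ + n ]
    vanish = ≈-trans (e-cong {+ r} {k - l} (≈-sym (residue (k - l) d {{d≢0}}))) (≈-trans (propagate {k} {l} h (- l)) (≡⇒≈ (cong e
        (solve 1 (λ a → a :+ :- a := con 0ℤ) refl l))))
    minimal : ∀ r → r ℕ.< d → geom ℓ r ≈ 0ℤ [ + n ] → r ≡ 0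
    minimal zero _ _ = refl
    minimal (suc r) r<d x = ⊥-elim (proj₂ (proj₂ (proj₂ cond)) (suc r) (s≤s z≤n) r<d (toModEq x))

  e-neg : ∀ k → e (- k) ≈ - (ℓ * e k) [ + n ]
  e-neg (+ zero) = ≡⇒≈ (solve 1 (λ a → con 0ℤ := :- (a :* con 0ℤ)) refl ℓ)
  e-neg (+ suc i) = ≈-refl
  e-neg -[1+ i ] = lc ((- geom ℓ (suc i)) ⊙ ℓ²≈1) (solve 2 (λ a b → a :- :- (b :* :- (b :* a)) := :- a :* (b :* b) :- :- a :* con 1ℤ) refl (geom ℓ
      (suc i)) ℓ)

  family : Family (p₁ {n} ℓ d)
  family = record
    { e = e ; χ = λ k → k ; s = λ _ → true ; e-cong = e-cong ; s-cong = λ _ → refl ; χ-cong = λ h → h ; letters = λ _ → refl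
    ; χ-rot = λ _ () ; χ-ref = λ _ _ → ≈-refl ; distinct = λ _ → distinct ; nonunit = λ _ ()
    ; rotation-word = 1ℤ ∷ 0ℤ ∷ [] , val-≈ (val-ref refl (val-ref refl val[])) (≡⇒≈ (refl))
    ; reflection-word = 0ℤ ∷ [] , 0ℤ - 0ℤ , val-ref refl val[] }
    where open Words (+ n) e (λ _ → true)

  reflRegCM : ReflRegCM d (p₁ {n} ℓ d)
  reflRegCM = FamilyMap.TwoReversals.reflRegCM 2≤n d≢0 (p₁ ℓ d) family {0ℤ}
    (hom-reversal family (- ℓ) 0ℤ 0ℤ (λ _ → refl) (λ _ → ≈-refl) (λ _ ()) (λ k _ → ≈-trans (≡⇒≈ (cong e
        (solve 1 (λ a → :- a :+ con 0ℤ := :- a) refl k))) (lc (e-neg k) (solve 3 (λ a b c → a :- (:- b :* c :+ con 0ℤ) := a :- :- (b :* c)) refl (e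
        (- k)) ℓ (e k)))))
    -- The symmetry e (1 - k) = 1 - e k; the reversal before it is e (-k) = - ℓ e k.
    (hom-reversal family -1ℤ 1ℤ 1ℤ (λ _ → refl) (λ _ → ≈-refl) (λ _ ())
      (λ k _ → (lc (e-suc (- k) ⊕ ℓ ⊙ e-neg k ⊕ (- e k) ⊙ ℓ²≈1) (solve 4 (λ a b c d → a :- (con -1ℤ :* b :+ con 1ℤ) := a :+ c :* d :+ :- b :*
          (c :* c) :- (con 1ℤ :+ c :* d :+ c :* :- (c :* b) :+ :- b :* con 1ℤ)) refl (e (- k + 1ℤ)) (e k) ℓ (e (- k))))))

module _ {A : Set} (f g : ℤ → A) where

  pick : ∀ {k} → ∃[ q ] (k ≡ + 2 * q ⊎ k ≡ + 2 * q + 1ℤ) → A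
  pick (q , inj₁ _) = f q
  pick (q , inj₂ _) = g q

  on-parity : ℤ → A
  on-parity k = pick (parity k)

  on-even : ∀ q → on-parity (+ 2 * q) ≡ f q
  on-even q = go (parity (+ 2 * q))
    where
    go : ∀ r → pick {+ 2 * q} r ≡ f q
    go (r , inj₁ eq) = cong f (sym (*-cancelˡ-≡ (+ 2) q r eq))
    go (r , inj₂ eq) = ⊥-elim (distinct-by-computation {0ℤ} {1ℤ} {+ 2} (lc (≡⇒≈ eq ⊕ (- q) ⊙ modulus≈0 ⊕ r ⊙ modulus≈0)
        (solve 2 (λ a b → con 0ℤ :- con 1ℤ := con (+ 2) :* a :+ :- a :* con (+ 2) :+ b :* con
        (+ 2) :- (con (+ 2) :* b :+ con 1ℤ :+ :- a :* con 0ℤ :+ b :* con 0ℤ)) refl q r)))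

  on-odd : ∀ q → on-parity (+ 2 * q + 1ℤ) ≡ g q
  on-odd q = go (parity (+ 2 * q + 1ℤ))
    where
    go : ∀ r → pick {+ 2 * q + 1ℤ} r ≡ g q
    go (r , inj₂ eq) = cong g (sym (*-cancelˡ-≡ (+ 2) q r (trans (solve 1 (λ a → con (+ 2) :* a := con (+ 2) :* a :+ con 1ℤ :- con 1ℤ) refl q)
        (trans (cong (_- 1ℤ) eq) (solve 1 (λ a → con (+ 2) :* a :+ con 1ℤ :- con 1ℤ := con (+ 2) :* a) refl r)))))
    go (r , inj₁ eq) = ⊥-elim (distinct-by-computation {1ℤ} {0ℤ} {+ 2} (lc (≡⇒≈ eq ⊕ (- q) ⊙ modulus≈0 ⊕ r ⊙ modulus≈0)
        (solve 2 (λ a b → con 1ℤ :- con 0ℤ := con (+ 2) :* a :+ con 1ℤ :+ :- a :* con (+ 2) :+ b :* con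
        (+ 2) :- (con (+ 2) :* b :+ :- a :* con 0ℤ :+ b :* con 0ℤ)) refl q r)))

parity-elim : (P : ℤ → Set) → (∀ q → P (+ 2 * q)) → (∀ q → P (+ 2 * q + 1ℤ)) → ∀ k → P k
parity-elim P f g k = go (parity k)
  where
  go : ∃[ q ] (k ≡ + 2 * q ⊎ k ≡ + 2 * q + 1ℤ) → P k
  go (q , inj₁ eq) = subst P (sym eq) (f q)
  go (q , inj₂ eq) = subst P (sym eq) (g q)

-- Common description of the families (2) and (3), with ν = 0 and ν = n/4 respectively.
module Family₂₃ {n : ℕ} (2≤n : 2 ℕ.≤ n) .{{_ : NonZero n}} (M ν : ℤ) (n≡ : + n ≡ + 2 * M) (4ν≈0 : + 4 * ν ≈ 0ℤ [ + n ])
  (2ν²≈0 : + 2 * (ν * ν) ≈ 0ℤ [ + n ]) (2Mν≈0 : + 2 * (M * ν) ≈ 0ℤ [ + n ]) where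

  Respects : {A : Set} → (ℤ → A) → (A → A → Set) → Set
  Respects h _∼_ = ∀ {k l} → k ≈ l [ + n ] → h k ∼ h l

  respects : {A : Set} (_∼_ : A → A → Set) (f g : ℤ → A) → (∀ q i → f (q + i * M) ∼ f q) → (∀ q i → g (q + i * M) ∼ g q) → Respects
      (on-parity f g) _∼_
  respects _∼_ f g f-cong g-cong {k} {l} (mod≈ i eq) = parity-elim (λ l → ∀ k → k - l ≡ i * + n → on-parity f g k ∼ on-parity f g l)
      (λ q k eq → subst (λ k → on-parity f g k ∼ on-parity f g (+ 2 * q)) (sym (trans (moved k (+ 2 * q) eq)
          (solve 3 (λ a b c → con (+ 2) :* a :+ b :* (con (+ 2) :* c) := con (+ 2) :* (a :+ b :* c)) refl q i M)))
        (subst₂ _∼_ (sym (on-even f g (q + i * M))) (sym (on-even f g q)) (f-cong q i)))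
      (λ q k eq → subst (λ k → on-parity f g k ∼ on-parity f g (+ 2 * q + 1ℤ)) (sym (trans (moved k (+ 2 * q + 1ℤ) eq)
          (solve 3 (λ a b c → con (+ 2) :* a :+ con 1ℤ :+ b :* (con (+ 2) :* c) := con (+ 2) :* (a :+ b :* c) :+ con 1ℤ) refl q i M)))
        (subst₂ _∼_ (sym (on-odd f g (q + i * M))) (sym (on-odd f g q)) (g-cong q i))) l k eq
    where
    moved : ∀ k l → k - l ≡ i * + n → k ≡ l + i * (+ 2 * M)
    moved k l eq = trans (solve 2 (λ a b → a := b :+ (a :- b)) refl k l) (cong (_+_ l) (trans eq (cong (i *_) n≡)))

  2M≈0 : + 2 * M ≈ 0ℤ [ + n ]
  2M≈0 = ≈-trans (≡⇒≈ (sym n≡)) modulus≈0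

  e χ : ℤ → ℤ
  e = on-parity (λ q → + 2 * q + q * (+ 2 * ν)) (λ q → + 2 * q + 1ℤ)
  χ = on-parity (λ q → + 2 * q) (λ q → - (+ 2 * q + 1ℤ))
  s : ℤ → Bool
  s = on-parity (λ _ → true) (λ _ → false)

  e-even : ∀ q → e (+ 2 * q) ≡ + 2 * q + q * (+ 2 * ν)
  e-even = on-even _ _
  e-odd : ∀ q → e (+ 2 * q + 1ℤ) ≡ + 2 * q + 1ℤ
  e-odd = on-odd _ _
  χ-even : ∀ q → χ (+ 2 * q) ≡ + 2 * q
  χ-even = on-even _ _
  χ-odd : ∀ q → χ (+ 2 * q + 1ℤ) ≡ - (+ 2 * q + 1ℤ)
  χ-odd = on-odd _ _
  s-even : ∀ q → s (+ 2 * q) ≡ true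
  s-even = on-even _ _
  s-odd : ∀ q → s (+ 2 * q + 1ℤ) ≡ false
  s-odd = on-odd _ _

  e-cong : Respects e (λ a b → a ≈ b [ + n ])
  e-cong = respects (λ a b → a ≈ b [ + n ]) (λ q → + 2 * q + q * (+ 2 * ν)) (λ q → + 2 * q + 1ℤ) (λ q i → (lc (i ⊙ 2M≈0 ⊕ i ⊙ 2Mν≈0)
      (solve 4 (λ a b c d → con (+ 2) :* (a :+ b :* c) :+ (a :+ b :* c) :* (con (+ 2) :* d) :- (con (+ 2) :* a :+ a :* (con (+ 2) :* d)) := b :*
      (con (+ 2) :* c) :+ b :* (con (+ 2) :* (c :* d)) :- (b :* con 0ℤ :+ b :* con 0ℤ)) refl q i M ν)))
    (λ q i → (lc (i ⊙ 2M≈0) (solve 3 (λ a b c → con (+ 2) :* (a :+ b :* c) :+ con 1ℤ :- (con (+ 2) :* a :+ con 1ℤ) := b :* (con (+ 2) :* c) :- b :* con 0ℤ) refl q i M)))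

  χ-cong : Respects χ (λ a b → a ≈ b [ + n ])
  χ-cong = respects (λ a b → a ≈ b [ + n ]) (λ q → + 2 * q) (λ q → - (+ 2 * q + 1ℤ)) (λ q i → (lc (i ⊙ 2M≈0)
      (solve 3 (λ a b c → con (+ 2) :* (a :+ b :* c) :- con (+ 2) :* a := b :* (con (+ 2) :* c) :- b :* con 0ℤ) refl q i M)))
      (λ q i → (lc ((- i) ⊙ 2M≈0) (solve 3 (λ a b c → :- (con (+ 2) :* (a :+ b :* c) :+ con 1ℤ) :- :- (con (+ 2) :* a :+ con 1ℤ) := :- b :*
      (con (+ 2) :* c) :- :- b :* con 0ℤ) refl q i M)))

  s-cong : Respects s _≡_
  s-cong = respects _≡_ (λ _ → true) (λ _ → false) (λ _ _ → refl) (λ _ _ → refl)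

  by-parity-of : (P : ℤ → Set) → (∀ q → s (+ 2 * q) ≡ true → P (+ 2 * q)) → (∀ q → s (+ 2 * q + 1ℤ) ≡ false → P (+ 2 * q + 1ℤ)) → ∀ k → P k
  by-parity-of P f g = parity-elim P (λ q → f q (s-even q)) (λ q → g q (s-odd q))

  χ-rot : ∀ k → s k ≡ false → s (χ k) ≡ false × e (χ k) ≈ - e k [ + n ]
  χ-rot = by-parity-of _ (λ q z y → bool-absurd y z)
      (λ q _ _ → let r = - q - 1ℤ ; χ≡ = trans (χ-odd q) (solve 1 (λ a → :- (con (+ 2) :* a :+ con 1ℤ) := con (+ 2) :* (:- a :- con 1ℤ) :+ con 1ℤ) refl q) in
    trans (cong s χ≡) (s-odd r) , ≡⇒≈ (trans (cong e χ≡) (trans (e-odd r) (trans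
        (solve 1 (λ a → con (+ 2) :* (:- a :- con 1ℤ) :+ con 1ℤ := :- (con (+ 2) :* a :+ con 1ℤ)) refl q) (cong -_ (sym (e-odd q)))))))

  χ-ref : ∀ k → s k ≡ true → χ k ≈ k [ + n ]
  χ-ref = by-parity-of _ (λ q _ _ → ≡⇒≈ (χ-even q)) (λ q y z → bool-absurd y z)

  distinct : ∀ {k l} → s k ≡ s l → e k ≈ e l [ + n ] → k ≈ l [ + n ]
  distinct {k} {l} = by-parity-of (λ k → ∀ l → s k ≡ s l → e k ≈ e l [ + n ] → k ≈ l [ + n ])
    (λ q z → by-parity-of _ (λ q' _ _ h → both-even q q' (≈-trans (≡⇒≈ (sym (e-even q))) (≈-trans h (≡⇒≈ (e-even q'))))) (λ q' y eq → bool-absurd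
        (trans eq y) z))
    (λ q y → by-parity-of _ (λ q' z eq → bool-absurd y (trans eq z)) (λ q' _ _ h → ≈-trans (≡⇒≈ (sym (e-odd q))) (≈-trans h (≡⇒≈ (e-odd q'))))) k l
    where
    both-even : ∀ q q' → + 2 * q + q * (+ 2 * ν) ≈ + 2 * q' + q' * (+ 2 * ν) [ + n ] → + 2 * q ≈ + 2 * q' [ + n ]
    -- Multiply by 1 - ν: (1 - ν)(2q + 2qν) = 2q - 2qν², and 2ν² = 0.
    both-even q q' h = lc (1ℤ ⊙ h ⊕ (- ν) ⊙ h ⊕ (q - q') ⊙ 2ν²≈0)
        (solve 3 (λ a b c → con (+ 2) :* a :- con (+ 2) :* b := con 1ℤ :* (con (+ 2) :* a :+ a :* (con (+ 2) :* c)) :+ :- c :* (con (+ 2) :* a :+ a :*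
        (con (+ 2) :* c)) :+ (a :- b) :* (con (+ 2) :* (c :* c)) :- (con 1ℤ :* (con (+ 2) :* b :+ b :* (con (+ 2) :* c)) :+ :- c :*
        (con (+ 2) :* b :+ b :* (con (+ 2) :* c)) :+ (a :- b) :* con 0ℤ)) refl q q' ν)

  nonunit : ∀ k → s k ≡ false → ¬ e k ≈ 0ℤ [ + n ]
  nonunit = by-parity-of _ (λ q z y → bool-absurd y z) (λ q _ _ h → distinct-by-computation {1ℤ} {0ℤ} {+ 2}
    (lc (≈-coarsen 2∣n h ⊕ ⊖ ≡⇒≈ (e-odd q) ⊕ (- q) ⊙ modulus≈0)
        (solve 2 (λ a b → con 1ℤ :- con 0ℤ := a :+ :- a :+ :- b :* con (+ 2) :- (con 0ℤ :+ :- (con (+ 2) :* b :+ con 1ℤ) :+ :- b :* con 0ℤ)) refl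
        (e (+ 2 * q + 1ℤ)) q)))
    where
    2∣n : + n ≈ 0ℤ [ + 2 ]
    2∣n = lc (≡⇒≈ n≡ ⊕ M ⊙ modulus≈0) (solve 2 (λ a b → a :- con 0ℤ := a :+ b :* con (+ 2) :- (con (+ 2) :* b :+ b :* con 0ℤ)) refl (+ n) M)

  module _ (x : Fin n → Dih n) (letters : ∀ i → x i ≡ el (e (+ toℕ i)) (s (+ toℕ i))) where

    family : Family x
    family = record
      { e = e ; χ = χ ; s = s ; e-cong = e-cong ; s-cong = s-cong ; χ-cong = χ-cong ; letters = letters ; χ-rot = χ-rot ; χ-ref = χ-ref
      ; distinct = distinct ; nonunit = nonunit
      ; rotation-word = 1ℤ ∷ [] , val-≈ (val-rot (s-odd 0ℤ) val[]) (≈-trans (≡⇒≈ (cong (_+ 0ℤ) (e-odd 0ℤ))) ≈-refl)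
      ; reflection-word = 0ℤ ∷ [] , _ , val-ref (s-even 0ℤ) val[] }
      where open Words (+ n) e s

    open Family family using (Reversal)

    -- The reversal k ↦ -k negates every exponent, so it is the group automorphism a ↦ a⁻¹ fixing b.
    reversal₀ : Reversal 0ℤ
    reversal₀ = hom-reversal family -1ℤ 0ℤ 0ℤ (λ k → proj₁ (negation k)) (λ k → proj₁ (proj₂ (negation k)))
        (λ k _ → ≈-trans (proj₂ (proj₂ (negation k))) (≡⇒≈ (solve 1 (λ a → :- a := con -1ℤ :* a) refl (e k))))
            (λ k _ → ≈-trans (proj₂ (proj₂ (negation k))) (≡⇒≈ (solve 1 (λ a → :- a := con -1ℤ :* a :+ con 0ℤ) refl (e k))))
      where
      negation : ∀ k → s (- k + 0ℤ) ≡ s k × χ (- k + 0ℤ) ≈ - χ k + 0ℤ [ + n ] × e (- k + 0ℤ) ≈ - e k [ + n ]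
      negation = by-parity-of _
        (λ q z → let k≡ = (solve 1 (λ a → :- (con (+ 2) :* a) :+ con 0ℤ := con (+ 2) :* :- a) refl q) in trans (cong s k≡) (trans (s-even (- q))
            (sym z)) ,
          ≡⇒≈ (trans (cong χ k≡) (trans (χ-even (- q)) (trans (solve 1 (λ a → con (+ 2) :* :- a := :- (con (+ 2) :* a) :+ con 0ℤ) refl q)
              (cong (λ z → - z + 0ℤ) (sym (χ-even q)))))) ,
          ≡⇒≈ (trans (cong e k≡) (trans (e-even (- q)) (trans
              (solve 2 (λ a b → con (+ 2) :* :- a :+ :- a :* (con (+ 2) :* b) := :- (con (+ 2) :* a :+ a :* (con (+ 2) :* b))) refl q ν)
              (cong -_ (sym (e-even q)))))))
        (λ q y → let k≡ = (solve 1 (λ a → :- (con (+ 2) :* a :+ con 1ℤ) :+ con 0ℤ := con (+ 2) :* (:- a :- con 1ℤ) :+ con 1ℤ) refl q) in trans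
            (cong s k≡) (trans (s-odd (- q - 1ℤ)) (sym y)) ,
          ≡⇒≈ (trans (cong χ k≡) (trans (χ-odd (- q - 1ℤ)) (trans
              (solve 1 (λ a → :- (con (+ 2) :* (:- a :- con 1ℤ) :+ con 1ℤ) := :- (:- (con (+ 2) :* a :+ con 1ℤ)) :+ con 0ℤ) refl q)
              (cong (λ z → - z + 0ℤ) (sym (χ-odd q)))))) ,
          ≡⇒≈ (trans (cong e k≡) (trans (e-odd (- q - 1ℤ)) (trans
              (solve 1 (λ a → con (+ 2) :* (:- a :- con 1ℤ) :+ con 1ℤ := :- (con (+ 2) :* a :+ con 1ℤ)) refl q) (cong -_ (sym (e-odd q)))))))

    -- The reversal k ↦ 1 - k exchanges rotations and reflections, so it is no group automorphism.
    -- The image exponent is a different linear form on each parity class of p, the kind of the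
    -- image depends only on the parity of p, and the offset moves with 2p.
    F c : ℤ → Bool → ℤ
    F p false = on-parity (λ r → + 2 * r + r * (+ 2 * ν)) (λ r → - (+ 2 * r) + r * (+ 2 * ν)) p
    F p true = on-parity (λ r → 1ℤ - + 2 * r + r * (+ 2 * ν)) (λ r → + 2 * r + 1ℤ + r * (+ 2 * ν)) p
    c p false = 1ℤ - + 2 * p
    c p true = + 2 * p - 1ℤ
    G : ℤ → Bool
    G = on-parity (λ _ → false) (λ _ → true)

    F-even-false : ∀ r → F (+ 2 * r) false ≡ + 2 * r + r * (+ 2 * ν)
    F-even-false = on-even _ _
    F-odd-false : ∀ r → F (+ 2 * r + 1ℤ) false ≡ - (+ 2 * r) + r * (+ 2 * ν)
    F-odd-false = on-odd _ _
    F-even-true : ∀ r → F (+ 2 * r) true ≡ 1ℤ - + 2 * r + r * (+ 2 * ν)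
    F-even-true = on-even _ _
    F-odd-true : ∀ r → F (+ 2 * r + 1ℤ) true ≡ + 2 * r + 1ℤ + r * (+ 2 * ν)
    F-odd-true = on-odd _ _
    G-even : ∀ r → G (+ 2 * r) ≡ false
    G-even = on-even _ _
    G-odd : ∀ r → G (+ 2 * r + 1ℤ) ≡ true
    G-odd = on-odd _ _

    Steps : ℤ → Bool → ℤ → Set
    Steps p t k = F (signed-sum t p (e k)) (t xor s k) ≈ signed-sum (G p) (F p t) (e (- k + c p t)) [ + n ]
      × G (signed-sum t p (e k)) ≡ G p xor s (- k + c p t)
      × c (signed-sum t p (e k)) (t xor s k) ≈ χ (- k + c p t) + χ k [ + n ]

    -- Inserts the values of all functions at arguments of known parity, so that each case is
    -- reduced to three arithmetic conditions.
    conclude : ∀ {p t k p' t' k' f' g' f g ε σ ξ' ξ} → signed-sum t p (e k) ≡ p' → t xor s k ≡ t' → - k + c p t ≡ k' →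
      F p' t' ≡ f' → G p' ≡ g' → F p t ≡ f → G p ≡ g → e k' ≡ ε → s k' ≡ σ → χ k' ≡ ξ' → χ k ≡ ξ →
      f' ≈ signed-sum g f ε [ + n ] → g' ≡ g xor σ → c p' t' ≈ ξ' + ξ [ + n ] → Steps p t k
    conclude {p} {t} {k} refl refl refl F' G' Fp Gp eε sσ χ' χk hF hG hc =
      ≈-trans (≡⇒≈ F') (≈-trans hF (≡⇒≈ (sym (trans (cong (λ b → signed-sum b (F p t) (e (- k + c p t))) Gp) (cong₂ (signed-sum _) Fp eε))))) ,
      trans G' (trans hG (sym (cong₂ _xor_ Gp sσ))) , ≈-trans hc (≡⇒≈ (sym (cong₂ _+_ χ' χk)))

    step-even-even : ∀ t r q → Steps (+ 2 * r) t (+ 2 * q)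
    step-even-even false r q = conclude {+ 2 * r} {false} {+ 2 * q} {+ 2 * (r + q + q * ν)} {true} {+ 2 * (- q - r - r) + 1ℤ}
        (trans (cong (_+_ (+ 2 * r)) (e-even q)) (solve 3 (λ a b c → con (+ 2) :* a :+ (con (+ 2) :* b :+ b :* (con (+ 2) :* c)) := con (+ 2) :* (a :+ b :+ b :* c)) refl r q ν))
            (cong (false xor_) (s-even q)) (solve 2 (λ a b → :- (con (+ 2) :* a) :+ (con 1ℤ :- con (+ 2) :* (con (+ 2) :* b)) := con (+ 2) :*
            (:- a :- b :- b) :+ con 1ℤ) refl q r)
        (F-even-true (r + q + q * ν)) (G-even (r + q + q * ν)) (F-even-false r) (G-even r) (e-odd (- q - r - r)) (s-odd (- q - r - r))
            (χ-odd (- q - r - r)) (χ-even q)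
        (lc (q ⊙ 2ν²≈0) (solve 3 (λ a b c → con 1ℤ :- con (+ 2) :* (a :+ b :+ b :* c) :+ (a :+ b :+ b :* c) :* (con (+ 2) :* c) :- (con
            (+ 2) :* a :+ a :* (con (+ 2) :* c) :+ (con (+ 2) :* (:- b :- a :- a) :+ con 1ℤ)) := b :*
            (con (+ 2) :* (c :* c)) :- b :* con 0ℤ) refl r q ν)) refl (lc (q ⊙ 4ν≈0)
            (solve 3 (λ a b c → con (+ 2) :* (con (+ 2) :* (a :+ b :+ b :* c)) :- con 1ℤ :- (:-
            (con (+ 2) :* (:- b :- a :- a) :+ con 1ℤ) :+ con (+ 2) :* b) := b :* (con (+ 4) :* c) :- b :* con 0ℤ) refl r q ν))
    step-even-even true r q = conclude {+ 2 * r} {true} {+ 2 * q} {+ 2 * (r - q - q * ν)} {false} {+ 2 * (r + r - q - 1ℤ) + 1ℤ}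
        (trans (cong (_-_ (+ 2 * r)) (e-even q)) (solve 3 (λ a b c → con (+ 2) :* a :- (con (+ 2) :* b :+ b :* (con (+ 2) :* c)) := con (+ 2) :* (a :- b :- b :* c)) refl r q ν))
            (cong (true xor_) (s-even q)) (solve 2 (λ a b → :- (con (+ 2) :* a) :+ (con (+ 2) :* (con (+ 2) :* b) :- con 1ℤ) := con (+ 2) :*
            (b :+ b :- a :- con 1ℤ) :+ con 1ℤ) refl q r)
        (F-even-false (r - q - q * ν)) (G-even (r - q - q * ν)) (F-even-true r) (G-even r) (e-odd (r + r - q - 1ℤ)) (s-odd (r + r - q - 1ℤ))
            (χ-odd (r + r - q - 1ℤ)) (χ-even q)
        (lc ((- q) ⊙ 4ν≈0 ⊕ (- q) ⊙ 2ν²≈0) (solve 3 (λ a b c → con (+ 2) :* (a :- b :- b :* c) :+ (a :- b :- b :* c) :*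
            (con (+ 2) :* c) :- (con 1ℤ :- con (+ 2) :* a :+ a :* (con (+ 2) :* c) :+ (con (+ 2) :* (a :+ a :- b :- con 1ℤ) :+ con 1ℤ)) := :- b :*
            (con (+ 4) :* c) :+ :- b :* (con (+ 2) :* (c :* c)) :- (:- b :* con 0ℤ :+ :- b :* con 0ℤ)) refl r q ν)) refl (lc (q ⊙ 4ν≈0)
            (solve 3 (λ a b c → con 1ℤ :- con (+ 2) :* (con (+ 2) :* (a :- b :- b :* c)) :- (:-
            (con (+ 2) :* (a :+ a :- b :- con 1ℤ) :+ con 1ℤ) :+ con (+ 2) :* b) := b :* (con (+ 4) :* c) :- b :* con 0ℤ) refl r q ν))
    step-even-odd : ∀ t r q → Steps (+ 2 * r) t (+ 2 * q + 1ℤ)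
    step-even-odd false r q = conclude {+ 2 * r} {false} {+ 2 * q + 1ℤ} {+ 2 * (r + q) + 1ℤ} {false} {+ 2 * (- q - r - r)}
        (trans (cong (_+_ (+ 2 * r)) (e-odd q)) (solve 2 (λ a b → con (+ 2) :* a :+ (con (+ 2) :* b :+ con 1ℤ) := con (+ 2) :* (a :+ b) :+ con 1ℤ) refl r q))
            (cong (false xor_) (s-odd q)) (solve 2 (λ a b → :- (con (+ 2) :* a :+ con 1ℤ) :+ (con 1ℤ :- con (+ 2) :* (con (+ 2) :* b)) := con (+ 2) :*
            (:- a :- b :- b)) refl q r)
        (F-odd-false (r + q)) (G-odd (r + q)) (F-even-false r) (G-even r) (e-even (- q - r - r)) (s-even (- q - r - r)) (χ-even (- q - r - r))
            (χ-odd q)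
        (lc (r ⊙ 4ν≈0 ⊕ q ⊙ 4ν≈0) (solve 3 (λ a b c → :- (con (+ 2) :* (a :+ b)) :+ (a :+ b) :* (con (+ 2) :* c) :- (con (+ 2) :* a :+ a :*
            (con (+ 2) :* c) :+ (con (+ 2) :* (:- b :- a :- a) :+ (:- b :- a :- a) :* (con (+ 2) :* c))) := a :* (con (+ 4) :* c) :+ b :*
            (con (+ 4) :* c) :- (a :* con 0ℤ :+ b :* con 0ℤ)) refl r q ν)) refl (≡⇒≈
            (solve 2 (λ a b → con 1ℤ :- con (+ 2) :* (con (+ 2) :* (a :+ b) :+ con 1ℤ) := con (+ 2) :* (:- b :- a :- a) :+ :- (con
            (+ 2) :* b :+ con 1ℤ)) refl r q))
    step-even-odd true r q = conclude {+ 2 * r} {true} {+ 2 * q + 1ℤ} {+ 2 * (r - q - 1ℤ) + 1ℤ} {true} {+ 2 * (r + r - q - 1ℤ)}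
        (trans (cong (_-_ (+ 2 * r)) (e-odd q)) (solve 2 (λ a b → con (+ 2) :* a :- (con (+ 2) :* b :+ con 1ℤ) := con (+ 2) :* (a :- b :- con 1ℤ) :+ con 1ℤ) refl r q))
            (cong (true xor_) (s-odd q)) (solve 2 (λ a b → :- (con (+ 2) :* a :+ con 1ℤ) :+ (con (+ 2) :* (con (+ 2) :* b) :- con 1ℤ) := con (+ 2) :*
            (b :+ b :- a :- con 1ℤ)) refl q r)
        (F-odd-true (r - q - 1ℤ)) (G-odd (r - q - 1ℤ)) (F-even-true r) (G-even r) (e-even (r + r - q - 1ℤ)) (s-even (r + r - q - 1ℤ))
            (χ-even (r + r - q - 1ℤ)) (χ-odd q)
        (lc ((- r) ⊙ 4ν≈0) (solve 3 (λ a b c → con (+ 2) :* (a :- b :- con 1ℤ) :+ con 1ℤ :+ (a :- b :- con 1ℤ) :* (con (+ 2) :* c) :- (con 1ℤ :- con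
            (+ 2) :* a :+ a :* (con (+ 2) :* c) :+ (con (+ 2) :* (a :+ a :- b :- con 1ℤ) :+ (a :+ a :- b :- con 1ℤ) :* (con (+ 2) :* c))) := :- a :*
            (con (+ 4) :* c) :- :- a :* con 0ℤ) refl r q ν)) refl (≡⇒≈
            (solve 2 (λ a b → con (+ 2) :* (con (+ 2) :* (a :- b :- con 1ℤ) :+ con 1ℤ) :- con 1ℤ := con (+ 2) :*
            (a :+ a :- b :- con 1ℤ) :+ :- (con (+ 2) :* b :+ con 1ℤ)) refl r q))
    step-odd-even : ∀ t r q → Steps (+ 2 * r + 1ℤ) t (+ 2 * q)
    step-odd-even false r q = conclude {+ 2 * r + 1ℤ} {false} {+ 2 * q} {+ 2 * (r + q + q * ν) + 1ℤ} {true} {+ 2 * (- q - r - r - 1ℤ) + 1ℤ}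
        (trans (cong (_+_ (+ 2 * r + 1ℤ)) (e-even q)) (solve 3 (λ a b c → con (+ 2) :* a :+ con 1ℤ :+ (con (+ 2) :* b :+ b :* (con (+ 2) :* c)) := con
            (+ 2) :* (a :+ b :+ b :* c) :+ con 1ℤ) refl r q ν)) (cong (false xor_) (s-even q))
            (solve 2 (λ a b → :- (con (+ 2) :* a) :+ (con 1ℤ :- con (+ 2) :* (con (+ 2) :* b :+ con 1ℤ)) := con (+ 2) :*
            (:- a :- b :- b :- con 1ℤ) :+ con 1ℤ) refl q r)
        (F-odd-true (r + q + q * ν)) (G-odd (r + q + q * ν)) (F-odd-false r) (G-odd r) (e-odd (- q - r - r - 1ℤ)) (s-odd (- q - r - r - 1ℤ))
            (χ-odd (- q - r - r - 1ℤ)) (χ-even q)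
        (lc (q ⊙ 4ν≈0 ⊕ q ⊙ 2ν²≈0) (solve 3 (λ a b c → con (+ 2) :* (a :+ b :+ b :* c) :+ con 1ℤ :+ (a :+ b :+ b :* c) :* (con (+ 2) :* c) :- (:-
            (con (+ 2) :* a) :+ a :* (con (+ 2) :* c) :- (con (+ 2) :* (:- b :- a :- a :- con 1ℤ) :+ con 1ℤ)) := b :* (con (+ 4) :* c) :+ b :*
            (con (+ 2) :* (c :* c)) :- (b :* con 0ℤ :+ b :* con 0ℤ)) refl r q ν)) refl (lc (q ⊙ 4ν≈0)
            (solve 3 (λ a b c → con (+ 2) :* (con (+ 2) :* (a :+ b :+ b :* c) :+ con 1ℤ) :- con 1ℤ :- (:-
            (con (+ 2) :* (:- b :- a :- a :- con 1ℤ) :+ con 1ℤ) :+ con (+ 2) :* b) := b :* (con (+ 4) :* c) :- b :* con 0ℤ) refl r q ν))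
    step-odd-even true r q = conclude {+ 2 * r + 1ℤ} {true} {+ 2 * q} {+ 2 * (r - q - q * ν) + 1ℤ} {false} {+ 2 * (r + r - q) + 1ℤ}
        (trans (cong (_-_ (+ 2 * r + 1ℤ)) (e-even q)) (solve 3 (λ a b c → con (+ 2) :* a :+ con 1ℤ :- (con (+ 2) :* b :+ b :* (con (+ 2) :* c)) := con
            (+ 2) :* (a :- b :- b :* c) :+ con 1ℤ) refl r q ν)) (cong (true xor_) (s-even q))
            (solve 2 (λ a b → :- (con (+ 2) :* a) :+ (con (+ 2) :* (con (+ 2) :* b :+ con 1ℤ) :- con 1ℤ) := con (+ 2) :*
            (b :+ b :- a) :+ con 1ℤ) refl q r)
        (F-odd-false (r - q - q * ν)) (G-odd (r - q - q * ν)) (F-odd-true r) (G-odd r) (e-odd (r + r - q)) (s-odd (r + r - q)) (χ-odd (r + r - q))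
            (χ-even q)
        (lc ((- q) ⊙ 2ν²≈0) (solve 3 (λ a b c → :- (con (+ 2) :* (a :- b :- b :* c)) :+ (a :- b :- b :* c) :* (con (+ 2) :* c) :- (con
            (+ 2) :* a :+ con 1ℤ :+ a :* (con (+ 2) :* c) :- (con (+ 2) :* (a :+ a :- b) :+ con 1ℤ)) := :- b :*
            (con (+ 2) :* (c :* c)) :- :- b :* con 0ℤ) refl r q ν)) refl (lc (q ⊙ 4ν≈0)
            (solve 3 (λ a b c → con 1ℤ :- con (+ 2) :* (con (+ 2) :* (a :- b :- b :* c) :+ con 1ℤ) :- (:-
            (con (+ 2) :* (a :+ a :- b) :+ con 1ℤ) :+ con (+ 2) :* b) := b :* (con (+ 4) :* c) :- b :* con 0ℤ) refl r q ν))
    step-odd-odd : ∀ t r q → Steps (+ 2 * r + 1ℤ) t (+ 2 * q + 1ℤ)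
    step-odd-odd false r q = conclude {+ 2 * r + 1ℤ} {false} {+ 2 * q + 1ℤ} {+ 2 * (r + q + 1ℤ)} {false} {+ 2 * (- q - r - r - 1ℤ)}
        (trans (cong (_+_ (+ 2 * r + 1ℤ)) (e-odd q))
            (solve 2 (λ a b → con (+ 2) :* a :+ con 1ℤ :+ (con (+ 2) :* b :+ con 1ℤ) := con (+ 2) :* (a :+ b :+ con 1ℤ)) refl r q)) (cong (false xor_)
            (s-odd q)) (solve 2 (λ a b → :- (con (+ 2) :* a :+ con 1ℤ) :+ (con 1ℤ :- con (+ 2) :* (con (+ 2) :* b :+ con 1ℤ)) := con (+ 2) :*
            (:- a :- b :- b :- con 1ℤ)) refl q r)
        (F-even-false (r + q + 1ℤ)) (G-even (r + q + 1ℤ)) (F-odd-false r) (G-odd r) (e-even (- q - r - r - 1ℤ)) (s-even (- q - r - r - 1ℤ))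
            (χ-even (- q - r - r - 1ℤ)) (χ-odd q)
        (lc ((- r) ⊙ 4ν≈0) (solve 3 (λ a b c → con (+ 2) :* (a :+ b :+ con 1ℤ) :+ (a :+ b :+ con 1ℤ) :* (con (+ 2) :* c) :- (:-
            (con (+ 2) :* a) :+ a :* (con (+ 2) :* c) :- (con (+ 2) :* (:- b :- a :- a :- con 1ℤ) :+ (:- b :- a :- a :- con 1ℤ) :*
            (con (+ 2) :* c))) := :- a :* (con (+ 4) :* c) :- :- a :* con 0ℤ) refl r q ν)) refl (≡⇒≈
            (solve 2 (λ a b → con 1ℤ :- con (+ 2) :* (con (+ 2) :* (a :+ b :+ con 1ℤ)) := con (+ 2) :* (:- b :- a :- a :- con 1ℤ) :+ :- (con
            (+ 2) :* b :+ con 1ℤ)) refl r q))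
    step-odd-odd true r q = conclude {+ 2 * r + 1ℤ} {true} {+ 2 * q + 1ℤ} {+ 2 * (r - q)} {true} {+ 2 * (r + r - q)}
        (trans (cong (_-_ (+ 2 * r + 1ℤ)) (e-odd q))
            (solve 2 (λ a b → con (+ 2) :* a :+ con 1ℤ :- (con (+ 2) :* b :+ con 1ℤ) := con (+ 2) :* (a :- b)) refl r q)) (cong (true xor_) (s-odd q))
            (solve 2 (λ a b → :- (con (+ 2) :* a :+ con 1ℤ) :+ (con (+ 2) :* (con (+ 2) :* b :+ con 1ℤ) :- con 1ℤ) := con (+ 2) :*
            (b :+ b :- a)) refl q r)
        (F-even-true (r - q)) (G-even (r - q)) (F-odd-true r) (G-odd r) (e-even (r + r - q)) (s-even (r + r - q)) (χ-even (r + r - q)) (χ-odd q)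
        (lc (r ⊙ 4ν≈0 ⊕ (- q) ⊙ 4ν≈0) (solve 3 (λ a b c → con 1ℤ :- con (+ 2) :* (a :- b) :+ (a :- b) :* (con (+ 2) :* c) :- (con
            (+ 2) :* a :+ con 1ℤ :+ a :* (con (+ 2) :* c) :- (con (+ 2) :* (a :+ a :- b) :+ (a :+ a :- b) :* (con (+ 2) :* c))) := a :*
            (con (+ 4) :* c) :+ :- b :* (con (+ 4) :* c) :- (a :* con 0ℤ :+ :- b :* con 0ℤ)) refl r q ν)) refl (≡⇒≈
            (solve 2 (λ a b → con (+ 2) :* (con (+ 2) :* (a :- b)) :- con 1ℤ := con (+ 2) :* (a :+ a :- b) :+ :- (con
            (+ 2) :* b :+ con 1ℤ)) refl r q))

    steps : ∀ p t k → Steps p t k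
    steps p t = parity-elim _ (λ q → parity-elim (λ p → Steps p t (+ 2 * q)) (λ r → step-even-even t r q) (λ r → step-odd-even t r q) p)
      (λ q → parity-elim (λ p → Steps p t (+ 2 * q + 1ℤ)) (λ r → step-even-odd t r q) (λ r → step-odd-odd t r q) p)

    reversal₁ : Reversal 1ℤ
    reversal₁ = record
      { F = F ; G = λ p _ → G p ; c = c
      ; F-cong = λ
        { false → respects (λ a b → a ≈ b [ + n ]) (λ r → + 2 * r + r * (+ 2 * ν)) (λ r → - (+ 2 * r) + r * (+ 2 * ν))
            (λ r i → (lc (i ⊙ 2M≈0 ⊕ i ⊙ 2Mν≈0) (solve 4 (λ a b c d → con (+ 2) :* (a :+ b :* c) :+ (a :+ b :* c) :* (con (+ 2) :* d) :- (con
            (+ 2) :* a :+ a :* (con (+ 2) :* d)) := b :* (con (+ 2) :* c) :+ b :*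
            (con (+ 2) :* (c :* d)) :- (b :* con 0ℤ :+ b :* con 0ℤ)) refl r i M ν)))
            (λ r i → (lc ((- i) ⊙ 2M≈0 ⊕ i ⊙ 2Mν≈0) (solve 4 (λ a b c d → :- (con (+ 2) :* (a :+ b :* c)) :+ (a :+ b :* c) :* (con (+ 2) :* d) :- (:-
                (con (+ 2) :* a) :+ a :* (con (+ 2) :* d)) := :- b :* (con (+ 2) :* c) :+ b :*
                (con (+ 2) :* (c :* d)) :- (:- b :* con 0ℤ :+ b :* con 0ℤ)) refl r i M ν)))
        ; true → respects (λ a b → a ≈ b [ + n ]) (λ r → 1ℤ - + 2 * r + r * (+ 2 * ν)) (λ r → + 2 * r + 1ℤ + r * (+ 2 * ν))
            (λ r i → (lc ((- i) ⊙ 2M≈0 ⊕ i ⊙ 2Mν≈0) (solve 4 (λ a b c d → con 1ℤ :- con (+ 2) :* (a :+ b :* c) :+ (a :+ b :* c) :*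
            (con (+ 2) :* d) :- (con 1ℤ :- con (+ 2) :* a :+ a :* (con (+ 2) :* d)) := :- b :* (con (+ 2) :* c) :+ b :*
            (con (+ 2) :* (c :* d)) :- (:- b :* con 0ℤ :+ b :* con 0ℤ)) refl r i M ν)))
            (λ r i → (lc (i ⊙ 2M≈0 ⊕ i ⊙ 2Mν≈0) (solve 4 (λ a b c d → con (+ 2) :* (a :+ b :* c) :+ con 1ℤ :+ (a :+ b :* c) :*
                (con (+ 2) :* d) :- (con (+ 2) :* a :+ con 1ℤ :+ a :* (con (+ 2) :* d)) := b :* (con (+ 2) :* c) :+ b :*
                (con (+ 2) :* (c :* d)) :- (b :* con 0ℤ :+ b :* con 0ℤ)) refl r i M ν))) }
      ; G-cong = λ t → respects _≡_ (λ _ → false) (λ _ → true) (λ _ _ → refl) (λ _ _ → refl)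
      ; c-cong = λ { false {p} {q} h → (lc ((-[1+ 1 ]) ⊙ h)
          (solve 2 (λ a b → con 1ℤ :- con (+ 2) :* a :- (con 1ℤ :- con (+ 2) :* b) := con (-[1+ 1 ]) :* a :- con (-[1+ 1 ]) :* b) refl p q)) ; true {p} {q} h →
          (lc ((+ 2) ⊙ h) (solve 2 (λ a b → con (+ 2) :* a :- con 1ℤ :- (con (+ 2) :* b :- con 1ℤ) := con (+ 2) :* a :- con (+ 2) :* b) refl p q)) }
      ; F-start = ≡⇒≈ (F-even-false 0ℤ) ; G-start = G-even 0ℤ ; c-start = ≈-refl
      ; F-step = λ p t k → proj₁ (steps p t k) ; G-step = λ p t k → proj₁ (proj₂ (steps p t k)) ; c-step = λ p t k → proj₂ (proj₂ (steps p t k)) }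

    reflRegCM : ReflRegCM n x
    reflRegCM = FamilyMap.TwoReversals.reflRegCM 2≤n (ℕ.>-nonZero (ℕ.<-≤-trans (s≤s z≤n) 2≤n)) x family {0ℤ} reversal₀ reversal₁

-- Regularity and reflexibility of families (4)–(6)

-- A linear form α + β m in the exponent m, where n = 2m.
Form : Set
Form = ℤ × ℤ

-- Sufficient for α + β m to vanish modulo 2m, whatever m is; so it can be decided once for a whole
-- family.
Null : Form → Set
Null (α , β) = α ≡ 0ℤ × β ≈ 0ℤ [ + 2 ]

null? : ∀ f → Dec (Null f)
null? (α , β) = (α ≟ 0ℤ) ×-dec (β ≈? 0ℤ [ + 2 ])

∀Bool? : {P : Bool → Set} → (∀ b → Dec (P b)) → Dec (∀ b → P b)
∀Bool? P? = map′ (λ { (f , g) false → f ; (f , g) true → g }) (λ f → f false , f true) (P? false ×-dec P? true)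

record Table (d : ℕ) : Set where
  field
    E : ℕ → Form
    K : ℕ → Bool
    X : ℕ → ℕ

  IsInverse : Fin d → Set
  IsInverse i = X (toℕ i) ℕ.< d × (K (toℕ i) ≡ false → K (X (toℕ i)) ≡ false × Null (proj₁ (E (X (toℕ i))) + proj₁ (E (toℕ i)) , proj₂
      (E (X (toℕ i))) + proj₂ (E (toℕ i)))) × (K (toℕ i) ≡ true → X (toℕ i) ≡ toℕ i)

  isInverse? : Dec (∀ i → IsInverse i)
  isInverse? = all? λ i → (_ ℕ.<? _) ×-dec ((_ ≟ᵇ _) →-dec ((_ ≟ᵇ _) ×-dec null? _)) ×-dec ((_ ≟ᵇ _) →-dec (_ ℕ.≟ _))

  -- V stands for a decidable reason why a form does not vanish modulo n. It is a parameter because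
  -- the reason for M₄ differs from that for M₅ and M₆.
  Separated : (Form → Set) → Set
  Separated V = (∀ (i j : Fin d) → K (toℕ i) ≡ K (toℕ j) → i ≢ j → V (proj₁ (E (toℕ i)) - proj₁ (E (toℕ j)) , proj₂ (E (toℕ i)) - proj₂
      (E (toℕ j)))) × (∀ (i : Fin d) → K (toℕ i) ≡ false → V (E (toℕ i)))

  separated? : ∀ {V} → (∀ f → Dec (V f)) → Dec (Separated V)
  separated? V? = (all? λ i → all? λ j → (_ ≟ᵇ _) →-dec (¬? (i Fin.≟ j) →-dec V? _)) ×-dec (all? λ i → (_ ≟ᵇ _) →-dec V? _)

  -- The reversal with F p t = κ p + T ρ t and G, c depending only on t and the residue ρ of p.
  record ReversalTable : Set where
    field
      κ : ℤ
      T : ℕ → Bool → Form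
      Gᵗ : ℕ → Bool → Bool
      cᵗ : ℕ → Bool → ℕ

    module At (N : ℕ) .{{_ : NonZero N}} .{{_ : NonZero d}} (μ : ℤ) (ρ : ℕ) (t : Bool) (i : ℕ) where
      ρ' i' : ℕ
      ρ' = signed-sum t (+ ρ) (proj₁ (E i) + proj₂ (E i) * μ) %ℕ N
      i' = (- + i + + cᵗ ρ t) %ℕ d
      t' : Bool
      t' = t xor K i
      -- The difference of the two sides of `F-step`. The terms κ p cancel, so only the residue ρ of
      -- p remains and the check is finite.
      defect : (Form → ℤ) → ℤ
      defect π = signed-sum t 0ℤ (κ * π (E i)) + π (T ρ' t') - signed-sum (Gᵗ ρ t) (π (T ρ t)) (π (E i'))
      Correct : Set
      Correct = Null (defect proj₁ , defect proj₂) × Gᵗ ρ' t' ≡ Gᵗ ρ t xor K i' × + cᵗ ρ' t' ≈ + X i' + + X i [ + d ]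

    AllCorrect : (N : ℕ) .{{_ : NonZero N}} .{{_ : NonZero d}} → ℤ → Set
    AllCorrect N μ = ∀ (ρ : Fin N) t (i : Fin d) → At.Correct N μ (toℕ ρ) t (toℕ i)

    allCorrect? : (N : ℕ) .{{_ : NonZero N}} .{{_ : NonZero d}} (μ : ℤ) → Dec (AllCorrect N μ)
    allCorrect? N μ = all? λ ρ → ∀Bool? λ t → all? λ i → null? _ ×-dec (_ ≟ᵇ _) ×-dec (_ ≈? _ [ + d ])

module TableFamily {n d : ℕ} (2≤n : 2 ℕ.≤ n) (d≢0 : NonZero d) .{{_ : NonZero n}} (𝕋 : Table d) (m : ℤ) (2m≈0 : + 2 * m ≈ 0ℤ [ + n ])
  (is-inverse : ∀ i → Table.IsInverse 𝕋 i) {V : Form → Set} (visible : ∀ {α β} → V (α , β) → ¬ α + β * m ≈ 0ℤ [ + n ])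
      (separated : Table.Separated 𝕋 V)
  (x : Fin d → Dih n) (letters : ∀ i → x i ≡ el (proj₁ (Table.E 𝕋 (toℕ i)) + proj₂ (Table.E 𝕋 (toℕ i)) * m) (Table.K 𝕋 (toℕ i)))
  (i₁ : Fin d) (K₁ : Table.K 𝕋 (toℕ i₁) ≡ false) (E₁ : Table.E 𝕋 (toℕ i₁) ≡ (1ℤ , 0ℤ)) (i₂ : Fin d) (K₂ : Table.K 𝕋 (toℕ i₂) ≡ true) where
  open Table 𝕋
  private
    instance
      d-nonZero : NonZero d
      d-nonZero = d≢0

  ⟦_⟧ : Form → ℤ
  ⟦ α , β ⟧ = α + β * m

  null⇒≈0 : ∀ {α β} → Null (α , β) → α + β * m ≈ 0ℤ [ + n ]
  null⇒≈0 {α} {β} (α≡0 , mod≈ q eq) = lc (≡⇒≈ α≡0 ⊕ m ⊙ ≡⇒≈ eq ⊕ q ⊙ 2m≈0)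
      (solve 4 (λ a b c d → a :+ b :* c :- con 0ℤ := a :+ c :* (b :- con 0ℤ) :+ d :* (con (+ 2) :* c) :- (con 0ℤ :+ c :*
      (d :* con (+ 2)) :+ d :* con 0ℤ)) refl α β m q)

  e χ : ℤ → ℤ
  e k = ⟦ E (k %ℕ d) ⟧
  χ k = + X (k %ℕ d)
  s : ℤ → Bool
  s k = K (k %ℕ d)

  residue-of : ∀ {i} → i ℕ.< d → + i %ℕ d ≡ i
  residue-of = ℕ.m<n⇒m%n≡m

  by-residue : (P : ℕ → Set) → (∀ (i : Fin d) → P (toℕ i)) → ∀ k → P (k %ℕ d)
  by-residue P f k = subst P (toℕ-fromℕ< (n%ℕd<d k d)) (f (Fin.fromℕ< (n%ℕd<d k d)))

  e-at : ∀ {k i} → k %ℕ d ≡ i → e k ≡ ⟦ E i ⟧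
  e-at eq = cong (λ i → ⟦ E i ⟧) eq

  χ-rot : ∀ k → s k ≡ false → s (χ k) ≡ false × e (χ k) ≈ - e k [ + n ]
  χ-rot = by-residue (λ i → K i ≡ false → K (+ X i %ℕ d) ≡ false × ⟦ E (+ X i %ℕ d) ⟧ ≈ - ⟦ E i ⟧ [ + n ]) λ i y →
    let lt , h , _ = is-inverse i
        y' , N = h y
        α , β = E (toℕ i)
        α' , β' = E (X (toℕ i))
    in trans (cong K (residue-of lt)) y' , ≈-trans (≡⇒≈ (e-at {+ X (toℕ i)} (residue-of lt))) (lc (null⇒≈0 N) (solve 5 (λ a b c d e → a :+ b :* c :- :- (d :+ e :* c) := a :+ d :+ (b :+ e) :* c :- con 0ℤ) refl α' β' m α β))

  χ-ref : ∀ k → s k ≡ true → χ k ≈ k [ + d ]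
  χ-ref k z = ≈-trans (≡⇒≈ (cong +_ (by-residue (λ i → K i ≡ true → X i ≡ i) (λ i → proj₂ (proj₂ (is-inverse i))) k z))) (≈-sym (residue k d))

  distinct : ∀ {k l} → s k ≡ s l → e k ≈ e l [ + n ] → k ≈ l [ + d ]
  distinct {k} {l} sk h = ≈-trans (residue k d) (≈-trans (≡⇒≈ (cong +_ (equal (Fin.fromℕ< (n%ℕd<d k d)) (Fin.fromℕ< (n%ℕd<d l d))
      (toℕ-fromℕ< (n%ℕd<d k d)) (toℕ-fromℕ< (n%ℕd<d l d))))) (≈-sym (residue l d)))
    where
    equal : ∀ (i j : Fin d) → toℕ i ≡ k %ℕ d → toℕ j ≡ l %ℕ d → k %ℕ d ≡ l %ℕ d
    equal i j i≡ j≡ = trans (sym i≡) (trans (cong toℕ (same (i Fin.≟ j))) j≡)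
      where
      α = proj₁ (E (toℕ i))
      β = proj₂ (E (toℕ i))
      α' = proj₁ (E (toℕ j))
      β' = proj₂ (E (toℕ j))
      h' : α + β * m ≈ α' + β' * m [ + n ]
      h' = subst₂ (λ i j → ⟦ E i ⟧ ≈ ⟦ E j ⟧ [ + n ]) (sym i≡) (sym j≡) h
      same : Dec (i ≡ j) → i ≡ j
      same (yes eq) = eq
      same (no i≢j) = ⊥-elim (visible (proj₁ separated i j (trans (cong K i≡) (trans sk (cong K (sym j≡)))) i≢j) (lc h'
          (solve 5 (λ a b c d e → a :- b :+ (c :- d) :* e :- con 0ℤ := a :+ c :* e :- (b :+ d :* e)) refl α α' β β' m)))

  nonunit : ∀ k → s k ≡ false → ¬ e k ≈ 0ℤ [ + n ]
  nonunit = by-residue (λ i → K i ≡ false → ¬ ⟦ E i ⟧ ≈ 0ℤ [ + n ]) (λ i y → visible (proj₂ separated i y))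

  index : Fin d → ℤ
  index i = + toℕ i

  at-index : ∀ i → index i %ℕ d ≡ toℕ i
  at-index i = residue-of (toℕ<n i)

  family : Family x
  family = record
    { e = e ; χ = χ ; s = s ; e-cong = λ h → ≡⇒≈ (cong (λ i → ⟦ E i ⟧) (%ℕ-cong d h)) ; s-cong = λ h → cong K (%ℕ-cong d h)
    ; χ-cong = λ h → ≡⇒≈ (cong (λ i → + X i) (%ℕ-cong d h))
    ; letters = λ i → trans (letters i) (cong (λ i → el ⟦ E i ⟧ (K i)) (sym (at-index i)))
    ; χ-rot = χ-rot ; χ-ref = χ-ref ; distinct = λ {k} {l} → distinct {k} {l} ; nonunit = nonunit
    ; rotation-word = index i₁ ∷ [] , val-≈ (val-rot (trans (cong K (at-index i₁)) K₁) val[])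
        (≈-trans (≡⇒≈ (cong (_+ 0ℤ) (trans (e-at {index i₁} (at-index i₁)) (cong ⟦_⟧ E₁)))) (≡⇒≈
        (solve 1 (λ a → con 1ℤ :+ con 0ℤ :* a :+ con 0ℤ := con 1ℤ) refl m)))
    ; reflection-word = index i₂ ∷ [] , _ , val-ref (trans (cong K (at-index i₂)) K₂) val[] }
    where open Words (+ n) e s

  open Family family using (Reversal)

  -- The table sees exponents modulo N only, so there m may be replaced by the number μ; the forms
  -- themselves keep m symbolic.
  module FromTable (ℝ : ReversalTable) (N : ℕ) (N≢0 : NonZero N) (μ : ℤ) (m≈μ : m ≈ μ [ + N ]) (N∣n : + n ≈ 0ℤ [ + N ]) where
    open ReversalTable ℝ
    private
      instance
        N-nonZero : NonZero N
        N-nonZero = N≢0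

    module _ (correct : AllCorrect N μ) (T-start : T 0 false ≡ (0ℤ , 0ℤ)) (G-start : Gᵗ 0 false ≡ false) where

      F c : ℤ → Bool → ℤ
      F p t = κ * p + ⟦ T (p %ℕ N) t ⟧
      c p t = + cᵗ (p %ℕ N) t
      G : ℤ → Bool → Bool
      G p t = Gᵗ (p %ℕ N) t

      residue-cong : ∀ {p q} → p ≈ q [ + n ] → p %ℕ N ≡ q %ℕ N
      residue-cong h = %ℕ-cong N (≈-coarsen N∣n h)

      Step : ℤ → Bool → ℤ → Set
      Step p t k = F (signed-sum t p (e k)) (t xor s k) ≈ signed-sum (G p t) (F p t) (e (- k + c p t)) [ + n ]
        × G (signed-sum t p (e k)) (t xor s k) ≡ G p t xor s (- k + c p t)
        × c (signed-sum t p (e k)) (t xor s k) ≈ χ (- k + c p t) + χ k [ + d ]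

      linear : ∀ t g κ p α β τ τ' γ γ' ε ε' → (signed-sum t 0ℤ (κ * α) + γ - signed-sum g τ ε) + (signed-sum t 0ℤ
          (κ * β) + γ' - signed-sum g τ' ε') * m ≈ 0ℤ [ + n ] →
        κ * signed-sum t p (α + β * m) + (γ + γ' * m) ≈ signed-sum g (κ * p + (τ + τ' * m)) (ε + ε' * m) [ + n ]
      linear false false κ p α β τ τ' γ γ' ε ε' h = lc h (solve 11 (λ a b c d e f g h i j k → a :* (b :+ (c :+ d :* e)) :+ (f :+ g :* e) :- (a :* b :+
          (h :+ i :* e) :+ (j :+ k :* e)) := con 0ℤ :+ a :* c :+ f :- (h :+ j) :+
          (con 0ℤ :+ a :* d :+ g :- (i :+ k)) :* e :- con 0ℤ) refl κ p α β m γ γ' τ τ' ε ε')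
      linear false true κ p α β τ τ' γ γ' ε ε' h = lc h (solve 11 (λ a b c d e f g h i j k → a :* (b :+ (c :+ d :* e)) :+ (f :+ g :* e) :- (a :* b :+
          (h :+ i :* e) :- (j :+ k :* e)) := con 0ℤ :+ a :* c :+ f :- (h :- j) :+
          (con 0ℤ :+ a :* d :+ g :- (i :- k)) :* e :- con 0ℤ) refl κ p α β m γ γ' τ τ' ε ε')
      linear true false κ p α β τ τ' γ γ' ε ε' h = lc h (solve 11 (λ a b c d e f g h i j k → a :* (b :- (c :+ d :* e)) :+ (f :+ g :* e) :- (a :* b :+
          (h :+ i :* e) :+ (j :+ k :* e)) := con 0ℤ :- a :* c :+ f :- (h :+ j) :+
          (con 0ℤ :- a :* d :+ g :- (i :+ k)) :* e :- con 0ℤ) refl κ p α β m γ γ' τ τ' ε ε')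
      linear true true κ p α β τ τ' γ γ' ε ε' h = lc h (solve 11 (λ a b c d e f g h i j k → a :* (b :- (c :+ d :* e)) :+ (f :+ g :* e) :- (a :* b :+
          (h :+ i :* e) :- (j :+ k :* e)) := con 0ℤ :- a :* c :+ f :- (h :- j) :+
          (con 0ℤ :- a :* d :+ g :- (i :- k)) :* e :- con 0ℤ) refl κ p α β m γ γ' τ τ' ε ε')

      step : ∀ p t k → Step p t k
      step p t k = go (Fin.fromℕ< (n%ℕd<d p N)) (Fin.fromℕ< (n%ℕd<d k d)) (toℕ-fromℕ< (n%ℕd<d p N)) (toℕ-fromℕ< (n%ℕd<d k d))
        where
        go : ∀ (r : Fin N) (i : Fin d) → toℕ r ≡ p %ℕ N → toℕ i ≡ k %ℕ d → Step p t k
        go r i r≡ i≡ =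
          ≈-trans (≡⇒≈ (cong₂ (λ ρ b → κ * signed-sum t p (e k) + ⟦ T ρ b ⟧) ρ'≡ t'≡))
            (≈-trans (≡⇒≈ (cong (λ z → κ * signed-sum t p z + ⟦ T ρ' t' ⟧) (e-at {k} (sym i≡))))
              (≈-trans (linear t g κ p α β (proj₁ (T ρ t)) (proj₂ (T ρ t)) (proj₁ (T ρ' t')) (proj₂ (T ρ' t')) (proj₁ (E i')) (proj₂ (E i'))
                  (null⇒≈0 {defect proj₁} {defect proj₂} (proj₁ C)))
                (≡⇒≈ (trans (cong (λ j → signed-sum g (κ * p + ⟦ T ρ t ⟧) ⟦ E j ⟧) (sym i'≡)) (cong (λ ρ → signed-sum (Gᵗ ρ t) (κ * p + ⟦ T ρ t ⟧)
                    (e (- k + c p t))) r≡))))) ,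
          trans (cong₂ Gᵗ ρ'≡ t'≡) (trans (proj₁ (proj₂ C)) (cong₂ _xor_ (cong (λ ρ → Gᵗ ρ t) r≡) (cong K (sym i'≡)))) ,
          ≈-trans (≡⇒≈ (cong +_ (cong₂ cᵗ ρ'≡ t'≡))) (≈-trans (proj₂ (proj₂ C)) (≡⇒≈ (cong₂ (λ a b → + X a + + X b) (sym i'≡) i≡)))
          where
          ρ : ℕ
          ρ = toℕ r
          C = correct r t i
          open At N μ ρ t (toℕ i)
          g : Bool
          g = Gᵗ ρ t
          α β : ℤ
          α = proj₁ (E (toℕ i))
          β = proj₂ (E (toℕ i))
          i'≡ : (- k + c p t) %ℕ d ≡ i'
          i'≡ = %ℕ-cong d (≈-trans (lc { - k + c p t}  { - + (k %ℕ d) + c p t} (⊖ residue k d)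
              (solve 3 (λ a b c → :- a :+ b :- (:- c :+ b) := :- a :- :- c) refl k (c p t) (+ (k %ℕ d)))) (≡⇒≈ (cong₂ (λ i ρ → - + i + + cᵗ ρ t)
              (sym i≡) (sym r≡))))
          t'≡ : t xor s k ≡ t'
          t'≡ = cong (λ i → t xor K i) (sym i≡)
          sum-cong : ∀ t {p q u v : ℤ} {M} → p ≈ q [ M ] → u ≈ v [ M ] → signed-sum t p u ≈ signed-sum t q v [ M ]
          sum-cong false x y = x ⊕ y
          sum-cong true {p} {q} {u} {v} x y = lc (x ⊕ ⊖ y) (solve 4 (λ a b c d → a :- b :- (c :- d) := a :+ :- b :- (c :+ :- d)) refl p u q v)
          ρ'≡ : signed-sum t p (e k) %ℕ N ≡ ρ'
          ρ'≡ = %ℕ-cong N (sum-cong t (≈-trans (residue p N) (≡⇒≈ (cong +_ (sym r≡)))) (≈-trans (≡⇒≈ (e-at {k} (sym i≡))) (lc (β ⊙ m≈μ)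
              (solve 4 (λ a b c d → a :+ b :* c :- (a :+ b :* d) := b :* c :- b :* d) refl α β m μ))))

      reversal : Reversal (+ cᵗ 0 false)
      reversal = record
        { F = F ; G = G ; c = c
        ; F-cong = λ t {p} {q} h → ≈-trans (lc {κ * p + ⟦ T (p %ℕ N) t ⟧}  {κ * q + ⟦ T (p %ℕ N) t ⟧} (κ ⊙ h)
            (solve 4 (λ a b c d → a :* b :+ c :- (a :* d :+ c) := a :* b :- a :* d) refl κ p (⟦ T (p %ℕ N) t ⟧) q))
            (≡⇒≈ (cong (λ ρ → κ * q + ⟦ T ρ t ⟧) (residue-cong h)))
        ; G-cong = λ t h → cong (λ ρ → Gᵗ ρ t) (residue-cong h)
        ; c-cong = λ t h → ≡⇒≈ (cong (λ ρ → + cᵗ ρ t) (residue-cong h))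
        ; F-start = ≈-trans (≡⇒≈ (cong (λ f → κ * 0ℤ + ⟦ f ⟧) (trans (cong (λ ρ → T ρ false) (zero-residue)) T-start))) (≡⇒≈
            (solve 2 (λ a b → a :* con 0ℤ :+ (con 0ℤ :+ con 0ℤ :* b) := con 0ℤ) refl κ m))
        ; G-start = trans (cong (λ ρ → Gᵗ ρ false) zero-residue) G-start
        ; c-start = ≡⇒≈ (cong (λ ρ → + cᵗ ρ false) zero-residue)
        ; F-step = λ p t k → proj₁ (step p t k) ; G-step = λ p t k → proj₁ (proj₂ (step p t k)) ; c-step = λ p t k → proj₂ (proj₂ (step p t k)) }
        where
        zero-residue : 0ℤ %ℕ N ≡ 0
        zero-residue = ℕ.m<n⇒m%n≡m (ℕ.>-nonZero⁻¹ N)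

small-nonzero : ∀ {n} → 3 ℕ.≤ n → ∀ α → ∣ α ∣ ℕ.≤ 2 → α ≢ 0ℤ → ¬ α ≈ 0ℤ [ + n ]
small-nonzero 3≤n (+ zero) _ α≢0 = ⊥-elim (α≢0 refl)
small-nonzero 3≤n (+ suc a) le _ = below-modulus≉0 (s≤s z≤n) (ℕ.≤-<-trans le 3≤n)
small-nonzero 3≤n -[1+ a ] le _ h = below-modulus≉0 {suc a} (s≤s z≤n) (ℕ.≤-<-trans le 3≤n) (⊖ h)

p₄-table : Table 4
p₄-table = record
  { E = λ { 0 → -1ℤ , 0ℤ ; 1 → 1ℤ , 0ℤ ; 2 → 0ℤ , 0ℤ ; _ → + 2 , 0ℤ }
  ; K = λ { 0 → false ; 1 → false ; _ → true }
  ; X = λ { 0 → 1 ; 1 → 0 ; i → i } }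

-- The second reversal, k ↦ 1 - k, is the group automorphism a ↦ a⁻¹, b ↦ a² b. The first, k ↦ -k,
-- depends on p modulo 3, which is where 3 | n enters.
p₄-reversals : Table.ReversalTable p₄-table × Table.ReversalTable p₄-table
p₄-reversals = record
    { κ = 1ℤ
    ; T = λ { 0 _ → 0ℤ , 0ℤ ; 1 false → 1ℤ , 0ℤ ; 1 true → 0ℤ , 0ℤ ; _ false → 0ℤ , 0ℤ ; _ true → -1ℤ , 0ℤ }
    ; Gᵗ = λ { 0 t → t ; 1 _ → true ; _ _ → false }
    ; cᵗ = λ { 0 _ → 0 ; 1 false → 3 ; 1 true → 2 ; _ false → 2 ; _ true → 3 } }
  , record { κ = -1ℤ ; T = λ { _ t → if t then (+ 2 , 0ℤ) else (0ℤ , 0ℤ) } ; Gᵗ = λ _ t → t ; cᵗ = λ _ _ → 1 }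

reflRegCM₄ : ∀ {n} → 2 ℕ.≤ n → .{{_ : NonZero n}} → ∃[ k ] (1 ℕ.≤ k × n ≡ 3 ℕ.* k) → ReflRegCM {n} 4 p₄
reflRegCM₄ {n} 2≤n (k@(suc k') , _ , n≡) = FamilyMap.TwoReversals.reflRegCM 2≤n _ p₄ family {0ℤ}
    (FromTable.reversal (proj₁ p₄-reversals) 3 _ 0ℤ ≈-refl 3∣n (toWitness {a? = Table.ReversalTable.allCorrect?
        (proj₁ p₄-reversals) 3 0ℤ} _) refl refl)
    (FromTable.reversal (proj₂ p₄-reversals) 3 _ 0ℤ ≈-refl 3∣n (toWitness {a? = Table.ReversalTable.allCorrect?
        (proj₂ p₄-reversals) 3 0ℤ} _) refl refl)
  where
  3∣n : + n ≈ 0ℤ [ + 3 ]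
  3∣n = ∣⇒≈0 (ℕ.divides k (trans n≡ (ℕ.*-comm 3 k)))
  3≤n : 3 ℕ.≤ n
  3≤n = subst (3 ℕ.≤_) (sym n≡) (ℕ.m≤m*n 3 k)
  Visible : Form → Set
  Visible (α , β) = ∣ α ∣ ℕ.≤ 2 × α ≢ 0ℤ
  visible? : ∀ f → Dec (Visible f)
  visible? (α , β) = (∣ α ∣ ℕ.≤? 2) ×-dec ¬? (α ≟ 0ℤ)
  visible : ∀ {α β} → Visible (α , β) → ¬ α + β * 0ℤ ≈ 0ℤ [ + n ]
  visible {α} {β} (le , α≢0) h = small-nonzero 3≤n α le α≢0 (lc h (solve 2 (λ a b → a :- con 0ℤ := a :+ b :* con 0ℤ :- con 0ℤ) refl α β))
  letters : ∀ i → p₄ i ≡ el (proj₁ (Table.E p₄-table (toℕ i)) + proj₂ (Table.E p₄-table (toℕ i)) * 0ℤ) (Table.K p₄-table (toℕ i))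
  letters = λ { Fin.zero → refl ; (Fin.suc Fin.zero) → refl ; (Fin.suc (Fin.suc Fin.zero)) → refl ; (Fin.suc (Fin.suc (Fin.suc Fin.zero))) → refl }
  open TableFamily 2≤n _ p₄-table 0ℤ (≡⇒≈ {+ 2 * 0ℤ} {0ℤ} refl) (toWitness {a? = Table.isInverse? p₄-table} _) {Visible} (λ {α} {β} → visible {α} {β})
      (toWitness {a? = Table.separated? p₄-table visible?} _) p₄
    letters (Fin.suc Fin.zero) refl refl (Fin.suc (Fin.suc Fin.zero)) refl

module Halved {n : ℕ} (m : ℕ) (n≡ : n ≡ m ℕ.+ m) (3≤m : 3 ℕ.≤ m) where

  2m≈0 : + 2 * + m ≈ 0ℤ [ + n ]
  2m≈0 = lc (⊖ ≡⇒≈ (trans (cong +_ n≡) (pos-+ m m)) ⊕ modulus≈0)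
      (solve 2 (λ a b → con (+ 2) :* a :- con 0ℤ := :- b :+ b :- (:- (a :+ a) :+ con 0ℤ)) refl (+ m) (+ n))

  half : + ℕ.⌊ n /2⌋ ≡ + m
  half = cong +_ (halve m n≡)

  Visible : Form → Set
  Visible f = ∣ proj₁ f ∣ ℕ.≤ 2 × ¬ Null f

  visible? : ∀ f → Dec (Visible f)
  visible? f = (∣ proj₁ f ∣ ℕ.≤? 2) ×-dec ¬? (null? f)

  -- For even β the value is α, for odd β it is α + m. As α is at most 2 in absolute value and m is
  -- at least 3, neither vanishes modulo 2m unless the form is null.
  visible : ∀ {α β} → Visible (α , β) → ¬ α + β * + m ≈ 0ℤ [ + n ]
  visible {α} {β} (le , ¬null) h = go (parity β)
    where
    3≤n : 3 ℕ.≤ n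
    3≤n = subst (3 ℕ.≤_) (sym n≡) (ℕ.≤-trans 3≤m (ℕ.m≤m+n m m))
    shifted : ∀ α → ∣ α ∣ ℕ.≤ 2 → ¬ α + + m ≈ 0ℤ [ + n ]
    shifted (+ a) le h = below-modulus≉0 {a ℕ.+ m} (ℕ.<-≤-trans (s≤s z≤n) (ℕ.≤-trans 3≤m (ℕ.m≤n+m m a))) (subst (a ℕ.+ m ℕ.<_) (sym n≡)
        (ℕ.+-monoˡ-< m (ℕ.≤-<-trans le 3≤m))) h
    shifted -[1+ a ] le h = below-modulus≉0 {m ℕ.∸ suc a} (ℕ.m<n⇒0<n∸m (ℕ.≤-<-trans le 3≤m)) (subst (m ℕ.∸ suc a ℕ.<_) (sym n≡)
        (ℕ.≤-<-trans (ℕ.m∸n≤m m (suc a)) (ℕ.m<m+n m (ℕ.<-≤-trans (s≤s z≤n) 3≤m))))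
      (≈-trans (≡⇒≈ (trans (pos-∸ (ℕ.≤-trans le (ℕ.<⇒≤ 3≤m))) (solve 2 (λ a b → a :- b := :- b :+ a) refl (+ m) (+ suc a)))) h)
    go : ∃[ q ] (β ≡ + 2 * q ⊎ β ≡ + 2 * q + 1ℤ) → ⊥
    go (q , inj₁ eq) = small-nonzero 3≤n α le (λ α≡0 → ¬null (α≡0 , (lc (≡⇒≈ eq ⊕ q ⊙ modulus≈0)
        (solve 2 (λ a b → a :- con 0ℤ := a :+ b :* con (+ 2) :- (con (+ 2) :* b :+ b :* con 0ℤ)) refl β q))))
        (lc (h ⊕ (- + m) ⊙ ≡⇒≈ eq ⊕ (- q) ⊙ 2m≈0) (solve 4 (λ a b c d → a :- con 0ℤ := a :+ b :* c :+ :- c :* b :+ :- d :*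
        (con (+ 2) :* c) :- (con 0ℤ :+ :- c :* (con (+ 2) :* d) :+ :- d :* con 0ℤ)) refl α β (+ m) q))
    go (q , inj₂ eq) = shifted α le (lc (h ⊕ (- + m) ⊙ ≡⇒≈ eq ⊕ (- q) ⊙ 2m≈0)
        (solve 4 (λ a b c d → a :+ b :- con 0ℤ := a :+ c :* b :+ :- b :* c :+ :- d :* (con (+ 2) :* b) :- (con 0ℤ :+ :- b :*
        (con (+ 2) :* d :+ con 1ℤ) :+ :- d :* con 0ℤ)) refl α (+ m) β q))

p₅-table : Table 6
p₅-table = record
  { E = λ { 0 → -1ℤ , 0ℤ ; 1 → 1ℤ , 0ℤ ; 2 → 0ℤ , 0ℤ ; 3 → 1ℤ , 1ℤ ; 4 → -1ℤ , 1ℤ ; _ → + 2 , 1ℤ }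
  ; K = λ { 2 → true ; 5 → true ; _ → false }
  ; X = λ { 0 → 1 ; 1 → 0 ; 3 → 4 ; 4 → 3 ; i → i } }

-- Again k ↦ 1 - k is a group automorphism, a ↦ a⁻¹, b ↦ a^(m + 2) b. The reversal k ↦ -k depends on
-- p modulo 4, where m is 2.
p₅-reversals : Table.ReversalTable p₅-table × Table.ReversalTable p₅-table
p₅-reversals = record
    { κ = 1ℤ
    ; T = λ { 0 false → 0ℤ , 0ℤ ; 0 true → -1ℤ , 1ℤ ; 1 false → 1ℤ , 1ℤ ; 1 true → 0ℤ , 0ℤ ; 2 false → 1ℤ , 0ℤ ; 2 true → 0ℤ , 0ℤ ; _ false → 0ℤ ,
        0ℤ ; _ true → -1ℤ , 0ℤ }
    ; Gᵗ = λ { 1 _ → true ; 2 _ → true ; _ _ → false }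
    ; cᵗ = λ { 0 false → 0 ; 0 true → 5 ; 1 false → 5 ; 1 true → 0 ; 2 false → 3 ; 2 true → 2 ; _ false → 2 ; _ true → 3 } }
  , record { κ = -1ℤ ; T = λ { _ t → if t then (+ 2 , 1ℤ) else (0ℤ , 0ℤ) } ; Gᵗ = λ _ t → t ; cᵗ = λ _ _ → 1 }

reflRegCM₅ : ∀ {n} → 2 ℕ.≤ n → .{{_ : NonZero n}} → ∃[ k ] (1 ℕ.≤ k × n ≡ 8 ℕ.* k ℕ.+ 4) → ReflRegCM {n} 6 p₅
reflRegCM₅ {n} 2≤n (k@(suc k') , _ , n≡) = FamilyMap.TwoReversals.reflRegCM 2≤n _ p₅ family {0ℤ}
    (FromTable.reversal (proj₁ p₅-reversals) 4 _ (+ 2) m≈2 4∣n (toWitness {a? = Table.ReversalTable.allCorrect? (proj₁ p₅-reversals) 4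
        (+ 2)} _) refl refl)
    (FromTable.reversal (proj₂ p₅-reversals) 4 _ (+ 2) m≈2 4∣n (toWitness {a? = Table.ReversalTable.allCorrect? (proj₂ p₅-reversals) 4
        (+ 2)} _) refl refl)
  where
  m : ℕ
  m = 4 ℕ.* k ℕ.+ 2
  open Halved {n} m (trans n≡ (solveℕ 1 (λ k → conℕ 8 ⊠ k ⊞ conℕ 4 :≡ (conℕ 4 ⊠ k ⊞ conℕ 2) ⊞ (conℕ 4 ⊠ k ⊞ conℕ 2)) refl k))
      (ℕ.≤-trans (s≤s (s≤s (s≤s z≤n))) (ℕ.≤-trans (ℕ.m≤m*n 4 k) (ℕ.m≤m+n (4 ℕ.* k) 2)))
  m≈2 : + m ≈ + 2 [ + 4 ]
  m≈2 = lc (≡⇒≈ (trans (pos-+ (4 ℕ.* k) 2) (cong (_+ + 2) (pos-* 4 k))) ⊕ (+ k) ⊙ modulus≈0)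
      (solve 2 (λ a b → a :- con (+ 2) := a :+ b :* con (+ 4) :- (con (+ 4) :* b :+ con (+ 2) :+ b :* con 0ℤ)) refl (+ m) (+ k))
  4∣n : + n ≈ 0ℤ [ + 4 ]
  4∣n = lc (≡⇒≈ (trans (cong +_ n≡) (trans (pos-+ (8 ℕ.* k) 4) (cong (_+ + 4) (pos-* 8 k)))) ⊕ ((+ 2 * + k) + 1ℤ) ⊙ modulus≈0)
      (solve 2 (λ a b → a :- con 0ℤ := a :+ (con (+ 2) :* b :+ con 1ℤ) :* con (+ 4) :- (con (+ 8) :* b :+ con (+ 4) :+
      (con (+ 2) :* b :+ con 1ℤ) :* con 0ℤ)) refl (+ n) (+ k))
  letters : ∀ i → p₅ {n} i ≡ el (proj₁ (Table.E p₅-table (toℕ i)) + proj₂ (Table.E p₅-table (toℕ i)) * + m) (Table.K p₅-table (toℕ i))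
  letters i = trans (table i) (cong (λ m → el (proj₁ (Table.E p₅-table (toℕ i)) + proj₂ (Table.E p₅-table (toℕ i)) * m)
      (Table.K p₅-table (toℕ i))) half)
    where
    h : ℤ
    h = + ℕ.⌊ n /2⌋
    table : ∀ i → p₅ {n} i ≡ el (proj₁ (Table.E p₅-table (toℕ i)) + proj₂ (Table.E p₅-table (toℕ i)) * h) (Table.K p₅-table (toℕ i))
    table Fin.zero = refl
    table (Fin.suc Fin.zero) = refl
    table (Fin.suc (Fin.suc Fin.zero)) = refl
    table (Fin.suc (Fin.suc (Fin.suc Fin.zero))) = el-cong (≡⇒≈ {h + + 1}  {1ℤ + 1ℤ * h}
        (solve 1 (λ a → a :+ con (+ 1) := con 1ℤ :+ con 1ℤ :* a) refl h)) refl
    table (Fin.suc (Fin.suc (Fin.suc (Fin.suc Fin.zero)))) = el-cong (≡⇒≈ {h - + 1}  { -1ℤ + 1ℤ * h}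
        (solve 1 (λ a → a :- con (+ 1) := con -1ℤ :+ con 1ℤ :* a) refl h)) refl
    table (Fin.suc (Fin.suc (Fin.suc (Fin.suc (Fin.suc Fin.zero))))) = el-cong (≡⇒≈ {h + + 2}  {+ 2 + 1ℤ * h}
        (solve 1 (λ a → a :+ con (+ 2) := con (+ 2) :+ con 1ℤ :* a) refl h)) refl
  open TableFamily 2≤n _ p₅-table (+ m) 2m≈0 (toWitness {a? = Table.isInverse? p₅-table} _) {Visible} (λ {α} {β} → visible {α} {β})
      (toWitness {a? = Table.separated? p₅-table visible?} _) p₅ letters
    (Fin.suc Fin.zero) refl refl (Fin.suc (Fin.suc Fin.zero)) refl

p₆-table : Table 6
p₆-table = record
  { E = λ { 0 → 0ℤ , 0ℤ ; 1 → - (+ 2) , 1ℤ ; 2 → 1ℤ , 0ℤ ; 3 → - (+ 2) , 0ℤ ; 4 → 0ℤ , 1ℤ ; _ → -1ℤ , 0ℤ }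
  ; K = λ { 2 → false ; 5 → false ; _ → true }
  ; X = λ { 2 → 5 ; 5 → 2 ; i → i } }

-- Here k ↦ 4 - k is the group automorphism fixing a with b ↦ a^m b, while k ↦ 5 - k depends on the
-- parity of p; m is odd.
p₆-reversals : Table.ReversalTable p₆-table × Table.ReversalTable p₆-table
p₆-reversals = record { κ = 1ℤ ; T = λ { _ t → if t then (0ℤ , 1ℤ) else (0ℤ , 0ℤ) } ; Gᵗ = λ _ t → t ; cᵗ = λ _ _ → 4 }
  , record
    { κ = -1ℤ
    ; T = λ { 0 false → 0ℤ , 0ℤ ; 0 true → -1ℤ , 0ℤ ; _ false → -1ℤ , 0ℤ ; _ true → - (+ 2) , 0ℤ }
    ; Gᵗ = λ { 0 _ → false ; _ _ → true }
    ; cᵗ = λ { 0 false → 5 ; 0 true → 2 ; _ false → 2 ; _ true → 5 } }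

reflRegCM₆ : ∀ {n} → 2 ℕ.≤ n → .{{_ : NonZero n}} → ∃[ k ] (1 ℕ.≤ k × n ≡ 4 ℕ.* k ℕ.+ 2) → ReflRegCM {n} 6 p₆
reflRegCM₆ {n} 2≤n (k@(suc k') , _ , n≡) = FamilyMap.TwoReversals.reflRegCM 2≤n _ p₆ family {+ 4}
    (FromTable.reversal (proj₁ p₆-reversals) 2 _ 1ℤ m≈1 2∣n (toWitness {a? = Table.ReversalTable.allCorrect? (proj₁ p₆-reversals) 2 1ℤ} _) refl refl)
    (FromTable.reversal (proj₂ p₆-reversals) 2 _ 1ℤ m≈1 2∣n (toWitness {a? = Table.ReversalTable.allCorrect? (proj₂ p₆-reversals) 2 1ℤ} _) refl refl)
  where
  m : ℕ
  m = 2 ℕ.* k ℕ.+ 1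
  open Halved {n} m (trans n≡ (solveℕ 1 (λ k → conℕ 4 ⊠ k ⊞ conℕ 2 :≡ (conℕ 2 ⊠ k ⊞ conℕ 1) ⊞ (conℕ 2 ⊠ k ⊞ conℕ 1)) refl k))
      (ℕ.+-monoˡ-≤ 1 (ℕ.m≤m*n 2 k))
  m≈1 : + m ≈ 1ℤ [ + 2 ]
  m≈1 = lc (≡⇒≈ (trans (pos-+ (2 ℕ.* k) 1) (cong (_+ 1ℤ) (pos-* 2 k))) ⊕ (+ k) ⊙ modulus≈0)
      (solve 2 (λ a b → a :- con 1ℤ := a :+ b :* con (+ 2) :- (con (+ 2) :* b :+ con 1ℤ :+ b :* con 0ℤ)) refl (+ m) (+ k))
  2∣n : + n ≈ 0ℤ [ + 2 ]
  2∣n = lc (≡⇒≈ (trans (cong +_ n≡) (trans (pos-+ (4 ℕ.* k) 2) (cong (_+ + 2) (pos-* 4 k)))) ⊕ ((+ 2 * + k) + 1ℤ) ⊙ modulus≈0)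
      (solve 2 (λ a b → a :- con 0ℤ := a :+ (con (+ 2) :* b :+ con 1ℤ) :* con (+ 2) :- (con (+ 4) :* b :+ con (+ 2) :+
      (con (+ 2) :* b :+ con 1ℤ) :* con 0ℤ)) refl (+ n) (+ k))
  letters : ∀ i → p₆ {n} i ≡ el (proj₁ (Table.E p₆-table (toℕ i)) + proj₂ (Table.E p₆-table (toℕ i)) * + m) (Table.K p₆-table (toℕ i))
  letters i = trans (table i) (cong (λ m → el (proj₁ (Table.E p₆-table (toℕ i)) + proj₂ (Table.E p₆-table (toℕ i)) * m)
      (Table.K p₆-table (toℕ i))) half)
    where
    h : ℤ
    h = + ℕ.⌊ n /2⌋
    table : ∀ i → p₆ {n} i ≡ el (proj₁ (Table.E p₆-table (toℕ i)) + proj₂ (Table.E p₆-table (toℕ i)) * h) (Table.K p₆-table (toℕ i))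
    table Fin.zero = refl
    table (Fin.suc Fin.zero) = el-cong (≡⇒≈ {h - + 2}  { - (+ 2) + 1ℤ * h}
        (solve 1 (λ a → a :- con (+ 2) := :- con (+ 2) :+ con 1ℤ :* a) refl h)) refl
    table (Fin.suc (Fin.suc Fin.zero)) = refl
    table (Fin.suc (Fin.suc (Fin.suc Fin.zero))) = refl
    table (Fin.suc (Fin.suc (Fin.suc (Fin.suc Fin.zero)))) = el-cong (≡⇒≈ {h}  {0ℤ + 1ℤ * h} (solve 1 (λ a → a := con 0ℤ :+ con 1ℤ :* a) refl h)) refl
    table (Fin.suc (Fin.suc (Fin.suc (Fin.suc (Fin.suc Fin.zero))))) = refl
  open TableFamily 2≤n _ p₆-table (+ m) 2m≈0 (toWitness {a? = Table.isInverse? p₆-table} _) {Visible} (λ {α} {β} → visible {α} {β})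
      (toWitness {a? = Table.separated? p₆-table visible?} _) p₆ letters
    (Fin.suc (Fin.suc Fin.zero)) refl refl Fin.zero refl

reflRegCM₂ : ∀ {n} → 2 ℕ.≤ n → .{{_ : NonZero n}} → 2 ℕ.∣ n → ReflRegCM {n} n p₂
reflRegCM₂ {n} 2≤n (ℕ.divides q n≡) = reflRegCM p₂ (λ i → letters i (isEven (toℕ i)) refl)
  where
  open Family₂₃ {n} 2≤n (+ q) 0ℤ (trans (cong +_ n≡) (trans (pos-* q 2) (solve 1 (λ a → a :* con (+ 2) := con (+ 2) :* a) refl (+ q)))) ≈-refl ≈-refl
      (≡⇒≈ (solve 1 (λ a → con (+ 2) :* (a :* con 0ℤ) := con 0ℤ) refl (+ q)))
  letters : ∀ i b → isEven (toℕ i) ≡ b → p₂ {n} i ≡ el (e (+ toℕ i)) (s (+ toℕ i))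
  letters i true h = let r = + ℕ.⌊ toℕ i /2⌋ ; i≡ = isEven⇒ℤ (toℕ i) h in
    trans (cong (λ b → if b then refl' (+ toℕ i) else rot (+ toℕ i)) h) (el-cong (≈-trans (lc {+ toℕ i}  {+ 2 * r + r * (+ 2 * 0ℤ)} (≡⇒≈ i≡)
        (solve 2 (λ a b → a :- (con (+ 2) :* b :+ b :* (con (+ 2) :* con 0ℤ)) := a :- con (+ 2) :* b) refl (+ toℕ i) r))
        (≡⇒≈ (sym (trans (cong e i≡) (e-even r))))) (sym (trans (cong s i≡) (s-even r))))
  letters i false h = let r = + ℕ.⌊ toℕ i /2⌋ ; i≡ = trans (¬isEven⇒ℤ (toℕ i) h) (solve 1 (λ a → con 1ℤ :+ con (+ 2) :* a := con (+ 2) :* a :+ con 1ℤ) refl r) in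
    trans (cong (λ b → if b then refl' (+ toℕ i) else rot (+ toℕ i)) h) (el-cong (≡⇒≈ (trans i≡ (sym (trans (cong e i≡) (e-odd r)))))
        (sym (trans (cong s i≡) (s-odd r))))

reflRegCM₃ : ∀ {n} → 2 ℕ.≤ n → .{{_ : NonZero n}} → 8 ℕ.∣ n → ReflRegCM {n} n p₃
reflRegCM₃ {n} 2≤n (ℕ.divides q n≡) = reflRegCM p₃ (λ i → letters i (isEven (toℕ i)) refl)
  where
  n≡8q : + n ≡ + 8 * + q
  n≡8q = trans (cong +_ n≡) (trans (pos-* q 8) (solve 1 (λ a → a :* con (+ 8) := con (+ 8) :* a) refl (+ q)))
  8q≈0 : + 8 * + q ≈ 0ℤ [ + n ]
  8q≈0 = ≈-trans (≡⇒≈ (sym n≡8q)) modulus≈0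
  -- With n = 8q these are M = n/2 and ν = n/4; that ν is even makes 2ν² vanish modulo n = 4ν.
  open Family₂₃ {n} 2≤n (+ 4 * + q) (+ 2 * + q) (trans n≡8q (solve 1 (λ a → con (+ 8) :* a := con (+ 2) :* (con (+ 4) :* a)) refl (+ q))) (lc 8q≈0
      (solve 1 (λ a → con (+ 4) :* (con (+ 2) :* a) :- con 0ℤ := con (+ 8) :* a :- con 0ℤ) refl (+ q)))
    (lc ((+ q) ⊙ 8q≈0) (solve 1 (λ a → con (+ 2) :* (con (+ 2) :* a :* (con (+ 2) :* a)) :- con 0ℤ := a :* (con (+ 8) :* a) :- a :* con 0ℤ) refl (+ q)))
        (lc ((+ 2 * + q) ⊙ 8q≈0) (solve 1 (λ a → con (+ 2) :* (con (+ 4) :* a :* (con (+ 2) :* a)) :- con 0ℤ := con (+ 2) :* a :*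
        (con (+ 8) :* a) :- con (+ 2) :* a :* con 0ℤ) refl (+ q)))
  half : + ℕ.⌊ n /2⌋ ≡ + 4 * + q
  half = trans (cong +_ (halve (4 ℕ.* q) (trans n≡ (trans (ℕ.*-comm q 8) (ℕ.*-distribʳ-+ q 4 4))))) (pos-* 4 q)
  letters : ∀ i b → isEven (toℕ i) ≡ b → p₃ {n} i ≡ el (e (+ toℕ i)) (s (+ toℕ i))
  letters i true h = let r = + ℕ.⌊ toℕ i /2⌋ ; M = + ℕ.⌊ n /2⌋ ; i≡ = isEven⇒ℤ (toℕ i) h in
    trans (cong (λ b → if b then refl' (+ (toℕ i ℕ.+ ℕ.⌊ toℕ i /2⌋ ℕ.* ℕ.⌊ n /2⌋)) else rot (+ toℕ i)) h)
      (el-cong (≈-trans (≡⇒≈ (pos-divmod ℕ.⌊ toℕ i /2⌋ ℕ.⌊ n /2⌋ refl)) (≈-trans (lc {+ toℕ i + r * M}  {+ 2 * r + r * (+ 2 * (+ 2 * + q))}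
          (≡⇒≈ i≡ ⊕ r ⊙ ≡⇒≈ half) (solve 4 (λ a b c d → a :+ b :* c :- (con (+ 2) :* b :+ b :* (con (+ 2) :* (con (+ 2) :* d))) := a :+ b :* c :- (con
          (+ 2) :* b :+ b :* (con (+ 4) :* d))) refl (+ toℕ i) r M (+ q))) (≡⇒≈ (sym (trans (cong e i≡) (e-even r))))))
          (sym (trans (cong s i≡) (s-even r))))
  letters i false h = let r = + ℕ.⌊ toℕ i /2⌋ ; i≡ = trans (¬isEven⇒ℤ (toℕ i) h) (solve 1 (λ a → con 1ℤ :+ con (+ 2) :* a := con (+ 2) :* a :+ con 1ℤ) refl r) in
    trans (cong (λ b → if b then refl' (+ (toℕ i ℕ.+ ℕ.⌊ toℕ i /2⌋ ℕ.* ℕ.⌊ n /2⌋)) else rot (+ toℕ i)) h)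
        (el-cong (≡⇒≈ (trans i≡ (sym (trans (cong e i≡) (e-odd r))))) (sym (trans (cong s i≡) (s-odd r))))

theorem1p1 :
  -- classification
  ((n : ℕ) → .{{_ : NonZero n}} → 2 ℕ.≤ n →
    (d : ℕ) (x : Fin d → Dih n) → ReflRegCM d x →
      (d ≡ 2 → MapIso (CM d x) (CM {n} 2 p₀))
    × (d ≡ 3 → MapIso (CM d x) (CM 3 q₂)
             ⊎ MapIso (CM d x) (CM 3 q₃)
             ⊎ MapIso (CM d x) (CM 3 q₄))
    × (4 ℕ.≤ d →
        (∃[ ℓ ] (Cond₁ n ℓ d × MapIso (CM d x) (CM {n} d (p₁ ℓ d))))
      ⊎ (2 ℕ.∣ n × MapIso (CM d x) (CM {n} n p₂))
      ⊎ (8 ℕ.∣ n × MapIso (CM d x) (CM {n} n p₃))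
      ⊎ ((∃[ k ] (1 ℕ.≤ k × n ≡ 3 ℕ.* k)) × MapIso (CM d x) (CM {n} 4 p₄))
      ⊎ ((∃[ k ] (1 ℕ.≤ k × n ≡ 8 ℕ.* k ℕ.+ 4)) × MapIso (CM d x) (CM {n} 6 p₅))
      ⊎ ((∃[ k ] (1 ℕ.≤ k × n ≡ 4 ℕ.* k ℕ.+ 2)) × MapIso (CM d x) (CM {n} 6 p₆))))
  -- the listed maps are reflexible regular Cayley maps
  × ((n : ℕ) → .{{_ : NonZero n}} → 2 ℕ.≤ n →
      ((ℓ : ℤ) (d : ℕ) → Cond₁ n ℓ d → ReflRegCM {n} d (p₁ ℓ d))
    × (2 ℕ.∣ n → ReflRegCM {n} n p₂)
    × (8 ℕ.∣ n → ReflRegCM {n} n p₃)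
    × ((∃[ k ] (1 ℕ.≤ k × n ≡ 3 ℕ.* k)) → ReflRegCM {n} 4 p₄)
    × ((∃[ k ] (1 ℕ.≤ k × n ≡ 8 ℕ.* k ℕ.+ 4)) → ReflRegCM {n} 6 p₅)
    × ((∃[ k ] (1 ℕ.≤ k × n ≡ 4 ℕ.* k ℕ.+ 2)) → ReflRegCM {n} 6 p₆))
theorem1p1 =
  (λ n 2≤n d x ok →
      (λ { refl → valency₂ 2≤n x (proj₁ ok) (FromMap.system 2≤n _ x ok) (model⇒iso 2≤n _ x ok) })
    , (λ { refl → Classify₃.valency₃ 2≤n x (FromMap.system 2≤n _ x ok) (model⇒iso 2≤n _ x ok) })
    , (λ 4≤d → let d≢0 = ℕ.>-nonZero (ℕ.<-≤-trans (s≤s z≤n) 4≤d) in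
        Classify.large-valency 2≤n x (FromMap.system 2≤n d≢0 x ok) (model⇒iso 2≤n d≢0 x ok) 4≤d))
  , (λ n 2≤n → (λ ℓ d cond → Family₁.reflRegCM 2≤n ℓ d cond)
    , reflRegCM₂ 2≤n , reflRegCM₃ 2≤n , reflRegCM₄ 2≤n , reflRegCM₅ 2≤n , reflRegCM₆ 2≤n)
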